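{- For every positive integer $h$ there is a constant $K_h>0$ such that for all sufficiently large $x$, there are at least $K_h x$ integers $n\le x$ such that $\phi(n)$ is $(1+1/h)$-dense in $[h,\phi(n)/(h+1))$ and $\lambda(n)$ is $(1+1/h)$-dense in $[h,\lambda(n)/(h+1))$.
   Context: $\phi$ is Euler's totient function and $\lambda(n)$ is Carmichael's function, the maximal order of an element of $(\mathbb{Z}/n\mathbb{Z})^*$. For real $u$ and a set $I$ of reals, an integer $n$ is said to be $u$-dense in $I$ if for every $y\in I$ the interval $(y,uy]$ contains a divisor of $n$. -}

module Defs where

open import Data.Nat as ℕ using (ℕ; zero; suc; _^_; _%_; NonZero)
open import Data.Nat.Divisibility using (_∣_)
open import Data.Nat.GCD using (gcd)
open import Data.Nat.Properties using (_≟_)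
open import Data.Bool using (Bool; true; false; if_then_else_)
open import Data.List using (List; []; length; filter; upTo; map; foldr)
open import Data.List as List using (_∷_)
open import Data.Integer using (+_)
open import Data.Rational using (ℚ; _/_; _*_; _≤_; _<_)
open import Data.Product using (∃-syntax; _×_)
open import Relation.Nullary.Decidable using (⌊_⌋)

ℕ→ℚ : ℕ → ℚ
ℕ→ℚ n = (+ n) / 1

oneTo : ℕ → List ℕ
oneTo n = map suc (upTo n)

φ : ℕ → ℕ
φ n = length (filter (λ k → gcd k n ≟ 1) (oneTo n))

leastIn : ℕ → (ℕ → Bool) → ℕ
leastIn bound t = go (oneTo bound)
  where
  go : List ℕ → ℕ
  go [] = 0
  go (k List.∷ ks) = if t k then k else go ks

-- multiplicative order of a modulo n (n ≥ 1, gcd(a,n) = 1):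
-- least k ≥ 1 with a^k ≡ 1 (mod n).  Such k exists and is ≤ φ(n) ≤ n,
-- so searching in [1..n] is exhaustive.
ord : (n : ℕ) → .{{_ : NonZero n}} → ℕ → ℕ
ord n a = leastIn n (λ k → ⌊ (a ^ k) % n ≟ 1 % n ⌋)

-- Carmichael's function: λ(n) = maximal order of an element of (ℤ/nℤ)^*,
-- the units being represented by 1 ≤ a ≤ n with gcd(a,n) = 1.
-- (n = 0 is never used; we set λ(0) = 0 to make the function total.)
carmichael : ℕ → ℕ
carmichael zero = 0
carmichael n@(suc _) = foldr ℕ._⊔_ 0
  (map (ord n) (filter (λ a → gcd a n ≟ 1) (oneTo n)))

DenseIn : ℕ → ℚ → ℚ → ℚ → Set
DenseIn m u a b = ∀ (y : ℚ) → a ≤ y → y < b →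
  ∃[ d ] (d ∣ m × y < ℕ→ℚ d × ℕ→ℚ d ≤ u * y)

{-# OPTIONS --safe #-}
-- A number m is dense as soon as it is a multiple of a fixed dense base and every larger prime P ∣ m
-- is dominated by a divisor of m all of whose primes are below P.  Since λ(n) ∣ φ(n), it suffices
-- to supply these divisors from λ(n): at every scale z we need boundedly many distinct primes
-- r ∈ (z^δ , z] dividing q - 1 for primes q ∣ n.  An upper bound sieve shows that, once δ is small,
-- a fixed proportion of the primes q of each size have such an r.
--
-- Take n = M² a q₁ ⋯ q_S q.  The square M² contributes the base.  The squarefree a, weighted by
-- 1/a, is a random set of primes with independent choices: the primes of a lying in the blocks
-- (β^(2^i) , β^(2^(i+1))] just above scale z yield the required r except with a probability that
-- is exponentially small in the number of these blocks, hence summable over all scales but the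
-- last few.  The boundedly many q₁, …, q_S serve these last scales, and the final prime q, free in
-- an interval of length comparable to x/(M² a q₁ ⋯ q_S), turns the weights 1/a into a positive
-- proportion of the integers up to x.

module Submission where

open import Defs
open import Data.Nat using (ℕ; zero; suc; _+_; _*_; _∸_; _^_; _⊓_; _⊔_; _≤_; _<_; _≥_; _>_; z≤n; s≤s; NonZero; _≤?_; _<?_; _≟_; pred; s≤s⁻¹; >-nonZero; ≢-nonZero⁻¹)
open import Data.Nat.Properties
open import Data.Nat.DivMod using (_%_; m%n<n; m<n⇒m%n≡m; m≡m%n+[m/n]*n; [m+n]%n≡m%n; [m+kn]%n≡m%n; n%n≡0; %-distribˡ-*; %-distribˡ-+; m%n%n≡m%n; m/n*n≤m; m*n/n≡m; m/n*n≡m; /-monoˡ-≤; m/n≤m; m/n<m; m<n*o⇒m/o<n; n%1≡0) renaming (_/_ to _div_)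
open import Data.Nat.Divisibility
open import Data.Nat.GCD using (gcd; module Bézout)
open import Data.Nat.Coprimality using (Coprime; coprime⇒gcd≡1; gcd≡1⇒coprime; coprime-divisor; coprime-Bézout; coprime-+) renaming (sym to coprime-sym)
open import Data.Nat.Primality using (Prime; prime?; prime⇒nonZero; prime⇒irreducible; euclidsLemma; ¬prime[1]; ¬prime[0]; productOfPrimes≥1)
open import Data.Nat.Primality.Factorisation using (factorise; factorisationHasAllPrimeFactors)
open import Data.Nat.ListAction using (sum; product)
open import Data.Integer using (ℤ; +_; -[1+_])
import Data.Integer as ℤ
import Data.Integer.Properties as ℤₚ
import Data.Integer.Divisibility.Signed as ℤ∣
open import Data.Rational using (ℚ; 0ℚ; 1ℚ; _/_) renaming (_+_ to _+ʳ_; _*_ to _*ʳ_; -_ to -ʳ_; _-_ to _-ʳ_; _≤_ to _≤ʳ_; _<_ to _<ʳ_)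
import Data.Rational as ℚ
import Data.Rational.Properties as ℚₚ
import Data.Rational.Unnormalised as ℚᵘ
import Data.Rational.Unnormalised.Properties as ℚᵘₚ
open import Data.Bool using (Bool; true; false; if_then_else_)
open import Data.List using (List; []; _∷_; _++_; length; filter; map; foldr; concatMap; upTo; applyUpTo; downFrom)
open import Data.List.Properties using (length-map; length-++; length-downFrom; filter-++; length-filter; length-upTo; ++-assoc; filter-accept; filter-reject; map-++; map-∘)
open import Data.List.Relation.Unary.All as All using (All; []; _∷_)
import Data.List.Relation.Unary.All.Properties as Allₚ
open import Data.List.Relation.Unary.Any as Any using (Any; here; there; any?)
open import Data.List.Relation.Unary.AllPairs as AllPairs using (AllPairs; []; _∷_)
import Data.List.Relation.Unary.AllPairs.Properties as AllPairsₚ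
open import Data.List.Relation.Unary.Unique.Propositional using (Unique)
import Data.List.Relation.Unary.Unique.Propositional.Properties as Uniqueₚ
open import Data.List.Membership.Propositional using (_∈_; _∉_; find; lose)
open import Data.List.Membership.Propositional.Properties
open import Data.List.Membership.DecPropositional _≟_ using (_∈?_)
open import Data.Product using (Σ; ∃-syntax; _×_; _,_; proj₁; proj₂)
open import Data.Sum using (_⊎_; inj₁; inj₂)
open import Data.Empty using (⊥-elim)
open import Data.Unit using (⊤; tt)
open import Function using (_∘_; id; case_of_)
open import Relation.Nullary using (¬_; Dec; yes; no; does)
open import Relation.Nullary.Decidable using (⌊_⌋; dec⇒maybe; _×-dec_; ¬?; toWitness)
open import Relation.Unary using (Decidable)
open import Relation.Binary.PropositionalEquality using (_≡_; _≢_; refl; sym; trans; cong; cong₂; subst; subst₂; module ≡-Reasoning)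
open import Tactic.RingSolver using (solve-∀)
open import Tactic.RingSolver.Core.AlmostCommutativeRing using (AlmostCommutativeRing; fromCommutativeRing)
import Data.Nat.Tactic.RingSolver as ℕSolver
import Data.Integer.Tactic.RingSolver as ℤSolver

-- The relation `r ∣ q - 1` guarantees only one factor `r` in `λ(n)`, however many `q ∣ n` share it.
-- So the primes `r` serving one scale must be distinct, and pairs of prime factors `q` sharing an
-- `r` have to be controlled in mean (`clashes`). The divisor supplied is then the product of the
-- `r`: for `P` below `bp (2 ^ (a + t + 1))` and every `r` at least `bp (2 ^ a)`, taking
-- `K = 2 ^ (t + 2)` of them reaches the square of that bound, and the spare factor absorbs
-- `h (h + 1)`. The failure probability of a scale decays with the number of blocks between it and
-- the top of the random part. At the last scales this number is bounded and the failures cannot be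
-- summed; `q₁, …, q_S` are forced there, at the price of a constant factor each. The total mass of
-- the weights `1/a` has the order of the logarithm of the range, by a lower bound for
-- `∏ (1 + 1/p)`, while the density of the last prime `q` loses one logarithm. The two cancel, so
-- every other loss must be a constant independent of `x`.

ring : AlmostCommutativeRing _ _
ring = fromCommutativeRing ℚₚ.+-*-commutativeRing (λ x → dec⇒maybe (0ℚ ℚₚ.≟ x))

-- ι and inv are abstract so that conversion checking never normalises fractions.
abstract
  ι : ℕ → ℚ
  ι n = ℚ.fromℚᵘ (ℚᵘ.mkℚᵘ (+ n) 0)

  inv : ℕ → ℚ
  -- With this default `inv-*`, `0≤inv` and `inv≤1` hold for all arguments; positivity is asked only
  -- where something is cancelled or compared.
  inv zero = 0ℚ
  inv (suc n) = ℚ.fromℚᵘ (ℚᵘ.mkℚᵘ (+ 1) n)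

  ι-def : ∀ n → ι n ≡ ℕ→ℚ n
  ι-def n = refl

  ι-+ : ∀ m n → ι (m + n) ≡ ι m +ʳ ι n
  ι-+ m n = ℚₚ.toℚᵘ-injective (ℚᵘₚ.≃-trans (ℚₚ.toℚᵘ-fromℚᵘ (ℚᵘ.mkℚᵘ (+ (m + n)) 0)) (ℚᵘₚ.≃-trans eq (ℚᵘₚ.≃-sym
    (ℚᵘₚ.≃-trans (ℚₚ.toℚᵘ-homo-+ (ι m) (ι n)) (ℚᵘₚ.+-cong (ℚₚ.toℚᵘ-fromℚᵘ (ℚᵘ.mkℚᵘ (+ m) 0)) (ℚₚ.toℚᵘ-fromℚᵘ (ℚᵘ.mkℚᵘ (+ n) 0)))))))
    where
    eq : ℚᵘ.mkℚᵘ (+ (m + n)) 0 ℚᵘ.≃ ℚᵘ.mkℚᵘ (+ m) 0 ℚᵘ.+ ℚᵘ.mkℚᵘ (+ n) 0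
    eq = ℚᵘ.*≡* (cong (ℤ._* + 1) (trans (ℤₚ.pos-+ m n) (cong₂ ℤ._+_ (sym (ℤₚ.*-identityʳ (+ m))) (sym (ℤₚ.*-identityʳ (+ n))))))

  ι-* : ∀ m n → ι (m * n) ≡ ι m *ʳ ι n
  ι-* m n = ℚₚ.toℚᵘ-injective (ℚᵘₚ.≃-trans (ℚₚ.toℚᵘ-fromℚᵘ (ℚᵘ.mkℚᵘ (+ (m * n)) 0)) (ℚᵘₚ.≃-trans eq (ℚᵘₚ.≃-sym
    (ℚᵘₚ.≃-trans (ℚₚ.toℚᵘ-homo-* (ι m) (ι n)) (ℚᵘₚ.*-cong (ℚₚ.toℚᵘ-fromℚᵘ (ℚᵘ.mkℚᵘ (+ m) 0)) (ℚₚ.toℚᵘ-fromℚᵘ (ℚᵘ.mkℚᵘ (+ n) 0)))))))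
    where
    eq : ℚᵘ.mkℚᵘ (+ (m * n)) 0 ℚᵘ.≃ ℚᵘ.mkℚᵘ (+ m) 0 ℚᵘ.* ℚᵘ.mkℚᵘ (+ n) 0
    eq = ℚᵘ.*≡* (cong (ℤ._* + 1) (ℤₚ.pos-* m n))

  ι0 : ι 0 ≡ 0ℚ
  ι0 = refl

  ι1 : ι 1 ≡ 1ℚ
  ι1 = refl

  ι-mono : ∀ {m n} → m ≤ n → ι m ≤ʳ ι n
  ι-mono {m} {n} le = ℚₚ.toℚᵘ-cancel-≤ (ℚᵘₚ.≤-trans (ℚᵘₚ.≤-reflexive (ℚₚ.toℚᵘ-fromℚᵘ (ℚᵘ.mkℚᵘ (+ m) 0)))
    (ℚᵘₚ.≤-trans le′ (ℚᵘₚ.≤-reflexive (ℚᵘₚ.≃-sym (ℚₚ.toℚᵘ-fromℚᵘ (ℚᵘ.mkℚᵘ (+ n) 0))))))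
    where
    le′ : ℚᵘ.mkℚᵘ (+ m) 0 ℚᵘ.≤ ℚᵘ.mkℚᵘ (+ n) 0
    le′ = ℚᵘ.*≤* (ℤₚ.*-monoʳ-≤-nonNeg (+ 1) (ℤ.+≤+ le))

  ι-cancel : ∀ {m n} → ι m ≤ʳ ι n → m ≤ n
  ι-cancel {m} {n} le with ℚᵘₚ.≤-trans (ℚᵘₚ.≤-reflexive (ℚᵘₚ.≃-sym (ℚₚ.toℚᵘ-fromℚᵘ (ℚᵘ.mkℚᵘ (+ m) 0)))) (ℚᵘₚ.≤-trans (ℚₚ.toℚᵘ-mono-≤ le) (ℚᵘₚ.≤-reflexive (ℚₚ.toℚᵘ-fromℚᵘ (ℚᵘ.mkℚᵘ (+ n) 0))))
  ... | ℚᵘ.*≤* le′ = ℤₚ.drop‿+≤+ (subst₂ ℤ._≤_ (ℤₚ.*-identityʳ (+ m)) (ℤₚ.*-identityʳ (+ n)) le′)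

  ι-inv : ∀ n → 1 ≤ n → ι n *ʳ inv n ≡ 1ℚ
  ι-inv (suc n) _ = ℚₚ.toℚᵘ-injective (ℚᵘₚ.≃-trans (ℚₚ.toℚᵘ-homo-* (ι (suc n)) (inv (suc n))) (ℚᵘₚ.≃-trans
     (ℚᵘₚ.*-cong (ℚₚ.toℚᵘ-fromℚᵘ (ℚᵘ.mkℚᵘ (+ (suc n)) 0)) (ℚₚ.toℚᵘ-fromℚᵘ (ℚᵘ.mkℚᵘ (+ 1) n))) eq))
    where
    eq : ℚᵘ.mkℚᵘ (+ suc n) 0 ℚᵘ.* ℚᵘ.mkℚᵘ (+ 1) n ℚᵘ.≃ ℚᵘ.mkℚᵘ (+ 1) 0
    eq = ℚᵘ.*≡* (trans (ℤₚ.*-identityʳ _) (trans (ℤₚ.*-identityʳ _) (sym (trans (ℤₚ.*-identityˡ _) (cong (+_) (+-identityʳ (suc n)))))))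

  inv-zero : inv 0 ≡ 0ℚ
  inv-zero = refl

  0≤inv : ∀ n → 0ℚ ≤ʳ inv n
  0≤inv zero = ℚₚ.≤-refl
  0≤inv (suc n) = ℚₚ.toℚᵘ-cancel-≤ (ℚᵘₚ.≤-trans (ℚᵘ.*≤* (ℤ.+≤+ z≤n))
      (ℚᵘₚ.≤-reflexive (ℚᵘₚ.≃-sym (ℚₚ.toℚᵘ-fromℚᵘ (ℚᵘ.mkℚᵘ (+ 1) n)))))

  frac-def : ∀ a b → (+ a) / suc b ≡ ι a *ʳ inv (suc b)
  frac-def a b = ℚₚ.toℚᵘ-injective (ℚᵘₚ.≃-trans (ℚₚ.toℚᵘ-fromℚᵘ (ℚᵘ.mkℚᵘ (+ a) b)) (ℚᵘₚ.≃-sym (ℚᵘₚ.≃-trans (ℚₚ.toℚᵘ-homo-* (ι a) (inv (suc b)))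
    (ℚᵘₚ.≃-trans (ℚᵘₚ.*-cong (ℚₚ.toℚᵘ-fromℚᵘ (ℚᵘ.mkℚᵘ (+ a) 0)) (ℚₚ.toℚᵘ-fromℚᵘ (ℚᵘ.mkℚᵘ (+ 1) b))) eq))))
    where
    eq : ℚᵘ.mkℚᵘ (+ a) 0 ℚᵘ.* ℚᵘ.mkℚᵘ (+ 1) b ℚᵘ.≃ ℚᵘ.mkℚᵘ (+ a) b
    eq = ℚᵘ.*≡* (cong₂ ℤ._*_ (ℤₚ.*-identityʳ (+ a)) (cong (+_) (sym (+-identityʳ (suc b)))))

≤ʳ-trans : ∀ {a b c} → a ≤ʳ b → b ≤ʳ c → a ≤ʳ c
≤ʳ-trans = ℚₚ.≤-trans

0≤ι : ∀ n → 0ℚ ≤ʳ ι n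
0≤ι n = subst (_≤ʳ ι n) ι0 (ι-mono z≤n)

0≤1 : 0ℚ ≤ʳ 1ℚ
0≤1 = subst (0ℚ ≤ʳ_) ι1 (0≤ι 1)

mulˡ : ∀ {a b} c → 0ℚ ≤ʳ c → a ≤ʳ b → c *ʳ a ≤ʳ c *ʳ b
mulˡ c 0≤c = ℚₚ.*-monoˡ-≤-nonNeg c {{ℚ.nonNegative 0≤c}}

mulʳ : ∀ {a b} c → 0ℚ ≤ʳ c → a ≤ʳ b → a *ʳ c ≤ʳ b *ʳ c
mulʳ c 0≤c = ℚₚ.*-monoʳ-≤-nonNeg c {{ℚ.nonNegative 0≤c}}

mul-mono : ∀ {a b c d} → 0ℚ ≤ʳ a → 0ℚ ≤ʳ c → a ≤ʳ b → c ≤ʳ d → a *ʳ c ≤ʳ b *ʳ d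
mul-mono {a} {b} {c} {d} 0≤a 0≤c a≤b c≤d = ≤ʳ-trans (mulʳ c 0≤c a≤b) (mulˡ b (≤ʳ-trans 0≤a a≤b) c≤d)

0≤* : ∀ {a b} → 0ℚ ≤ʳ a → 0ℚ ≤ʳ b → 0ℚ ≤ʳ a *ʳ b
0≤* {a} {b} 0≤a 0≤b = subst (_≤ʳ a *ʳ b) (ℚₚ.*-zeroʳ a) (mulˡ a 0≤a 0≤b)

0≤+ : ∀ {a b} → 0ℚ ≤ʳ a → 0ℚ ≤ʳ b → 0ℚ ≤ʳ a +ʳ b
0≤+ 0≤a 0≤b = ℚₚ.+-mono-≤ 0≤a 0≤b

add-mono : ∀ {a b c d} → a ≤ʳ b → c ≤ʳ d → a +ʳ c ≤ʳ b +ʳ d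
add-mono = ℚₚ.+-mono-≤

≤+ʳ : ∀ {a} b → 0ℚ ≤ʳ b → a ≤ʳ a +ʳ b
≤+ʳ {a} b 0≤b = subst (_≤ʳ a +ʳ b) (ℚₚ.+-identityʳ a) (ℚₚ.+-monoʳ-≤ a 0≤b)

≤+ˡ : ∀ {a} b → 0ℚ ≤ʳ b → a ≤ʳ b +ʳ a
≤+ˡ {a} b 0≤b = subst (a ≤ʳ_) (ℚₚ.+-comm a b) (≤+ʳ b 0≤b)

≤-byʳ : ∀ {a b} c → 0ℚ ≤ʳ c → b ≡ a +ʳ c → a ≤ʳ b
≤-byʳ c 0≤c eq = subst (_ ≤ʳ_) (sym eq) (≤+ʳ c 0≤c)

sub-mono : ∀ {a b c} → a +ʳ b ≤ʳ c → a ≤ʳ c -ʳ b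
sub-mono {a} {b} {c} le = subst (_≤ʳ c -ʳ b) (e a b) (ℚₚ.+-monoˡ-≤ (-ʳ b) le)
  where
  e : ∀ a b → (a +ʳ b) -ʳ b ≡ a
  e = solve-∀ ring

add-cancelʳ : ∀ {a b} c → a +ʳ c ≤ʳ b +ʳ c → a ≤ʳ b
add-cancelʳ {a} {b} c le = subst₂ _≤ʳ_ (e a c) (e b c) (ℚₚ.+-monoˡ-≤ (-ʳ c) le)
  where
  e : ∀ a b → (a +ʳ b) -ʳ b ≡ a
  e = solve-∀ ring

inv-ι : ∀ n → 1 ≤ n → inv n *ʳ ι n ≡ 1ℚ
inv-ι n p = trans (ℚₚ.*-comm (inv n) (ι n)) (ι-inv n p)

ι-cancelˡ : ∀ {a b} n → 1 ≤ n → ι n *ʳ a ≤ʳ ι n *ʳ b → a ≤ʳ b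
ι-cancelˡ {a} {b} n p le = subst₂ _≤ʳ_ (e a) (e b) (mulˡ (inv n) (0≤inv n) le)
  where
  e : ∀ a → inv n *ʳ (ι n *ʳ a) ≡ a
  e a = trans (sym (ℚₚ.*-assoc (inv n) (ι n) a)) (trans (cong (_*ʳ a) (inv-ι n p)) (ℚₚ.*-identityˡ a))

ι-cancelˡ-≡ : ∀ {a b} n → 1 ≤ n → ι n *ʳ a ≡ ι n *ʳ b → a ≡ b
ι-cancelˡ-≡ n p eq = ℚₚ.≤-antisym (ι-cancelˡ n p (ℚₚ.≤-reflexive eq)) (ι-cancelˡ n p (ℚₚ.≤-reflexive (sym eq)))

inv-unique : ∀ n a → 1 ≤ n → ι n *ʳ a ≡ 1ℚ → a ≡ inv n
inv-unique n a p eq = ι-cancelˡ-≡ n p (trans eq (sym (ι-inv n p)))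

inv1 : inv 1 ≡ 1ℚ
inv1 = sym (inv-unique 1 1ℚ ≤-refl (trans (cong (_*ʳ 1ℚ) ι1) (ℚₚ.*-identityˡ 1ℚ)))

inv-* : ∀ m n → inv (m * n) ≡ inv m *ʳ inv n
inv-* zero n = trans inv-zero (sym (trans (cong (_*ʳ inv n) inv-zero) (ℚₚ.*-zeroˡ (inv n))))
inv-* (suc m) zero = trans (cong inv (*-zeroʳ (suc m))) (trans inv-zero (sym (trans (cong (inv (suc m) *ʳ_) inv-zero) (ℚₚ.*-zeroʳ (inv (suc m))))))
inv-* m@(suc _) n@(suc _) = sym (inv-unique (m * n) _ (s≤s z≤n) (begin
  ι (m * n) *ʳ (inv m *ʳ inv n)   ≡⟨ cong (_*ʳ (inv m *ʳ inv n)) (ι-* m n) ⟩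
  ι m *ʳ ι n *ʳ (inv m *ʳ inv n)  ≡⟨ e (ι m) (ι n) (inv m) (inv n) ⟩
  ι m *ʳ inv m *ʳ (ι n *ʳ inv n)  ≡⟨ cong₂ _*ʳ_ (ι-inv m (s≤s z≤n)) (ι-inv n (s≤s z≤n)) ⟩
  1ℚ *ʳ 1ℚ                        ≡⟨ ℚₚ.*-identityˡ 1ℚ ⟩
  1ℚ ∎))
  where
  open ≡-Reasoning
  e : ∀ a b c d → a *ʳ b *ʳ (c *ʳ d) ≡ a *ʳ c *ʳ (b *ʳ d)
  e = solve-∀ ring

inv-anti : ∀ {m n} → 1 ≤ m → m ≤ n → inv n ≤ʳ inv m
inv-anti {m} {n} 1≤m m≤n = ι-cancelˡ n (≤-trans 1≤m m≤n) (subst (_≤ʳ ι n *ʳ inv m)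
  (trans (ι-inv m 1≤m) (sym (ι-inv n (≤-trans 1≤m m≤n)))) (mulʳ (inv m) (0≤inv m) (ι-mono m≤n)))

inv≤1 : ∀ n → inv n ≤ʳ 1ℚ
inv≤1 zero = subst (_≤ʳ 1ℚ) (sym inv-zero) 0≤1
inv≤1 (suc n) = subst (inv (suc n) ≤ʳ_) inv1 (inv-anti ≤-refl (s≤s z≤n))

≤ι*⇒inv*≤ : ∀ {a b} n → 1 ≤ n → a ≤ʳ ι n *ʳ b → inv n *ʳ a ≤ʳ b
≤ι*⇒inv*≤ {a} {b} n p le = ι-cancelˡ n p (subst (_≤ʳ ι n *ʳ b) (sym (trans (sym (ℚₚ.*-assoc (ι n) (inv n) a)) (trans (cong (_*ʳ a) (ι-inv n p)) (ℚₚ.*-identityˡ a)))) le)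

inv*≤⇒≤ι* : ∀ {a b} n → 1 ≤ n → inv n *ʳ a ≤ʳ b → a ≤ʳ ι n *ʳ b
inv*≤⇒≤ι* {a} {b} n p le = subst (_≤ʳ ι n *ʳ b) (trans (sym (ℚₚ.*-assoc (ι n) (inv n) a)) (trans (cong (_*ʳ a) (ι-inv n p)) (ℚₚ.*-identityˡ a))) (mulˡ (ι n) (0≤ι n) le)

-- Finite sums over lists and over initial segments.

∑ : ∀ {A : Set} → (A → ℚ) → List A → ℚ
∑ f [] = 0ℚ
∑ f (x ∷ xs) = f x +ʳ ∑ f xs

private
  variable
    𝔸 𝔹 : Set

∑-++ : ∀ (f : 𝔸 → ℚ) xs ys → ∑ f (xs ++ ys) ≡ ∑ f xs +ʳ ∑ f ys
∑-++ f [] ys = sym (ℚₚ.+-identityˡ _)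
∑-++ f (x ∷ xs) ys = trans (cong (f x +ʳ_) (∑-++ f xs ys)) (sym (ℚₚ.+-assoc (f x) (∑ f xs) (∑ f ys)))

∑-map : ∀ (f : 𝔹 → ℚ) (g : 𝔸 → 𝔹) xs → ∑ f (map g xs) ≡ ∑ (f ∘ g) xs
∑-map f g [] = refl
∑-map f g (x ∷ xs) = cong (f (g x) +ʳ_) (∑-map f g xs)

∑-concatMap : ∀ (f : 𝔹 → ℚ) (g : 𝔸 → List 𝔹) xs → ∑ f (concatMap g xs) ≡ ∑ (λ x → ∑ f (g x)) xs
∑-concatMap f g [] = refl
∑-concatMap f g (x ∷ xs) = trans (∑-++ f (g x) (concatMap g xs)) (cong (∑ f (g x) +ʳ_) (∑-concatMap f g xs))

∑-cong : ∀ {f g : 𝔸 → ℚ} xs → (∀ {x} → x ∈ xs → f x ≡ g x) → ∑ f xs ≡ ∑ g xs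
∑-cong [] h = refl
∑-cong (x ∷ xs) h = cong₂ _+ʳ_ (h (here refl)) (∑-cong xs (h ∘ there))

∑-mono : ∀ {f g : 𝔸 → ℚ} xs → (∀ {x} → x ∈ xs → f x ≤ʳ g x) → ∑ f xs ≤ʳ ∑ g xs
∑-mono [] h = ℚₚ.≤-refl
∑-mono (x ∷ xs) h = add-mono (h (here refl)) (∑-mono xs (h ∘ there))

∑-nonneg : ∀ {f : 𝔸 → ℚ} xs → (∀ {x} → x ∈ xs → 0ℚ ≤ʳ f x) → 0ℚ ≤ʳ ∑ f xs
∑-nonneg [] h = ℚₚ.≤-refl
∑-nonneg (x ∷ xs) h = 0≤+ (h (here refl)) (∑-nonneg xs (h ∘ there))

∑-*ˡ : ∀ c (f : 𝔸 → ℚ) xs → ∑ (λ x → c *ʳ f x) xs ≡ c *ʳ ∑ f xs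
∑-*ˡ c f [] = sym (ℚₚ.*-zeroʳ c)
∑-*ˡ c f (x ∷ xs) = trans (cong (c *ʳ f x +ʳ_) (∑-*ˡ c f xs)) (sym (ℚₚ.*-distribˡ-+ c (f x) (∑ f xs)))

∑-+ : ∀ (f g : 𝔸 → ℚ) xs → ∑ (λ x → f x +ʳ g x) xs ≡ ∑ f xs +ʳ ∑ g xs
∑-+ f g [] = sym (ℚₚ.+-identityˡ 0ℚ)
∑-+ f g (x ∷ xs) = trans (cong (f x +ʳ g x +ʳ_) (∑-+ f g xs)) (e (f x) (g x) (∑ f xs) (∑ g xs))
  where
  e : ∀ a b c d → a +ʳ b +ʳ (c +ʳ d) ≡ a +ʳ c +ʳ (b +ʳ d)
  e = solve-∀ ring

∑-const : ∀ c (xs : List 𝔸) → ∑ (λ _ → c) xs ≡ ι (length xs) *ʳ c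
∑-const c [] = sym (trans (cong (_*ʳ c) ι0) (ℚₚ.*-zeroˡ c))
∑-const c (x ∷ xs) = trans (cong (c +ʳ_) (∑-const c xs)) (trans (e c (ι (length xs))) (cong (_*ʳ c) (trans (cong (_+ʳ ι (length xs)) (sym ι1)) (sym (ι-+ 1 (length xs))))))
  where
  e : ∀ c l → c +ʳ l *ʳ c ≡ (1ℚ +ʳ l) *ʳ c
  e = solve-∀ ring

𝟙 : ∀ {P : Set} → Dec P → ℚ
𝟙 d = if does d then 1ℚ else 0ℚ

0≤𝟙 : ∀ {P : Set} (d : Dec P) → 0ℚ ≤ʳ 𝟙 d
0≤𝟙 (yes _) = 0≤1
0≤𝟙 (no _) = ℚₚ.≤-refl

𝟙-yes : ∀ {P : Set} (d : Dec P) → P → 𝟙 d ≡ 1ℚ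
𝟙-yes (yes _) p = refl
𝟙-yes (no ¬p) p = ⊥-elim (¬p p)

𝟙-no : ∀ {P : Set} (d : Dec P) → ¬ P → 𝟙 d ≡ 0ℚ
𝟙-no (yes p) ¬p = ⊥-elim (¬p p)
𝟙-no (no _) ¬p = refl

∑-filter : ∀ {P : 𝔸 → Set} (P? : Decidable P) (f : 𝔸 → ℚ) xs → ∑ f (filter P? xs) ≡ ∑ (λ x → 𝟙 (P? x) *ʳ f x) xs
∑-filter P? f [] = refl
∑-filter P? f (x ∷ xs) with P? x
... | yes _ = cong₂ _+ʳ_ (sym (ℚₚ.*-identityˡ (f x))) (∑-filter P? f xs)
... | no _ = trans (∑-filter P? f xs) (sym (trans (cong (_+ʳ _) (ℚₚ.*-zeroˡ (f x))) (ℚₚ.+-identityˡ _)))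

∑-filter-split : ∀ {P : 𝔸 → Set} (P? : Decidable P) (f : 𝔸 → ℚ) xs → ∑ f xs ≡ ∑ f (filter P? xs) +ʳ ∑ f (filter (¬? ∘ P?) xs)
∑-filter-split P? f [] = sym (ℚₚ.+-identityˡ 0ℚ)
∑-filter-split P? f (x ∷ xs) with P? x
... | yes _ = trans (cong (f x +ʳ_) (∑-filter-split P? f xs)) (sym (ℚₚ.+-assoc (f x) _ _))
... | no _ = trans (cong (f x +ʳ_) (∑-filter-split P? f xs)) (e (f x) (∑ f (filter P? xs)) (∑ f (filter (¬? ∘ P?) xs)))
  where
  e : ∀ a b c → a +ʳ (b +ʳ c) ≡ b +ʳ (a +ʳ c)
  e = solve-∀ ring

∈-remove : ∀ {x : 𝔸} ys → x ∈ ys → List 𝔸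
∈-remove (y ∷ ys) (here _) = ys
∈-remove (y ∷ ys) (there p) = y ∷ ∈-remove ys p

∑-remove : ∀ (f : 𝔸 → ℚ) {x} ys (p : x ∈ ys) → ∑ f ys ≡ f x +ʳ ∑ f (∈-remove ys p)
∑-remove f (y ∷ ys) (here refl) = refl
∑-remove f {x} (y ∷ ys) (there p) = trans (cong (f y +ʳ_) (∑-remove f ys p)) (e (f y) (f x) _)
  where
  e : ∀ a b c → a +ʳ (b +ʳ c) ≡ b +ʳ (a +ʳ c)
  e = solve-∀ ring

∈-remove-≢ : ∀ {x y : 𝔸} ys (p : x ∈ ys) → y ∈ ys → x ≢ y → y ∈ ∈-remove ys p
∈-remove-≢ (_ ∷ ys) (here refl) (here refl) ne = ⊥-elim (ne refl)
∈-remove-≢ (_ ∷ ys) (here _) (there q) ne = q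
∈-remove-≢ (_ ∷ ys) (there p) (here e) ne = here e
∈-remove-≢ (_ ∷ ys) (there p) (there q) ne = there (∈-remove-≢ ys p q ne)

∑-⊆ : ∀ (f : 𝔸 → ℚ) xs ys → (∀ x → 0ℚ ≤ʳ f x) → Unique xs → (∀ {x} → x ∈ xs → x ∈ ys) → ∑ f xs ≤ʳ ∑ f ys
∑-⊆ f [] ys 0≤f u sub = ∑-nonneg ys (λ {x} _ → 0≤f x)
∑-⊆ f (x ∷ xs) ys 0≤f (x∉ ∷ u) sub = subst (f x +ʳ ∑ f xs ≤ʳ_) (sym (∑-remove f ys (sub (here refl))))
  (ℚₚ.+-monoʳ-≤ (f x) (∑-⊆ f xs _ 0≤f u (λ q → ∈-remove-≢ ys (sub (here refl)) (sub (there q)) (All.lookup x∉ q))))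

length-⊆ : ∀ (xs ys : List 𝔸) → Unique xs → (∀ {x} → x ∈ xs → x ∈ ys) → length xs ≤ length ys
length-⊆ xs ys u sub = ι-cancel (subst₂ _≤ʳ_ (e xs) (e ys) (∑-⊆ (λ _ → 1ℚ) xs ys (λ _ → 0≤1) u sub))
  where
  e : ∀ (zs : List 𝔸) → ∑ (λ _ → 1ℚ) zs ≡ ι (length zs)
  e zs = trans (∑-const 1ℚ zs) (ℚₚ.*-identityʳ _)

∑< : ℕ → (ℕ → ℚ) → ℚ
∑< zero f = 0ℚ
∑< (suc n) f = ∑< n f +ʳ f n

∑<-cong : ∀ n {f g} → (∀ m → m < n → f m ≡ g m) → ∑< n f ≡ ∑< n g
∑<-cong zero h = refl
∑<-cong (suc n) h = cong₂ _+ʳ_ (∑<-cong n (λ m lt → h m (m≤n⇒m≤1+n lt))) (h n ≤-refl)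

∑<-mono : ∀ n {f g} → (∀ m → m < n → f m ≤ʳ g m) → ∑< n f ≤ʳ ∑< n g
∑<-mono zero h = ℚₚ.≤-refl
∑<-mono (suc n) h = add-mono (∑<-mono n (λ m lt → h m (m≤n⇒m≤1+n lt))) (h n ≤-refl)

∑<-+ : ∀ n f g → ∑< n (λ m → f m +ʳ g m) ≡ ∑< n f +ʳ ∑< n g
∑<-+ zero f g = sym (ℚₚ.+-identityˡ 0ℚ)
∑<-+ (suc n) f g = trans (cong (_+ʳ (f n +ʳ g n)) (∑<-+ n f g)) (e (∑< n f) (∑< n g) (f n) (g n))
  where
  e : ∀ a b c d → a +ʳ b +ʳ (c +ʳ d) ≡ a +ʳ c +ʳ (b +ʳ d)
  e = solve-∀ ring

∑<-*ˡ : ∀ n c f → ∑< n (λ m → c *ʳ f m) ≡ c *ʳ ∑< n f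
∑<-*ˡ zero c f = sym (ℚₚ.*-zeroʳ c)
∑<-*ˡ (suc n) c f = trans (cong (_+ʳ c *ʳ f n) (∑<-*ˡ n c f)) (sym (ℚₚ.*-distribˡ-+ c (∑< n f) (f n)))

∑<-const : ∀ n c → ∑< n (λ _ → c) ≡ ι n *ʳ c
∑<-const zero c = sym (trans (cong (_*ʳ c) ι0) (ℚₚ.*-zeroˡ c))
∑<-const (suc n) c = trans (cong (_+ʳ c) (∑<-const n c)) (trans (e c (ι n)) (cong (_*ʳ c) (trans (cong (_+ʳ ι n) (sym ι1)) (sym (ι-+ 1 n)))))
  where
  e : ∀ c l → l *ʳ c +ʳ c ≡ (1ℚ +ʳ l) *ʳ c
  e = solve-∀ ring

∑<-split : ∀ m n f → ∑< (m + n) f ≡ ∑< m f +ʳ ∑< n (λ i → f (m + i))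
∑<-split m zero f = trans (cong (λ z → ∑< z f) (+-identityʳ m)) (sym (ℚₚ.+-identityʳ _))
∑<-split m (suc n) f = trans (cong (λ z → ∑< z f) (+-suc m n)) (trans (cong (_+ʳ f (m + n)) (∑<-split m n f)) (ℚₚ.+-assoc (∑< m f) _ _))

∑<-swap : ∀ m n (f : ℕ → ℕ → ℚ) → ∑< m (λ i → ∑< n (f i)) ≡ ∑< n (λ j → ∑< m (λ i → f i j))
∑<-swap m zero f = trans (∑<-const m 0ℚ) (ℚₚ.*-zeroʳ (ι m))
∑<-swap m (suc n) f = trans (∑<-+ m (λ i → ∑< n (f i)) (λ i → f i n)) (cong (_+ʳ ∑< m (λ i → f i n)) (∑<-swap m n f))

∑<-downFrom : ∀ N f → ∑< N f ≡ ∑ f (downFrom N)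
∑<-downFrom zero f = refl
∑<-downFrom (suc N) f = trans (ℚₚ.+-comm (∑< N f) (f N)) (cong (f N +ʳ_) (∑<-downFrom N f))

-- Periodic functions and sums over complete periods.

Per : ℕ → (ℕ → ℚ) → Set
Per M F = ∀ m → F (m + M) ≡ F m

per-mult : ∀ {M F} → Per M F → ∀ k m → F (m + k * M) ≡ F m
per-mult {M} {F} per zero m = cong F (+-identityʳ m)
per-mult {M} {F} per (suc k) m = trans (cong F (e m M (k * M))) (trans (per (m + k * M)) (per-mult per k m))
  where
  e : ∀ m M x → m + (M + x) ≡ m + x + M
  e = ℕSolver.solve-∀

∑<-shift : ∀ {M F} → Per M F → ∀ c → ∑< M (λ m → F (c + m)) ≡ ∑< M F
∑<-shift per zero = refl
∑<-shift {M} {F} per (suc c) = trans step (∑<-shift per c)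
  where
  open ≡-Reasoning
  step : ∑< M (λ m → F (suc c + m)) ≡ ∑< M (λ m → F (c + m))
  step = begin
    ∑< M (λ m → F (suc c + m))                             ≡⟨ ∑<-cong M (λ m _ → cong F (sym (+-suc c m))) ⟩
    ∑< M (λ m → F (c + suc m))                             ≡⟨ e (F (c + 0)) _ ⟩
    (F (c + 0) +ʳ ∑< M (λ m → F (c + suc m))) -ʳ F (c + 0) ≡⟨ cong (λ z → (z +ʳ ∑< M (λ m → F (c + suc m))) -ʳ F (c + 0)) (sym (ℚₚ.+-identityˡ (F (c + 0)))) ⟩
    (∑< 1 (λ m → F (c + m)) +ʳ ∑< M (λ m → F (c + suc m))) -ʳ F (c + 0) ≡⟨ cong (_-ʳ F (c + 0)) (sym (∑<-split 1 M (λ m → F (c + m)))) ⟩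
    ∑< M (λ m → F (c + m)) +ʳ F (c + M) -ʳ F (c + 0)       ≡⟨ cong (λ z → ∑< M (λ m → F (c + m)) +ʳ z -ʳ F (c + 0)) (trans (per c) (cong F (sym (+-identityʳ c)))) ⟩
    ∑< M (λ m → F (c + m)) +ʳ F (c + 0) -ʳ F (c + 0)       ≡⟨ e′ _ (F (c + 0)) ⟩
    ∑< M (λ m → F (c + m)) ∎
    where
    e : ∀ a b → b ≡ (a +ʳ b) -ʳ a
    e = solve-∀ ring
    e′ : ∀ a b → a +ʳ b -ʳ b ≡ a
    e′ = solve-∀ ring

∑<-grid : ∀ p M f → ∑< (p * M) f ≡ ∑< p (λ b → ∑< M (λ a → f (b * M + a)))
∑<-grid zero M f = refl
∑<-grid (suc p) M f = trans (cong (λ z → ∑< z f) (+-comm M (p * M)))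
  (trans (∑<-split (p * M) M f) (cong (_+ʳ ∑< M (λ a → f (p * M + a))) (∑<-grid p M f)))

∑<-periods : ∀ {M F} → Per M F → ∀ k → ∑< (k * M) F ≡ ι k *ʳ ∑< M F
∑<-periods {M} {F} per k = trans (∑<-grid k M F)
  (trans (∑<-cong k (λ b _ → ∑<-shift per (b * M))) (∑<-const k (∑< M F)))

-- By Bézout, `1` is the difference of a multiple of one period and a multiple of the other, so the
-- values at `a` and `suc a` agree.
coprime-periods⇒constant : ∀ {M p u} → Per M u → Per p u → Coprime M p → ∀ a → u a ≡ u 0
coprime-periods⇒constant {M} {p} {u} perM perp cop zero = refl
coprime-periods⇒constant {M} {p} {u} perM perp cop (suc a) = trans step (coprime-periods⇒constant perM perp cop a)
  where
  open ≡-Reasoning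
  shuffle : ∀ {X Y} → 1 + X ≡ Y → suc a + X ≡ a + Y
  shuffle {X} eq = trans (sym (+-suc a X)) (cong (λ z → a + z) eq)
  step : u (suc a) ≡ u a
  step with coprime-Bézout cop
  ... | Bézout.+- x y eq = begin
    u (suc a)         ≡⟨ sym (per-mult perp y (suc a)) ⟩
    u (suc a + y * p) ≡⟨ cong u (shuffle eq) ⟩
    u (a + x * M)     ≡⟨ per-mult perM x a ⟩
    u a ∎
  ... | Bézout.-+ x y eq = begin
    u (suc a)         ≡⟨ sym (per-mult perM x (suc a)) ⟩
    u (suc a + x * M) ≡⟨ cong u (shuffle eq) ⟩
    u (a + y * p)     ≡⟨ per-mult perp y a ⟩
    u a ∎

-- Summed over one residue class modulo M, t is periodic modulo both M and p, hence constant.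
∑<-CRT : ∀ {M p F t} → 1 ≤ p → Per M F → Per p t → Coprime M p →
  ∑< (M * p) (λ m → F m *ʳ t m) ≡ ∑< M F *ʳ ∑< p t
∑<-CRT {M} {p} {F} {t} 1≤p perF pert cop = begin
  ∑< (M * p) (λ m → F m *ʳ t m)                                      ≡⟨ cong (λ z → ∑< z (λ m → F m *ʳ t m)) (*-comm M p) ⟩
  ∑< (p * M) (λ m → F m *ʳ t m)                                      ≡⟨ ∑<-grid p M _ ⟩
  ∑< p (λ b → ∑< M (λ a → F (b * M + a) *ʳ t (b * M + a)))           ≡⟨ ∑<-swap p M _ ⟩
  ∑< M (λ a → ∑< p (λ b → F (b * M + a) *ʳ t (b * M + a)))           ≡⟨ ∑<-cong M (λ a _ → ∑<-cong p (λ b _ → cong (_*ʳ t (b * M + a)) (trans (cong F (+-comm (b * M) a)) (per-mult perF b a)))) ⟩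
  ∑< M (λ a → ∑< p (λ b → F a *ʳ t (b * M + a)))                     ≡⟨ ∑<-cong M (λ a _ → ∑<-*ˡ p (F a) (λ b → t (b * M + a))) ⟩
  ∑< M (λ a → F a *ʳ u a)                                            ≡⟨ ∑<-cong M (λ a _ → trans (cong (F a *ʳ_) (trans (coprime-periods⇒constant perMu perpu cop a) u0)) (ℚₚ.*-comm (F a) (∑< p t))) ⟩
  ∑< M (λ a → ∑< p t *ʳ F a)                                         ≡⟨ ∑<-*ˡ M (∑< p t) F ⟩
  ∑< p t *ʳ ∑< M F                                                   ≡⟨ ℚₚ.*-comm (∑< p t) (∑< M F) ⟩
  ∑< M F *ʳ ∑< p t ∎
  where
  open ≡-Reasoning
  u : ℕ → ℚ
  u a = ∑< p (λ b → t (b * M + a))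
  perpu : Per p u
  perpu a = ∑<-cong p (λ b _ → trans (cong t (sym (+-assoc (b * M) a p))) (pert (b * M + a)))
  -- Passing from `a` to `a + M` moves `b` to `b + 1`, and the summand has period `p` as a function
  -- of `b`.
  perMu : Per M u
  perMu a = trans (∑<-cong p (λ b _ → cong t (e b M a))) (∑<-shift {F = λ b → t (b * M + a)} per′ 1)
    where
    e : ∀ b M a → b * M + (a + M) ≡ (1 + b) * M + a
    e = ℕSolver.solve-∀
    e′ : ∀ b M p a → (b + p) * M + a ≡ (b * M + a) + M * p
    e′ = ℕSolver.solve-∀
    per′ : Per p (λ b → t (b * M + a))
    per′ b = trans (cong t (e′ b M p a)) (per-mult pert M (b * M + a))
  -- Since `u` is constant, `u 0` is found by averaging `u` over `a < p`: after swapping the sums,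
  -- every inner sum is a full period of `t`.
  u0 : u 0 ≡ ∑< p t
  u0 = ι-cancelˡ-≡ p 1≤p (begin
    ι p *ʳ u 0                                   ≡⟨ sym (∑<-const p (u 0)) ⟩
    ∑< p (λ _ → u 0)                             ≡⟨ ∑<-cong p (λ a _ → sym (coprime-periods⇒constant perMu perpu cop a)) ⟩
    ∑< p u                                       ≡⟨ ∑<-swap p p (λ a b → t (b * M + a)) ⟩
    ∑< p (λ b → ∑< p (λ a → t (b * M + a)))      ≡⟨ ∑<-cong p (λ b _ → ∑<-shift pert (b * M)) ⟩
    ∑< p (λ b → ∑< p t)                          ≡⟨ ∑<-const p (∑< p t) ⟩
    ι p *ʳ ∑< p t ∎)

-- Truncated sums over products of distinct primes.

quot : ℕ → ℕ → ℕ
quot D zero = 0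
quot D (suc p) = D div suc p

quot-*≤ : ∀ D p → quot D p * p ≤ D
quot-*≤ D zero = z≤n
quot-*≤ D (suc p) = m/n*n≤m D (suc p)

quot-mono : ∀ {D E} p → D ≤ E → quot D p ≤ quot E p
quot-mono zero le = z≤n
quot-mono (suc p) le = /-monoˡ-≤ (suc p) le

≤quot : ∀ {k D} p → 1 ≤ p → k * p ≤ D → k ≤ quot D p
≤quot {k} (suc p) _ le = subst (_≤ _) (m*n/n≡m k (suc p)) (/-monoˡ-≤ (suc p) le)

quot-< : ∀ x b → 1 ≤ b → x < suc (quot x b) * b
quot-< x b@(suc _) _ = ≤-trans (≤-reflexive (cong suc (m≡m%n+[m/n]*n x b))) (+-monoˡ-≤ (x div b * b) (m%n<n x b))

quot≤ : ∀ D p → quot D p ≤ D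
quot≤ D zero = z≤n
quot≤ D (suc p) = m/n≤m D (suc p)

-- A diagonal term of `bilinear` has to satisfy both truncations; this keeps the joint condition
-- `D ⊓ E` stable when a prime is split off.
quot-⊓ : ∀ D E p → quot D p ⊓ quot E p ≡ quot (D ⊓ E) p
quot-⊓ D E p with ≤-total D E
... | inj₁ le = trans (m≤n⇒m⊓n≡m (quot-mono p le)) (cong (λ z → quot z p) (sym (m≤n⇒m⊓n≡m le)))
... | inj₂ le = trans (m≥n⇒m⊓n≡n (quot-mono p le)) (cong (λ z → quot z p) (sym (m≥n⇒m⊓n≡n le)))

-- gsum w ps D is the sum of ∏_{p ∈ d} w p over the subsets d of ps with product at most D.
δ₁ : ℕ → ℚ
δ₁ zero = 0ℚ
δ₁ (suc _) = 1ℚ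

gsum : (ℕ → ℚ) → List ℕ → ℕ → ℚ
gsum w [] D = δ₁ D
gsum w (p ∷ ps) D = gsum w ps D +ʳ w p *ʳ gsum w ps (quot D p)

0≤δ₁ : ∀ D → 0ℚ ≤ʳ δ₁ D
0≤δ₁ zero = ℚₚ.≤-refl
0≤δ₁ (suc _) = 0≤1

gsum-nonneg : ∀ w ps D → (∀ p → 0ℚ ≤ʳ w p) → 0ℚ ≤ʳ gsum w ps D
gsum-nonneg w [] D 0≤w = 0≤δ₁ D
gsum-nonneg w (p ∷ ps) D 0≤w = 0≤+ (gsum-nonneg w ps D 0≤w) (0≤* (0≤w p) (gsum-nonneg w ps (quot D p) 0≤w))

gsum-mono : ∀ w ps {D E} → (∀ p → 0ℚ ≤ʳ w p) → D ≤ E → gsum w ps D ≤ʳ gsum w ps E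
gsum-mono w [] {zero} {E} 0≤w le = 0≤δ₁ E
gsum-mono w [] {suc D} {suc E} 0≤w le = ℚₚ.≤-refl
gsum-mono w (p ∷ ps) 0≤w le = add-mono (gsum-mono w ps 0≤w le) (mulˡ (w p) (0≤w p) (gsum-mono w ps 0≤w (quot-mono p le)))

1≤gsum : ∀ w ps D → (∀ p → 0ℚ ≤ʳ w p) → 1 ≤ D → 1ℚ ≤ʳ gsum w ps D
1≤gsum w [] (suc D) 0≤w _ = ℚₚ.≤-refl
1≤gsum w (p ∷ ps) D 0≤w 1≤D = ≤ʳ-trans (1≤gsum w ps D 0≤w 1≤D) (≤+ʳ _ (0≤* (0≤w p) (gsum-nonneg w ps (quot D p) 0≤w)))

-- An upper bound sieve by comparison of second moments.

module Sieve (τ : ℕ → ℕ → ℚ) (g : ℕ → ℚ) (0≤g : ∀ p → 0ℚ ≤ʳ g p) where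

  -- τ p is normalised to have mean 0 and mean square g p, and equals g p off the removed classes.
  record Local (p : ℕ) : Set where
    field
      pos  : 1 ≤ p
      per  : Per p (τ p)
      lo   : ∀ m → -ʳ 1ℚ ≤ʳ τ p m
      hi   : ∀ m → τ p m ≤ʳ 1ℚ
      mean : ∑< p (τ p) ≡ 0ℚ
      var  : ∑< p (λ m → τ p m *ʳ τ p m) ≡ ι p *ʳ g p
      dens : inv p ≤ʳ g p

  f : List ℕ → ℕ → ℕ → ℚ
  f ps D m = gsum (λ p → τ p m) ps D

  Bdd : (ℕ → ℚ) → Set
  Bdd F = ∀ m → (-ʳ 1ℚ ≤ʳ F m) × (F m ≤ʳ 1ℚ)

  bdd-* : ∀ {a b} → -ʳ 1ℚ ≤ʳ a → a ≤ʳ 1ℚ → -ʳ 1ℚ ≤ʳ b → b ≤ʳ 1ℚ → (-ʳ 1ℚ ≤ʳ a *ʳ b) × (a *ʳ b ≤ʳ 1ℚ)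
  bdd-* {a} {b} la ua lb ub =
    ≤-halve (≤-byʳ _ (0≤+ (0≤* (sh la) (sh lb)) (0≤* (sh′ ua) (sh′ ub))) (e₁ a b)) ,
    ≤-halve (≤-byʳ _ (0≤+ (0≤* (sh la) (sh′ ub)) (0≤* (sh′ ua) (sh lb))) (e₂ a b))
    where
    sh : ∀ {a} → -ʳ 1ℚ ≤ʳ a → 0ℚ ≤ʳ a +ʳ 1ℚ
    sh {a} le = ℚₚ.+-monoˡ-≤ 1ℚ le
    sh′ : ∀ {a} → a ≤ʳ 1ℚ → 0ℚ ≤ʳ 1ℚ -ʳ a
    sh′ {a} le = subst (_≤ʳ 1ℚ -ʳ a) (ℚₚ.+-inverseʳ a) (ℚₚ.+-monoˡ-≤ (-ʳ a) le)
    ≤-halve : ∀ {x y} → x +ʳ x ≤ʳ y +ʳ y → x ≤ʳ y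
    ≤-halve {x} {y} le = ι-cancelˡ 2 (s≤s z≤n) (subst₂ _≤ʳ_ (dbl x) (dbl y) le)
      where
      e : ∀ x → x +ʳ x ≡ (1ℚ +ʳ 1ℚ) *ʳ x
      e = solve-∀ ring
      dbl : ∀ x → x +ʳ x ≡ ι 2 *ʳ x
      dbl x = trans (e x) (cong (_*ʳ x) (sym (trans (ι-+ 1 1) (cong₂ _+ʳ_ ι1 ι1))))
    e₁ : ∀ a b → a *ʳ b +ʳ a *ʳ b ≡ -ʳ 1ℚ +ʳ -ʳ 1ℚ +ʳ ((a +ʳ 1ℚ) *ʳ (b +ʳ 1ℚ) +ʳ (1ℚ -ʳ a) *ʳ (1ℚ -ʳ b))
    e₁ = solve-∀ ring
    e₂ : ∀ a b → 1ℚ +ʳ 1ℚ ≡ a *ʳ b +ʳ a *ʳ b +ʳ ((a +ʳ 1ℚ) *ʳ (1ℚ -ʳ b) +ʳ (1ℚ -ʳ a) *ʳ (b +ʳ 1ℚ))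
    e₂ = solve-∀ ring

  ∑<-lo : ∀ {F} → Bdd F → ∀ n → -ʳ (ι n) ≤ʳ ∑< n F
  ∑<-lo {F} bd n = subst (_≤ʳ ∑< n F) (trans (∑<-const n (-ʳ 1ℚ)) (e (ι n))) (∑<-mono n (λ m _ → proj₁ (bd m)))
    where
    e : ∀ a → a *ʳ (-ʳ 1ℚ) ≡ -ʳ a
    e = solve-∀ ring

  ∑<-hi : ∀ {F} → Bdd F → ∀ n → ∑< n F ≤ʳ ι n
  ∑<-hi {F} bd n = subst (∑< n F ≤ʳ_) (trans (∑<-const n 1ℚ) (ℚₚ.*-identityʳ (ι n))) (∑<-mono n (λ m _ → proj₂ (bd m)))

  -- Write `N = k M + ρ`. After multiplication by `M`, the incomplete period contributes at most
  -- `M²`, and replacing `k M` by `N` in the main term costs at most `ρ M ≤ M²`.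
  periodic-average : ∀ {M F} → 1 ≤ M → Per M F → Bdd F → ∀ N →
    ι M *ʳ ∑< N F ≤ʳ ι N *ʳ ∑< M F +ʳ ι 2 *ʳ (ι M *ʳ ι M)
  periodic-average {M@(suc M-1)} {F} 1≤M per bd N = begin
    ι M *ʳ ∑< N F                                ≡⟨ cong (ι M *ʳ_) sumN ⟩
    ι M *ʳ (ι k *ʳ Σ′ +ʳ part)                    ≤⟨ mulˡ (ι M) (0≤ι M) (ℚₚ.+-monoʳ-≤ (ι k *ʳ Σ′) (≤ʳ-trans (∑<-hi {λ i → F (k * M + i)} (λ m → bd (k * M + m)) ρ) ρ≤M)) ⟩
    ι M *ʳ (ι k *ʳ Σ′ +ʳ ι M)                     ≡⟨ e₁ (ι M) (ι k) Σ′ (ι ρ) ⟩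
    (ι ρ +ʳ ι k *ʳ ι M) *ʳ Σ′ +ʳ (ι M *ʳ ι M +ʳ ι ρ *ʳ (-ʳ Σ′))  ≤⟨ ℚₚ.+-monoʳ-≤ ((ι ρ +ʳ ι k *ʳ ι M) *ʳ Σ′) (ℚₚ.+-monoʳ-≤ (ι M *ʳ ι M) (≤ʳ-trans (mulˡ (ι ρ) (0≤ι ρ) negΣ) (mulʳ (ι M) (0≤ι M) ρ≤M))) ⟩
    (ι ρ +ʳ ι k *ʳ ι M) *ʳ Σ′ +ʳ (ι M *ʳ ι M +ʳ ι M *ʳ ι M)      ≡⟨ cong₂ _+ʳ_ (cong (_*ʳ Σ′) (sym ιN)) (e₂ (ι M *ʳ ι M)) ⟩
    ι N *ʳ Σ′ +ʳ (1ℚ +ʳ 1ℚ) *ʳ (ι M *ʳ ι M)       ≡⟨ cong (λ z → ι N *ʳ Σ′ +ʳ z *ʳ (ι M *ʳ ι M)) (sym (trans (ι-+ 1 1) (cong₂ _+ʳ_ ι1 ι1))) ⟩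
    ι N *ʳ Σ′ +ʳ ι 2 *ʳ (ι M *ʳ ι M) ∎
    where
    open ℚₚ.≤-Reasoning
    k = N div M
    ρ = N % M
    Σ′ = ∑< M F
    part = ∑< ρ (λ i → F (k * M + i))
    ρ≤M : ι ρ ≤ʳ ι M
    ρ≤M = ι-mono (<⇒≤ (m%n<n N M))
    ιN : ι N ≡ ι ρ +ʳ ι k *ʳ ι M
    ιN = trans (cong ι (m≡m%n+[m/n]*n N M)) (trans (ι-+ ρ (k * M)) (cong (ι ρ +ʳ_) (ι-* k M)))
    sumN : ∑< N F ≡ ι k *ʳ Σ′ +ʳ part
    sumN = trans (cong (λ z → ∑< z F) (trans (m≡m%n+[m/n]*n N M) (+-comm ρ (k * M)))) (trans (∑<-split (k * M) ρ F) (cong (_+ʳ part) (∑<-periods per k)))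
    negΣ : -ʳ Σ′ ≤ʳ ι M
    negΣ = subst (-ʳ Σ′ ≤ʳ_) (e (ι M)) (ℚₚ.neg-antimono-≤ (∑<-lo bd M))
      where
      e : ∀ a → -ʳ (-ʳ a) ≡ a
      e = solve-∀ ring
    e₁ : ∀ M k S r → M *ʳ (k *ʳ S +ʳ M) ≡ (r +ʳ k *ʳ M) *ʳ S +ʳ (M *ʳ M +ʳ r *ʳ (-ʳ S))
    e₁ = solve-∀ ring
    e₂ : ∀ a → a +ʳ a ≡ (1ℚ +ʳ 1ℚ) *ʳ a
    e₂ = solve-∀ ring

  G : List ℕ → ℕ → ℚ
  G = gsum g

  Tot : List ℕ → ℕ → ℚ
  Tot = gsum ι

  0≤Tot : ∀ ps D → 0ℚ ≤ʳ Tot ps D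
  0≤Tot ps D = gsum-nonneg ι ps D 0≤ι

  -- Orthogonality: the products ∏_{p ∈ d} τ p for different d are uncorrelated, up to the error of an incomplete period.
  bilinear : ∀ ps → All Local ps → AllPairs Coprime ps → ∀ {M F} → 1 ≤ M → Per M F → Bdd F → All (Coprime M) ps → ∀ N D E →
    ι M *ʳ ∑< N (λ m → F m *ʳ (f ps D m *ʳ f ps E m)) ≤ʳ
      ι N *ʳ ∑< M F *ʳ G ps (D ⊓ E) +ʳ ι 2 *ʳ (ι M *ʳ ι M) *ʳ (Tot ps D *ʳ Tot ps E)
  bilinear [] _ _ {M} {F} 1≤M per bd _ N D E = base D E
    where
    zero-case : ∀ a b c → a ≡ 0ℚ → b ≡ 0ℚ → ι M *ʳ ∑< N (λ m → F m *ʳ b) ≤ʳ c *ʳ a +ʳ ι 2 *ʳ (ι M *ʳ ι M) *ʳ b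
    zero-case a b c refl refl = ℚₚ.≤-reflexive (trans (cong (ι M *ʳ_) (trans (∑<-cong N (λ m _ → ℚₚ.*-zeroʳ (F m))) (trans (∑<-const N 0ℚ) (ℚₚ.*-zeroʳ (ι N))))) (e (ι M) c (ι 2 *ʳ (ι M *ʳ ι M))))
      where
      e : ∀ a b c → a *ʳ 0ℚ ≡ b *ʳ 0ℚ +ʳ c *ʳ 0ℚ
      e = solve-∀ ring
    base : ∀ D E → ι M *ʳ ∑< N (λ m → F m *ʳ (δ₁ D *ʳ δ₁ E)) ≤ʳ
      ι N *ʳ ∑< M F *ʳ δ₁ (D ⊓ E) +ʳ ι 2 *ʳ (ι M *ʳ ι M) *ʳ (δ₁ D *ʳ δ₁ E)
    base zero E = zero-case 0ℚ (0ℚ *ʳ δ₁ E) (ι N *ʳ ∑< M F) refl (ℚₚ.*-zeroˡ (δ₁ E))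
    base (suc D) zero = zero-case 0ℚ (1ℚ *ʳ 0ℚ) (ι N *ʳ ∑< M F) refl refl
    base (suc D) (suc E) = subst₂ _≤ʳ_ (cong (ι M *ʳ_) (∑<-cong N (λ m _ → e (F m)))) (cong₂ _+ʳ_ (sym (ℚₚ.*-identityʳ (ι N *ʳ ∑< M F))) (e (ι 2 *ʳ (ι M *ʳ ι M)))) (periodic-average 1≤M per bd N)
      where
      e : ∀ a → a ≡ a *ʳ (1ℚ *ʳ 1ℚ)
      e = solve-∀ ring
  bilinear (p ∷ ps) (lp ∷ lps) (cp ∷ cps) {M} {F} 1≤M perF bd (cM ∷ cMs) N D E = begin
    ι M *ʳ ∑< N (λ m → F m *ʳ (f (p ∷ ps) D m *ʳ f (p ∷ ps) E m))
      ≡⟨ cong (ι M *ʳ_) (∑<-cong N (λ m _ → e₀ (F m) (τ p m) (f ps D m) (f ps D′ m) (f ps E m) (f ps E′ m))) ⟩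
    ι M *ʳ ∑< N (λ m → t₁ m +ʳ (t₂ m +ʳ (t₃ m +ʳ t₄ m)))
      ≡⟨ cong (ι M *ʳ_) (trans (∑<-+ N t₁ _) (cong (∑< N t₁ +ʳ_) (trans (∑<-+ N t₂ _) (cong (∑< N t₂ +ʳ_) (∑<-+ N t₃ t₄))))) ⟩
    ι M *ʳ (∑< N t₁ +ʳ (∑< N t₂ +ʳ (∑< N t₃ +ʳ ∑< N t₄)))
      ≡⟨ e₁ (ι M) (∑< N t₁) (∑< N t₂) (∑< N t₃) (∑< N t₄) ⟩
    ι M *ʳ ∑< N t₁ +ʳ (ι M *ʳ ∑< N t₂ +ʳ (ι M *ʳ ∑< N t₃ +ʳ ι M *ʳ ∑< N t₄))
      ≤⟨ add-mono ih₁ (add-mono ih₂ (add-mono ih₃ ih₄)) ⟩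
    (X *ʳ G ps (D ⊓ E) +ʳ c *ʳ (TD *ʳ TE)) +ʳ (c *ʳ (ι p *ʳ (TD′ *ʳ TE)) +ʳ (c *ʳ (ι p *ʳ (TD *ʳ TE′)) +ʳ (X *ʳ (g p *ʳ G ps (D′ ⊓ E′)) +ʳ c *ʳ (ι p *ʳ (TD′ *ʳ TE′)))))
      ≤⟨ ℚₚ.+-monoʳ-≤ (X *ʳ G ps (D ⊓ E) +ʳ c *ʳ (TD *ʳ TE)) (ℚₚ.+-monoʳ-≤ (c *ʳ (ι p *ʳ (TD′ *ʳ TE))) (ℚₚ.+-monoʳ-≤ (c *ʳ (ι p *ʳ (TD *ʳ TE′))) (ℚₚ.+-monoʳ-≤ (X *ʳ (g p *ʳ G ps (D′ ⊓ E′))) (mulˡ c 0≤c p≤p²)))) ⟩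
    (X *ʳ G ps (D ⊓ E) +ʳ c *ʳ (TD *ʳ TE)) +ʳ (c *ʳ (ι p *ʳ (TD′ *ʳ TE)) +ʳ (c *ʳ (ι p *ʳ (TD *ʳ TE′)) +ʳ (X *ʳ (g p *ʳ G ps (D′ ⊓ E′)) +ʳ c *ʳ (ι p *ʳ (ι p *ʳ (TD′ *ʳ TE′))))))
      ≡⟨ e₂ X (G ps (D ⊓ E)) c TD TE TD′ TE′ (ι p) (g p) (G ps (D′ ⊓ E′)) ⟩
    X *ʳ (G ps (D ⊓ E) +ʳ g p *ʳ G ps (D′ ⊓ E′)) +ʳ c *ʳ (Tot (p ∷ ps) D *ʳ Tot (p ∷ ps) E)
      ≡⟨ cong (λ z → X *ʳ (G ps (D ⊓ E) +ʳ g p *ʳ G ps z) +ʳ c *ʳ (Tot (p ∷ ps) D *ʳ Tot (p ∷ ps) E)) (quot-⊓ D E p) ⟩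
    X *ʳ G (p ∷ ps) (D ⊓ E) +ʳ c *ʳ (Tot (p ∷ ps) D *ʳ Tot (p ∷ ps) E) ∎
    where
    open ℚₚ.≤-Reasoning
    open Local lp
    D′ = quot D p
    E′ = quot E p
    TD = Tot ps D
    TE = Tot ps E
    TD′ = Tot ps D′
    TE′ = Tot ps E′
    X = ι N *ʳ ∑< M F
    c = ι 2 *ʳ (ι M *ʳ ι M)
    0≤c : 0ℚ ≤ʳ c
    0≤c = 0≤* (0≤ι 2) (0≤* (0≤ι M) (0≤ι M))
    -- The square term produces only one factor `p` in its error. Raising it to `p²` lets the four
    -- errors assemble into the product of `Tot ps D + p Tot ps D′` and `Tot ps E + p Tot ps E′`.
    p≤p² : ι p *ʳ (TD′ *ʳ TE′) ≤ʳ ι p *ʳ (ι p *ʳ (TD′ *ʳ TE′))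
    p≤p² = mulˡ (ι p) (0≤ι p) (subst (_≤ʳ ι p *ʳ (TD′ *ʳ TE′)) (ℚₚ.*-identityˡ _) (mulʳ (TD′ *ʳ TE′) (0≤* (0≤Tot ps D′) (0≤Tot ps E′)) (subst (_≤ʳ ι p) ι1 (ι-mono pos))))
    -- The induction absorbs the factor at `p` into the weight, whose period becomes `M * p`. Mean
    -- zero then removes the main term of both cross terms, and the mean square `g p` gives the main
    -- term of the square.
    Fτ = λ m → F m *ʳ τ p m
    Fττ = λ m → F m *ʳ (τ p m *ʳ τ p m)
    t₁ t₂ t₃ t₄ : ℕ → ℚ
    t₁ m = F m *ʳ (f ps D m *ʳ f ps E m)
    t₂ m = Fτ m *ʳ (f ps D′ m *ʳ f ps E m)
    t₃ m = Fτ m *ʳ (f ps D m *ʳ f ps E′ m)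
    t₄ m = Fττ m *ʳ (f ps D′ m *ʳ f ps E′ m)
    e₀ : ∀ F t d d′ e e′ → F *ʳ ((d +ʳ t *ʳ d′) *ʳ (e +ʳ t *ʳ e′)) ≡ F *ʳ (d *ʳ e) +ʳ (F *ʳ t *ʳ (d′ *ʳ e) +ʳ (F *ʳ t *ʳ (d *ʳ e′) +ʳ F *ʳ (t *ʳ t) *ʳ (d′ *ʳ e′)))
    e₀ = solve-∀ ring
    e₁ : ∀ M a b c d → M *ʳ (a +ʳ (b +ʳ (c +ʳ d))) ≡ M *ʳ a +ʳ (M *ʳ b +ʳ (M *ʳ c +ʳ M *ʳ d))
    e₁ = solve-∀ ring
    e₂ : ∀ X G c d e d′ e′ p g G′ → (X *ʳ G +ʳ c *ʳ (d *ʳ e)) +ʳ (c *ʳ (p *ʳ (d′ *ʳ e)) +ʳ (c *ʳ (p *ʳ (d *ʳ e′)) +ʳ (X *ʳ (g *ʳ G′) +ʳ c *ʳ (p *ʳ (p *ʳ (d′ *ʳ e′)))))) ≡ X *ʳ (G +ʳ g *ʳ G′) +ʳ c *ʳ ((d +ʳ p *ʳ d′) *ʳ (e +ʳ p *ʳ e′))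
    e₂ = solve-∀ ring
    perpp : Per p (λ m → τ p m *ʳ τ p m)
    perpp m = cong₂ _*ʳ_ (per m) (per m)
    1≤Mp : 1 ≤ M * p
    1≤Mp = *-mono-≤ 1≤M pos
    lift : ∀ {t} → Per p t → Per (M * p) (λ m → F m *ʳ t m)
    lift {t} pert m = cong₂ _*ʳ_ (trans (cong (λ z → F (m + z)) (*-comm M p)) (per-mult perF p m)) (per-mult pert M m)
    bddFτ : Bdd Fτ
    bddFτ m = bdd-* (proj₁ (bd m)) (proj₂ (bd m)) (lo m) (hi m)
    bddFττ : Bdd Fττ
    bddFττ m = let b = bdd-* (lo m) (hi m) (lo m) (hi m) in bdd-* (proj₁ (bd m)) (proj₂ (bd m)) (proj₁ b) (proj₂ b)
    coprime-* : ∀ {q} → Coprime M q → Coprime p q → Coprime (M * p) q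
    coprime-* {q} cM cp {d} (d∣Mp , d∣q) = cp (coprime-divisor (λ {x} (x∣d , x∣M) → cM (x∣M , ∣-trans x∣d d∣q)) d∣Mp , d∣q)
    cMp : All (Coprime (M * p)) ps
    cMp = zip cMs cp
      where
      zip : ∀ {qs} → All (Coprime M) qs → All (Coprime p) qs → All (Coprime (M * p)) qs
      zip [] [] = []
      zip (a ∷ as) (b ∷ bs) = (λ {d} → coprime-* a b {d}) ∷ zip as bs
    ih₁ = bilinear ps lps cps 1≤M perF bd cMs N D E
    unscale : ∀ {a} G T₁ T₂ S → ι (M * p) *ʳ a ≤ʳ ι N *ʳ (ι p *ʳ S) *ʳ G +ʳ ι 2 *ʳ (ι (M * p) *ʳ ι (M * p)) *ʳ (T₁ *ʳ T₂) →
      ι M *ʳ a ≤ʳ ι N *ʳ S *ʳ G +ʳ c *ʳ (ι p *ʳ (T₁ *ʳ T₂))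
    unscale {a} G T₁ T₂ S le = ι-cancelˡ p pos (subst₂ _≤ʳ_ (trans (cong (_*ʳ a) (ι-* M p)) (u₁ (ι M) (ι p) a)) (trans (cong (λ z → ι N *ʳ (ι p *ʳ S) *ʳ G +ʳ ι 2 *ʳ (z *ʳ z) *ʳ (T₁ *ʳ T₂)) (ι-* M p)) (u₂ (ι N) (ι p) S G (ι 2) (ι M) (T₁ *ʳ T₂))) le)
      where
      u₁ : ∀ M p a → M *ʳ p *ʳ a ≡ p *ʳ (M *ʳ a)
      u₁ = solve-∀ ring
      u₂ : ∀ N p S G k M T → N *ʳ (p *ʳ S) *ʳ G +ʳ k *ʳ ((M *ʳ p) *ʳ (M *ʳ p)) *ʳ T ≡ p *ʳ (N *ʳ S *ʳ G +ʳ k *ʳ (M *ʳ M) *ʳ (p *ʳ T))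
      u₂ = solve-∀ ring
    meanFτ : ∑< (M * p) Fτ ≡ ι p *ʳ 0ℚ
    meanFτ = trans (∑<-CRT pos perF per cM) (trans (cong (∑< M F *ʳ_) mean) (trans (ℚₚ.*-zeroʳ (∑< M F)) (sym (ℚₚ.*-zeroʳ (ι p)))))
    meanFττ : ∑< (M * p) Fττ ≡ ι p *ʳ (∑< M F *ʳ g p)
    meanFττ = trans (∑<-CRT pos perF perpp cM) (trans (cong (∑< M F *ʳ_) var) (v (∑< M F) (ι p) (g p)))
      where
      v : ∀ a b c → a *ʳ (b *ʳ c) ≡ b *ʳ (a *ʳ c)
      v = solve-∀ ring
    cross : ∀ d e → ι M *ʳ ∑< N (λ m → Fτ m *ʳ (f ps d m *ʳ f ps e m)) ≤ʳ c *ʳ (ι p *ʳ (Tot ps d *ʳ Tot ps e))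
    cross d e = subst (ι M *ʳ ∑< N (λ m → Fτ m *ʳ (f ps d m *ʳ f ps e m)) ≤ʳ_) (z (ι N) (G ps (d ⊓ e)) (c *ʳ (ι p *ʳ (Tot ps d *ʳ Tot ps e)))) (unscale (G ps (d ⊓ e)) (Tot ps d) (Tot ps e) 0ℚ
      (subst (λ S → ι (M * p) *ʳ ∑< N (λ m → Fτ m *ʳ (f ps d m *ʳ f ps e m)) ≤ʳ ι N *ʳ S *ʳ G ps (d ⊓ e) +ʳ ι 2 *ʳ (ι (M * p) *ʳ ι (M * p)) *ʳ (Tot ps d *ʳ Tot ps e)) meanFτ
        (bilinear ps lps cps 1≤Mp (lift per) bddFτ cMp N d e)))
      where
      z : ∀ N G x → N *ʳ 0ℚ *ʳ G +ʳ x ≡ x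
      z = solve-∀ ring
    ih₂ = cross D′ E
    ih₃ = cross D E′
    ih₄ : ι M *ʳ ∑< N t₄ ≤ʳ X *ʳ (g p *ʳ G ps (D′ ⊓ E′)) +ʳ c *ʳ (ι p *ʳ (TD′ *ʳ TE′))
    ih₄ = subst (λ z → ι M *ʳ ∑< N t₄ ≤ʳ z +ʳ c *ʳ (ι p *ʳ (TD′ *ʳ TE′))) (z (ι N) (∑< M F) (g p) (G ps (D′ ⊓ E′)))
      (unscale (G ps (D′ ⊓ E′)) TD′ TE′ (∑< M F *ʳ g p)
        (subst (λ S → ι (M * p) *ʳ ∑< N t₄ ≤ʳ ι N *ʳ S *ʳ G ps (D′ ⊓ E′) +ʳ ι 2 *ʳ (ι (M * p) *ʳ ι (M * p)) *ʳ (TD′ *ʳ TE′)) meanFττ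
          (bilinear ps lps cps 1≤Mp (lift perpp) bddFττ cMp N D′ E′)))
      where
      z : ∀ N S g G → N *ʳ (S *ʳ g) *ʳ G ≡ N *ʳ S *ʳ (g *ʳ G)
      z = solve-∀ ring

  -- A product `d ≤ D` satisfies `d ≤ D² / d`, and `dens` gives `1 / d ≤ ∏ g p`. This expresses the
  -- error of the sieve through its main term.
  Tot≤ : ∀ ps → All Local ps → ∀ D → Tot ps D ≤ʳ ι (D * D) *ʳ G ps D
  Tot≤ [] _ zero = ℚₚ.≤-reflexive (sym (ℚₚ.*-zeroʳ (ι 0)))
  Tot≤ [] _ (suc D) = subst₂ _≤ʳ_ ι1 (sym (ℚₚ.*-identityʳ _)) (ι-mono (s≤s z≤n))
  Tot≤ (p ∷ ps) (lp ∷ lps) D = begin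
    Tot ps D +ʳ ι p *ʳ Tot ps q                                ≤⟨ add-mono (Tot≤ ps lps D) (mulˡ (ι p) (0≤ι p) (Tot≤ ps lps q)) ⟩
    ι (D * D) *ʳ G ps D +ʳ ι p *ʳ (ι (q * q) *ʳ G ps q)        ≡⟨ cong (ι (D * D) *ʳ G ps D +ʳ_) (sym (ℚₚ.*-assoc (ι p) (ι (q * q)) (G ps q))) ⟩
    ι (D * D) *ʳ G ps D +ʳ ι p *ʳ ι (q * q) *ʳ G ps q          ≤⟨ ℚₚ.+-monoʳ-≤ (ι (D * D) *ʳ G ps D) (mulʳ (G ps q) (gsum-nonneg g ps q 0≤g) key) ⟩
    ι (D * D) *ʳ G ps D +ʳ ι (D * D) *ʳ g p *ʳ G ps q          ≡⟨ e (ι (D * D)) (G ps D) (g p) (G ps q) ⟩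
    ι (D * D) *ʳ (G ps D +ʳ g p *ʳ G ps q) ∎
    where
    open ℚₚ.≤-Reasoning
    open Local lp
    q = quot D p
    e : ∀ d G g G′ → d *ʳ G +ʳ d *ʳ g *ʳ G′ ≡ d *ʳ (G +ʳ g *ʳ G′)
    e = solve-∀ ring
    pq : p * (p * (q * q)) ≤ D * D
    pq = subst (_≤ D * D) (e′ p q) (*-mono-≤ (quot-*≤ D p) (quot-*≤ D p))
      where
      e′ : ∀ p q → q * p * (q * p) ≡ p * (p * (q * q))
      e′ = ℕSolver.solve-∀
    key : ι p *ʳ ι (q * q) ≤ʳ ι (D * D) *ʳ g p
    key = ≤ʳ-trans (ι-cancelˡ p pos (subst₂ _≤ʳ_ (trans (ι-* p (p * (q * q))) (cong (ι p *ʳ_) (ι-* p (q * q)))) (k (ι (D * D))) (ι-mono pq))) (mulˡ (ι (D * D)) (0≤ι _) dens)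
      where
      k : ∀ x → x ≡ ι p *ʳ (x *ʳ inv p)
      k x = trans (trans (sym (ℚₚ.*-identityʳ x)) (cong (x *ʳ_) (sym (ι-inv p pos)))) (v x (ι p) (inv p))
        where
        v : ∀ a b c → a *ʳ (b *ʳ c) ≡ b *ʳ (a *ʳ c)
        v = solve-∀ ring

  Sifted : List ℕ → ℕ → Set
  Sifted ps m = All (λ p → τ p m ≡ g p) ps

  sifted-f : ∀ ps {m} → Sifted ps m → ∀ D → f ps D m ≡ G ps D
  sifted-f [] _ D = refl
  sifted-f (p ∷ ps) (e ∷ es) D = cong₂ _+ʳ_ (sifted-f ps es D) (cong₂ _*ʳ_ e (sifted-f ps es (quot D p)))

  square-nonneg : ∀ a → 0ℚ ≤ʳ a *ʳ a
  square-nonneg a with ℚₚ.≤-total 0ℚ a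
  ... | inj₁ 0≤a = 0≤* 0≤a 0≤a
  ... | inj₂ a≤0 = subst (0ℚ ≤ʳ_) (e a) (0≤* 0≤-a 0≤-a)
    where
    e : ∀ a → (-ʳ a) *ʳ (-ʳ a) ≡ a *ʳ a
    e = solve-∀ ring
    0≤-a : 0ℚ ≤ʳ -ʳ a
    0≤-a = ℚₚ.neg-antimono-≤ a≤0

  -- On a sifted `m` the function `f ps D` has the constant value `G ps D`, while its square sums
  -- over `m < N` to at most `N G + 2 D⁴ G²` by `bilinear` and `Tot≤`. Comparing the two and
  -- cancelling one factor `G ≥ 1` gives the claim; any lower bound `B` of `G` may then take its
  -- place.
  sieve : ∀ ps → All Local ps → AllPairs Coprime ps → ∀ N D → 1 ≤ D → ∀ xs → Unique xs → All (_< N) xs → All (Sifted ps) xs →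
    ∀ B → 0ℚ ≤ʳ B → B ≤ʳ G ps D → ι (length xs ∸ 2 * (D * D * (D * D))) *ʳ B ≤ʳ ι N
  sieve ps lps cps N D 1≤D xs uxs xs<N sxs B 0≤B B≤G = ≤ʳ-trans (mulˡ _ (0≤ι _) B≤G) (final (≤-total (length xs) (2 * Q)))
    where
    open ℚₚ.≤-Reasoning
    Q = D * D * (D * D)
    g′ = G ps D
    1≤g′ : 1ℚ ≤ʳ g′
    1≤g′ = 1≤gsum g ps D 0≤g 1≤D
    cop1 : ∀ qs → All (Coprime 1) qs
    cop1 [] = []
    cop1 (q ∷ qs) = (λ (d∣1 , _) → ∣1⇒≡1 d∣1) ∷ cop1 qs
    F1 : ℕ → ℚ
    F1 _ = 1ℚ
    bdd1 : Bdd F1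
    bdd1 m = ≤ʳ-trans (ℚₚ.neg-antimono-≤ 0≤1) 0≤1 , ℚₚ.≤-refl
    main : ∑< N (λ m → f ps D m *ʳ f ps D m) ≤ʳ ι N *ʳ g′ +ʳ ι 2 *ʳ (Tot ps D *ʳ Tot ps D)
    main = subst₂ _≤ʳ_ (trans (cong (_*ʳ ∑< N (λ m → 1ℚ *ʳ (f ps D m *ʳ f ps D m))) ι1) (trans (ℚₚ.*-identityˡ (∑< N (λ m → 1ℚ *ʳ (f ps D m *ʳ f ps D m)))) (∑<-cong N (λ m _ → ℚₚ.*-identityˡ (f ps D m *ʳ f ps D m)))))
       (cong₂ _+ʳ_ (cong₂ _*ʳ_ (trans (cong (ι N *ʳ_) (ℚₚ.+-identityˡ 1ℚ)) (ℚₚ.*-identityʳ (ι N))) (cong (G ps) (⊓-idem D)))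
         (cong (_*ʳ (Tot ps D *ʳ Tot ps D)) (trans (cong (λ z → ι 2 *ʳ (z *ʳ z)) ι1) (ℚₚ.*-identityʳ (ι 2)))))
       (bilinear ps lps cps {1} {F1} ≤-refl (λ _ → refl) bdd1 (cop1 ps) N D D)
    lower : ι (length xs) *ʳ (g′ *ʳ g′) ≤ʳ ∑< N (λ m → f ps D m *ʳ f ps D m)
    lower = begin
      ι (length xs) *ʳ (g′ *ʳ g′)              ≡⟨ sym (∑-const (g′ *ʳ g′) xs) ⟩
      ∑ (λ _ → g′ *ʳ g′) xs                    ≡⟨ ∑-cong xs (λ x∈ → let e = sym (sifted-f ps (All.lookup sxs x∈) D) in cong₂ _*ʳ_ e e) ⟩
      ∑ (λ m → f ps D m *ʳ f ps D m) xs        ≤⟨ ∑-⊆ _ xs (downFrom N) (λ m → square-nonneg (f ps D m)) uxs (λ x∈ → ∈-downFrom⁺ (All.lookup xs<N x∈)) ⟩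
      ∑ (λ m → f ps D m *ʳ f ps D m) (downFrom N) ≡⟨ sym (∑<-downFrom N _) ⟩
      ∑< N (λ m → f ps D m *ʳ f ps D m) ∎
    err : ι 2 *ʳ (Tot ps D *ʳ Tot ps D) ≤ʳ ι (2 * Q) *ʳ (g′ *ʳ g′)
    err = begin
      ι 2 *ʳ (Tot ps D *ʳ Tot ps D)                    ≤⟨ mulˡ (ι 2) (0≤ι 2) (mul-mono (0≤Tot ps D) (0≤Tot ps D) (Tot≤ ps lps D) (Tot≤ ps lps D)) ⟩
      ι 2 *ʳ (ι (D * D) *ʳ g′ *ʳ (ι (D * D) *ʳ g′))     ≡⟨ e (ι 2) (ι (D * D)) g′ ⟩
      ι 2 *ʳ (ι (D * D) *ʳ ι (D * D)) *ʳ (g′ *ʳ g′)     ≡⟨ cong (_*ʳ (g′ *ʳ g′)) (sym (trans (ι-* 2 Q) (cong (ι 2 *ʳ_) (ι-* (D * D) (D * D))))) ⟩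
      ι (2 * Q) *ʳ (g′ *ʳ g′) ∎
      where
      e : ∀ a d g → a *ʳ (d *ʳ g *ʳ (d *ʳ g)) ≡ a *ʳ (d *ʳ d) *ʳ (g *ʳ g)
      e = solve-∀ ring
    all : ι (length xs) *ʳ (g′ *ʳ g′) ≤ʳ ι N *ʳ g′ +ʳ ι (2 * Q) *ʳ (g′ *ʳ g′)
    all = ≤ʳ-trans lower (≤ʳ-trans main (ℚₚ.+-monoʳ-≤ (ι N *ʳ g′) err))
    final : length xs ≤ 2 * Q ⊎ 2 * Q ≤ length xs → ι (length xs ∸ 2 * Q) *ʳ g′ ≤ʳ ι N
    final (inj₁ le) = subst (_≤ʳ ι N) (sym (trans (cong (λ z → ι z *ʳ g′) (m≤n⇒m∸n≡0 le)) (trans (cong (_*ʳ g′) ι0) (ℚₚ.*-zeroˡ g′)))) (0≤ι N)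
    final (inj₂ le) = ℚₚ.*-cancelʳ-≤-pos g′ {{ℚ.positive (ℚₚ.<-≤-trans (ℚₚ.positive⁻¹ 1ℚ) 1≤g′)}} (add-cancelʳ (ι (2 * Q) *ʳ (g′ *ʳ g′))
      (subst (_≤ʳ ι N *ʳ g′ +ʳ ι (2 * Q) *ʳ (g′ *ʳ g′)) eq all))
      where
      eq : ι (length xs) *ʳ (g′ *ʳ g′) ≡ ι (length xs ∸ 2 * Q) *ʳ g′ *ʳ g′ +ʳ ι (2 * Q) *ʳ (g′ *ʳ g′)
      eq = trans (cong (λ z → z *ʳ (g′ *ʳ g′)) (trans (cong ι (sym (m∸n+n≡m le))) (ι-+ (length xs ∸ 2 * Q) (2 * Q)))) (e (ι (length xs ∸ 2 * Q)) (ι (2 * Q)) g′)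
        where
        e : ∀ a b g → (a +ʳ b) *ʳ (g *ʳ g) ≡ a *ʳ g *ʳ g +ʳ b *ʳ (g *ʳ g)
        e = solve-∀ ring

unique-map-on : ∀ {A B : Set} {f : A → B} xs → Unique xs → (∀ {x y} → x ∈ xs → y ∈ xs → f x ≡ f y → x ≡ y) → Unique (map f xs)
unique-map-on [] u inj = []
unique-map-on {f = f} (x ∷ xs) (x∉ ∷ u) inj = Allₚ.map⁺ (All.tabulate (λ {y} y∈ e → All.lookup x∉ y∈ (inj (here refl) (there y∈) e)))
  ∷ unique-map-on xs u (λ a b → inj (there a) (there b))

-- A pair of subsets with products at most `D` and `E` has a union with product at most `D * E`.
-- Each prime of the union lies in the first only, the second only, or both, with total weight
-- `s p + ρ p + s p ρ p`.
gsum-conv : ∀ s ρ g → (∀ p → 0ℚ ≤ʳ s p) → (∀ p → 0ℚ ≤ʳ ρ p) → (∀ p → 0ℚ ≤ʳ g p) → ∀ ps →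
  All (λ p → 1 ≤ p × s p +ʳ ρ p +ʳ s p *ʳ ρ p ≤ʳ g p) ps → ∀ D E → gsum s ps D *ʳ gsum ρ ps E ≤ʳ gsum g ps (D * E)
gsum-conv s ρ g 0≤s 0≤ρ 0≤g [] _ zero E = ℚₚ.≤-reflexive (ℚₚ.*-zeroˡ (δ₁ E))
gsum-conv s ρ g 0≤s 0≤ρ 0≤g [] _ (suc D) zero = subst (λ z → 1ℚ *ʳ 0ℚ ≤ʳ δ₁ z) (sym (*-zeroʳ (suc D))) ℚₚ.≤-refl
gsum-conv s ρ g 0≤s 0≤ρ 0≤g [] _ (suc D) (suc E) = ℚₚ.≤-refl
gsum-conv s ρ g 0≤s 0≤ρ 0≤g (p ∷ ps) ((1≤p , le) ∷ les) D E = begin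
  (a +ʳ s p *ʳ a′) *ʳ (b +ʳ ρ p *ʳ b′)                                          ≡⟨ e₁ a (s p) a′ b (ρ p) b′ ⟩
  a *ʳ b +ʳ (s p *ʳ (a′ *ʳ b) +ʳ (ρ p *ʳ (a *ʳ b′) +ʳ s p *ʳ ρ p *ʳ (a′ *ʳ b′)))
    ≤⟨ add-mono (ih D E) (add-mono (mulˡ (s p) (0≤s p) (≤ʳ-trans (ih D′ E) (mono c₁))) (add-mono (mulˡ (ρ p) (0≤ρ p) (≤ʳ-trans (ih D E′) (mono c₂))) (mulˡ (s p *ʳ ρ p) (0≤* (0≤s p) (0≤ρ p)) (≤ʳ-trans (ih D′ E′) (mono c₃))))) ⟩
  X +ʳ (s p *ʳ Y +ʳ (ρ p *ʳ Y +ʳ s p *ʳ ρ p *ʳ Y))                              ≡⟨ e₂ X Y (s p) (ρ p) ⟩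
  X +ʳ (s p +ʳ ρ p +ʳ s p *ʳ ρ p) *ʳ Y                                          ≤⟨ ℚₚ.+-monoʳ-≤ X (mulʳ Y (gsum-nonneg g ps (quot (D * E) p) 0≤g) le) ⟩
  X +ʳ g p *ʳ Y ∎
  where
  open ℚₚ.≤-Reasoning
  D′ = quot D p
  E′ = quot E p
  a = gsum s ps D
  a′ = gsum s ps D′
  b = gsum ρ ps E
  b′ = gsum ρ ps E′
  X = gsum g ps (D * E)
  Y = gsum g ps (quot (D * E) p)
  ih = gsum-conv s ρ g 0≤s 0≤ρ 0≤g ps les
  mono : ∀ {x} → x ≤ quot (D * E) p → gsum g ps x ≤ʳ Y
  mono = gsum-mono g ps 0≤g
  c₁ : D′ * E ≤ quot (D * E) p
  c₁ = ≤quot p 1≤p (subst (_≤ D * E) (e D′ p E) (*-monoˡ-≤ E (quot-*≤ D p)))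
    where
    e : ∀ a b c → a * b * c ≡ a * c * b
    e = ℕSolver.solve-∀
  c₂ : D * E′ ≤ quot (D * E) p
  c₂ = ≤quot p 1≤p (subst (_≤ D * E) (sym (*-assoc D E′ p)) (*-monoʳ-≤ D (quot-*≤ E p)))
  c₃ : D′ * E′ ≤ quot (D * E) p
  c₃ = ≤-trans (*-monoʳ-≤ D′ (quot≤ E p)) c₁
  e₁ : ∀ a s a′ b r b′ → (a +ʳ s *ʳ a′) *ʳ (b +ʳ r *ʳ b′) ≡ a *ʳ b +ʳ (s *ʳ (a′ *ʳ b) +ʳ (r *ʳ (a *ʳ b′) +ʳ s *ʳ r *ʳ (a′ *ʳ b′)))
  e₁ = solve-∀ ring
  e₂ : ∀ X Y s r → X +ʳ (s *ʳ Y +ʳ (r *ʳ Y +ʳ s *ʳ r *ʳ Y)) ≡ X +ʳ (s +ʳ r +ʳ s *ʳ r) *ʳ Y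
  e₂ = solve-∀ ring

-- Only the one-element subsets are kept on the right; those exceeding the truncation must carry
-- weight zero.
∑≤gsum : ∀ ρ → (∀ p → 0ℚ ≤ʳ ρ p) → ∀ ps E → 1 ≤ E → All (λ p → 1 ≤ p × (p ≤ E ⊎ ρ p ≡ 0ℚ)) ps → ∑ ρ ps ≤ʳ gsum ρ ps E
∑≤gsum ρ 0≤ρ [] (suc E) _ _ = 0≤1
∑≤gsum ρ 0≤ρ (p ∷ ps) E 1≤E ((1≤p , h) ∷ hs) = subst (_≤ʳ gsum ρ ps E +ʳ ρ p *ʳ gsum ρ ps (quot E p)) (ℚₚ.+-comm (∑ ρ ps) (ρ p)) (add-mono (∑≤gsum ρ 0≤ρ ps E 1≤E hs) (go h))
  where
  go : p ≤ E ⊎ ρ p ≡ 0ℚ → ρ p ≤ʳ ρ p *ʳ gsum ρ ps (quot E p)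
  go (inj₁ le) = subst (_≤ʳ ρ p *ʳ gsum ρ ps (quot E p)) (ℚₚ.*-identityʳ (ρ p)) (mulˡ (ρ p) (0≤ρ p) (1≤gsum ρ ps (quot E p) 0≤ρ (≤quot p 1≤p (subst (_≤ E) (sym (*-identityˡ p)) le))))
  go (inj₂ z) = subst (_≤ʳ ρ p *ʳ gsum ρ ps (quot E p)) (sym z) (0≤* (0≤ρ p) (gsum-nonneg ρ ps (quot E p) 0≤ρ))

-- For `n = p - 1` this sums the geometric series `1/p + 1/p² + ⋯ = 1/(p - 1)` in one recursive
-- step.
inv-pred : ∀ n → 1 ≤ n → inv (suc n) *ʳ (1ℚ +ʳ inv n) ≡ inv n
inv-pred n 1≤n = ι-cancelˡ-≡ (suc n) (s≤s z≤n) (begin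
  ι (suc n) *ʳ (inv (suc n) *ʳ (1ℚ +ʳ inv n)) ≡⟨ sym (ℚₚ.*-assoc (ι (suc n)) (inv (suc n)) (1ℚ +ʳ inv n)) ⟩
  ι (suc n) *ʳ inv (suc n) *ʳ (1ℚ +ʳ inv n)   ≡⟨ cong (_*ʳ (1ℚ +ʳ inv n)) (ι-inv (suc n) (s≤s z≤n)) ⟩
  1ℚ *ʳ (1ℚ +ʳ inv n)                         ≡⟨ ℚₚ.*-identityˡ (1ℚ +ʳ inv n) ⟩
  1ℚ +ʳ inv n                                 ≡⟨ ℚₚ.+-comm 1ℚ (inv n) ⟩
  inv n +ʳ 1ℚ                                 ≡⟨ cong (inv n +ʳ_) (sym (ι-inv n 1≤n)) ⟩
  inv n +ʳ ι n *ʳ inv n                       ≡⟨ e (inv n) (ι n) ⟩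
  (1ℚ +ʳ ι n) *ʳ inv n                        ≡⟨ cong (λ z → (z +ʳ ι n) *ʳ inv n) (sym ι1) ⟩
  (ι 1 +ʳ ι n) *ʳ inv n                       ≡⟨ cong (_*ʳ inv n) (sym (ι-+ 1 n)) ⟩
  ι (suc n) *ʳ inv n ∎)
  where
  open ≡-Reasoning
  e : ∀ a b → a +ʳ b *ʳ a ≡ (1ℚ +ʳ b) *ʳ a
  e = solve-∀ ring

-- Primes and harmonic sums over smooth numbers.

prime⇒≥2 : ∀ {p} → Prime p → 2 ≤ p
prime⇒≥2 {zero} pp = ⊥-elim (¬prime[0] pp)
prime⇒≥2 {suc zero} pp = ⊥-elim (¬prime[1] pp)
prime⇒≥2 {suc (suc _)} pp = s≤s (s≤s z≤n)

prime⇒≥1 : ∀ {p} → Prime p → 1 ≤ p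
prime⇒≥1 pp = <⇒≤ (prime⇒≥2 pp)

prime-divisor : ∀ n → 2 ≤ n → ∃[ p ] (Prime p × p ∣ n)
prime-divisor n@(suc _) 2≤n with factorise n
... | record { factors = [] ; isFactorisation = e ; factorsPrime = _ } = ⊥-elim (<-irrefl (sym e) 2≤n)
... | record { factors = p ∷ ps ; isFactorisation = e ; factorsPrime = pp ∷ _ } = p , pp , subst (p ∣_) (sym e) (m∣m*n (product ps))

prime∣prime : ∀ {p q} → Prime p → Prime q → p ∣ q → p ≡ q
prime∣prime pp pq d with prime⇒irreducible pq d
... | inj₁ refl = ⊥-elim (¬prime[1] pp)
... | inj₂ e = e

distinct-primes-coprime : ∀ {p q} → Prime p → Prime q → p ≢ q → Coprime p q
distinct-primes-coprime {p} {q} pp pq ne {d} (d∣p , d∣q) with prime⇒irreducible pp d∣p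
... | inj₁ e = e
... | inj₂ refl = ⊥-elim (ne (prime∣prime pp pq d∣q))

unique-primes-coprime : ∀ ps → All Prime ps → Unique ps → AllPairs Coprime ps
unique-primes-coprime [] _ _ = []
unique-primes-coprime (p ∷ ps) (pp ∷ pps) (p∉ ∷ u) = go ps pps p∉ ∷ unique-primes-coprime ps pps u
  where
  go : ∀ qs → All Prime qs → All (p ≢_) qs → All (Coprime p) qs
  go [] _ _ = []
  go (q ∷ qs) (pq ∷ pqs) (ne ∷ nes) = (λ {d} → distinct-primes-coprime pp pq ne {d}) ∷ go qs pqs nes

Smooth : List ℕ → ℕ → Set
Smooth ps n = ∀ {q} → Prime q → q ∣ n → q ∈ ps

sub-inv : ℕ → ℚ
sub-inv p = inv (pred p)

0≤sub-inv : ∀ p → 0ℚ ≤ʳ sub-inv p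
0≤sub-inv p = 0≤inv (pred p)

-- Splitting off the multiples of p turns the harmonic sum over p-smooth numbers into a geometric series in 1/p.
smooth-harmonic : ∀ ps → All Prime ps → ∀ k D → D ≤ k → ∀ L → Unique L → All (λ n → 1 ≤ n × n ≤ D × Smooth ps n) L →
  ∑ inv L ≤ʳ gsum sub-inv ps D
smooth-harmonic [] _ k D D≤k [] u as = 0≤δ₁ D
smooth-harmonic [] _ k D D≤k (n ∷ L) u as@((1≤n , n≤D , sm) ∷ _) =
  ≤ʳ-trans (∑-⊆ inv (n ∷ L) (1 ∷ []) 0≤inv u (λ {x} x∈ → one x (All.lookup as x∈)))
    (subst₂ _≤ʳ_ (sym (trans (ℚₚ.+-identityʳ (inv 1)) inv1)) refl (δ≥1 (≤-trans 1≤n n≤D)))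
  where
  δ≥1 : ∀ {D} → 1 ≤ D → 1ℚ ≤ʳ δ₁ D
  δ≥1 {suc D} _ = ℚₚ.≤-refl
  one : ∀ x → 1 ≤ x × x ≤ D × Smooth [] x → x ∈ (1 ∷ [])
  one (suc zero) _ = here refl
  one (suc (suc x)) (_ , _ , sm) with prime-divisor (suc (suc x)) (s≤s (s≤s z≤n))
  ... | q , pq , q∣ with sm pq q∣
  ... | ()
smooth-harmonic (p ∷ ps) (pp ∷ pps) zero D D≤k [] u as = gsum-nonneg sub-inv (p ∷ ps) D 0≤sub-inv
smooth-harmonic (p ∷ ps) (pp ∷ pps) zero D D≤k (n ∷ L) u ((1≤n , n≤D , _) ∷ _) = ⊥-elim (<-irrefl refl (≤-trans 1≤n (≤-trans n≤D D≤k)))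
smooth-harmonic (p@(suc p-1) ∷ ps) (pp ∷ pps) (suc k) D D≤k L u as = begin
  ∑ inv L                                             ≡⟨ trans (∑-filter-split (p ∣?_) inv L) (ℚₚ.+-comm (∑ inv Lp) (∑ inv L₀)) ⟩
  ∑ inv L₀ +ʳ ∑ inv Lp                                ≤⟨ ℚₚ.+-monoˡ-≤ (∑ inv Lp) (smooth-harmonic ps pps (suc k) D D≤k L₀ (Uniqueₚ.filter⁺ (¬? ∘ (p ∣?_)) u) (All.tabulate sm₀)) ⟩
  gsum sub-inv ps D +ʳ ∑ inv Lp                       ≡⟨ cong (gsum sub-inv ps D +ʳ_) LpL₁ ⟩
  gsum sub-inv ps D +ʳ inv p *ʳ ∑ inv L₁              ≤⟨ ℚₚ.+-monoʳ-≤ (gsum sub-inv ps D) (mulˡ (inv p) (0≤inv p) (≤ʳ-trans (smooth-harmonic (p ∷ ps) (pp ∷ pps) k D′ D′≤k L₁ uL₁ (Allₚ.map⁺ (All.tabulate sm₁))) step)) ⟩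
  gsum sub-inv ps D +ʳ inv p *ʳ ((1ℚ +ʳ sub-inv p) *ʳ Y)  ≡⟨ cong (gsum sub-inv ps D +ʳ_) (trans (sym (ℚₚ.*-assoc (inv p) (1ℚ +ʳ sub-inv p) Y)) (cong (_*ʳ Y) (inv-pred p-1 1≤p-1))) ⟩
  gsum sub-inv ps D +ʳ sub-inv p *ʳ Y ∎
  where
  open ℚₚ.≤-Reasoning
  1≤p-1 : 1 ≤ p-1
  1≤p-1 = s≤s⁻¹ (prime⇒≥2 pp)
  D′ = quot D p
  Y = gsum sub-inv ps D′
  L₀ = filter (¬? ∘ (p ∣?_)) L
  Lp = filter (p ∣?_) L
  L₁ = map (λ n → quot n p) Lp
  back : ∀ {n} → p ∣ n → n ≡ quot n p * p
  back {n} p∣n = sym (m/n*n≡m p∣n)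
  inLp : ∀ {n} → n ∈ Lp → p ∣ n × (1 ≤ n × n ≤ D × Smooth (p ∷ ps) n)
  inLp n∈ = let (n∈L , p∣n) = ∈-filter⁻ (p ∣?_) {xs = L} n∈ in p∣n , All.lookup as n∈L
  uL₁ : Unique L₁
  uL₁ = unique-map-on Lp (Uniqueₚ.filter⁺ (p ∣?_) u) (λ {x} {y} x∈ y∈ e → trans (back (proj₁ (inLp x∈))) (trans (cong (_* p) e) (sym (back (proj₁ (inLp y∈))))))
  LpL₁ : ∑ inv Lp ≡ inv p *ʳ ∑ inv L₁
  LpL₁ = trans (∑-cong Lp (λ {x} x∈ → trans (cong inv (trans (back (proj₁ (inLp x∈))) (*-comm (quot x p) p))) (inv-* p (quot x p)))) (trans (∑-*ˡ (inv p) (λ n → inv (quot n p)) Lp) (cong (inv p *ʳ_) (sym (∑-map inv (λ n → quot n p) Lp))))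
  D′≤k : D′ ≤ k
  D′≤k = go D D≤k
    where
    go : ∀ D → D ≤ suc k → quot D p ≤ k
    go zero _ = ≤-trans (quot≤ 0 p) z≤n
    go (suc D) le = s≤s⁻¹ (≤-trans (m/n<m (suc D) p (prime⇒≥2 pp)) le)
  sm₀ : ∀ {n} → n ∈ L₀ → 1 ≤ n × n ≤ D × Smooth ps n
  sm₀ {n} n∈ = let (n∈L , p∤n) = ∈-filter⁻ (¬? ∘ (p ∣?_)) {xs = L} n∈ ; (a , b , s) = All.lookup as n∈L in
    a , b , λ {q} pq q∣n → case s pq q∣n of λ { (here refl) → ⊥-elim (p∤n q∣n) ; (there q∈) → q∈ }
  sm₁ : ∀ {n} → n ∈ Lp → 1 ≤ quot n p × quot n p ≤ D′ × Smooth (p ∷ ps) (quot n p)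
  sm₁ {n} n∈ = let (p∣n , 1≤n , n≤D , s) = inLp n∈ in
    pos (quot n p) (subst (1 ≤_) (back p∣n) 1≤n) , quot-mono p n≤D , λ {q} pq q∣ → s pq (subst (q ∣_) (sym (back p∣n)) (∣m⇒∣m*n p q∣))
    where
    pos : ∀ x → 1 ≤ x * p → 1 ≤ x
    pos (suc x) _ = s≤s z≤n
  -- Weakening `quot D′ p` to `D′` forgets the size of the higher powers of `p`, so that they sum to
  -- a full geometric series.
  step : gsum sub-inv (p ∷ ps) D′ ≤ʳ (1ℚ +ʳ sub-inv p) *ʳ Y
  step = subst (gsum sub-inv (p ∷ ps) D′ ≤ʳ_) (e Y (sub-inv p)) (ℚₚ.+-monoʳ-≤ Y (mulˡ (sub-inv p) (0≤sub-inv p) (gsum-mono sub-inv ps 0≤sub-inv (quot≤ D′ p))))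
    where
    e : ∀ y s → y +ʳ s *ʳ y ≡ (1ℚ +ʳ s) *ʳ y
    e = solve-∀ ring

1≤2^ : ∀ k → 1 ≤ 2 ^ k
1≤2^ k = m^n>0 2 k

harmonic : ∀ k → ι k *ʳ inv 2 ≤ʳ ∑< (2 ^ k) (λ m → inv (suc m))
harmonic zero = subst₂ _≤ʳ_ (sym (trans (cong (_*ʳ inv 2) ι0) (ℚₚ.*-zeroˡ (inv 2)))) refl (0≤+ ℚₚ.≤-refl (0≤inv 1))
harmonic (suc k) = begin
  ι (suc k) *ʳ inv 2                                                       ≡⟨ trans (cong (_*ʳ inv 2) (trans (ι-+ 1 k) (cong (_+ʳ ι k) ι1))) (e (ι k) (inv 2)) ⟩
  ι k *ʳ inv 2 +ʳ inv 2                                                    ≤⟨ add-mono (harmonic k) half ⟩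
  ∑< u (λ m → inv (suc m)) +ʳ ∑< u (λ i → inv (suc (u + i)))               ≡⟨ sym (∑<-split u u (λ m → inv (suc m))) ⟩
  ∑< (u + u) (λ m → inv (suc m))                                           ≡⟨ cong (λ z → ∑< (u + z) (λ m → inv (suc m))) (sym (+-identityʳ u)) ⟩
  ∑< (2 ^ suc k) (λ m → inv (suc m)) ∎
  where
  open ℚₚ.≤-Reasoning
  u = 2 ^ k
  e : ∀ a b → (1ℚ +ʳ a) *ʳ b ≡ a *ʳ b +ʳ b
  e = solve-∀ ring
  half : inv 2 ≤ʳ ∑< u (λ i → inv (suc (u + i)))
  half = begin
    inv 2                                 ≡⟨ sym (trans (cong (ι u *ʳ_) (trans (cong inv (*-comm 2 u)) (inv-* u 2))) (trans (sym (ℚₚ.*-assoc (ι u) (inv u) (inv 2))) (trans (cong (_*ʳ inv 2) (ι-inv u (1≤2^ k))) (ℚₚ.*-identityˡ (inv 2))))) ⟩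
    ι u *ʳ inv (2 * u)                    ≡⟨ sym (∑<-const u (inv (2 * u))) ⟩
    ∑< u (λ i → inv (2 * u))              ≤⟨ ∑<-mono u (λ i i<u → inv-anti (s≤s z≤n) (≤-trans (≤-trans (≤-reflexive (sym (+-suc u i))) (+-monoʳ-≤ u i<u)) (≤-reflexive (cong (λ z → u + z) (sym (+-identityʳ u))))) ) ⟩
    ∑< u (λ i → inv (suc (u + i))) ∎

-- Sieving by residue classes.

ite : ∀ {P A : Set} → Dec P → A → A → A
ite d a b = if does d then a else b

ite-yes : ∀ {P A : Set} (d : Dec P) {a b : A} → P → ite d a b ≡ a
ite-yes (yes _) _ = refl
ite-yes (no ¬p) p = ⊥-elim (¬p p)

ite-no : ∀ {P A : Set} (d : Dec P) {a b : A} → ¬ P → ite d a b ≡ b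
ite-no (yes p) ¬p = ⊥-elim (¬p p)
ite-no (no _) _ = refl

ite-elim : ∀ {P A : Set} (C : A → Set) (d : Dec P) {a b : A} → C a → C b → C (ite d a b)
ite-elim C (yes _) ca cb = ca
ite-elim C (no _) ca cb = cb

rem : ℕ → ℕ → ℕ
rem m zero = m
rem m (suc p) = m % suc p

ι2 : ι 2 ≡ 1ℚ +ʳ 1ℚ
ι2 = trans (ι-+ 1 1) (cong₂ _+ʳ_ ι1 ι1)

-- Sieving by the residue classes 0, …, ω p - 1 modulo each p.
module Residues (ω : ℕ → ℕ) where

  g : ℕ → ℚ
  g p = ι (ω p) *ʳ inv (p ∸ ω p)

  0≤g : ∀ p → 0ℚ ≤ʳ g p
  0≤g p = 0≤* (0≤ι _) (0≤inv _)

  τ : ℕ → ℕ → ℚ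
  τ p m = ite (rem m p <? ω p) (-ʳ 1ℚ) (g p)

  open Sieve τ g 0≤g public

  τ-in : ∀ p m → rem m p < ω p → τ p m ≡ -ʳ 1ℚ
  τ-in p m h = ite-yes (rem m p <? ω p) h

  τ-out : ∀ p m → ¬ (rem m p < ω p) → τ p m ≡ g p
  τ-out p m ¬h = ite-no (rem m p <? ω p) ¬h

  local : ∀ p → 1 ≤ ω p → ω p + ω p ≤ p → Local p
  local zero 1≤w 2w≤p = ⊥-elim (<-irrefl refl (≤-trans 1≤w (≤-trans (m≤m+n _ _) 2w≤p)))
  local p@(suc p-1) 1≤w 2w≤p = record
    { pos = s≤s z≤n ; per = λ m → cong (λ z → ite (z <? w) (-ʳ 1ℚ) (g p)) ([m+n]%n≡m%n m p)
    ; lo = lo ; hi = hi ; mean = mean ; var = var ; dens = dens }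
    where
    w = ω p
    n = p ∸ w
    w≤p : w ≤ p
    w≤p = ≤-trans (m≤m+n w w) 2w≤p
    w≤n : w ≤ n
    w≤n = subst (_≤ n) (m+n∸n≡m w w) (∸-monoˡ-≤ w 2w≤p)
    1≤n : 1 ≤ n
    1≤n = ≤-trans 1≤w w≤n
    p≡ : p ≡ w + n
    p≡ = sym (m+[n∸m]≡n w≤p)
    ng : ι n *ʳ g p ≡ ι w
    ng = trans (e (ι n) (ι w) (inv n)) (trans (cong (ι w *ʳ_) (ι-inv n 1≤n)) (ℚₚ.*-identityʳ (ι w)))
      where
      e : ∀ n w i → n *ʳ (w *ʳ i) ≡ w *ʳ (n *ʳ i)
      e = solve-∀ ring
    -- This is where `ω p + ω p ≤ p` enters: at most half the classes are removed, so `τ p` stays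
    -- within `[-1 , 1]`.
    g≤1 : g p ≤ʳ 1ℚ
    g≤1 = ι-cancelˡ n 1≤n (subst₂ _≤ʳ_ (sym ng) (sym (ℚₚ.*-identityʳ (ι n))) (ι-mono w≤n))
    lo : ∀ m → -ʳ 1ℚ ≤ʳ τ p m
    lo m = ite-elim (-ʳ 1ℚ ≤ʳ_) (rem m p <? w) ℚₚ.≤-refl (≤ʳ-trans (ℚₚ.neg-antimono-≤ 0≤1) (0≤g p))
    hi : ∀ m → τ p m ≤ʳ 1ℚ
    hi m = ite-elim (_≤ʳ 1ℚ) (rem m p <? w) (≤ʳ-trans (ℚₚ.neg-antimono-≤ 0≤1) 0≤1) g≤1
    sumOf : (h : ℚ → ℚ) → ∑< p (λ m → h (τ p m)) ≡ ι w *ʳ h (-ʳ 1ℚ) +ʳ ι n *ʳ h (g p)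
    sumOf h = trans (cong (λ z → ∑< z (λ m → h (τ p m))) p≡) (trans (∑<-split w n _) (cong₂ _+ʳ_
      (trans (∑<-cong w (λ m m<w → cong h (τ-in p m (subst (_< w) (sym (m<n⇒m%n≡m (≤-trans m<w w≤p))) m<w)))) (∑<-const w _))
      (trans (∑<-cong n (λ i i<n → cong h (τ-out p (w + i) (λ lt → <-irrefl refl (≤-trans (subst (_< w) (m<n⇒m%n≡m (subst (w + i <_) (sym p≡) (+-monoʳ-< w i<n))) lt) (m≤m+n w i)))))) (∑<-const n _))))
    mean : ∑< p (τ p) ≡ 0ℚ
    mean = trans (sumOf (λ z → z)) (trans (cong (ι w *ʳ (-ʳ 1ℚ) +ʳ_) ng) (e (ι w)))
      where
      e : ∀ w → w *ʳ (-ʳ 1ℚ) +ʳ w ≡ 0ℚ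
      e = solve-∀ ring
    var : ∑< p (λ m → τ p m *ʳ τ p m) ≡ ι p *ʳ g p
    var = trans (sumOf (λ z → z *ʳ z)) (trans (cong (ι w *ʳ (-ʳ 1ℚ *ʳ -ʳ 1ℚ) +ʳ_) (sym (ℚₚ.*-assoc (ι n) (g p) (g p))))
      (trans (cong (λ z → ι w *ʳ (-ʳ 1ℚ *ʳ -ʳ 1ℚ) +ʳ z *ʳ g p) ng) (trans (e (ι w) (g p)) (trans (cong (λ z → ι w *ʳ g p +ʳ z) (sym ng)) (trans (e′ (ι w) (ι n) (g p)) (cong (_*ʳ g p) (trans (sym (ι-+ w n)) (cong ι (sym p≡)))))))))
      where
      e : ∀ w g → w *ʳ (-ʳ 1ℚ *ʳ -ʳ 1ℚ) +ʳ w *ʳ g ≡ w *ʳ g +ʳ w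
      e = solve-∀ ring
      e′ : ∀ w n g → w *ʳ g +ʳ n *ʳ g ≡ (w +ʳ n) *ʳ g
      e′ = solve-∀ ring
    dens : inv p ≤ʳ g p
    dens = ≤ʳ-trans (inv-anti 1≤n (m∸n≤m p w)) (subst (_≤ʳ g p) (ℚₚ.*-identityˡ (inv n)) (mulʳ (inv n) (0≤inv n) (subst (_≤ʳ ι w) ι1 (ι-mono 1≤w))))

-- Sieving for primes q such that no r ∈ R divides q - 1.

primesBelow : ℕ → List ℕ
primesBelow n = filter prime? (downFrom n)

∈-primesBelow⁺ : ∀ {p n} → Prime p → p < n → p ∈ primesBelow n
∈-primesBelow⁺ pp lt = ∈-filter⁺ prime? (∈-downFrom⁺ lt) pp

∈-primesBelow⁻ : ∀ {p n} → p ∈ primesBelow n → Prime p × p < n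
∈-primesBelow⁻ {p} {n} p∈ = let (a , b) = ∈-filter⁻ prime? {xs = downFrom n} p∈ in b , ∈-downFrom⁻ a

primesBelow-unique : ∀ n → Unique (primesBelow n)
primesBelow-unique n = Uniqueₚ.filter⁺ prime? (Uniqueₚ.downFrom⁺ n)

primesBelow-prime : ∀ n → All Prime (primesBelow n)
primesBelow-prime n = All.tabulate (λ p∈ → proj₁ (∈-primesBelow⁻ {n = n} p∈))

-- `Dk k` is the level of the sieve and `Qk k` its fourth power, which governs the error. The range
-- to be sieved has length `Qk k * Qk k`, so the error is about the square root of the range.
Dk Qk : ℕ → ℕ
Dk k = 2 ^ k * 2 ^ k
Qk k = Dk k * Dk k * (Dk k * Dk k)

1≤Dk : ∀ k → 1 ≤ Dk k
1≤Dk k = *-mono-≤ (1≤2^ k) (1≤2^ k)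

1≤Qk : ∀ k → 1 ≤ Qk k
1≤Qk k = *-mono-≤ (*-mono-≤ (1≤Dk k) (1≤Dk k)) (*-mono-≤ (1≤Dk k) (1≤Dk k))

module SievePrimes (R : List ℕ) (k : ℕ) (uR : Unique R) (pR : All (λ r → Prime r × 4 ≤ r × r ≤ 2 ^ k) R) where

  -- Class `0` is removed because `q` is prime. For `r ∈ R` class `1` is removed as well, because
  -- `r ∣ q - 1` is excluded.
  ω : ℕ → ℕ
  ω p = ite (p ∈? R) 2 1

  open Residues ω

  ps : List ℕ
  ps = primesBelow (suc (Dk k))

  ω-cases : ∀ p → (p ∈ R × ω p ≡ 2) ⊎ (p ∉ R × ω p ≡ 1)
  ω-cases p = go (p ∈? R)
    where
    go : (d : Dec (p ∈ R)) → (p ∈ R × ite d 2 1 ≡ 2) ⊎ (p ∉ R × ite d 2 1 ≡ 1)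
    go (yes h) = inj₁ (h , refl)
    go (no h) = inj₂ (h , refl)

  locals : All Local ps
  locals = All.tabulate λ {p} p∈ → local-prime p (proj₁ (∈-primesBelow⁻ {n = suc (Dk k)} p∈))
    where
    local-prime : ∀ p → Prime p → Local p
    local-prime p pp with ω-cases p
    ... | inj₁ (p∈R , e) = local p (subst (1 ≤_) (sym e) (s≤s z≤n)) (subst (λ z → z + z ≤ p) (sym e) (proj₁ (proj₂ (All.lookup pR p∈R))))
    ... | inj₂ (_ , e) = local p (subst (1 ≤_) (sym e) (s≤s z≤n)) (subst (λ z → z + z ≤ p) (sym e) (prime⇒≥2 pp))

  ρ : ℕ → ℚ
  ρ p = ite (p ∈? R) (inv p) 0ℚ

  0≤ρ : ∀ p → 0ℚ ≤ʳ ρ p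
  0≤ρ p = ite-elim (0ℚ ≤ʳ_) (p ∈? R) (0≤inv p) ℚₚ.≤-refl

  ρ-in : ∀ {p} → p ∈ R → ρ p ≡ inv p
  ρ-in {p} = ite-yes (p ∈? R)

  ρ-out : ∀ {p} → p ∉ R → ρ p ≡ 0ℚ
  ρ-out {p} = ite-no (p ∈? R)

  -- The claim is `(1 + 1/(p - 1)) (1 + ρ p) ≤ 1 + g p`. Off `R` it is an equality; on `R` the left
  -- side is `1 + 2/(p - 1)` and the right side `1 + 2/(p - 2)`.
  conv-cond : ∀ p → Prime p → sub-inv p +ʳ ρ p +ʳ sub-inv p *ʳ ρ p ≤ʳ g p
  conv-cond zero pp = ⊥-elim (¬prime[0] pp)
  conv-cond p@(suc n) pp with ω-cases p
  ... | inj₂ (p∉ , e) = ℚₚ.≤-reflexive (trans (cong (λ z → inv n +ʳ z +ʳ inv n *ʳ z) (ρ-out p∉)) (trans (e′ (inv n)) (sym (trans (cong (λ z → ι z *ʳ inv (p ∸ z)) e) (trans (cong (_*ʳ inv n) ι1) (ℚₚ.*-identityˡ (inv n)))))))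
    where
    e′ : ∀ a → a +ʳ 0ℚ +ʳ a *ʳ 0ℚ ≡ a
    e′ = solve-∀ ring
  ... | inj₁ (p∈ , e) = begin
    inv n +ʳ ρ p +ʳ inv n *ʳ ρ p        ≡⟨ cong (λ z → inv n +ʳ z +ʳ inv n *ʳ z) (ρ-in p∈) ⟩
    inv n +ʳ inv p +ʳ inv n *ʳ inv p    ≡⟨ e₁ (inv n) (inv p) ⟩
    inv n +ʳ inv p *ʳ (1ℚ +ʳ inv n)     ≡⟨ cong (inv n +ʳ_) (inv-pred n 1≤n) ⟩
    inv n +ʳ inv n                      ≡⟨ trans (e₂ (inv n)) (cong (_*ʳ inv n) (sym ι2)) ⟩
    ι 2 *ʳ inv n                        ≤⟨ mulˡ (ι 2) (0≤ι 2) (inv-anti (≤-trans (s≤s z≤n) (∸-monoˡ-≤ {4} 2 4≤p)) (∸-monoʳ-≤ p (s≤s (z≤n {1})))) ⟩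
    ι 2 *ʳ inv (p ∸ 2)                  ≡⟨ cong (λ z → ι z *ʳ inv (p ∸ z)) (sym e) ⟩
    g p ∎
    where
    open ℚₚ.≤-Reasoning
    1≤n : 1 ≤ n
    1≤n = s≤s⁻¹ (prime⇒≥2 pp)
    4≤p : 4 ≤ p
    4≤p = proj₁ (proj₂ (All.lookup pR p∈))
    e₁ : ∀ a b → a +ʳ b +ʳ a *ʳ b ≡ a +ʳ b *ʳ (1ℚ +ʳ a)
    e₁ = solve-∀ ring
    e₂ : ∀ a → a +ʳ a ≡ (1ℚ +ʳ 1ℚ) *ʳ a
    e₂ = solve-∀ ring

  2^k≤Dk : 2 ^ k ≤ Dk k
  2^k≤Dk = subst (_≤ Dk k) (*-identityʳ (2 ^ k)) (*-monoʳ-≤ (2 ^ k) (1≤2^ k))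

  harm : ι k *ʳ inv 2 ≤ʳ gsum sub-inv ps (2 ^ k)
  harm = ≤ʳ-trans (harmonic k) (subst (_≤ʳ gsum sub-inv ps (2 ^ k)) (trans (∑-map inv suc (downFrom (2 ^ k))) (sym (∑<-downFrom (2 ^ k) (λ m → inv (suc m)))))
    (smooth-harmonic ps (primesBelow-prime (suc (Dk k))) (2 ^ k) (2 ^ k) ≤-refl (map suc (downFrom (2 ^ k))) (Uniqueₚ.map⁺ suc-injective (Uniqueₚ.downFrom⁺ (2 ^ k)))
      (Allₚ.map⁺ (All.tabulate (λ {n} n∈ → let n< = ∈-downFrom⁻ n∈ in s≤s z≤n , n< , λ {q} pq q∣ → ∈-primesBelow⁺ pq (s≤s (≤-trans (∣⇒≤ q∣) (≤-trans n< 2^k≤Dk))))))))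

  -- The level splits as `Dk k = 2 ^ k * 2 ^ k`: one factor carries the harmonic sum, worth at least
  -- `k/2`, the other the gain `A` from the extra classes modulo the `r ∈ R`.
  G≥ : ∀ A → 0ℚ ≤ʳ A → A ≤ʳ gsum ρ ps (2 ^ k) → ι k *ʳ inv 2 *ʳ A ≤ʳ G ps (Dk k)
  G≥ A 0≤A A≤ = ≤ʳ-trans (mul-mono (0≤* (0≤ι k) (0≤inv 2)) 0≤A harm A≤)
    (gsum-conv sub-inv ρ g 0≤sub-inv 0≤ρ 0≤g ps (All.tabulate (λ {p} p∈ → let pp = proj₁ (∈-primesBelow⁻ {n = suc (Dk k)} p∈) in prime⇒≥1 pp , conv-cond p pp)) (2 ^ k) (2 ^ k))

  ρ-sum : ∑ inv R ≤ʳ gsum ρ ps (2 ^ k)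
  ρ-sum = begin
    ∑ inv R              ≡⟨ ∑-cong R (λ r∈ → sym (ρ-in r∈)) ⟩
    ∑ ρ R                ≤⟨ ∑-⊆ ρ R ps 0≤ρ uR (λ {r} r∈ → let (pr , _ , r≤) = All.lookup pR r∈ in ∈-primesBelow⁺ pr (s≤s (≤-trans r≤ 2^k≤Dk))) ⟩
    ∑ ρ ps               ≤⟨ ∑≤gsum ρ 0≤ρ ps (2 ^ k) (1≤2^ k) (All.tabulate (λ {p} p∈ → prime⇒≥1 (proj₁ (∈-primesBelow⁻ {n = suc (Dk k)} p∈)) , small p)) ⟩
    gsum ρ ps (2 ^ k) ∎
    where
    open ℚₚ.≤-Reasoning
    small : ∀ p → p ≤ 2 ^ k ⊎ ρ p ≡ 0ℚ
    small p with ω-cases p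
    ... | inj₁ (h , _) = inj₁ (proj₂ (proj₂ (All.lookup pR h)))
    ... | inj₂ (h , _) = inj₂ (ρ-out h)

  sift : ∀ A → ι A ≤ʳ gsum ρ ps (2 ^ k) → ∀ xs → Unique xs → All (λ q → Prime q × Dk k < q × q < Qk k * Qk k × All (λ r → ¬ r ∣ pred q) R) xs →
    k * A * (length xs ∸ 2 * Qk k) ≤ 2 * (Qk k * Qk k)
  sift A A≤ xs uxs as = ι-cancel (subst₂ _≤ʳ_ e₁ (sym (ι-* 2 N)) (mulˡ (ι 2) (0≤ι 2) main))
    where
    N = Qk k * Qk k
    L = length xs ∸ 2 * Qk k
    B = ι k *ʳ inv 2 *ʳ ι A
    main : ι L *ʳ B ≤ʳ ι N
    main = sieve ps locals (unique-primes-coprime ps (primesBelow-prime (suc (Dk k))) (primesBelow-unique (suc (Dk k)))) N (Dk k) (1≤Dk k) xs uxs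
      (All.map (λ h → proj₁ (proj₂ (proj₂ h))) as) (All.map sifted as) B (0≤* (0≤* (0≤ι k) (0≤inv 2)) (0≤ι A)) (G≥ (ι A) (0≤ι A) A≤)
      where
      -- A sieving prime is at most `Dk k < q`, hence does not divide the prime `q`; remainder `1`
      -- modulo `r ∈ R` would mean `r ∣ q - 1`.
      sifted : ∀ {q} → Prime q × Dk k < q × q < N × All (λ r → ¬ r ∣ pred q) R → Sifted ps q
      sifted {q} (pq , D<q , _ , nr) = All.tabulate λ {p} p∈ → τ-out p q (avoid p (∈-primesBelow⁻ {n = suc (Dk k)} p∈))
        where
        nz : ∀ p → Prime p × p < suc (Dk k) → rem q p ≢ 0
        nz p@(suc _) (pp , p≤) e = <-irrefl (prime∣prime pp pq (m%n≡0⇒n∣m q p e)) (≤-trans p≤ D<q)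
        nz zero (pp , _) _ = ¬prime[0] pp
        avoid : ∀ p → Prime p × p < suc (Dk k) → ¬ (rem q p < ω p)
        avoid zero (pp , _) _ = ¬prime[0] pp
        avoid p@(suc _) h lt with ω-cases p | q % p in eq
        ... | inj₁ (_ , e) | zero = nz p h eq
        ... | inj₂ (_ , e) | zero = nz p h eq
        ... | inj₂ (_ , e) | suc x = case subst (suc x <_) e lt of λ { (s≤s ()) }
        ... | inj₁ (_ , e) | suc (suc x) = case subst (suc (suc x) <_) e lt of λ { (s≤s (s≤s ())) }
        ... | inj₁ (p∈R , e) | suc zero = All.lookup nr p∈R (divides (q div p) (cong pred (trans (m≡m%n+[m/n]*n q p) (cong (_+ q div p * p) eq))))
    e₁ : ι 2 *ʳ (ι L *ʳ B) ≡ ι (k * A * L)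
    e₁ = trans (v (ι 2) (ι L) (ι k) (inv 2) (ι A)) (trans (cong (_*ʳ (ι k *ʳ ι A *ʳ ι L)) (ι-inv 2 (s≤s z≤n))) (trans (ℚₚ.*-identityˡ (ι k *ʳ ι A *ʳ ι L)) (sym (trans (ι-* (k * A) L) (cong (_*ʳ ι L) (ι-* k A))))))
      where
      v : ∀ t l k h a → t *ʳ (l *ʳ (k *ʳ h *ʳ a)) ≡ t *ʳ h *ʳ (k *ʳ a *ʳ l)
      v = solve-∀ ring

-- Chebyshev's lower bound for the number of primes.

bin : ℕ → ℕ → ℕ
bin n zero = 1
bin zero (suc k) = 0
bin (suc n) (suc k) = bin n k + bin n (suc k)

bin-absorb : ∀ n k → suc k * bin (suc n) (suc k) ≡ suc n * bin n k
bin-absorb zero zero = refl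
bin-absorb zero (suc k) = *-zeroʳ (suc (suc k))
bin-absorb (suc n) k = trans (*-distribˡ-+ (suc k) (bin (suc n) k) (bin (suc n) (suc k))) (trans (cong (λ z → suc k * bin (suc n) k + z) (bin-absorb n k)) (go k))
  where
  go : ∀ k → suc k * bin (suc n) k + suc n * bin n k ≡ suc (suc n) * bin (suc n) k
  go zero = e n
    where
    e : ∀ n → 1 * 1 + suc n * 1 ≡ suc (suc n) * 1
    e = ℕSolver.solve-∀
  go (suc k) = trans (cong (λ z → bin (suc n) (suc k) + z + suc n * bin n (suc k)) (bin-absorb n k)) (e n (bin n k) (bin n (suc k)))
    where
    e : ∀ n a b → (a + b) + suc n * a + suc n * b ≡ suc (suc n) * (a + b)
    e = ℕSolver.solve-∀

bin-absorb′ : ∀ m e → suc e * bin (suc (m + e)) m ≡ suc (m + e) * bin (m + e) m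
bin-absorb′ zero e = refl
bin-absorb′ (suc m) e = +-cancelˡ-≡ (suc m * X) _ _ (begin
  suc m * X + suc e * X          ≡⟨ e₁ m e X ⟩
  suc n * X                      ≡⟨ *-distribˡ-+ (suc n) (bin n m) (bin n (suc m)) ⟩
  suc n * bin n m + suc n * bin n (suc m) ≡⟨ cong (_+ suc n * bin n (suc m)) (sym (bin-absorb n m)) ⟩
  suc m * X + suc n * bin n (suc m) ∎)
  where
  open ≡-Reasoning
  n = suc m + e
  X = bin (suc n) (suc m)
  e₁ : ∀ m e X → suc m * X + suc e * X ≡ suc (suc m + e) * X
  e₁ = ℕSolver.solve-∀

bin-pos : ∀ m e → 1 ≤ bin (m + e) m
bin-pos zero e = ≤-refl
bin-pos (suc m) e = ≤-trans (bin-pos m e) (m≤m+n _ _)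

-- Leibniz harmonic triangle: 1/z = 1/x - 1/y for neighbouring entries, so divisibility propagates.
leibniz-∣ : ∀ N M → 1 ≤ M → (∀ k → 1 ≤ k → k ≤ N → k ∣ M) → ∀ m e → m + e < N → suc (m + e) * bin (m + e) m ∣ M
leibniz-∣ N M 1≤M h zero e lt = subst (_∣ M) (sym (*-identityʳ (suc e))) (h (suc e) (s≤s z≤n) lt)
leibniz-∣ N M 1≤M h (suc m) e lt with leibniz-∣ N M 1≤M h m e (≤-trans (n≤1+n _) lt) | leibniz-∣ N M 1≤M h m (suc e) (subst (_< N) (sym (+-suc m e)) lt)
... | divides u M≡ux | divides v M≡vy₀ = divides (u ∸ v) (sym (*-cancelʳ-≡ _ _ (x * y) {{>-nonZero (*-mono-≤ 1≤x 1≤y)}} final))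
  where
  open ≡-Reasoning
  n = m + e
  s = suc (suc n)
  x = suc n * bin n m
  y = s * bin (suc n) m
  z = s * bin (suc n) (suc m)
  1≤x : 1 ≤ x
  1≤x = *-mono-≤ {1} {suc n} (s≤s z≤n) (bin-pos m e)
  1≤y : 1 ≤ y
  1≤y = *-mono-≤ {1} {s} (s≤s z≤n) (subst (λ k → 1 ≤ bin k m) (+-suc m e) (bin-pos m (suc e)))
  M≡vy : M ≡ v * y
  M≡vy = trans M≡vy₀ (cong (λ k → v * (suc k * bin k m)) (+-suc m e))
  zx : suc m * z ≡ s * x
  zx = trans (sw (suc m) s (bin (suc n) (suc m))) (cong (s *_) (bin-absorb n m))
    where
    sw : ∀ a b c → a * (b * c) ≡ b * (a * c)
    sw = ℕSolver.solve-∀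
  yx : suc e * y ≡ s * x
  yx = trans (sw (suc e) s (bin (suc n) m)) (cong (s *_) (bin-absorb′ m e))
    where
    sw : ∀ a b c → a * (b * c) ≡ b * (a * c)
    sw = ℕSolver.solve-∀
  xyz : x * y + z * x ≡ z * y
  xyz = *-cancelˡ-≡ _ _ s (begin
    s * (x * y + z * x)              ≡⟨ e₁ s x y z ⟩
    (s * x) * y + z * (s * x)        ≡⟨ cong₂ (λ a b → a * y + z * b) (sym zx) (sym yx) ⟩
    (suc m * z) * y + z * (suc e * y) ≡⟨ e₂ m e y z ⟩
    s * (z * y) ∎)
    where
    e₁ : ∀ s x y z → s * (x * y + z * x) ≡ (s * x) * y + z * (s * x)
    e₁ = ℕSolver.solve-∀
    e₂ : ∀ m e y z → (suc m * z) * y + z * (suc e * y) ≡ suc (suc (m + e)) * (z * y)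
    e₂ = ℕSolver.solve-∀
  v≤u : v ≤ u
  v≤u = *-cancelʳ-≤ v u x {{>-nonZero 1≤x}} (≤-trans (*-monoʳ-≤ v x≤y) (≤-reflexive (trans (sym M≡vy) M≡ux)))
    where
    x≤y : x ≤ y
    x≤y = *-mono-≤ (n≤1+n (suc n)) (mono n m)
      where
      mono : ∀ n m → bin n m ≤ bin (suc n) m
      mono n zero = ≤-refl
      mono n (suc m) = m≤n+m _ _
  final : (u ∸ v) * z * (x * y) ≡ M * (x * y)
  final = +-cancelʳ-≡ (v * z * (x * y)) _ _ (begin
    (u ∸ v) * z * (x * y) + v * z * (x * y) ≡⟨ e₁ (u ∸ v) v z (x * y) ⟩
    ((u ∸ v) + v) * z * (x * y)             ≡⟨ cong (λ k → k * z * (x * y)) (m∸n+n≡m v≤u) ⟩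
    u * z * (x * y)                         ≡⟨ e₂ u z x y ⟩
    (u * x) * (z * y)                       ≡⟨ cong₂ _*_ (sym M≡ux) (sym xyz) ⟩
    M * (x * y + z * x)                     ≡⟨ *-distribˡ-+ M (x * y) (z * x) ⟩
    M * (x * y) + M * (z * x)               ≡⟨ cong (λ k → M * (x * y) + k * (z * x)) M≡vy ⟩
    M * (x * y) + v * y * (z * x)           ≡⟨ cong (λ k → M * (x * y) + k) (e₃ v y z x) ⟩
    M * (x * y) + v * z * (x * y) ∎)
    where
    e₁ : ∀ a v z w → a * z * w + v * z * w ≡ (a + v) * z * w
    e₁ = ℕSolver.solve-∀
    e₂ : ∀ u z x y → u * z * (x * y) ≡ (u * x) * (z * y)
    e₂ = ℕSolver.solve-∀
    e₃ : ∀ v y z x → v * y * (z * x) ≡ v * z * (x * y)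
    e₃ = ℕSolver.solve-∀

rowsum : ℕ → ℕ → ℕ
rowsum n zero = 1
rowsum n (suc j) = rowsum n j + bin n (suc j)

rowsum-suc : ∀ n j → rowsum (suc n) (suc j) ≡ rowsum n (suc j) + rowsum n j
rowsum-suc n zero = e (bin n 1)
  where
  e : ∀ a → 1 + (1 + a) ≡ (1 + a) + 1
  e = ℕSolver.solve-∀
rowsum-suc n (suc j) = trans (cong (_+ bin (suc n) (suc (suc j))) (rowsum-suc n j)) (e (rowsum n (suc j)) (rowsum n j) (bin n (suc j)) (bin n (suc (suc j))))
  where
  e : ∀ a b c d → a + b + (c + d) ≡ a + d + (b + c)
  e = ℕSolver.solve-∀

bin-over : ∀ n e → bin n (suc (n + e)) ≡ 0
bin-over zero e = refl
bin-over (suc n) e = cong₂ _+_ (bin-over n e) (trans (cong (λ z → bin n (suc z)) (sym (+-suc n e))) (bin-over n (suc e)))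

rowsum-full : ∀ n → rowsum n n ≡ 2 ^ n
rowsum-full zero = refl
rowsum-full (suc n) = trans (rowsum-suc n n) (trans (cong₂ _+_ (trans (cong (λ z → rowsum n n + z) (trans (cong (λ z → bin n (suc z)) (sym (+-identityʳ n))) (bin-over n 0))) (+-identityʳ _)) refl) (trans (cong₂ _+_ (rowsum-full n) (rowsum-full n)) (cong (λ z → 2 ^ n + z) (sym (+-identityʳ (2 ^ n))))))

-- Each of the `n + 1` numbers `(n + 1) bin n m` divides `M`, hence is at most `M`, and together
-- they sum to `(n + 1) 2 ^ n`.
common-multiple-≥ : ∀ n M → 1 ≤ M → (∀ k → 1 ≤ k → k ≤ suc n → k ∣ M) → 2 ^ n ≤ M
common-multiple-≥ n M 1≤M h = *-cancelˡ-≤ (suc n) (subst (λ z → suc n * z ≤ suc n * M) (rowsum-full n) (bound n ≤-refl))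
  where
  entry : ∀ m → m ≤ n → suc n * bin n m ≤ M
  entry m m≤n = subst (λ z → suc z * bin z m ≤ M) (m+[n∸m]≡n m≤n) (∣⇒≤ {{>-nonZero 1≤M}} (leibniz-∣ (suc n) M 1≤M h m (n ∸ m) (≤-reflexive (cong suc (m+[n∸m]≡n m≤n)))))
  bound : ∀ j → j ≤ n → suc n * rowsum n j ≤ suc j * M
  bound zero _ = ≤-trans (entry 0 z≤n) (≤-reflexive (sym (*-identityˡ M)))
  bound (suc j) le = ≤-trans (≤-reflexive (*-distribˡ-+ (suc n) (rowsum n j) (bin n (suc j)))) (≤-trans (+-mono-≤ (bound j (≤-trans (n≤1+n j) le)) (entry (suc j) le)) (≤-reflexive (+-comm (suc j * M) M)))

split-power : ∀ p → 2 ≤ p → ∀ fuel k → 1 ≤ k → k ≤ fuel → ∃[ v ] ∃[ k′ ] (k ≡ p ^ v * k′ × ¬ p ∣ k′)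
split-power p 2≤p zero k 1≤k le = ⊥-elim (<-irrefl refl (≤-trans 1≤k le))
split-power p 2≤p (suc fuel) k 1≤k le with p ∣? k
... | no ¬d = 0 , k , sym (+-identityʳ k) , ¬d
... | yes (divides c k≡) with split-power p 2≤p fuel c (pos c (subst (1 ≤_) k≡ 1≤k)) (s≤s⁻¹ (≤-trans (subst (c <_) (sym k≡) (m<m*n c p {{>-nonZero (pos c (subst (1 ≤_) k≡ 1≤k))}} 2≤p)) le))
  where
  pos : ∀ c → 1 ≤ c * p → 1 ≤ c
  pos (suc c) _ = s≤s z≤n
... | v , k′ , c≡ , nd = suc v , k′ , trans k≡ (trans (cong (_* p) c≡) (e (p ^ v) k′ p)) , nd
  where
  e : ∀ a b c → a * b * c ≡ c * a * b
  e = ℕSolver.solve-∀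

n<2^n : ∀ n → n < 2 ^ n
n<2^n zero = s≤s z≤n
n<2^n (suc n) = ≤-trans (+-mono-≤ (1≤2^ n) (n<2^n n)) (≤-reflexive (cong (λ z → 2 ^ n + z) (sym (+-identityʳ (2 ^ n)))))

maxExp : ℕ → ℕ → ℕ → ℕ
maxExp N p zero = 0
maxExp N p (suc e) = ite (p ^ suc e ≤? N) (suc e) (maxExp N p e)

maxExp-≤ : ∀ N p e → 1 ≤ N → p ^ maxExp N p e ≤ N
maxExp-≤ N p zero 1≤N = 1≤N
maxExp-≤ N p (suc e) 1≤N = go (p ^ suc e ≤? N)
  where
  go : (d : Dec (p ^ suc e ≤ N)) → p ^ ite d (suc e) (maxExp N p e) ≤ N
  go (yes h) = h
  go (no _) = maxExp-≤ N p e 1≤N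

maxExp-max : ∀ N p e v → v ≤ e → p ^ v ≤ N → v ≤ maxExp N p e
maxExp-max N p zero v le _ = le
maxExp-max N p (suc e) v le h = go (p ^ suc e ≤? N)
  where
  go : (d : Dec (p ^ suc e ≤ N)) → v ≤ ite d (suc e) (maxExp N p e)
  go (yes _) = le
  go (no ¬h) = maxExp-max N p e v (s≤s⁻¹ (≤∧≢⇒< le (λ { refl → ¬h h }))) h

-- For `ps` the primes up to `N` this is the least common multiple of `1, …, N`. Every factor is at
-- most `N`, which yields the bound `N ^ length ps`.
bigLcm : ℕ → List ℕ → ℕ
bigLcm N ps = product (map (λ p → p ^ maxExp N p N) ps)

bigLcm-∣ : ∀ N ps → All Prime ps → ∀ k → 1 ≤ k → k ≤ N → Smooth ps k → k ∣ bigLcm N ps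
bigLcm-∣ N [] _ k 1≤k _ sm with k ≟ 1
... | yes refl = ∣-refl
... | no k≢1 with prime-divisor k (≤∧≢⇒< 1≤k (λ e → k≢1 (sym e)))
... | q , pq , q∣ with sm pq q∣
... | ()
bigLcm-∣ N (p ∷ ps) (pp ∷ pps) k 1≤k k≤N sm with split-power p (prime⇒≥2 pp) k k 1≤k ≤-refl
... | v , k′ , k≡ , nd = subst (_∣ bigLcm N (p ∷ ps)) (sym k≡) (*-pres-∣ (pow-∣ v≤) (bigLcm-∣ N ps pps k′ 1≤k′ (≤-trans k′≤k k≤N) sm′))
  where
  1≤pv : 1 ≤ p ^ v
  1≤pv = m^n>0 p {{prime⇒nonZero pp}} v
  1≤k′ : 1 ≤ k′
  1≤k′ = go k′ (subst (1 ≤_) k≡ 1≤k)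
    where
    go : ∀ x → 1 ≤ p ^ v * x → 1 ≤ x
    go zero le = ⊥-elim (<-irrefl refl (subst (1 ≤_) (*-zeroʳ (p ^ v)) le))
    go (suc x) _ = s≤s z≤n
  k′≤k : k′ ≤ k
  k′≤k = subst (k′ ≤_) (sym k≡) (m≤n*m k′ (p ^ v) {{>-nonZero 1≤pv}})
  pv≤N : p ^ v ≤ N
  pv≤N = ≤-trans (subst (p ^ v ≤_) (sym k≡) (m≤m*n (p ^ v) k′ {{>-nonZero 1≤k′}})) k≤N
  v≤ : v ≤ maxExp N p N
  v≤ = maxExp-max N p N v (<⇒≤ (≤-trans (n<2^n v) (≤-trans (^-monoˡ-≤ v (prime⇒≥2 pp)) pv≤N))) pv≤N
  pow-∣ : ∀ {a b} → a ≤ b → p ^ a ∣ p ^ b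
  pow-∣ {a} {b} le = subst (p ^ a ∣_) (trans (sym (^-distribˡ-+-* p a (b ∸ a))) (cong (p ^_) (m+[n∸m]≡n le))) (m∣m*n (p ^ (b ∸ a)))
  sm′ : Smooth ps k′
  sm′ {q} pq q∣ with sm pq (subst (q ∣_) (sym k≡) (∣n⇒∣m*n (p ^ v) q∣))
  ... | here refl = ⊥-elim (nd q∣)
  ... | there q∈ = q∈

bigLcm-≤ : ∀ N ps → 1 ≤ N → bigLcm N ps ≤ N ^ length ps
bigLcm-≤ N [] _ = ≤-refl
bigLcm-≤ N (p ∷ ps) 1≤N = *-mono-≤ (maxExp-≤ N p N 1≤N) (bigLcm-≤ N ps 1≤N)

bigLcm-pos : ∀ N ps → All Prime ps → 1 ≤ bigLcm N ps
bigLcm-pos N [] _ = ≤-refl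
bigLcm-pos N (p ∷ ps) (pp ∷ pps) = *-mono-≤ (m^n>0 p {{prime⇒nonZero pp}} (maxExp N p N)) (bigLcm-pos N ps pps)

2^-cancel-≤ : ∀ {a b} → 2 ^ a ≤ 2 ^ b → a ≤ b
2^-cancel-≤ {a} {b} le with a ≤? b
... | yes h = h
... | no ¬h = ⊥-elim (<-irrefl refl (≤-trans (^-monoʳ-< 2 (s≤s (s≤s z≤n)) (≰⇒> ¬h)) le))

-- The least common multiple of `1, …, n + 1` is at least `2 ^ n` and at most `(n + 1) ^ π(n + 1)`;
-- the exponents of `2` are compared.
chebyshev : ∀ n w → suc n ≤ 2 ^ w → n ≤ w * length (primesBelow (suc (suc n)))
chebyshev n w le = 2^-cancel-≤ (begin
  2 ^ n              ≤⟨ common-multiple-≥ n (bigLcm (suc n) ps) (bigLcm-pos (suc n) ps pps) (λ k 1≤k k≤ → bigLcm-∣ (suc n) ps pps k 1≤k k≤ (λ pq q∣k → ∈-primesBelow⁺ pq (s≤s (≤-trans (∣⇒≤ {{>-nonZero 1≤k}} q∣k) k≤)))) ⟩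
  bigLcm (suc n) ps  ≤⟨ bigLcm-≤ (suc n) ps (s≤s z≤n) ⟩
  suc n ^ length ps  ≤⟨ ^-monoˡ-≤ (length ps) le ⟩
  (2 ^ w) ^ length ps ≡⟨ ^-*-assoc 2 w (length ps) ⟩
  2 ^ (w * length ps) ∎)
  where
  open ≤-Reasoning
  ps = primesBelow (suc (suc n))
  pps = primesBelow-prime (suc (suc n))

-- bp k = β^k with β = 2¹⁶; this base makes room for a sieve of level 2^(2k) below bp k.
abstract
  bp : ℕ → ℕ
  bp k = 2 ^ (16 * k)

  bp-def : ∀ k → bp k ≡ 2 ^ (16 * k)
  bp-def k = refl

bp-+ : ∀ a b → bp (a + b) ≡ bp a * bp b
bp-+ a b = trans (bp-def (a + b)) (trans (trans (cong (2 ^_) (*-distribˡ-+ 16 a b)) (^-distribˡ-+-* 2 (16 * a) (16 * b))) (cong₂ _*_ (sym (bp-def a)) (sym (bp-def b))))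

bp-mono : ∀ {a b} → a ≤ b → bp a ≤ bp b
bp-mono {a} {b} le = subst₂ _≤_ (sym (bp-def a)) (sym (bp-def b)) (^-monoʳ-≤ 2 (*-monoʳ-≤ 16 le))

1≤bp : ∀ k → 1 ≤ bp k
1≤bp k = subst (1 ≤_) (sym (bp-def k)) (1≤2^ (16 * k))

bp0 : bp 0 ≡ 1
bp0 = bp-def 0

bp-^ : ∀ a n → bp a ^ n ≡ bp (a * n)
bp-^ a n = trans (cong (_^ n) (bp-def a)) (trans (^-*-assoc 2 (16 * a) n) (trans (cong (2 ^_) (*-assoc 16 a n)) (sym (bp-def (a * n)))))

bp-Q : ∀ k → bp k ≡ Qk k * Qk k
bp-Q k = trans (bp-def k) (trans (cong (2 ^_) (*-comm 16 k)) (trans (sym (^-*-assoc 2 k 16)) (e (2 ^ k))))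
  where
  e : ∀ u → u * (u * (u * (u * (u * (u * (u * (u * (u * (u * (u * (u * (u * (u * (u * (u * 1))))))))))))))) ≡ ((u * u) * (u * u) * ((u * u) * (u * u))) * ((u * u) * (u * u) * ((u * u) * (u * u)))
  e = ℕSolver.solve-∀

Qk-def : ∀ k → Qk k ≡ 2 ^ (8 * k)
Qk-def k = trans (e (2 ^ k)) (trans (^-*-assoc 2 k 8) (cong (2 ^_) (*-comm k 8)))
  where
  e : ∀ u → (u * u) * (u * u) * ((u * u) * (u * u)) ≡ u * (u * (u * (u * (u * (u * (u * (u * 1)))))))
  e = ℕSolver.solve-∀

Dk-def : ∀ k → Dk k ≡ 2 ^ (2 * k)
Dk-def k = trans (e (2 ^ k)) (trans (^-*-assoc 2 k 2) (cong (2 ^_) (*-comm k 2)))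
  where
  e : ∀ u → u * u ≡ u * (u * 1)
  e = ℕSolver.solve-∀

-- The factor `256` is what `hit-count` uses: there the error `2 Q`, multiplied by `128 (k + 1)`,
-- has to stay below `Q²`.
256k≤Qk : ∀ k → 1 ≤ k → 256 * k ≤ Qk k
256k≤Qk (suc k) _ = ≤-trans (≤-trans (*-monoʳ-≤ 256 (≤-trans (n<2^n k) (^-monoʳ-≤ 2 (m≤n*m k 8)))) (≤-reflexive (trans (sym (^-distribˡ-+-* 2 8 (8 * k))) (cong (2 ^_) (sym (*-suc 8 k)))))) (≤-reflexive (sym (Qk-def (suc k))))

-- Primes between consecutive powers of β, and those hit by R.

J : ℕ → List ℕ
J k = filter (bp k ≤?_) (primesBelow (bp (suc k)))

∈-J⁻ : ∀ {k q} → q ∈ J k → Prime q × bp k ≤ q × q < bp (suc k)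
∈-J⁻ {k} {q} q∈ = let (a , b) = ∈-filter⁻ (bp k ≤?_) {xs = primesBelow (bp (suc k))} q∈ ; (c , d) = ∈-primesBelow⁻ {n = bp (suc k)} a in c , b , d

∈-J⁺ : ∀ {k q} → Prime q → bp k ≤ q → q < bp (suc k) → q ∈ J k
∈-J⁺ {k} pq lo hi = ∈-filter⁺ (bp k ≤?_) (∈-primesBelow⁺ pq hi) lo

J-unique : ∀ k → Unique (J k)
J-unique k = Uniqueₚ.filter⁺ (bp k ≤?_) (primesBelow-unique (bp (suc k)))

length-filter-split : ∀ {A : Set} {P : A → Set} (P? : Decidable P) xs → length xs ≡ length (filter P? xs) + length (filter (¬? ∘ P?) xs)
length-filter-split P? [] = refl
length-filter-split P? (x ∷ xs) with P? x
... | yes _ = cong suc (length-filter-split P? xs)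
... | no _ = trans (cong suc (length-filter-split P? xs)) (sym (+-suc _ _))

-- The sieve with `R = []` and gain `A = 1`. The primes up to the level, as well as the error of the
-- sieve, are absorbed because `k` is tiny compared with `Qk k`.
π-upper : ∀ k → 1 ≤ k → k * length (primesBelow (bp k)) ≤ 3 * bp k
π-upper k 1≤k = begin
  k * length ps                                   ≡⟨ cong (k *_) (length-filter-split (Dk k <?_) ps) ⟩
  k * (length xs + length ys)                     ≤⟨ *-monoʳ-≤ k (+-mono-≤ xs≤ ys≤) ⟩
  k * ((length xs ∸ 2 * Q) + 2 * Q + (Q + Q))     ≡⟨ e k (length xs ∸ 2 * Q) Q ⟩
  k * 1 * (length xs ∸ 2 * Q) + 4 * k * Q         ≤⟨ +-mono-≤ sifted (*-monoˡ-≤ Q (≤-trans (*-monoˡ-≤ k 4≤256) (256k≤Qk k 1≤k))) ⟩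
  2 * (Q * Q) + Q * Q                             ≡⟨ e₂ (Q * Q) ⟩
  3 * (Q * Q)                                     ≡⟨ cong (3 *_) (sym (bp-Q k)) ⟩
  3 * bp k ∎
  where
  open ≤-Reasoning
  4≤256 : 4 ≤ 256
  4≤256 = toWitness {a? = 4 ≤? 256} tt
  Q = Qk k
  ps = primesBelow (bp k)
  xs = filter (Dk k <?_) ps
  ys = filter (¬? ∘ (Dk k <?_)) ps
  e : ∀ k l Q → k * (l + 2 * Q + (Q + Q)) ≡ k * 1 * l + 4 * k * Q
  e = ℕSolver.solve-∀
  e₂ : ∀ x → 2 * x + x ≡ 3 * x
  e₂ = ℕSolver.solve-∀
  xs≤ : length xs ≤ (length xs ∸ 2 * Q) + 2 * Q
  xs≤ = ≤-trans (m≤n+m∸n (length xs) (2 * Q)) (≤-reflexive (+-comm (2 * Q) _))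
  D≤Q : Dk k ≤ Q
  D≤Q = subst₂ _≤_ (sym (Dk-def k)) (sym (Qk-def k)) (^-monoʳ-≤ 2 (*-monoˡ-≤ k (toWitness {a? = 2 ≤? 8} tt)))
  ys≤ : length ys ≤ Q + Q
  ys≤ = ≤-trans (length-⊆ ys (downFrom (suc (Dk k))) (Uniqueₚ.filter⁺ (¬? ∘ (Dk k <?_)) (primesBelow-unique (bp k)))
     (λ {q} q∈ → ∈-downFrom⁺ (s≤s (≮⇒≥ (proj₂ (∈-filter⁻ (¬? ∘ (Dk k <?_)) {xs = ps} q∈))))))
     (≤-trans (≤-reflexive (length-downFrom (suc (Dk k)))) (+-mono-≤ (1≤Qk k) D≤Q))
  open SievePrimes [] k [] [] using (sift; ρ; 0≤ρ)
  sifted : k * 1 * (length xs ∸ 2 * Q) ≤ 2 * (Q * Q)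
  sifted = sift 1 (subst (_≤ʳ gsum ρ (primesBelow (suc (Dk k))) (2 ^ k)) (sym ι1) (1≤gsum ρ (primesBelow (suc (Dk k))) (2 ^ k) 0≤ρ (1≤2^ k))) xs (Uniqueₚ.filter⁺ (Dk k <?_) (primesBelow-unique (bp k)))
    (All.tabulate λ {q} q∈ → let (a , b) = ∈-filter⁻ (Dk k <?_) {xs = ps} q∈ ; (c , d) = ∈-primesBelow⁻ {n = bp k} a in c , b , subst (q <_) (bp-Q k) d , [])

π-lower : ∀ k → 1 ≤ k → bp k ≤ 16 * k * length (primesBelow (bp k)) + 2
π-lower k 1≤k = go (bp k) 2≤ refl
  where
  2≤ : 2 ≤ bp k
  2≤ = subst (2 ≤_) (sym (bp-def k)) (^-monoʳ-≤ 2 {1} (≤-trans 1≤k (m≤n*m k 16)))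
  go : ∀ N → 2 ≤ N → N ≡ bp k → N ≤ 16 * k * length (primesBelow N) + 2
  go (suc zero) (s≤s ()) _
  go (suc (suc n)) _ e = ≤-trans (≤-reflexive (+-comm 2 n)) (+-monoˡ-≤ 2 (chebyshev n (16 * k) (≤-trans (n≤1+n (suc n)) (≤-reflexive (trans e (bp-def k))))))

hits : List ℕ → ℕ → Set
hits R q = Any (λ r → r ∣ pred q) R

hits? : ∀ R → Decidable (hits R)
hits? R q = any? (λ r → r ∣? pred q) R

private
  -- Here `a`, `l`, `j`, `g`, `b` stand for `k + 1` times the numbers of primes below `bp (suc k)`,
  -- below `bp k`, in `J k`, of its hits and of its misses. Chebyshev's bound times `4` leaves `3 N`
  -- on the right besides `64 g`: `2 N` from the misses and `400 N′` from the primes below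
  -- `N′ = bp k`, which the large ratio `β` makes at most `N`.
  cancel-arith : ∀ N N′ a l j g b → 1 ≤ N′ → N ≤ 16 * a + 2 → a ≤ l + j → j ≡ g + b → l ≤ 6 * N′ → 32 * b ≤ N → 400 * N′ ≤ N → N ≤ 64 * g
  cancel-arith N N′ a l j g b 1≤N′ h₁ h₂ h₃ h₄ h₅ h₆ = +-cancelʳ-≤ N N (64 * g) (+-cancelʳ-≤ (N + N) (N + N) (64 * g + N) (begin
    N + N + (N + N)                                        ≡⟨ e₁ N ⟩
    4 * N                                                  ≤⟨ *-monoʳ-≤ 4 (≤-trans h₁ (+-monoˡ-≤ 2 (*-monoʳ-≤ 16 (≤-trans h₂ (≤-reflexive (cong (λ z → l + z) h₃)))))) ⟩
    4 * (16 * (l + (g + b)) + 2)                           ≡⟨ e₂ l g b ⟩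
    64 * l + 64 * g + 2 * (32 * b) + 8                     ≤⟨ +-mono-≤ (+-mono-≤ (+-monoˡ-≤ (64 * g) (*-monoʳ-≤ 64 h₄)) (*-monoʳ-≤ 2 h₅)) (*-monoʳ-≤ 8 1≤N′) ⟩
    64 * (6 * N′) + 64 * g + 2 * N + 8 * N′                ≤⟨ m≤m+n _ (8 * N′) ⟩
    64 * (6 * N′) + 64 * g + 2 * N + 8 * N′ + 8 * N′       ≡⟨ e₃ N′ g N ⟩
    400 * N′ + (64 * g + (N + N))                          ≤⟨ +-monoˡ-≤ _ h₆ ⟩
    N + (64 * g + (N + N))                                 ≡⟨ e₄ N g ⟩
    64 * g + N + (N + N) ∎))
    where
    open ≤-Reasoning
    e₁ : ∀ N → N + N + (N + N) ≡ 4 * N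
    e₁ = ℕSolver.solve-∀
    e₂ : ∀ l g b → 4 * (16 * (l + (g + b)) + 2) ≡ 64 * l + 64 * g + 2 * (32 * b) + 8
    e₂ = ℕSolver.solve-∀
    e₃ : ∀ n g N → 64 * (6 * n) + 64 * g + 2 * N + 8 * n + 8 * n ≡ 400 * n + (64 * g + (N + N))
    e₃ = ℕSolver.solve-∀
    e₄ : ∀ N g → N + (64 * g + (N + N)) ≡ 64 * g + N + (N + N)
    e₄ = ℕSolver.solve-∀

low-count : ∀ k → 1 ≤ k → suc k * length (primesBelow (bp k)) ≤ 6 * bp k
low-count k 1≤k = ≤-trans (*-monoˡ-≤ (length (primesBelow (bp k))) (≤-trans (+-monoˡ-≤ k 1≤k) (≤-reflexive (e k)))) (≤-trans (≤-reflexive (*-assoc 2 k _)) (≤-trans (*-monoʳ-≤ 2 (π-upper k 1≤k)) (≤-reflexive (e₂ (bp k)))))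
  where
  e : ∀ k → k + k ≡ 2 * k
  e = ℕSolver.solve-∀
  e₂ : ∀ n → 2 * (3 * n) ≡ 6 * n
  e₂ = ℕSolver.solve-∀

400bp≤ : ∀ k → 400 * bp k ≤ bp (suc k)
400bp≤ k = ≤-trans (*-monoˡ-≤ (bp k) (≤-trans (toWitness {a? = 400 ≤? 65536} tt) (≤-reflexive (sym (bp-def 1))))) (≤-reflexive (sym (bp-+ 1 k)))

J-cover : ∀ k → length (primesBelow (bp (suc k))) ≤ length (primesBelow (bp k)) + length (J k)
J-cover k = ≤-trans (≤-reflexive (trans (length-filter-split (bp k ≤?_) ps) (+-comm (length (J k)) _))) (+-monoˡ-≤ (length (J k))
  (length-⊆ _ (primesBelow (bp k)) (Uniqueₚ.filter⁺ (¬? ∘ (bp k ≤?_)) (primesBelow-unique (bp (suc k))))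
    (λ {q} q∈ → let (a , b) = ∈-filter⁻ (¬? ∘ (bp k ≤?_)) {xs = ps} q∈ in ∈-primesBelow⁺ (proj₁ (∈-primesBelow⁻ {n = bp (suc k)} a)) (≰⇒> b))))
  where
  ps = primesBelow (bp (suc k))

-- The misses avoid class `1` modulo every `r ∈ R`, so the sieve applies to them with gain `A = 128`
-- and leaves at most `N / (32 (k + 1))` of them. Chebyshev provides about `N / (16 (k + 1))`
-- primes, so a fixed proportion are hits.
hit-count : ∀ k → 1 ≤ k → ∀ R → Unique R → All (λ r → Prime r × 4 ≤ r × r ≤ 2 ^ suc k) R → ι 128 ≤ʳ ∑ inv R →
  bp (suc k) ≤ 64 * (suc k * length (filter (hits? R) (J k)))
hit-count k 1≤k R uR pR big = cancel-arith N (bp k) (suc k * length (primesBelow N)) (suc k * length (primesBelow (bp k))) (suc k * length (J k)) (suc k * length (filter (hits? R) (J k))) (suc k * length bad) (1≤bp k)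
  (≤-trans (π-lower (suc k) (s≤s z≤n)) (≤-reflexive (cong (_+ 2) (*-assoc 16 (suc k) _))))
  (≤-trans (*-monoʳ-≤ (suc k) (J-cover k)) (≤-reflexive (*-distribˡ-+ (suc k) (length (primesBelow (bp k))) (length (J k)))))
  (trans (cong (suc k *_) (length-filter-split (hits? R) (J k))) (*-distribˡ-+ (suc k) (length (filter (hits? R) (J k))) (length bad)))
  (low-count k 1≤k)
  bad≤
  (400bp≤ k)
  where
  open ≤-Reasoning
  N = bp (suc k)
  Q = Qk (suc k)
  bad = filter (¬? ∘ hits? R) (J k)
  open SievePrimes R (suc k) uR pR using (sift; ρ-sum)
  D<bp : Dk (suc k) < bp k
  D<bp = subst₂ _<_ (sym (Dk-def (suc k))) (sym (bp-def k)) (^-monoʳ-< 2 (s≤s (s≤s z≤n)) lt)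
    where
    lt : 2 * suc k < 16 * k
    lt = ≤-trans (≤-trans (≤-reflexive (e k)) (+-monoʳ-≤ (2 * k) (*-monoʳ-≤ 3 1≤k))) (≤-trans (≤-reflexive (e′ k)) (*-monoˡ-≤ k (toWitness {a? = 5 ≤? 16} tt)))
      where
      e : ∀ k → suc (2 * suc k) ≡ 2 * k + 3 * 1
      e = ℕSolver.solve-∀
      e′ : ∀ k → 2 * k + 3 * k ≡ 5 * k
      e′ = ℕSolver.solve-∀
  sifted : suc k * 128 * (length bad ∸ 2 * Q) ≤ 2 * (Q * Q)
  sifted = sift 128 (≤ʳ-trans big ρ-sum) bad (Uniqueₚ.filter⁺ (¬? ∘ hits? R) (J-unique k))
    (All.tabulate λ {q} q∈ → let (a , b) = ∈-filter⁻ (¬? ∘ hits? R) {xs = J k} q∈ ; (c , d , e) = ∈-J⁻ {k} a in c , ≤-trans D<bp d , subst (q <_) (bp-Q (suc k)) e , All.tabulate (λ r∈ r∣ → b (lose r∈ r∣)))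
  bad≤ : 32 * (suc k * length bad) ≤ N
  bad≤ = *-cancelˡ-≤ 4 (begin
    4 * (32 * (suc k * length bad))                            ≤⟨ *-monoʳ-≤ 4 (*-monoʳ-≤ 32 (*-monoʳ-≤ (suc k) (≤-trans (m≤n+m∸n (length bad) (2 * Q)) (≤-reflexive (+-comm (2 * Q) _))))) ⟩
    4 * (32 * (suc k * ((length bad ∸ 2 * Q) + 2 * Q)))        ≡⟨ e (suc k) (length bad ∸ 2 * Q) Q ⟩
    suc k * 128 * (length bad ∸ 2 * Q) + 256 * suc k * Q       ≤⟨ +-mono-≤ sifted (*-monoˡ-≤ Q (256k≤Qk (suc k) (s≤s z≤n))) ⟩
    2 * (Q * Q) + Q * Q                                        ≤⟨ m≤m+n _ (Q * Q) ⟩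
    2 * (Q * Q) + Q * Q + Q * Q                                ≡⟨ e₂ (Q * Q) ⟩
    4 * (Q * Q)                                                ≡⟨ cong (4 *_) (sym (bp-Q (suc k))) ⟩
    4 * N ∎)
    where
    e : ∀ k l Q → 4 * (32 * (k * (l + 2 * Q))) ≡ k * 128 * l + 256 * k * Q
    e = ℕSolver.solve-∀
    e₂ : ∀ x → 2 * x + x + x ≡ 4 * x
    e₂ = ℕSolver.solve-∀

J-count : ∀ k → 1 ≤ k → bp (suc k) ≤ 64 * (suc k * length (J k))
J-count k 1≤k = cancel-arith N (bp k) (suc k * length (primesBelow N)) (suc k * length (primesBelow (bp k))) (suc k * length (J k)) (suc k * length (J k)) 0 (1≤bp k)
  (≤-trans (π-lower (suc k) (s≤s z≤n)) (≤-reflexive (cong (_+ 2) (*-assoc 16 (suc k) _))))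
  (≤-trans (*-monoʳ-≤ (suc k) (J-cover k)) (≤-reflexive (*-distribˡ-+ (suc k) (length (primesBelow (bp k))) (length (J k)))))
  (sym (+-identityʳ _)) (low-count k 1≤k) z≤n (400bp≤ k)
  where
  N = bp (suc k)

-- Euler's function as a sum over a period.

∑-applyUpTo : ∀ (f : ℕ → ℚ) (g : ℕ → ℕ) n → ∑ f (applyUpTo g n) ≡ ∑< n (f ∘ g)
∑-applyUpTo f g zero = refl
∑-applyUpTo f g (suc n) = trans (cong (f (g 0) +ʳ_) (∑-applyUpTo f (g ∘ suc) n)) (sym (trans (∑<-split 1 n (f ∘ g)) (cong (_+ʳ ∑< n (f ∘ g ∘ suc)) (ℚₚ.+-identityˡ (f (g 0))))))

length-filter-∑ : ∀ {A : Set} {P : A → Set} (P? : Decidable P) xs → ι (length (filter P? xs)) ≡ ∑ (λ x → 𝟙 (P? x)) xs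
length-filter-∑ P? xs = trans (sym (trans (∑-const 1ℚ (filter P? xs)) (ℚₚ.*-identityʳ (ι (length (filter P? xs)))))) (trans (∑-filter P? (λ _ → 1ℚ) xs) (∑-cong xs (λ {x} _ → ℚₚ.*-identityʳ (𝟙 (P? x)))))

𝟙-⇔ : ∀ {P Q : Set} (p : Dec P) (q : Dec Q) → (P → Q) → (Q → P) → 𝟙 p ≡ 𝟙 q
𝟙-⇔ (yes p) q f g = sym (𝟙-yes q (f p))
𝟙-⇔ (no ¬p) q f g = sym (𝟙-no q (λ y → ¬p (g y)))

𝟙-× : ∀ {R P Q : Set} (r : Dec R) (p : Dec P) (q : Dec Q) → (P → Q → R) → (R → P) → (R → Q) → 𝟙 r ≡ 𝟙 p *ʳ 𝟙 q
𝟙-× r (yes a) (yes b) f g h = 𝟙-yes r (f a b)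
𝟙-× r (no ¬a) q f g h = trans (𝟙-no r (λ c → ¬a (g c))) (sym (ℚₚ.*-zeroˡ (𝟙 q)))
𝟙-× r (yes a) (no ¬b) f g h = 𝟙-no r (λ c → ¬b (h c))

cop→gcd : ∀ k n → Coprime k n → gcd k n ≡ 1
cop→gcd k n = coprime⇒gcd≡1 {k} {n}

gcd→cop : ∀ k n → gcd k n ≡ 1 → Coprime k n
gcd→cop k n = gcd≡1⇒coprime {k} {n}

-- As a function of period `n` this indicator makes `φ n` a sum over a full period, to which
-- `∑<-periods` and `∑<-CRT` apply.
unit : ℕ → ℕ → ℚ
unit n k = 𝟙 (gcd k n ≟ 1)

coprime-+ʳ : ∀ {k n} → Coprime k n → Coprime (k + n) n
coprime-+ʳ {k} {n} c = subst (λ z → Coprime z n) (+-comm n k) (coprime-+ c)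

coprime-+⁻ : ∀ {k n} → Coprime (k + n) n → Coprime k n
coprime-+⁻ c (d∣k , d∣n) = c (∣m∣n⇒∣m+n d∣k d∣n , d∣n)

unit-per : ∀ n → Per n (unit n)
unit-per n k = 𝟙-⇔ (gcd (k + n) n ≟ 1) (gcd k n ≟ 1) (λ e → cop→gcd k n (coprime-+⁻ (gcd→cop (k + n) n e))) (λ e → cop→gcd (k + n) n (coprime-+ʳ (gcd→cop k n e)))

φ-∑ : ∀ n → ι (φ n) ≡ ∑< n (unit n)
φ-∑ n = trans (length-filter-∑ (λ k → gcd k n ≟ 1) (oneTo n)) (trans (∑-map (unit n) suc (upTo n)) (trans (∑-applyUpTo (unit n ∘ suc) id n) (∑<-shift (unit-per n) 1)))

ι-injective : ∀ {m n} → ι m ≡ ι n → m ≡ n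
ι-injective e = ≤-antisym (ι-cancel (ℚₚ.≤-reflexive e)) (ι-cancel (ℚₚ.≤-reflexive (sym e)))

coprime-*ʳ : ∀ {k a b} → Coprime k a → Coprime k b → Coprime k (a * b)
coprime-*ʳ ca cb {d} (d∣k , d∣ab) = cb (d∣k , coprime-divisor (λ (x∣d , x∣a) → ca (∣-trans x∣d d∣k , x∣a)) d∣ab)

φ-prime-∣ : ∀ p m → p ∣ m → φ (p * m) ≡ p * φ m
φ-prime-∣ p m p∣m = ι-injective (begin
  ι (φ (p * m))              ≡⟨ φ-∑ (p * m) ⟩
  ∑< (p * m) (unit (p * m))  ≡⟨ ∑<-cong (p * m) (λ k _ → 𝟙-⇔ (gcd k (p * m) ≟ 1) (gcd k m ≟ 1)
      (λ e → cop→gcd k m (λ {d} (a , b) → gcd→cop k (p * m) e (a , ∣n⇒∣m*n p b)))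
      (λ e → let c = gcd→cop k m e in cop→gcd k (p * m) (coprime-*ʳ (λ (a , b) → c (a , ∣-trans b p∣m)) c))) ⟩
  ∑< (p * m) (unit m)        ≡⟨ ∑<-periods (unit-per m) p ⟩
  ι p *ʳ ∑< m (unit m)       ≡⟨ cong (ι p *ʳ_) (sym (φ-∑ m)) ⟩
  ι p *ʳ ι (φ m)             ≡⟨ sym (ι-* p (φ m)) ⟩
  ι (p * φ m) ∎)
  where open ≡-Reasoning

prime∤⇒coprime : ∀ {p k} → Prime p → ¬ p ∣ k → Coprime k p
prime∤⇒coprime pp nd (d∣k , d∣p) with prime⇒irreducible pp d∣p
... | inj₁ e = e
... | inj₂ refl = ⊥-elim (nd d∣k)

φ-prime : ∀ p → Prime p → φ p ≡ pred p
φ-prime zero pp = ⊥-elim (¬prime[0] pp)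
φ-prime p@(suc n) pp = ι-injective (begin
  ι (φ p)                                ≡⟨ φ-∑ p ⟩
  ∑< p (unit p)                          ≡⟨ ∑<-split 1 n (unit p) ⟩
  (0ℚ +ʳ unit p 0) +ʳ ∑< n (λ k → unit p (suc k)) ≡⟨ cong₂ _+ʳ_ (trans (ℚₚ.+-identityˡ (unit p 0)) (𝟙-no (gcd 0 p ≟ 1) (λ e → <-irrefl (sym (gcd→cop 0 p e (p ∣0 , ∣-refl))) (prime⇒≥2 pp)))) (trans (∑<-cong n (λ k k<n → 𝟙-yes (gcd (suc k) p ≟ 1) (cop→gcd (suc k) p (prime∤⇒coprime pp (λ d → <-irrefl refl (≤-trans (s≤s k<n) (∣⇒≤ d))))))) (∑<-const n 1ℚ)) ⟩
  0ℚ +ʳ ι n *ʳ 1ℚ                        ≡⟨ trans (ℚₚ.+-identityˡ (ι n *ʳ 1ℚ)) (ℚₚ.*-identityʳ (ι n)) ⟩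
  ι n ∎)
  where open ≡-Reasoning

φ-prime-∤ : ∀ p m → Prime p → ¬ p ∣ m → φ (p * m) ≡ pred p * φ m
φ-prime-∤ p m pp nd = ι-injective (begin
  ι (φ (p * m))                                    ≡⟨ trans (cong (λ z → ι (φ z)) (*-comm p m)) (φ-∑ (m * p)) ⟩
  ∑< (m * p) (unit (m * p))                        ≡⟨ ∑<-cong (m * p) (λ k _ → split k) ⟩
  ∑< (m * p) (λ k → unit m k *ʳ unit p k)          ≡⟨ ∑<-CRT (prime⇒≥1 pp) (unit-per m) (unit-per p) (prime∤⇒coprime pp nd) ⟩
  ∑< m (unit m) *ʳ ∑< p (unit p)                   ≡⟨ cong₂ _*ʳ_ (sym (φ-∑ m)) (trans (sym (φ-∑ p)) (cong ι (φ-prime p pp))) ⟩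
  ι (φ m) *ʳ ι (pred p)                            ≡⟨ trans (sym (ι-* (φ m) (pred p))) (cong ι (*-comm (φ m) (pred p))) ⟩
  ι (pred p * φ m) ∎)
  where
  open ≡-Reasoning
  split : ∀ k → unit (m * p) k ≡ unit m k *ʳ unit p k
  split k = 𝟙-× (gcd k (m * p) ≟ 1) (gcd k m ≟ 1) (gcd k p ≟ 1)
    (λ a b → cop→gcd k (m * p) (coprime-*ʳ (gcd→cop k m a) (gcd→cop k p b)))
    (λ e → cop→gcd k m (λ (x , y) → gcd→cop k (m * p) e (x , ∣m⇒∣m*n p y)))
    (λ e → cop→gcd k p (λ (x , y) → gcd→cop k (m * p) e (x , ∣n⇒∣m*n m y)))

φ-pos : ∀ n → 1 ≤ n → 1 ≤ φ n
φ-pos n@(suc m) _ = ι-cancel (subst₂ _≤ʳ_ (sym ι1) (sym (φ-∑ n)) (subst (1ℚ ≤ʳ_) (∑<-shift (unit-per n) 1) (subst (1ℚ ≤ʳ_) (sym (∑<-split 1 m (λ k → unit n (suc k))))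
  (subst (_≤ʳ (0ℚ +ʳ unit n 1) +ʳ ∑< m (λ k → unit n (suc (suc k)))) (trans (ℚₚ.+-identityʳ (0ℚ +ʳ unit n 1)) (trans (ℚₚ.+-identityˡ (unit n 1)) (𝟙-yes (gcd 1 n ≟ 1) (cop→gcd 1 n (λ {d} (d∣1 , _) → ∣1⇒≡1 d∣1)))))
    (ℚₚ.+-monoʳ-≤ (0ℚ +ʳ unit n 1) (subst (_≤ʳ ∑< m (λ k → unit n (suc (suc k)))) (trans (∑<-const m 0ℚ) (ℚₚ.*-zeroʳ (ι m))) (∑<-mono m (λ k _ → 0≤𝟙 (gcd (suc (suc k)) n ≟ 1)))))))))

-- Adding a prime `q` to the product multiplies `φ` by `q` or by `q - 1`, both at most `B`. Hence
-- only the primes `P ≤ B` ever have to be dominated.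
φ-prime-bound : ∀ qs → All Prime qs → ∀ {P} B → All (_≤ B) qs → Prime P → P ∣ φ (product qs) → P ≤ B
φ-prime-bound [] _ B _ pP P∣ = ⊥-elim (<-irrefl (sym (∣1⇒≡1 P∣)) (prime⇒≥2 pP))
φ-prime-bound (q ∷ qs) (pq ∷ pqs) {P} B (q≤B ∷ qs≤B) pP P∣ with q ∣? product qs
... | yes d = case euclidsLemma q (φ (product qs)) pP (subst (P ∣_) (φ-prime-∣ q (product qs) d) P∣) of λ
  { (inj₁ P∣q) → ≤-trans (∣⇒≤ {{prime⇒nonZero pq}} P∣q) q≤B ; (inj₂ P∣φ) → φ-prime-bound qs pqs B qs≤B pP P∣φ }
... | no nd = case euclidsLemma (pred q) (φ (product qs)) pP (subst (P ∣_) (φ-prime-∤ q (product qs) pq nd) P∣) of λ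
  { (inj₁ P∣q) → ≤-trans (∣⇒≤ {{>-nonZero (pred-mono-≤ (prime⇒≥2 pq))}} P∣q) (≤-trans pred[n]≤n q≤B) ; (inj₂ P∣φ) → φ-prime-bound qs pqs B qs≤B pP P∣φ }

-- Congruences, orders and Carmichael's function.

module Mod (n : ℕ) {{nz : NonZero n}} where

  infix 4 _≈_
  _≈_ : ℕ → ℕ → Set
  a ≈ b = a % n ≡ b % n

  ≈-* : ∀ {a b c d} → a ≈ b → c ≈ d → a * c ≈ b * d
  ≈-* {a} {b} {c} {d} p q = trans (%-distribˡ-* a c n) (trans (cong₂ (λ x y → (x * y) % n) p q) (sym (%-distribˡ-* b d n)))

  ≈-^ : ∀ {a b} → a ≈ b → ∀ k → a ^ k ≈ b ^ k
  ≈-^ p zero = refl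
  ≈-^ {a} {b} p (suc k) = ≈-* {a} {b} {a ^ k} {b ^ k} p (≈-^ p k)

  ≈⇒∣ : ∀ {a b} → a ≤ b → a ≈ b → n ∣ b ∸ a
  ≈⇒∣ {a} {b} le e = divides (b div n ∸ a div n) (begin
    b ∸ a                                              ≡⟨ cong₂ _∸_ (m≡m%n+[m/n]*n b n) (m≡m%n+[m/n]*n a n) ⟩
    (b % n + b div n * n) ∸ (a % n + a div n * n)      ≡⟨ cong (λ z → (z + b div n * n) ∸ (a % n + a div n * n)) (sym e) ⟩
    (a % n + b div n * n) ∸ (a % n + a div n * n)      ≡⟨ [m+n]∸[m+o]≡n∸o (a % n) (b div n * n) (a div n * n) ⟩
    b div n * n ∸ a div n * n                          ≡⟨ sym (*-distribʳ-∸ n (b div n) (a div n)) ⟩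
    (b div n ∸ a div n) * n ∎)
    where open ≡-Reasoning

  ∣⇒≈ : ∀ {a b} → a ≤ b → n ∣ b ∸ a → a ≈ b
  ∣⇒≈ {a} {b} le (divides c e) = trans (sym ([m+kn]%n≡m%n a c n)) (cong (_% n) (trans (cong (λ z → a + z) (sym e)) (m+[n∸m]≡n le)))

  ≈-cancel : ∀ {a b} c → Coprime c n → a * c ≈ b * c → a ≈ b
  ≈-cancel {a} {b} c cop e with ≤-total a b
  ... | inj₁ le = ∣⇒≈ le (coprime-divisor (coprime-sym cop) (subst (n ∣_) (trans (sym (*-distribʳ-∸ c b a)) (*-comm (b ∸ a) c)) (≈⇒∣ (*-monoˡ-≤ c le) e)))
  ... | inj₂ le = sym (∣⇒≈ le (coprime-divisor (coprime-sym cop) (subst (n ∣_) (trans (sym (*-distribʳ-∸ c a b)) (*-comm (a ∸ b) c)) (≈⇒∣ (*-monoˡ-≤ c le) (sym e)))))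

  ≈-small : ∀ {a b} → a < n → b < n → a ≈ b → a ≡ b
  ≈-small la lb e = trans (sym (m<n⇒m%n≡m la)) (trans e (m<n⇒m%n≡m lb))

  coprime-≈ : ∀ {a b} → a ≈ b → Coprime a n → Coprime b n
  coprime-≈ {a} {b} e cop {d} (d∣b , d∣n) = cop (∣n∣m%n⇒∣m d∣n (subst (d ∣_) (sym e) (%-presˡ-∣ d∣b d∣n)) , d∣n)

  One : ℕ → ℕ → Set
  One a k = a ^ k ≈ 1

  one-+ : ∀ {a} j k → One a j → One a k → One a (j + k)
  one-+ {a} j k p q = trans (cong (_% n) (^-distribˡ-+-* a j k)) (≈-* {a ^ j} {1} {a ^ k} {1} p q)

  one-+⁻ : ∀ {a} j k → One a j → One a (j + k) → One a k
  one-+⁻ {a} j k p q = trans (sym (trans (≈-* {a ^ j} {1} {a ^ k} {a ^ k} p refl) (cong (_% n) (*-identityˡ (a ^ k))))) (trans (cong (_% n) (sym (^-distribˡ-+-* a j k))) q)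

  one-* : ∀ {a} j → One a j → ∀ c → One a (c * j)
  one-* j p zero = refl
  one-* j p (suc c) = one-+ j (c * j) p (one-* j p c)

coprime-^ : ∀ {a n} → Coprime a n → ∀ k → Coprime (a ^ k) n
coprime-^ c zero (d∣1 , _) = ∣1⇒≡1 d∣1
coprime-^ c (suc k) = coprime-sym (coprime-*ʳ (coprime-sym c) (coprime-sym (coprime-^ c k)))

product-⊆ : ∀ xs ys → Unique xs → (∀ {x} → x ∈ xs → x ∈ ys) → length xs ≡ length ys → product xs ≡ product ys
product-⊆ [] [] u sub e = refl
product-⊆ (x ∷ xs) ys (x∉ ∷ u) sub e = trans (cong (x *_) (product-⊆ xs (∈-remove ys m) u (λ q → ∈-remove-≢ ys m (sub (there q)) (All.lookup x∉ q)) (suc-injective (trans e (len ys m))))) (sym (prod ys m))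
  where
  m = sub (here refl)
  len : ∀ ys (m : x ∈ ys) → length ys ≡ suc (length (∈-remove ys m))
  len (_ ∷ ys) (here _) = refl
  len (_ ∷ ys) (there m) = cong suc (len ys m)
  prod : ∀ ys (m : x ∈ ys) → product ys ≡ x * product (∈-remove ys m)
  prod (_ ∷ ys) (here refl) = refl
  prod (y ∷ ys) (there m) = trans (cong (y *_) (prod ys m)) (sw y x _)
    where
    sw : ∀ a b c → a * (b * c) ≡ b * (a * c)
    sw = ℕSolver.solve-∀

∈-oneTo⁻ : ∀ {k n} → k ∈ oneTo n → 1 ≤ k × k ≤ n
∈-oneTo⁻ k∈ with ∈-map⁻ suc k∈
... | _ , i∈ , refl = s≤s z≤n , ∈-upTo⁻ i∈

∈-oneTo⁺ : ∀ {k n} → 1 ≤ k → k ≤ n → k ∈ oneTo n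
∈-oneTo⁺ {suc k} _ le = ∈-map⁺ suc (∈-upTo⁺ le)

units : ℕ → List ℕ
units n = filter (λ k → gcd k n ≟ 1) (oneTo n)

∈-units⁻ : ∀ {k n} → k ∈ units n → 1 ≤ k × k ≤ n × Coprime k n
∈-units⁻ {k} {n} k∈ = let (a , b) = ∈-filter⁻ (λ k → gcd k n ≟ 1) {xs = oneTo n} k∈ ; (c , d) = ∈-oneTo⁻ a in c , d , gcd→cop k n b

∈-units⁺ : ∀ {k n} → 1 ≤ k → k ≤ n → Coprime k n → k ∈ units n
∈-units⁺ {k} {n} 1≤k k≤n c = ∈-filter⁺ (λ k → gcd k n ≟ 1) (∈-oneTo⁺ 1≤k k≤n) (cop→gcd k n c)

units-unique : ∀ n → Unique (units n)
units-unique n = Uniqueₚ.filter⁺ (λ k → gcd k n ≟ 1) (Uniqueₚ.map⁺ suc-injective (Uniqueₚ.upTo⁺ n))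

φ≤ : ∀ n → φ n ≤ n
φ≤ n = ≤-trans (length-filter (λ k → gcd k n ≟ 1) (oneTo n)) (≤-reflexive (trans (length-map suc (upTo n)) (length-upTo n)))

euler : ∀ n {{_ : NonZero n}} a → Coprime a n → Mod.One n a (φ n)
-- For `n = 1` the only unit is represented by `1 = n`, which is not a residue below `n`; from
-- `n = 2` on every unit is below `n`, as `lt` asserts.
euler (suc zero) a c = trans (n%1≡0 (a ^ φ 1)) (sym (n%1≡0 1))
euler n@(suc (suc _)) a c = ≈-cancel {a ^ φ n} {1} (product (units n)) (coprime-product (units n) (λ k∈ → proj₂ (proj₂ (∈-units⁻ k∈)))) (begin
  (a ^ φ n * product (units n)) % n    ≡⟨ sym (pull (units n)) ⟩
  product (map f (units n)) % n        ≡⟨ cong (_% n) (product-⊆ (map f (units n)) (units n) umap sub (length-map f (units n))) ⟩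
  product (units n) % n                ≡⟨ cong (_% n) (sym (*-identityˡ (product (units n)))) ⟩
  (1 * product (units n)) % n ∎)
  where
  open Mod n
  open ≡-Reasoning
  f : ℕ → ℕ
  f u = (a * u) % n
  coprime-product : ∀ us → (∀ {k} → k ∈ us → Coprime k n) → Coprime (product us) n
  coprime-product [] h (d∣1 , _) = ∣1⇒≡1 d∣1
  coprime-product (u ∷ us) h = coprime-sym (coprime-*ʳ (coprime-sym (h (here refl))) (coprime-sym (coprime-product us (h ∘ there))))
  pull : ∀ us → product (map f us) % n ≡ (a ^ length us * product us) % n
  pull [] = refl
  pull (u ∷ us) = trans (≈-* {f u} {a * u} {product (map f us)} {a ^ length us * product us} (m%n%n≡m%n (a * u) n) (pull us)) (cong (_% n) (sw a u (a ^ length us) (product us)))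
    where
    sw : ∀ a u b c → a * u * (b * c) ≡ a * b * (u * c)
    sw = ℕSolver.solve-∀
  lt : ∀ {k} → k ∈ units n → k < n
  lt {k} k∈ = let (_ , k≤n , c) = ∈-units⁻ k∈ in ≤∧≢⇒< {k} {n} k≤n (λ e → case subst (λ z → Coprime z n) e c {n} (∣-refl , ∣-refl) of λ ())
  umap : Unique (map f (units n))
  umap = unique-map-on (units n) (units-unique n) (λ {x} {y} x∈ y∈ e → ≈-small {x} {y} (lt x∈) (lt y∈) (≈-cancel {x} {y} a c (trans (cong (_% n) (*-comm x a)) (trans e (cong (_% n) (*-comm a y))))))
  sub : ∀ {x} → x ∈ map f (units n) → x ∈ units n
  sub x∈ with ∈-map⁻ f x∈
  ... | u , u∈ , refl = ∈-units⁺ (n≢0⇒n>0 (λ e → case cop {n} (n ∣0 , ∣-refl) e of λ ())) (<⇒≤ (m%n<n (a * u) n)) cop′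
    where
    cop′ : Coprime (f u) n
    cop′ = coprime-≈ {a * u} {f u} (sym (m%n%n≡m%n (a * u) n)) (coprime-sym (coprime-*ʳ (coprime-sym c) (coprime-sym (proj₂ (proj₂ (∈-units⁻ u∈))))))
    cop : ∀ {d} → d ∣ 0 × d ∣ n → f u ≡ 0 → d ≡ 1
    cop (x , y) e = subst (λ z → Coprime z n) e cop′ (x , y)

FirstTrue : (ℕ → Bool) → List ℕ → ℕ → Set
FirstTrue t xs r = (∃[ ys ] ∃[ zs ] (xs ≡ ys ++ r ∷ zs × t r ≡ true × All (λ k → t k ≡ false) ys)) ⊎ All (λ k → t k ≡ false) xs

firstTrue : ∀ t (go : List ℕ → ℕ) → (∀ k ks → go (k ∷ ks) ≡ (if t k then k else go ks)) → ∀ xs → FirstTrue t xs (go xs)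
firstTrue t go e [] = inj₂ []
firstTrue t go e (x ∷ xs) rewrite e x xs with t x in eq
... | true = inj₁ ([] , xs , refl , eq , [])
... | false with firstTrue t go e xs
... | inj₂ h = inj₂ (eq ∷ h)
... | inj₁ (ys , zs , p , h , fs) = inj₁ (x ∷ ys , zs , cong (x ∷_) p , h , eq ∷ fs)

-- The search inside leastIn is a local function: the metavariable below is its only name.
mutual
  leastIn-go : ℕ → (ℕ → Bool) → List ℕ → ℕ
  leastIn-go bound t = _

  leastIn-first : ∀ bound t → FirstTrue t (oneTo bound) (leastIn bound t)
  leastIn-first bound t with oneTo bound
  ... | xs = firstTrue t (leastIn-go bound t) (λ _ _ → refl) xs

oneTo-sorted : ∀ n → AllPairs _<_ (oneTo n)
oneTo-sorted n = AllPairsₚ.map⁺ (AllPairsₚ.applyUpTo⁺₁ id n (λ i<j _ → s≤s i<j))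

sorted-before : ∀ ys {r zs k} → AllPairs _<_ (ys ++ r ∷ zs) → k ∈ ys ++ r ∷ zs → k < r → k ∈ ys
sorted-before [] (h ∷ _) (here refl) lt = ⊥-elim (<-irrefl refl lt)
sorted-before [] (h ∷ _) (there k∈) lt = ⊥-elim (<-asym lt (All.lookup h k∈))
sorted-before (y ∷ ys) (_ ∷ s) (here e) lt = here e
sorted-before (y ∷ ys) (_ ∷ s) (there k∈) lt = there (sorted-before ys s k∈ lt)

⌊⌋-true : ∀ {P : Set} (d : Dec P) → ⌊ d ⌋ ≡ true → P
⌊⌋-true (yes p) _ = p

⌊⌋-false : ∀ {P : Set} (d : Dec P) → ⌊ d ⌋ ≡ false → ¬ P
⌊⌋-false (no ¬p) _ = ¬p

module Ord (n : ℕ) {{nz : NonZero n}} where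
  open Mod n

  1≤n : 1 ≤ n
  1≤n = n≢0⇒n>0 (≢-nonZero⁻¹ n)

  ord-spec : ∀ a → Coprime a n → 1 ≤ ord n a × One a (ord n a) × (∀ k → 1 ≤ k → k < ord n a → ¬ One a k)
  ord-spec a c with leastIn-first n (λ k → ⌊ (a ^ k) % n ≟ 1 % n ⌋)
  ... | inj₂ none = ⊥-elim (⌊⌋-false ((a ^ φ n) % n ≟ 1 % n) (All.lookup none (∈-oneTo⁺ (φ-pos n 1≤n) (φ≤ n))) (euler n a c))
  ... | inj₁ (ys , zs , e , h , fs) = proj₁ bounds , ⌊⌋-true ((a ^ r) % n ≟ 1 % n) h ,
    λ k 1≤k k<r → ⌊⌋-false ((a ^ k) % n ≟ 1 % n) (All.lookup fs (sorted-before ys (subst (AllPairs _<_) e (oneTo-sorted n)) (subst (k ∈_) e (∈-oneTo⁺ 1≤k (≤-trans (<⇒≤ k<r) (proj₂ bounds)))) k<r))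
    where
    r = ord n a
    bounds : 1 ≤ r × r ≤ n
    bounds = ∈-oneTo⁻ (subst (r ∈_) (sym e) (∈-++⁺ʳ ys (here refl)))

  ord-∣ : ∀ a → Coprime a n → ∀ k → One a k → ord n a ∣ k
  ord-∣ a c k h = m%n≡0⇒n∣m k o {{nzo}} (r≡0 (k % o) refl)
    where
    o = ord n a
    spec = ord-spec a c
    instance
      nzo : NonZero o
      nzo = >-nonZero (proj₁ spec)
    hr : One a (k % o)
    hr = one-+⁻ {a} (k div o * o) (k % o) (one-* o (proj₁ (proj₂ spec)) (k div o)) (subst (One a) (trans (m≡m%n+[m/n]*n k o) (+-comm (k % o) (k div o * o))) h)
    r≡0 : ∀ r → r ≡ k % o → k % o ≡ 0
    r≡0 zero e = sym e
    r≡0 (suc r) e = ⊥-elim (proj₂ (proj₂ spec) (k % o) (subst (1 ≤_) e (s≤s z≤n)) (m%n<n k o) hr)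

^-distribʳ-*-nat : ∀ j a b → (a * b) ^ j ≡ a ^ j * b ^ j
^-distribʳ-*-nat zero a b = refl
^-distribʳ-*-nat (suc j) a b = trans (cong (a * b *_) (^-distribʳ-*-nat j a b)) (sw a b (a ^ j) (b ^ j))
  where
  sw : ∀ a b c d → a * b * (c * d) ≡ a * c * (b * d)
  sw = ℕSolver.solve-∀

maximum-≥ : ∀ (f : ℕ → ℕ) xs {x} → x ∈ xs → f x ≤ foldr _⊔_ 0 (map f xs)
maximum-≥ f (x ∷ xs) (here refl) = m≤m⊔n (f x) _
maximum-≥ f (y ∷ xs) (there x∈) = ≤-trans (maximum-≥ f xs x∈) (m≤n⊔m (f y) _)

maximum-attained : ∀ (f : ℕ → ℕ) xs → (∃[ x ] (x ∈ xs × foldr _⊔_ 0 (map f xs) ≡ f x)) ⊎ foldr _⊔_ 0 (map f xs) ≡ 0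
maximum-attained f [] = inj₂ refl
maximum-attained f (x ∷ xs) with ≤-total (f x) (foldr _⊔_ 0 (map f xs))
... | inj₂ ge = inj₁ (x , here refl , m≥n⇒m⊔n≡m ge)
... | inj₁ le with maximum-attained f xs
... | inj₁ (y , y∈ , e) = inj₁ (y , there y∈ , trans (m≤n⇒m⊔n≡n le) e)
... | inj₂ e = inj₂ (trans (m≤n⇒m⊔n≡n le) e)

carmichael-def : ∀ n {{nz : NonZero n}} → carmichael n ≡ foldr _⊔_ 0 (map (ord n) (units n))
carmichael-def (suc n) = refl

-- The primes of `M` are stripped one after another until one occurs in `M` to a higher power than
-- in `B`. If its power in `M` is no higher, the rest `M′` still fails to divide `B`.
non-divisor : ∀ fuel M B → 1 ≤ M → M ≤ fuel → 1 ≤ B → ¬ M ∣ B →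
  ∃[ p ] ∃[ f ] ∃[ t ] ∃[ c ] (Prime p × M ≡ t * p ^ suc f × B ≡ p ^ f * c × ¬ p ∣ c)
non-divisor zero M B 1≤M le = ⊥-elim (<-irrefl refl (≤-trans 1≤M le))
non-divisor (suc fuel) (suc zero) B 1≤M le 1≤B nd = ⊥-elim (nd (1∣ B))
non-divisor (suc fuel) M@(suc (suc _)) B 1≤M le 1≤B nd with prime-divisor M (s≤s (s≤s z≤n))
... | p , pp , p∣M with split-power p (prime⇒≥2 pp) M M 1≤M ≤-refl | split-power p (prime⇒≥2 pp) B B 1≤B ≤-refl
... | v , M′ , M≡ , ndM | w , c , B≡ , ndB with suc w ≤? v
... | yes le′ = p , w , M′ * p ^ (v ∸ suc w) , c , pp , trans M≡ (trans (cong (λ z → p ^ z * M′) (sym (m∸n+n≡m le′))) (trans (cong (_* M′) (^-distribˡ-+-* p (v ∸ suc w) (suc w))) (sw (p ^ (v ∸ suc w)) (p ^ suc w) M′))) , B≡ , ndB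
  where
  sw : ∀ a b c → a * b * c ≡ c * a * b
  sw = ℕSolver.solve-∀
... | no ¬le = let (p′ , f , t , c′ , pp′ , e₁ , e₂ , nd′) = non-divisor fuel M′ B 1≤M′ (s≤s⁻¹ (≤-trans M′<M le)) 1≤B nd₁ in
    p′ , f , p ^ v * t , c′ , pp′ , trans M≡ (trans (cong (p ^ v *_) e₁) (sym (*-assoc (p ^ v) t (p′ ^ suc f)))) , e₂ , nd′
  where
  v≤w : v ≤ w
  v≤w = s≤s⁻¹ (≰⇒> ¬le)
  1≤M′ : 1 ≤ M′
  1≤M′ = go M′ (subst (1 ≤_) M≡ 1≤M)
    where
    go : ∀ x → 1 ≤ p ^ v * x → 1 ≤ x
    go zero h = ⊥-elim (<-irrefl refl (subst (1 ≤_) (*-zeroʳ (p ^ v)) h))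
    go (suc x) _ = s≤s z≤n
  pos-v : ∀ v → M ≡ p ^ v * M′ → 2 ≤ p ^ v
  pos-v zero e = ⊥-elim (ndM (subst (p ∣_) (trans e (*-identityˡ M′)) p∣M))
  pos-v (suc v) _ = *-mono-≤ (prime⇒≥2 pp) (m^n>0 p {{prime⇒nonZero pp}} v)
  M′<M : M′ < M
  M′<M = subst (M′ <_) (trans (*-comm M′ (p ^ v)) (sym M≡)) (m<m*n M′ (p ^ v) {{>-nonZero 1≤M′}} (pos-v v M≡))
  copM′ : ∀ j → Coprime (p ^ j) M′
  copM′ = coprime-^ (coprime-sym (prime∤⇒coprime pp ndM))
  nd₁ : ¬ M′ ∣ B
  nd₁ M′∣B = nd (subst₂ _∣_ (sym M≡) (sym B≡) (subst (λ z → p ^ v * M′ ∣ z * c) (trans (sym (^-distribˡ-+-* p v (w ∸ v))) (cong (p ^_) (m+[n∸m]≡n v≤w)))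
    (subst (p ^ v * M′ ∣_) (sym (*-assoc (p ^ v) (p ^ (w ∸ v)) c)) (*-monoʳ-∣ (p ^ v) (∣n⇒∣m*n (p ^ (w ∸ v)) (coprime-divisor (coprime-sym (copM′ w)) (subst (M′ ∣_) B≡ M′∣B)))))))

module Carmichael (n : ℕ) {{nz : NonZero n}} where
  open Mod n
  open Ord n

  representative : ∀ a → Coprime a n → ∃[ b ] (b ∈ units n × b ≈ a)
  representative a c with a % n in eq
  ... | suc r = suc r , ∈-units⁺ (s≤s z≤n) (<⇒≤ lt) (coprime-≈ {a} {suc r} (trans eq (sym (m<n⇒m%n≡m lt))) c) , m<n⇒m%n≡m lt
    where
    lt : suc r < n
    lt = subst (_< n) eq (m%n<n a n)
  -- Units are represented in `1, …, n`, so the remainder `0` is represented by `n` itself.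
  ... | zero = n , ∈-units⁺ 1≤n ≤-refl (coprime-≈ {a} {n} (trans eq (sym (n%n≡0 n))) c) , n%n≡0 n

  λ-attained : ∃[ g ] (Coprime g n × carmichael n ≡ ord n g)
  λ-attained with maximum-attained (ord n) (units n)
  ... | inj₁ (g , g∈ , e) = g , proj₂ (proj₂ (∈-units⁻ g∈)) , trans (carmichael-def n) e
  ... | inj₂ e = ⊥-elim (<-irrefl refl (≤-trans (proj₁ (ord-spec 1 c1)) (≤-trans (maximum-≥ (ord n) (units n) (∈-units⁺ ≤-refl 1≤n c1)) (≤-reflexive e))))
    where
    c1 : Coprime 1 n
    c1 (d∣1 , _) = ∣1⇒≡1 d∣1

  λ-pos : 1 ≤ carmichael n
  λ-pos = let (g , c , e) = λ-attained in subst (1 ≤_) (sym e) (proj₁ (ord-spec g c))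

  λ∣φ : carmichael n ∣ φ n
  λ∣φ = let (g , c , e) = λ-attained in subst (_∣ φ n) (sym e) (ord-∣ g c (φ n) (euler n g c))

  λ-max : ∀ M b → Coprime b n → (∀ k → One b k → M ∣ k) → M ≤ carmichael n
  λ-max M b c h = let (b′ , b′∈ , e) = representative b c ; cb = proj₂ (proj₂ (∈-units⁻ b′∈)) ; (1≤o , o , _) = ord-spec b′ cb in
    ≤-trans (∣⇒≤ {{>-nonZero 1≤o}} (h (ord n b′) (trans (sym (≈-^ {b′} {b} e (ord n b′))) o)))
      (subst (ord n b′ ≤_) (sym (carmichael-def n)) (maximum-≥ (ord n) (units n) b′∈))

  -- If ord a ∤ λ, then combining suitable powers of a and of an element of order λ gives an order exceeding λ.
  ord-∣λ : ∀ a → Coprime a n → ord n a ∣ carmichael n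
  ord-∣λ a ca with ord n a ∣? carmichael n
  ... | yes d = d
  ... | no nd with non-divisor (ord n a) (ord n a) (carmichael n) (proj₁ (ord-spec a ca)) ≤-refl λ-pos nd
  ... | p , f , t , c , pp , M≡ , λ≡ , ndc = ⊥-elim (<-irrefl refl (≤-trans big (λ-max (p ^ suc f * c) b copb both)))
    where
    1≤M = proj₁ (ord-spec a ca)
    g = proj₁ λ-attained
    cg = proj₁ (proj₂ λ-attained)
    λ≡ord = proj₂ (proj₂ λ-attained)
    P = p ^ suc f
    1≤pf : 1 ≤ p ^ f
    1≤pf = m^n>0 p {{prime⇒nonZero pp}} f
    1≤t : 1 ≤ t
    1≤t = go t (subst (1 ≤_) M≡ 1≤M)
      where
      go : ∀ x → 1 ≤ x * P → 1 ≤ x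
      go (suc x) _ = s≤s z≤n
    1≤c : 1 ≤ c
    1≤c = go c (subst (1 ≤_) λ≡ λ-pos)
      where
      go : ∀ x → 1 ≤ p ^ f * x → 1 ≤ x
      go zero h = ⊥-elim (<-irrefl refl (subst (1 ≤_) (*-zeroʳ (p ^ f)) h))
      go (suc x) _ = s≤s z≤n
    -- The exponents killing `a ^ t` are multiples of `p ^ (f + 1)`, those killing `g ^ (p ^ f)` are
    -- multiples of `c`. These numbers are coprime, so the order of `b` is a multiple of
    -- `p ^ (f + 1) * c = p λ(n)`.
    b = a ^ t * g ^ (p ^ f)
    copb : Coprime b n
    copb = coprime-sym (coprime-*ʳ (coprime-sym (coprime-^ ca t)) (coprime-sym (coprime-^ cg (p ^ f))))
    big : carmichael n < P * c
    big = subst (_< P * c) (sym λ≡) (*-monoˡ-< c {{>-nonZero 1≤c}} (subst (p ^ f <_) (*-comm (p ^ f) p) (m<m*n (p ^ f) p {{>-nonZero 1≤pf}} (prime⇒≥2 pp))))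
    copPc : Coprime P c
    copPc = coprime-^ (coprime-sym (prime∤⇒coprime pp ndc)) (suc f)
    a-part : ∀ k → One (a ^ t) k → P ∣ k
    a-part k o = *-cancelˡ-∣ t {{>-nonZero 1≤t}} (subst (_∣ t * k) M≡ (ord-∣ a ca (t * k) (trans (cong (_% n) (sym (^-*-assoc a t k))) o)))
    g-part : ∀ k → One (g ^ (p ^ f)) k → c ∣ k
    g-part k o = *-cancelˡ-∣ (p ^ f) {{>-nonZero 1≤pf}} (subst (_∣ p ^ f * k) (trans (sym λ≡ord) λ≡) (ord-∣ g cg (p ^ f * k) (trans (cong (_% n) (sym (^-*-assoc g (p ^ f) k))) o)))
    g-one : ∀ k → One (g ^ (p ^ f)) (k * c)
    g-one k = trans (cong (_% n) (^-*-assoc g (p ^ f) (k * c))) (subst (One g) (trans (cong (k *_) (trans (sym λ≡ord) λ≡)) (sw k (p ^ f) c)) (one-* (ord n g) (proj₁ (proj₂ (ord-spec g cg))) k))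
      where
      sw : ∀ a b c → a * (b * c) ≡ b * (a * c)
      sw = ℕSolver.solve-∀
    a-one : ∀ k → One (a ^ t) (k * P)
    a-one k = trans (cong (_% n) (^-*-assoc a t (k * P))) (subst (One a) (trans (cong (k *_) M≡) (sw k t P)) (one-* (ord n a) (proj₁ (proj₂ (ord-spec a ca))) k))
      where
      sw : ∀ a b c → a * (b * c) ≡ b * (a * c)
      sw = ℕSolver.solve-∀
    both : ∀ k → One b k → P * c ∣ k
    both k o = coprime-product-∣ copPc (coprime-divisor copPc (subst (P ∣_) (*-comm k c) P∣kc)) c∣k
      where
      pw : ∀ j → (a ^ t * g ^ (p ^ f)) ^ j ≡ (a ^ t) ^ j * (g ^ (p ^ f)) ^ j
      pw j = ^-distribʳ-*-nat j (a ^ t) (g ^ (p ^ f))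
      -- Raising to the power `k * c` kills the second factor of `b` and leaves a statement about
      -- `a ^ t` alone; `c∣k` is obtained symmetrically.
      P∣kc : P ∣ k * c
      P∣kc = a-part (k * c) (trans (sym (trans (≈-* {(a ^ t) ^ (k * c)} {(a ^ t) ^ (k * c)} {(g ^ (p ^ f)) ^ (k * c)} {1} refl (g-one k)) (cong (_% n) (*-identityʳ _))))
        (trans (cong (_% n) (sym (pw (k * c)))) (subst (One b) (*-comm c k) (one-* {b} k o c))))
      c∣k : c ∣ k
      c∣k = coprime-divisor (coprime-sym copPc) (subst (c ∣_) (*-comm k P) (g-part (k * P) (trans (sym (trans (≈-* {(a ^ t) ^ (k * P)} {1} {(g ^ (p ^ f)) ^ (k * P)} {(g ^ (p ^ f)) ^ (k * P)} (a-one k) refl) (cong (_% n) (*-identityˡ _))))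
        (trans (cong (_% n) (sym (pw (k * P)))) (subst (One b) (*-comm P k) (one-* {b} k o P))))))
      coprime-product-∣ : ∀ {x y} → Coprime x y → x ∣ k → y ∣ k → x * y ∣ k
      coprime-product-∣ {x} {y} cop (divides u e) y∣ = subst (x * y ∣_) (trans (*-comm x u) (sym e)) (*-monoʳ-∣ x (coprime-divisor (coprime-sym cop) (subst (y ∣_) (trans e (*-comm u x)) y∣)))

  exponent-∣λ : ∀ M a → Coprime a n → (∀ k → One a k → M ∣ k) → M ∣ carmichael n
  exponent-∣λ M a ca h = ∣-trans (h (ord n a) (proj₁ (proj₂ (ord-spec a ca)))) (ord-∣λ a ca)

-- Divisors of λ(uv) obtained from elements modulo u.

≈-+ : ∀ n {{_ : NonZero n}} a b c d → a % n ≡ b % n → c % n ≡ d % n → (a + c) % n ≡ (b + d) % n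
≈-+ n a b c d p q = trans (%-distribˡ-+ a c n) (trans (cong₂ (λ x y → (x + y) % n) p q) (sym (%-distribˡ-+ b d n)))

inverse-mod : ∀ u {{_ : NonZero u}} v → Coprime v u → ∃[ w ] ((v * w) % u ≡ 1 % u)
inverse-mod u v c = go (φ u) (φ-pos u (n≢0⇒n>0 (≢-nonZero⁻¹ u))) (euler u v c)
  where
  go : ∀ F → 1 ≤ F → (v ^ F) % u ≡ 1 % u → ∃[ w ] ((v * w) % u ≡ 1 % u)
  go (suc F) _ e = v ^ F , e

CRT-lift : ∀ u v {{_ : NonZero u}} → Coprime u v → ∀ g → 1 ≤ g → Coprime g u → ∃[ a ] (1 ≤ a × a % u ≡ g % u × Coprime a (u * v))
CRT-lift u v cuv (suc g) _ cg with inverse-mod u v (coprime-sym cuv)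
... | w , vw = a , s≤s z≤n , a≈g , coprime-*ʳ (Mod.coprime-≈ u {suc g} {a} (sym a≈g) cg) cav
  where
  -- The given residue is `suc g`, so the lift congruent to it modulo `u` and to `1` modulo `v`
  -- needs no subtraction; `v w ≡ 1` modulo `u`.
  a = 1 + v * (w * g)
  cav : Coprime a v
  cav {d} (d∣a , d∣v) = ∣1⇒≡1 (∣m+n∣m⇒∣n {d} {v * (w * g)} {1} (subst (d ∣_) (+-comm 1 (v * (w * g))) d∣a) (∣m⇒∣m*n (w * g) d∣v))
  a≈g : a % u ≡ suc g % u
  a≈g = ≈-+ u 1 1 (v * (w * g)) g refl (trans (cong (_% u) (sym (*-assoc v w g))) (trans (Mod.≈-* u {v * w} {1} {g} {g} vw refl) (cong (_% u) (*-identityˡ g))))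

one-∣ : ∀ n u {{_ : NonZero n}} {{_ : NonZero u}} → u ∣ n → ∀ a k → 1 ≤ a → Mod.One n a k → Mod.One u a k
one-∣ n u u∣n a k 1≤a o = sym (Mod.∣⇒≈ u {1} {a ^ k} 1≤ak (∣-trans u∣n (Mod.≈⇒∣ n {1} {a ^ k} 1≤ak (sym o))))
  where
  1≤ak : 1 ≤ a ^ k
  1≤ak = m^n>0 a {{>-nonZero 1≤a}} k

module _ (u v : ℕ) {{nu : NonZero u}} {{nuv : NonZero (u * v)}} (cuv : Coprime u v) where

  lift-∣λ : ∀ M g → 1 ≤ g → Coprime g u → (∀ k → Mod.One u g k → M ∣ k) → M ∣ carmichael (u * v)
  lift-∣λ M g 1≤g cg h = let (a , 1≤a , e , ca) = CRT-lift u v cuv g 1≤g cg in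
    Carmichael.exponent-∣λ (u * v) M a ca (λ k o → h k (trans (sym (Mod.≈-^ u {a} {g} e k)) (one-∣ (u * v) u (m∣m*n v) a k 1≤a o)))

-- Modulo `M²` one has `(1 + M) ^ k ≡ 1 + k M`, so `1 + M` has order divisible by `M`. This is why
-- `n` contains the square of the base.
square-∣λ : ∀ M v {{_ : NonZero (M * M)}} {{_ : NonZero (M * M * v)}} → Coprime (M * M) v → M ∣ carmichael (M * M * v)
square-∣λ zero v {{()}}
square-∣λ M@(suc _) v cop = lift-∣λ (M * M) v cop M (suc M) (s≤s z≤n) cop-sM order
  where
  cop-sM : Coprime (suc M) (M * M)
  cop-sM = coprime-*ʳ c c
    where
    c : Coprime (suc M) M
    c {d} (d∣sM , d∣M) = ∣1⇒≡1 (∣m+n∣m⇒∣n {d} {M} {1} (subst (d ∣_) (+-comm 1 M) d∣sM) d∣M)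
  expand : ∀ k → ∃[ c ] (suc M ^ k ≡ 1 + (k * M + c * (M * M)))
  expand zero = 0 , refl
  expand (suc k) = let (c , e) = expand k in k + c + c * M , trans (cong (suc M *_) e) (sw M k c)
    where
    sw : ∀ M k c → suc M * (1 + (k * M + c * (M * M))) ≡ 1 + (suc k * M + (k + c + c * M) * (M * M))
    sw = ℕSolver.solve-∀
  order : ∀ k → Mod.One (M * M) (suc M) k → M ∣ k
  order k o = let (c , e) = expand k in
    *-cancelʳ-∣ M (∣m+n∣n⇒∣m (subst (M * M ∣_) (cong (_∸ 1) e) (Mod.≈⇒∣ (M * M) {1} {suc M ^ k} (m^n>0 (suc M) k) (sym o))) (n∣m*n c))
    where
    ∣m+n∣n⇒∣m : ∀ {d a b} → d ∣ a + b → d ∣ b → d ∣ a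
    ∣m+n∣n⇒∣m {d} {a} {b} x y = ∣m+n∣m⇒∣n (subst (d ∣_) (+-comm a b) x) y

-- Monic polynomials: the list holds the coefficients below the leading `1`, constant term first. So
-- the degree is the length, and no polynomial vanishes identically modulo a prime.
ev : List ℤ → ℤ → ℤ
ev [] x = + 1
ev (c ∷ cs) x = x ℤ.* ev cs x ℤ.+ c

comb : ℤ → List ℤ → List ℤ → List ℤ
comb a [] hs = []
comb a (c ∷ cs) [] = (c ℤ.+ a) ∷ cs
comb a (c ∷ cs) (h ∷ hs) = (c ℤ.+ a ℤ.* h) ∷ comb a cs hs

ev-comb : ∀ a cs hs x → length cs ≡ suc (length hs) → ev (comb a cs hs) x ≡ ev cs x ℤ.+ a ℤ.* ev hs x
ev-comb a (c ∷ cs) [] x e = sw x (ev cs x) c a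
  where
  sw : ∀ x v c a → x ℤ.* v ℤ.+ (c ℤ.+ a) ≡ x ℤ.* v ℤ.+ c ℤ.+ a ℤ.* + 1
  sw = ℤSolver.solve-∀
ev-comb a (c ∷ cs) (h ∷ hs) x e = trans (cong (λ z → x ℤ.* z ℤ.+ (c ℤ.+ a ℤ.* h)) (ev-comb a cs hs x (suc-injective e))) (sw x (ev cs x) (ev hs x) c a h)
  where
  sw : ∀ x v w c a h → x ℤ.* (v ℤ.+ a ℤ.* w) ℤ.+ (c ℤ.+ a ℤ.* h) ≡ x ℤ.* v ℤ.+ c ℤ.+ a ℤ.* (x ℤ.* w ℤ.+ h)
  sw = ℤSolver.solve-∀

comb-length : ∀ a cs hs → length (comb a cs hs) ≡ length cs
comb-length a [] hs = refl
comb-length a (c ∷ cs) [] = refl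
comb-length a (c ∷ cs) (h ∷ hs) = cong suc (comb-length a cs hs)

-- Synthetic division by `X - a`. The quotient is again monic, so its leading coefficient stays
-- implicit and the list gets shorter by one.
quo : ℤ → List ℤ → List ℤ
quo a [] = []
quo a (c ∷ []) = []
quo a (c ∷ cs@(_ ∷ _)) = comb a cs (quo a cs)

quo-length : ∀ a c cs → length (quo a (c ∷ cs)) ≡ length cs
quo-length a c [] = refl
quo-length a c cs@(_ ∷ _) = comb-length a cs (quo a cs)

ev-quo : ∀ a c cs x → ev (c ∷ cs) x ℤ.- ev (c ∷ cs) a ≡ (x ℤ.- a) ℤ.* ev (quo a (c ∷ cs)) x
ev-quo a c [] x = sw x a c
  where
  sw : ∀ x a c → (x ℤ.* + 1 ℤ.+ c) ℤ.- (a ℤ.* + 1 ℤ.+ c) ≡ (x ℤ.- a) ℤ.* + 1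
  sw = ℤSolver.solve-∀
ev-quo a c cs@(d ∷ ds) x = trans (sw₁ x a c (ev cs x) (ev cs a)) (trans (cong (λ z → (x ℤ.- a) ℤ.* ev cs x ℤ.+ a ℤ.* z) (ev-quo a d ds x))
  (trans (sw₂ x a (ev cs x) (ev (quo a cs) x)) (cong ((x ℤ.- a) ℤ.*_) (sym (ev-comb a cs (quo a cs) x (cong suc (sym (quo-length a d ds))))))))
  where
  sw₁ : ∀ x a c v w → (x ℤ.* v ℤ.+ c) ℤ.- (a ℤ.* w ℤ.+ c) ≡ (x ℤ.- a) ℤ.* v ℤ.+ a ℤ.* (v ℤ.- w)
  sw₁ = ℤSolver.solve-∀
  sw₂ : ∀ x a v h → (x ℤ.- a) ℤ.* v ℤ.+ a ℤ.* ((x ℤ.- a) ℤ.* h) ≡ (x ℤ.- a) ℤ.* (v ℤ.+ a ℤ.* h)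
  sw₂ = ℤSolver.solve-∀

roots-≤-degree : ∀ q → Prime q → ∀ d cs → length cs ≡ d → ∀ xs → Unique xs → All (_< q) xs → All (λ x → + q ℤ∣.∣ ev cs (+ x)) xs → length xs ≤ d
roots-≤-degree q pq d cs len [] _ _ _ = z≤n
roots-≤-degree q pq d [] len (x ∷ xs) _ _ (r ∷ _) = ⊥-elim (<-irrefl (sym (∣1⇒≡1 (ℤ∣.∣⇒∣ᵤ r))) (prime⇒≥2 pq))
roots-≤-degree q pq (suc d) (c ∷ cs) len (a ∷ xs) (a∉ ∷ u) (a<q ∷ xs<q) (ra ∷ rs) =
  s≤s (roots-≤-degree q pq d (quo (+ a) (c ∷ cs)) (trans (quo-length (+ a) c cs) (suc-injective len)) xs u xs<q (All.tabulate root))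
  where
  root : ∀ {x} → x ∈ xs → + q ℤ∣.∣ ev (quo (+ a) (c ∷ cs)) (+ x)
  root {x} x∈ with euclidsLemma ℤ.∣ + x ℤ.- + a ∣ ℤ.∣ ev (quo (+ a) (c ∷ cs)) (+ x) ∣ pq
     (subst (q ∣_) (ℤₚ.abs-* (+ x ℤ.- + a) _) (ℤ∣.∣⇒∣ᵤ (subst (+ q ℤ∣.∣_) (ev-quo (+ a) c cs (+ x)) (ℤ∣.∣m∣n⇒∣m-n (All.lookup rs x∈) ra))))
  ... | inj₂ h = ℤ∣.∣ᵤ⇒∣ h
  ... | inj₁ h = ⊥-elim (separate x a (All.lookup xs<q x∈) a<q (λ e → All.lookup a∉ x∈ (sym e)) (subst (λ z → q ∣ ℤ.∣ z ∣) (ℤₚ.[+m]-[+n]≡m⊖n x a) h))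
    where
    small : ∀ k → q ∣ k → k < q → k ≡ 0
    small zero _ _ = refl
    small (suc k) d lt = ⊥-elim (<-irrefl refl (≤-trans lt (∣⇒≤ d)))
    separate : ∀ x a → x < q → a < q → x ≢ a → ¬ (q ∣ ℤ.∣ x ℤ.⊖ a ∣)
    separate x a x<q a<q ne d with ≤-total x a
    ... | inj₁ le = ne (≤-antisym le (m∸n≡0⇒m≤n (small (a ∸ x) (subst (q ∣_) (ℤₚ.∣⊖∣-≤ le) d) (≤-trans (s≤s (m∸n≤m a x)) a<q))))
    ... | inj₂ le = ne (≤-antisym (m∸n≡0⇒m≤n (small (x ∸ a) (subst (q ∣_) (cong ℤ.∣_∣ (ℤₚ.⊖-≥ le)) d) (≤-trans (s≤s (m∸n≤m x a)) x<q))) le)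

zeros : ℕ → List ℤ
zeros zero = []
zeros (suc m) = + 0 ∷ zeros m

zeros-length : ∀ m → length (zeros m) ≡ m
zeros-length zero = refl
zeros-length (suc m) = cong suc (zeros-length m)

ev-zeros : ∀ m x → ev (zeros m) (+ x) ≡ + (x ^ m)
ev-zeros zero x = refl
ev-zeros (suc m) x = trans (ℤₚ.+-identityʳ _) (trans (cong (+ x ℤ.*_) (ev-zeros m x)) (sym (ℤₚ.pos-* x (x ^ m))))

non-root : ∀ q {{_ : NonZero q}} → Prime q → ∀ e → suc e < pred q → ∃[ g ] (1 ≤ g × Coprime g q × ¬ Mod.One q g (suc e))
non-root q@(suc q-1) pq e lt with any? (λ g → ¬? ((g ^ suc e) % q ≟ 1 % q)) (map suc (downFrom q-1))
... | yes some = let (g , g∈ , h) = find some ; (i , i∈ , g≡) = ∈-map⁻ suc g∈ in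
  g , subst (1 ≤_) (sym g≡) (s≤s z≤n) , subst (λ z → Coprime z q) (sym g≡) (prime∤⇒coprime pq (λ d → <-irrefl refl (≤-trans (s≤s (∈-downFrom⁻ i∈)) (∣⇒≤ d)))) , h
... | no none = ⊥-elim (<-irrefl refl (≤-trans lt (≤-trans (≤-reflexive (sym (trans (length-map suc (downFrom q-1)) (length-downFrom q-1))))
    -- The coefficients are those of `X ^ (e + 1) - 1`. If every nonzero residue were a root, there
    -- would be `q - 1 > e + 1` roots.
    (roots-≤-degree q pq (suc e) (-[1+ 0 ] ∷ zeros e) (cong suc (zeros-length e)) (map suc (downFrom q-1)) (Uniqueₚ.map⁺ suc-injective (Uniqueₚ.downFrom⁺ q-1))
      (Allₚ.map⁺ (All.tabulate (λ i∈ → s≤s (∈-downFrom⁻ i∈)))) (All.tabulate root)))))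
  where
  root : ∀ {x} → x ∈ map suc (downFrom q-1) → + q ℤ∣.∣ ev (-[1+ 0 ] ∷ zeros e) (+ x)
  root {x} x∈ with (x ^ suc e) % q ≟ 1 % q
  ... | no h = ⊥-elim (none (lose x∈ h))
  ... | yes h = ℤ∣.∣ᵤ⇒∣ (subst (λ z → q ∣ ℤ.∣ z ∣) (sym eq) (Mod.≈⇒∣ q {1} {x ^ suc e} 1≤ (sym h)))
    where
    1≤ : 1 ≤ x ^ suc e
    1≤ = let (i , _ , e′) = ∈-map⁻ suc x∈ in m^n>0 x {{>-nonZero (subst (1 ≤_) (sym e′) (s≤s z≤n))}} (suc e)
    eq : ev (-[1+ 0 ] ∷ zeros e) (+ x) ≡ + (x ^ suc e ∸ 1)
    eq = trans (cong (λ z → + x ℤ.* z ℤ.+ -[1+ 0 ]) (ev-zeros e x)) (trans (cong (ℤ._+ -[1+ 0 ]) (sym (ℤₚ.pos-* x (x ^ e)))) (ℤₚ.⊖-≥ 1≤))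

prime-∣-complement : ∀ {r o e} → Prime r → o ∣ r * e → ¬ o ∣ e → r ∣ o
prime-∣-complement {r} {o} pr d nd with r ∣? o
... | yes h = h
... | no h = ⊥-elim (nd (coprime-divisor (prime∤⇒coprime pr h) d))

module _ (q : ℕ) {{nq : NonZero q}} (pq : Prime q) where

  -- Take `g` with `g ^ ((q - 1) / r) ≢ 1`. Its order divides `q - 1` but not `(q - 1) / r`, so the
  -- prime `r` divides it.
  element-of-order : ∀ {r} → Prime r → r ∣ pred q → ∃[ g ] (1 ≤ g × Coprime g q × (∀ k → Mod.One q g k → r ∣ k))
  element-of-order {r} pr (divides zero e) = ⊥-elim (<-irrefl (sym e) (pred-mono-≤ (prime⇒≥2 pq)))
  element-of-order {r} pr (divides (suc e) q-1≡) with non-root q pq e (subst (suc e <_) (sym q-1≡) (m<m*n (suc e) r (prime⇒≥2 pr)))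
  ... | g , 1≤g , cg , ¬one = g , 1≤g , cg , λ k o → ∣-trans r∣o (Ord.ord-∣ q g cg k o)
    where
    o∣ : ord q g ∣ r * suc e
    o∣ = subst (ord q g ∣_) (trans (φ-prime q pq) (trans q-1≡ (*-comm (suc e) r))) (Ord.ord-∣ q g cg (φ q) (euler q g cg))
    o∤ : ¬ ord q g ∣ suc e
    o∤ (divides c se≡) = ¬one (subst (Mod.One q g) (sym se≡) (Mod.one-* q {g} (ord q g) (proj₁ (proj₂ (Ord.ord-spec q g cg))) c))
    r∣o : r ∣ ord q g
    r∣o = prime-∣-complement pr o∣ o∤

prime-∣λ : ∀ q v {{_ : NonZero (q * v)}} → Prime q → Coprime q v → ∀ {r} → Prime r → r ∣ pred q → r ∣ carmichael (q * v)
prime-∣λ q v {{nqv}} pq cop {r} pr r∣ = let (g , 1≤g , cg , h) = element-of-order q {{prime⇒nonZero pq}} pq pr r∣ in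
  lift-∣λ q v {{prime⇒nonZero pq}} {{nqv}} cop r g 1≤g cg h

-- Dense integers and their extension by further primes.

fac : ℕ → ℕ
fac zero = 1
fac (suc n) = suc n * fac n

1≤fac : ∀ n → 1 ≤ fac n
1≤fac zero = ≤-refl
1≤fac (suc n) = *-mono-≤ {1} {suc n} (s≤s z≤n) (1≤fac n)

∣fac : ∀ {d} n → 1 ≤ d → d ≤ n → d ∣ fac n
∣fac {suc d} zero _ ()
∣fac {d} (suc n) 1≤d le with d ≟ suc n
... | yes refl = m∣m*n (fac n)
... | no ne = ∣n⇒∣m*n (suc n) (∣fac n 1≤d (s≤s⁻¹ (≤∧≢⇒< le ne)))

∈⇒∣product : ∀ {x} xs → x ∈ xs → x ∣ product xs
∈⇒∣product (x ∷ xs) (here refl) = m∣m*n (product xs)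
∈⇒∣product (y ∷ xs) (there x∈) = ∣n⇒∣m*n y (∈⇒∣product xs x∈)

least-prime : ∀ c → 2 ≤ c → ∃[ P ] (Prime P × P ∣ c × (∀ {q} → Prime q → q ∣ c → P ≤ q))
least-prime c@(suc _) 2≤c with factorise c
... | record { factors = [] ; isFactorisation = e ; factorsPrime = _ } = ⊥-elim (<-irrefl (sym e) 2≤c)
... | record { factors = p ∷ ps ; isFactorisation = e ; factorsPrime = pp ∷ pps } =
  let (P , P∈ , min) = least p ps in P , All.lookup (pp ∷ pps) P∈ , subst (P ∣_) (sym e) (∈⇒∣product (p ∷ ps) P∈) ,
    λ {q} pq q∣c → min q (factorisationHasAllPrimeFactors pq (subst (q ∣_) e q∣c) (pp ∷ pps))
  where
  least : ∀ x xs → ∃[ m ] (m ∈ x ∷ xs × (∀ y → y ∈ x ∷ xs → m ≤ y))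
  least x [] = x , here refl , λ { y (here refl) → ≤-refl }
  least x (y ∷ ys) with least y ys
  ... | m , m∈ , min with ≤-total x m
  ... | inj₁ le = x , here refl , λ { z (here refl) → ≤-refl ; z (there z∈) → ≤-trans le (min z z∈) }
  ... | inj₂ ge = m , there m∈ , λ { z (here refl) → ge ; z (there z∈) → min z z∈ }

module Density (h : ℕ) where

  Hit : ℕ → ℕ → ℕ → Set
  Hit m s t = ∃[ d ] (d ∣ m × s < d * t × h * (d * t) ≤ suc h * s)

  -- y = s/t ranges over the rationals of [h , m/(h+1)).
  Dense : ℕ → Set
  Dense m = ∀ s t → 1 ≤ t → h * t ≤ s → suc h * s < m * t → Hit m s t

  DenseBelow : ℕ → ℕ → Set
  DenseBelow m U = ∀ s t → 1 ≤ t → h * t ≤ s → s < U * t → Hit m s t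

  -- The mirror image of `Hit` under `d = m / e` and `y ↦ m / y`: here `e` lies below `y = s / t` by
  -- a factor of at most `1 + 1/h`.
  CoHit : ℕ → ℕ → ℕ → Set
  CoHit m s t = ∃[ e ] (e ∣ m × e * t < s × h * s ≤ suc h * (e * t) × 1 ≤ e)

  CoDense : ℕ → ℕ → Set
  CoDense m U = ∀ s t → 1 ≤ t → suc h * t < s → s ≤ U * t → CoHit m s t

  private
    sw₁ : ∀ a b c → a * (b * c) ≡ b * a * c
    sw₁ = ℕSolver.solve-∀
    sw₂ : ∀ a b c → a * b * c ≡ b * (a * c)
    sw₂ = ℕSolver.solve-∀

  Hit-* : ∀ {m s} p t → Hit m s (p * t) → Hit (p * m) s t
  Hit-* {m} {s} p t (d , d∣m , lt , le) = p * d , *-monoʳ-∣ p d∣m , subst (s <_) (sw₁ d p t) lt , subst (λ z → h * z ≤ suc h * s) (sw₁ d p t) le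

  -- For `y ≥ U` the point `y / p` is still at least `h`, because `p * h ≤ U`; a divisor found for
  -- it is multiplied by `p`.
  denseBelow-* : ∀ {m U} p → 1 ≤ p → p * h ≤ U → DenseBelow m U → DenseBelow (p * m) (p * U)
  denseBelow-* {m} {U} p 1≤p pe D s t 1≤t lo hi with s <? U * t
  ... | yes lt = let (d , d∣m , a , b) = D s t 1≤t lo lt in d , ∣n⇒∣m*n p d∣m , a , b
  ... | no ge = Hit-* p t (D s (p * t) (*-mono-≤ 1≤p 1≤t) (≤-trans (≤-reflexive (sw₁ h p t)) (≤-trans (*-monoˡ-≤ t pe) (≮⇒≥ ge))) (subst (s <_) (sw₂ p U t) hi))

  coDense-* : ∀ {m U} p → 1 ≤ p → p * suc h ≤ U → CoDense m U → CoDense (p * m) (p * U)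
  coDense-* {m} {U} p 1≤p pe D s t 1≤t lo hi with s ≤? U * t
  ... | yes le = let (d , d∣m , a , b , c) = D s t 1≤t lo le in d , ∣n⇒∣m*n p d∣m , a , b , c
  ... | no gt = let (e , e∣m , a , b , c) = D s (p * t) (*-mono-≤ 1≤p 1≤t) (≤-trans (s≤s (≤-trans (≤-reflexive (sw₁ (suc h) p t)) (*-monoˡ-≤ t pe))) (≰⇒> gt)) (subst (s ≤_) (sw₂ p U t) hi) in
     p * e , *-monoʳ-∣ p e∣m , subst (_< s) (sw₁ e p t) a , subst (λ z → h * s ≤ suc h * z) (sw₁ e p t) b , *-mono-≤ 1≤p c

  -- The divisor is `⌊y⌋ + 1`, which exceeds `y` by at most `1 ≤ y / h`.
  denseBelow-fac : ∀ W → DenseBelow (fac W) W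
  denseBelow-fac W s t@(suc _) 1≤t lo hi = suc q , ∣fac W (s≤s z≤n) (m<n*o⇒m/o<n {s} {W} {t} hi) , lt , le
    where
    q = s div t
    lt : s < t + q * t
    lt = ≤-trans (≤-reflexive (cong suc (m≡m%n+[m/n]*n s t))) (+-monoˡ-≤ (q * t) (m%n<n s t))
    le : h * (t + q * t) ≤ suc h * s
    le = ≤-trans (≤-reflexive (*-distribˡ-+ h t (q * t))) (+-mono-≤ lo (*-monoʳ-≤ h (m/n*n≤m s t)))

  -- The divisor is `⌈y⌉ - 1`, which falls short of `y` by at most `1 < y / (h + 1)`.
  coDense-fac : ∀ W → CoDense (fac W) W
  coDense-fac W zero t@(suc _) 1≤t () hi
  coDense-fac W (suc s) t@(suc _) 1≤t lo hi = e , ∣fac W 1≤e e≤W , s≤s (m/n*n≤m s t) , le , 1≤e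
    where
    e = s div t
    e≤W : e ≤ W
    e≤W = <⇒≤ (m<n*o⇒m/o<n {s} {W} {t} hi)
    near : suc s ≤ t + e * t
    near = ≤-trans (≤-reflexive (cong suc (m≡m%n+[m/n]*n s t))) (+-monoˡ-≤ (e * t) (m%n<n s t))
    1≤e : 1 ≤ e
    1≤e = go e near
      where
      go : ∀ e → suc s ≤ t + e * t → 1 ≤ e
      go zero n = ⊥-elim (<-irrefl refl (≤-trans lo (≤-trans (≤-trans n (≤-reflexive (+-identityʳ t))) (m≤m+n t (h * t)))))
      go (suc _) _ = s≤s z≤n
    le : h * suc s ≤ suc h * (e * t)
    le = +-cancelʳ-≤ (suc h * t) _ _ (≤-trans (+-monoʳ-≤ (h * suc s) (<⇒≤ lo)) (≤-trans (≤-reflexive (+-comm (h * suc s) (suc s))) (≤-trans (*-monoʳ-≤ (suc h) near) (≤-reflexive (trans (*-distribˡ-+ (suc h) t (e * t)) (+-comm (suc h * t) (suc h * (e * t))))))))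

  iterate : ∀ {m U} (D : ℕ → ℕ → Set) (c : ℕ) → c ≤ U → 1 ≤ U → (∀ {m U} → c ≤ U → D m U → D (2 * m) (2 * U)) → D m U → ∀ A → D (2 ^ A * m) (2 ^ A * U)
  iterate {m} {U} D c c≤U 1≤U step d zero = subst₂ D (sym (*-identityˡ m)) (sym (*-identityˡ U)) d
  iterate {m} {U} D c c≤U 1≤U step d (suc A) = subst₂ D (sym (*-assoc 2 (2 ^ A) m)) (sym (*-assoc 2 (2 ^ A) U)) (step (≤-trans c≤U (m≤n*m U (2 ^ A) {{>-nonZero (1≤2^ A)}})) (iterate D c c≤U 1≤U step d A))

  -- Small y are served by the divisors k 2^i with k ≤ W, large y by the complementary divisors.
  base-dense : ∀ W A → 2 * suc h ≤ W → fac W ≤ 2 ^ A → Dense (2 ^ A * fac W)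
  base-dense W A W≥ A≥ s t 1≤t lo hi with s <? 2 ^ A * W * t
  ... | yes lt = iterate DenseBelow (2 * h) (≤-trans (*-monoʳ-≤ 2 (n≤1+n h)) W≥) 1≤W (λ c d → denseBelow-* 2 (s≤s z≤n) c d) (denseBelow-fac W) A s t 1≤t lo lt
    where
    1≤W : 1 ≤ W
    1≤W = ≤-trans (s≤s z≤n) W≥
  ... | no ge with iterate CoDense (2 * suc h) W≥ 1≤W (λ c d → coDense-* 2 (s≤s z≤n) c d) (coDense-fac W) A (m * t) s 1≤s hi bound
    where
    1≤W : 1 ≤ W
    1≤W = ≤-trans (s≤s z≤n) W≥
    m = 2 ^ A * fac W
    1≤s : 1 ≤ s
    1≤s = ≤-trans (*-mono-≤ (*-mono-≤ (1≤2^ A) 1≤W) 1≤t) (≮⇒≥ ge)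
    -- The two ranges overlap: `y ≥ 2 ^ A * W` gives `m / y ≤ fac W / W`, which is at most `2 ^ A`
    -- by the choice of `A`.
    bound : m * t ≤ 2 ^ A * W * s
    bound = ≤-trans (≤-reflexive (*-assoc (2 ^ A) (fac W) t)) (≤-trans (*-monoʳ-≤ (2 ^ A) (≤-trans (*-monoˡ-≤ t A≥) (≤-trans (≤-trans (≤-reflexive (cong (_* t) (sym (*-identityʳ (2 ^ A))))) (*-monoˡ-≤ t (*-monoʳ-≤ (2 ^ A) 1≤W))) (≤-trans (≮⇒≥ ge) (m≤n*m s W {{>-nonZero 1≤W}}))))) (≤-reflexive (sym (*-assoc (2 ^ A) W s))))
  ... | e , divides d m≡ , a , b , 1≤e = d , divides e (trans m≡ (*-comm d e)) ,
      *-cancelˡ-< e s (d * t) (subst (e * s <_) eq a) ,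
      *-cancelˡ-≤ e {{>-nonZero 1≤e}} (subst₂ _≤_ (trans (cong (h *_) eq) (sw h e (d * t))) (sw (suc h) e s) b)
    where
    eq : 2 ^ A * fac W * t ≡ e * (d * t)
    eq = trans (cong (_* t) m≡) (trans (cong (_* t) (*-comm d e)) (*-assoc e d t))
    sw : ∀ a b c → a * (b * c) ≡ b * (a * c)
    sw = ℕSolver.solve-∀

  -- Below `m / (h + 1)` the divisors of `m` serve. From there on `y / p ≥ h` because
  -- `p h (h + 1) ≤ m`, and a divisor of `m` found for `y / p` is multiplied by `p`.
  dense-* : ∀ {m} p → 1 ≤ p → p * (h * suc h) ≤ m → Dense m → Dense (p * m)
  dense-* {m} p 1≤p pe D s t 1≤t lo hi with suc h * s <? m * t
  ... | yes lt = let (d , d∣m , a , b) = D s t 1≤t lo lt in d , ∣n⇒∣m*n p d∣m , a , b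
  ... | no ge = Hit-* p t (D s (p * t) (*-mono-≤ 1≤p 1≤t) (*-cancelˡ-≤ (suc h) (≤-trans (≤-reflexive (sw h p t)) (≤-trans (*-monoˡ-≤ t pe) (≮⇒≥ ge)))) (subst (suc h * s <_) (sw₂ p m t) hi))
    where
    sw : ∀ h p t → suc h * (h * (p * t)) ≡ p * (h * suc h) * t
    sw = ℕSolver.solve-∀

  Reachable : ℕ → ℕ → ℕ → Set
  Reachable M m P = P * (h * suc h) ≤ M ⊎ (∃[ D ] (D ∣ m × (∀ {q} → Prime q → q ∣ D → q < P) × P * (h * suc h) ≤ D))

  -- Multiply in the missing primes in increasing order: when P is the least one left, every P-smooth divisor of m has been used.
  dense-from-base : ∀ M m → 1 ≤ m → 1 ≤ M → Dense M → M ∣ m → (∀ {P} → Prime P → P ∣ m → Reachable M m P) → Dense m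
  dense-from-base M m 1≤m 1≤M dM (divides c₀ m≡₀) reach = go c₀ c₀ M ≤-refl m≡₀ ≤-refl dM
    where
    go : ∀ fuel c m′ → c ≤ fuel → m ≡ c * m′ → M ≤ m′ → Dense m′ → Dense m
    go fuel zero m′ _ e _ _ = ⊥-elim (<-irrefl refl (subst (1 ≤_) e 1≤m))
    go fuel (suc zero) m′ _ e _ d = subst Dense (sym (trans e (*-identityˡ m′))) d
    go (suc fuel) c@(suc (suc _)) m′ c≤ e M≤ d with least-prime c (s≤s (s≤s z≤n))
    ... | P , pP , divides c′ c≡ , min = go fuel c′ (P * m′) (s≤s⁻¹ (≤-trans c′<c c≤)) (trans e (trans (cong (_* m′) c≡) (*-assoc c′ P m′))) (≤-trans M≤ (m≤n*m m′ P {{prime⇒nonZero pP}})) (dense-* P (prime⇒≥1 pP) room d)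
      where
      1≤c′ : 1 ≤ c′
      1≤c′ = pos c′ c≡
        where
        pos : ∀ x → c ≡ x * P → 1 ≤ x
        pos (suc x) _ = s≤s z≤n
      c′<c : c′ < c
      c′<c = subst (c′ <_) (sym c≡) (m<m*n c′ P {{>-nonZero 1≤c′}} (prime⇒≥2 pP))
      1≤m′ : 1 ≤ m′
      1≤m′ = ≤-trans 1≤M M≤
      room : P * (h * suc h) ≤ m′
      room with reach pP (subst (P ∣_) (sym e) (∣m⇒∣m*n m′ (divides c′ c≡)))
      ... | inj₁ le = ≤-trans le M≤
      ... | inj₂ (D , D∣m , small , le) = ≤-trans le (∣⇒≤ {{>-nonZero 1≤m′}} (coprime-divisor cop (subst (D ∣_) e D∣m)))
        where
        cop : Coprime D c
        cop {zero} (_ , z∣c) = case 0∣⇒≡0 z∣c of λ ()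
        cop {suc zero} _ = refl
        cop {x@(suc (suc _))} (x∣D , x∣c) = let (q , pq , q∣x) = prime-divisor x (s≤s (s≤s z≤n)) in
          ⊥-elim (<-irrefl refl (≤-trans (small pq (∣-trans q∣x x∣D)) (min pq (∣-trans q∣x x∣c))))

Dense⇒DenseIn : ∀ h m → Density.Dense (suc h) m → DenseIn m ((+ suc (suc h)) / suc h) ((+ suc h) / 1) ((+ m) / suc (suc h))
Dense⇒DenseIn h-1 m D y lo hi = go y lo hi
  where
  h = suc h-1
  move : ∀ a b t → 1 ≤ t → ι a ≤ʳ ι b *ʳ inv t → a * t ≤ b
  move a b t 1≤t le = ι-cancel (subst₂ _≤ʳ_ (sym (ι-* a t)) (trans (ℚₚ.*-assoc (ι b) (inv t) (ι t)) (trans (cong (ι b *ʳ_) (inv-ι t 1≤t)) (ℚₚ.*-identityʳ (ι b)))) (mulʳ (ι t) (0≤ι t) le))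
  unmove : ∀ a b t → 1 ≤ t → a * t ≤ b → ι a ≤ʳ ι b *ʳ inv t
  unmove a b t 1≤t le = subst (_≤ʳ ι b *ʳ inv t) (trans (cong (_*ʳ inv t) (ι-* a t)) (trans (ℚₚ.*-assoc (ι a) (ι t) (inv t)) (trans (cong (ι a *ʳ_) (ι-inv t 1≤t)) (ℚₚ.*-identityʳ (ι a))))) (mulʳ (inv t) (0≤inv t) (ι-mono le))
  core : ∀ s t-1 → ι h ≤ʳ ι s *ʳ inv (suc t-1) → ι s *ʳ inv (suc t-1) <ʳ ι m *ʳ inv (suc h) →
    ∃[ d ] (d ∣ m × ι s *ʳ inv (suc t-1) <ʳ ι d × ι d ≤ʳ ι (suc h) *ʳ inv h *ʳ (ι s *ʳ inv (suc t-1)))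
  core s t-1 lo hi = let (d , d∣m , lt , le) = D s t (s≤s z≤n) (move h s t (s≤s z≤n) lo) bound in
    d , d∣m , ℚₚ.≰⇒> (λ c → <-irrefl refl (≤-trans lt (move d s t (s≤s z≤n) c))) , upper d le
    where
    t = suc t-1
    bound : suc h * s < m * t
    bound = ≰⇒> (λ c → ℚₚ.<-irrefl refl (ℚₚ.<-≤-trans hi (subst (_≤ʳ ι s *ʳ inv t) (ℚₚ.*-comm (inv (suc h)) (ι m))
      (≤ι*⇒inv*≤ (suc h) (s≤s z≤n) (subst (ι m ≤ʳ_) (trans (cong (_*ʳ inv t) (ι-* (suc h) s)) (ℚₚ.*-assoc (ι (suc h)) (ι s) (inv t))) (unmove m (suc h * s) t (s≤s z≤n) c))))))
    upper : ∀ d → h * (d * t) ≤ suc h * s → ι d ≤ʳ ι (suc h) *ʳ inv h *ʳ (ι s *ʳ inv t)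
    upper d le = subst (ι d ≤ʳ_) (trans (cong₂ (λ a b → a *ʳ b) (ι-* (suc h) s) (inv-* h t)) (e (ι (suc h)) (ι s) (inv h) (inv t)))
      (unmove d (suc h * s) (h * t) (s≤s z≤n) (subst (_≤ suc h * s) (sw h d t) le))
      where
      sw : ∀ h d t → h * (d * t) ≡ d * (h * t)
      sw = ℕSolver.solve-∀
      e : ∀ a b c d → a *ʳ b *ʳ (c *ʳ d) ≡ a *ʳ c *ʳ (b *ʳ d)
      e = solve-∀ ring
  ιh : (+ h) / 1 ≡ ι h
  ιh = sym (ι-def h)
  go : ∀ y → (+ h) / 1 ≤ʳ y → y <ʳ (+ m) / suc h → ∃[ d ] (d ∣ m × y <ʳ ℕ→ℚ d × ℕ→ℚ d ≤ʳ ((+ suc h) / h) *ʳ y)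
  go y@(ℚ.mkℚ (+ s) t-1 _) lo hi = let (d , d∣m , a , b) = core s t-1 (subst₂ _≤ʳ_ ιh y≡ lo) (subst₂ _<ʳ_ y≡ (frac-def m h) hi) in
    d , d∣m , subst₂ _<ʳ_ (sym y≡) (ι-def d) a , subst₂ _≤ʳ_ (ι-def d) (cong₂ _*ʳ_ (sym (frac-def (suc h) h-1)) (sym y≡)) b
    where
    y≡ : y ≡ ι s *ʳ inv (suc t-1)
    y≡ = trans (sym (ℚₚ.↥p/↧p≡p y)) (frac-def s t-1)
  go y@(ℚ.mkℚ -[1+ _ ] t-1 _) lo hi = ⊥-elim (ℚₚ.<-irrefl refl (ℚₚ.<-≤-trans (ℚₚ.negative⁻¹ y) (≤ʳ-trans (subst (0ℚ ≤ʳ_) (sym ιh) (0≤ι h)) lo)))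

-- Random sets of primes weighted by 1/a.

subs : List ℕ → List (List ℕ)
subs [] = [] ∷ []
subs (p ∷ ps) = subs ps ++ map (p ∷_) (subs ps)

wt : List ℕ → ℚ
wt s = inv (product s)

0≤wt : ∀ s → 0ℚ ≤ʳ wt s
0≤wt s = 0≤inv (product s)

-- 𝔼 ps F sums F s / ∏ s over the subsets s of ps (an unnormalised expectation).
𝔼 : List ℕ → (List ℕ → ℚ) → ℚ
𝔼 [] F = F []
𝔼 (p ∷ ps) F = 𝔼 ps F +ʳ inv p *ʳ 𝔼 ps (λ s → F (p ∷ s))

𝔼-subs : ∀ ps F → 𝔼 ps F ≡ ∑ (λ s → wt s *ʳ F s) (subs ps)
𝔼-subs [] F = sym (trans (ℚₚ.+-identityʳ (wt [] *ʳ F [])) (trans (cong (_*ʳ F []) inv1) (ℚₚ.*-identityˡ (F []))))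
𝔼-subs (p ∷ ps) F = begin
  𝔼 ps F +ʳ inv p *ʳ 𝔼 ps (λ s → F (p ∷ s))                                        ≡⟨ cong₂ (λ a b → a +ʳ inv p *ʳ b) (𝔼-subs ps F) (𝔼-subs ps (λ s → F (p ∷ s))) ⟩
  ∑ f (subs ps) +ʳ inv p *ʳ ∑ (λ s → wt s *ʳ F (p ∷ s)) (subs ps)                  ≡⟨ cong (∑ f (subs ps) +ʳ_) (sym (∑-*ˡ (inv p) (λ s → wt s *ʳ F (p ∷ s)) (subs ps))) ⟩
  ∑ f (subs ps) +ʳ ∑ (λ s → inv p *ʳ (wt s *ʳ F (p ∷ s))) (subs ps)                ≡⟨ cong (∑ f (subs ps) +ʳ_) (∑-cong (subs ps) (λ {s} _ → trans (sym (ℚₚ.*-assoc (inv p) (wt s) (F (p ∷ s)))) (cong (_*ʳ F (p ∷ s)) (sym (inv-* p (product s)))))) ⟩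
  ∑ f (subs ps) +ʳ ∑ (f ∘ (p ∷_)) (subs ps)                                        ≡⟨ cong (∑ f (subs ps) +ʳ_) (sym (∑-map f (p ∷_) (subs ps))) ⟩
  ∑ f (subs ps) +ʳ ∑ f (map (p ∷_) (subs ps))                                      ≡⟨ sym (∑-++ f (subs ps) (map (p ∷_) (subs ps))) ⟩
  ∑ f (subs (p ∷ ps)) ∎
  where
  open ≡-Reasoning
  f : List ℕ → ℚ
  f s = wt s *ʳ F s

𝔼-mono : ∀ ps {F G} → (∀ s → F s ≤ʳ G s) → 𝔼 ps F ≤ʳ 𝔼 ps G
𝔼-mono [] h = h []
𝔼-mono (p ∷ ps) h = add-mono (𝔼-mono ps h) (mulˡ (inv p) (0≤inv p) (𝔼-mono ps (λ s → h (p ∷ s))))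

𝔼-+ : ∀ ps F G → 𝔼 ps (λ s → F s +ʳ G s) ≡ 𝔼 ps F +ʳ 𝔼 ps G
𝔼-+ [] F G = refl
𝔼-+ (p ∷ ps) F G = trans (cong₂ (λ a b → a +ʳ inv p *ʳ b) (𝔼-+ ps F G) (𝔼-+ ps (F ∘ (p ∷_)) (G ∘ (p ∷_)))) (e (𝔼 ps F) (𝔼 ps G) (inv p) (𝔼 ps (F ∘ (p ∷_))) (𝔼 ps (G ∘ (p ∷_))))
  where
  e : ∀ a b i c d → a +ʳ b +ʳ i *ʳ (c +ʳ d) ≡ a +ʳ i *ʳ c +ʳ (b +ʳ i *ʳ d)
  e = solve-∀ ring

𝔼-*ˡ : ∀ ps c F → 𝔼 ps (λ s → c *ʳ F s) ≡ c *ʳ 𝔼 ps F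
𝔼-*ˡ [] c F = refl
𝔼-*ˡ (p ∷ ps) c F = trans (cong₂ (λ a b → a +ʳ inv p *ʳ b) (𝔼-*ˡ ps c F) (𝔼-*ˡ ps c (F ∘ (p ∷_)))) (e c (𝔼 ps F) (inv p) (𝔼 ps (F ∘ (p ∷_))))
  where
  e : ∀ c a i b → c *ʳ a +ʳ i *ʳ (c *ʳ b) ≡ c *ʳ (a +ʳ i *ʳ b)
  e = solve-∀ ring

𝔼-zero : ∀ ps → 𝔼 ps (λ _ → 0ℚ) ≡ 0ℚ
𝔼-zero [] = refl
𝔼-zero (p ∷ ps) = trans (cong (λ z → z +ʳ inv p *ʳ z) (𝔼-zero ps)) (trans (ℚₚ.+-identityˡ (inv p *ʳ 0ℚ)) (ℚₚ.*-zeroʳ (inv p)))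

𝔼-∑ : ∀ {I : Set} ps (F : I → List ℕ → ℚ) (is : List I) → 𝔼 ps (λ s → ∑ (λ i → F i s) is) ≡ ∑ (λ i → 𝔼 ps (F i)) is
𝔼-∑ ps F [] = 𝔼-zero ps
𝔼-∑ ps F (i ∷ is) = trans (𝔼-+ ps (F i) (λ s → ∑ (λ i → F i s) is)) (cong (𝔼 ps (F i) +ʳ_) (𝔼-∑ ps F is))

-- The Euler product `∏ (1 + θ p / p)`, the value of `𝔼` on the multiplicative function `mul θ`. For
-- `θ = 1` it is the total mass `W`, the missing normalisation of `𝔼`.
PP : (ℕ → ℚ) → List ℕ → ℚ
PP θ [] = 1ℚ
PP θ (p ∷ ps) = (1ℚ +ʳ θ p *ʳ inv p) *ʳ PP θ ps

one : ℕ → ℚ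
one _ = 1ℚ

W : List ℕ → ℚ
W = PP one

mul : (ℕ → ℚ) → List ℕ → ℚ
mul θ [] = 1ℚ
mul θ (q ∷ s) = θ q *ʳ mul θ s

𝔼-mul : ∀ θ ps → 𝔼 ps (mul θ) ≡ PP θ ps
𝔼-mul θ [] = refl
𝔼-mul θ (p ∷ ps) = trans (cong (λ z → 𝔼 ps (mul θ) +ʳ inv p *ʳ z) (𝔼-*ˡ ps (θ p) (mul θ))) (trans (cong (λ z → z +ʳ inv p *ʳ (θ p *ʳ z)) (𝔼-mul θ ps)) (e (PP θ ps) (inv p) (θ p)))
  where
  e : ∀ a i t → a +ʳ i *ʳ (t *ʳ a) ≡ (1ℚ +ʳ t *ʳ i) *ʳ a
  e = solve-∀ ring

𝔼-one : ∀ ps → 𝔼 ps (λ _ → 1ℚ) ≡ W ps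
𝔼-one [] = refl
𝔼-one (p ∷ ps) = trans (cong (λ z → z +ʳ inv p *ʳ z) (𝔼-one ps)) (e (W ps) (inv p))
  where
  e : ∀ a i → a +ʳ i *ʳ a ≡ (1ℚ +ʳ 1ℚ *ʳ i) *ʳ a
  e = solve-∀ ring

PP-++ : ∀ θ ps qs → PP θ (ps ++ qs) ≡ PP θ ps *ʳ PP θ qs
PP-++ θ [] qs = sym (ℚₚ.*-identityˡ (PP θ qs))
PP-++ θ (p ∷ ps) qs = trans (cong ((1ℚ +ʳ θ p *ʳ inv p) *ʳ_) (PP-++ θ ps qs)) (sym (ℚₚ.*-assoc (1ℚ +ʳ θ p *ʳ inv p) (PP θ ps) (PP θ qs)))

0≤PP : ∀ θ ps → (∀ p → 0ℚ ≤ʳ θ p) → 0ℚ ≤ʳ PP θ ps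
0≤PP θ [] h = 0≤1
0≤PP θ (p ∷ ps) h = 0≤* (0≤+ 0≤1 (0≤* (h p) (0≤inv p))) (0≤PP θ ps h)

0≤W : ∀ ps → 0ℚ ≤ʳ W ps
0≤W ps = 0≤PP one ps (λ _ → 0≤1)

1≤W : ∀ ps → 1ℚ ≤ʳ W ps
1≤W [] = ℚₚ.≤-refl
1≤W (p ∷ ps) = subst (_≤ʳ W (p ∷ ps)) (ℚₚ.*-identityˡ 1ℚ) (mul-mono 0≤1 0≤1 (≤+ʳ (1ℚ *ʳ inv p) (0≤* 0≤1 (0≤inv p))) (1≤W ps))

PP-mono : ∀ {θ η} ps → (∀ p → 0ℚ ≤ʳ θ p) → (∀ p → θ p ≤ʳ η p) → PP θ ps ≤ʳ PP η ps
PP-mono [] h le = ℚₚ.≤-refl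
PP-mono {θ} {η} (p ∷ ps) h le = mul-mono (0≤+ 0≤1 (0≤* (h p) (0≤inv p))) (0≤PP θ ps h) (ℚₚ.+-monoʳ-≤ 1ℚ (mulʳ (inv p) (0≤inv p) (le p))) (PP-mono ps h le)

PP-remove : ∀ θ {x} ys (p : x ∈ ys) → PP θ ys ≡ (1ℚ +ʳ θ x *ʳ inv x) *ʳ PP θ (∈-remove ys p)
PP-remove θ (y ∷ ys) (here refl) = refl
PP-remove θ {x} (y ∷ ys) (there p) = trans (cong ((1ℚ +ʳ θ y *ʳ inv y) *ʳ_) (PP-remove θ ys p)) (e (1ℚ +ʳ θ y *ʳ inv y) (1ℚ +ʳ θ x *ʳ inv x) (PP θ (∈-remove ys p)))
  where
  e : ∀ a b c → a *ʳ (b *ʳ c) ≡ b *ʳ (a *ʳ c)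
  e = solve-∀ ring

W-⊆ : ∀ xs ys → Unique xs → (∀ {x} → x ∈ xs → x ∈ ys) → W xs ≤ʳ W ys
W-⊆ [] ys u sub = 1≤W ys
W-⊆ (x ∷ xs) ys (x∉ ∷ u) sub = subst (W (x ∷ xs) ≤ʳ_) (sym (PP-remove one ys m)) (mulˡ (1ℚ +ʳ 1ℚ *ʳ inv x) (0≤+ 0≤1 (0≤* 0≤1 (0≤inv x))) (W-⊆ xs (∈-remove ys m) u (λ q → ∈-remove-≢ ys m (sub (there q)) (All.lookup x∉ q))))
  where
  m = sub (here refl)

𝔼-count : ∀ x → (∀ q → 0ℚ ≤ʳ x q) → ∀ ps → 𝔼 ps (∑ x) ≤ʳ W ps *ʳ ∑ (λ p → x p *ʳ inv p) ps
𝔼-count x 0≤x [] = ℚₚ.≤-reflexive (sym (ℚₚ.*-zeroʳ 1ℚ))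
𝔼-count x 0≤x (p ∷ ps) = begin
  𝔼 ps (∑ x) +ʳ i *ʳ 𝔼 ps (λ s → x p +ʳ ∑ x s)        ≡⟨ cong (λ z → 𝔼 ps (∑ x) +ʳ i *ʳ z) (trans (𝔼-+ ps (λ _ → x p) (∑ x)) (cong (_+ʳ 𝔼 ps (∑ x)) const)) ⟩
  𝔼 ps (∑ x) +ʳ i *ʳ (x p *ʳ w +ʳ 𝔼 ps (∑ x))          ≤⟨ add-mono ih (mulˡ i (0≤inv p) (ℚₚ.+-monoʳ-≤ (x p *ʳ w) ih)) ⟩
  w *ʳ σ +ʳ i *ʳ (x p *ʳ w +ʳ w *ʳ σ)                  ≤⟨ ≤-byʳ (i *ʳ (i *ʳ (x p *ʳ w))) (0≤* (0≤inv p) (0≤* (0≤inv p) (0≤* (0≤x p) (0≤W ps)))) (e w σ i (x p)) ⟩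
  (1ℚ +ʳ 1ℚ *ʳ i) *ʳ w *ʳ (x p *ʳ i +ʳ σ) ∎
  where
  open ℚₚ.≤-Reasoning
  i = inv p
  w = W ps
  σ = ∑ (λ p → x p *ʳ inv p) ps
  ih = 𝔼-count x 0≤x ps
  const : 𝔼 ps (λ _ → x p) ≡ x p *ʳ w
  const = trans (cong (λ z → 𝔼 ps (λ _ → z)) (sym (ℚₚ.*-identityʳ (x p)))) (trans (𝔼-*ˡ ps (x p) (λ _ → 1ℚ)) (cong (x p *ʳ_) (𝔼-one ps)))
  e : ∀ w σ i x → (1ℚ +ʳ 1ℚ *ʳ i) *ʳ w *ʳ (x *ʳ i +ʳ σ) ≡ w *ʳ σ +ʳ i *ʳ (x *ʳ w +ʳ w *ʳ σ) +ʳ i *ʳ (i *ʳ (x *ʳ w))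
  e = solve-∀ ring

-- When `x` is an indicator, this is the number of pairs of entries in its class, so a value below
-- `1` means at most one such entry.
pairs : (ℕ → ℚ) → List ℕ → ℚ
pairs x [] = 0ℚ
pairs x (q ∷ s) = x q *ʳ ∑ x s +ʳ pairs x s

𝔼-pairs : ∀ x → (∀ q → 0ℚ ≤ʳ x q) → ∀ ps → let σ = ∑ (λ p → x p *ʳ inv p) ps in 𝔼 ps (pairs x) ≤ʳ W ps *ʳ (σ *ʳ σ)
𝔼-pairs x 0≤x [] = ℚₚ.≤-reflexive (sym (ℚₚ.*-zeroʳ 1ℚ))
𝔼-pairs x 0≤x (p ∷ ps) = begin
  𝔼 ps (pairs x) +ʳ i *ʳ 𝔼 ps (λ s → x p *ʳ ∑ x s +ʳ pairs x s)      ≡⟨ cong (λ z → 𝔼 ps (pairs x) +ʳ i *ʳ z) (trans (𝔼-+ ps (λ s → x p *ʳ ∑ x s) (pairs x)) (cong (_+ʳ 𝔼 ps (pairs x)) (𝔼-*ˡ ps (x p) (∑ x)))) ⟩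
  𝔼 ps (pairs x) +ʳ i *ʳ (x p *ʳ 𝔼 ps (∑ x) +ʳ 𝔼 ps (pairs x))       ≤⟨ add-mono ih (mulˡ i (0≤inv p) (add-mono (mulˡ (x p) (0≤x p) (𝔼-count x 0≤x ps)) ih)) ⟩
  w *ʳ (σ *ʳ σ) +ʳ i *ʳ (x p *ʳ (w *ʳ σ) +ʳ w *ʳ (σ *ʳ σ))            ≤⟨ ≤-byʳ rest 0≤rest (e w σ i (x p)) ⟩
  (1ℚ +ʳ 1ℚ *ʳ i) *ʳ w *ʳ ((x p *ʳ i +ʳ σ) *ʳ (x p *ʳ i +ʳ σ)) ∎
  where
  open ℚₚ.≤-Reasoning
  i = inv p
  w = W ps
  σ = ∑ (λ p → x p *ʳ inv p) ps
  ih = 𝔼-pairs x 0≤x ps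
  0≤i = 0≤inv p
  0≤w = 0≤W ps
  0≤xp = 0≤x p
  0≤σ : 0ℚ ≤ʳ σ
  0≤σ = ∑-nonneg ps (λ {q} _ → 0≤* (0≤x q) (0≤inv q))
  xi = x p *ʳ i
  0≤xi = 0≤* 0≤xp 0≤i
  rest = w *ʳ (xi *ʳ σ) +ʳ w *ʳ (xi *ʳ xi) +ʳ i *ʳ (w *ʳ (xi *ʳ σ +ʳ (xi *ʳ σ +ʳ xi *ʳ xi)))
  0≤rest : 0ℚ ≤ʳ rest
  0≤rest = 0≤+ (0≤+ (0≤* 0≤w (0≤* 0≤xi 0≤σ)) (0≤* 0≤w (0≤* 0≤xi 0≤xi))) (0≤* 0≤i (0≤* 0≤w (0≤+ (0≤* 0≤xi 0≤σ) (0≤+ (0≤* 0≤xi 0≤σ) (0≤* 0≤xi 0≤xi)))))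
  e : ∀ w σ i x → (1ℚ +ʳ 1ℚ *ʳ i) *ʳ w *ʳ ((x *ʳ i +ʳ σ) *ʳ (x *ʳ i +ʳ σ)) ≡
    w *ʳ (σ *ʳ σ) +ʳ i *ʳ (x *ʳ (w *ʳ σ) +ʳ w *ʳ (σ *ʳ σ)) +ʳ (w *ʳ (x *ʳ i *ʳ σ) +ʳ w *ʳ (x *ʳ i *ʳ (x *ʳ i)) +ʳ i *ʳ (w *ʳ (x *ʳ i *ʳ σ +ʳ (x *ʳ i *ʳ σ +ʳ x *ʳ i *ʳ (x *ʳ i)))))
  e = solve-∀ ring

½+½ : inv 2 +ʳ inv 2 ≡ 1ℚ
½+½ = trans (e (inv 2)) (trans (cong (_*ʳ inv 2) (sym ι2)) (ι-inv 2 (s≤s z≤n)))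
  where
  e : ∀ a → a +ʳ a ≡ (1ℚ +ʳ 1ℚ) *ʳ a
  e = solve-∀ ring

module Half {G : ℕ → Set} (G? : Decidable G) where

  -- With this choice `mul θ s` is `2` to the minus number of good primes in `s`: an exponential
  -- moment, whose mean is small unless few good primes are rare.
  θ : ℕ → ℚ
  θ q = ite (G? q) (inv 2) 1ℚ

  0≤θ : ∀ q → 0ℚ ≤ʳ θ q
  0≤θ q = ite-elim (0ℚ ≤ʳ_) (G? q) (0≤inv 2) 0≤1

  θ≤1 : ∀ q → θ q ≤ʳ 1ℚ
  θ≤1 q = ite-elim (_≤ʳ 1ℚ) (G? q) (inv≤1 2) ℚₚ.≤-refl

  θ-yes : ∀ {q} → G q → θ q ≡ inv 2
  θ-yes {q} = ite-yes (G? q)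

  θ-no : ∀ {q} → ¬ G q → θ q ≡ 1ℚ
  θ-no {q} = ite-no (G? q)

  -- A good `p` enters `W` with `1 + 1/p` but `PP θ` with `1 + 1/(2p)`, and the ratio is at least
  -- `1 + 1/(4p)`. The product of these ratios is at least one plus the sum of the `1/(4p)`.
  gain : ∀ ps → PP θ ps *ʳ (1ℚ +ʳ inv 4 *ʳ ∑ inv (filter G? ps)) ≤ʳ W ps
  gain [] = ℚₚ.≤-reflexive (trans (ℚₚ.*-identityˡ (1ℚ +ʳ inv 4 *ʳ 0ℚ)) (trans (cong (1ℚ +ʳ_) (ℚₚ.*-zeroʳ (inv 4))) (ℚₚ.+-identityʳ 1ℚ)))
  gain (p ∷ ps) = go (G? p)
    where
    open ℚₚ.≤-Reasoning
    i = inv p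
    X = inv 4 *ʳ ∑ inv (filter G? ps)
    T = PP θ ps
    0≤X : 0ℚ ≤ʳ X
    0≤X = 0≤* (0≤inv 4) (∑-nonneg (filter G? ps) (λ {q} _ → 0≤inv q))
    0≤T : 0ℚ ≤ʳ T
    0≤T = 0≤PP θ ps 0≤θ
    filter-yes : G p → ∑ inv (filter G? (p ∷ ps)) ≡ i +ʳ ∑ inv (filter G? ps)
    filter-yes g with G? p
    ... | yes _ = refl
    ... | no ¬g = ⊥-elim (¬g g)
    filter-no : ¬ G p → ∑ inv (filter G? (p ∷ ps)) ≡ ∑ inv (filter G? ps)
    filter-no ¬g with G? p
    ... | yes g = ⊥-elim (¬g g)
    ... | no _ = refl
    ½i≤1 : inv 2 *ʳ i ≤ʳ 1ℚ
    ½i≤1 = subst (inv 2 *ʳ i ≤ʳ_) (ℚₚ.*-identityˡ 1ℚ) (mul-mono (0≤inv 2) (0≤inv p) (inv≤1 2) (inv≤1 p))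
    ¼ : inv 4 ≡ inv 2 *ʳ inv 2
    ¼ = inv-* 2 2
    go : Dec (G p) → (1ℚ +ʳ θ p *ʳ i) *ʳ T *ʳ (1ℚ +ʳ inv 4 *ʳ ∑ inv (filter G? (p ∷ ps))) ≤ʳ (1ℚ +ʳ 1ℚ *ʳ i) *ʳ W ps
    go (no ¬g) = begin
      (1ℚ +ʳ θ p *ʳ i) *ʳ T *ʳ (1ℚ +ʳ inv 4 *ʳ ∑ inv (filter G? (p ∷ ps)))  ≡⟨ cong₂ (λ a b → (1ℚ +ʳ a *ʳ i) *ʳ T *ʳ (1ℚ +ʳ inv 4 *ʳ b)) (θ-no ¬g) (filter-no ¬g) ⟩
      (1ℚ +ʳ 1ℚ *ʳ i) *ʳ T *ʳ (1ℚ +ʳ X)    ≡⟨ ℚₚ.*-assoc (1ℚ +ʳ 1ℚ *ʳ i) T (1ℚ +ʳ X) ⟩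
      (1ℚ +ʳ 1ℚ *ʳ i) *ʳ (T *ʳ (1ℚ +ʳ X))  ≤⟨ mulˡ (1ℚ +ʳ 1ℚ *ʳ i) (0≤+ 0≤1 (0≤* 0≤1 (0≤inv p))) (gain ps) ⟩
      (1ℚ +ʳ 1ℚ *ʳ i) *ʳ W ps ∎
    go (yes g) = begin
      (1ℚ +ʳ θ p *ʳ i) *ʳ T *ʳ (1ℚ +ʳ inv 4 *ʳ ∑ inv (filter G? (p ∷ ps)))  ≡⟨ cong₂ (λ a b → (1ℚ +ʳ a *ʳ i) *ʳ T *ʳ (1ℚ +ʳ b)) (θ-yes g) (trans (cong (inv 4 *ʳ_) (filter-yes g)) (trans (ℚₚ.*-distribˡ-+ (inv 4) i (∑ inv (filter G? ps))) (cong (λ z → z *ʳ i +ʳ X) ¼))) ⟩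
      (1ℚ +ʳ inv 2 *ʳ i) *ʳ T *ʳ (1ℚ +ʳ (inv 2 *ʳ inv 2 *ʳ i +ʳ X))
        ≤⟨ ≤-byʳ (T *ʳ (inv 2 *ʳ i *ʳ X +ʳ inv 2 *ʳ (inv 2 *ʳ i *ʳ (1ℚ -ʳ inv 2 *ʳ i)))) (0≤* 0≤T (0≤+ (0≤* (0≤* (0≤inv 2) (0≤inv p)) 0≤X) (0≤* (0≤inv 2) (0≤* (0≤* (0≤inv 2) (0≤inv p)) 0≤1-½i))))
           (trans (cong (λ z → (1ℚ +ʳ z *ʳ i) *ʳ (T *ʳ (1ℚ +ʳ X))) (sym ½+½)) (trans (e₀ (inv 2) i T X) (trans (cong (λ z → T *ʳ (1ℚ +ʳ X +ʳ inv 2 *ʳ i *ʳ (1ℚ +ʳ X +ʳ (z +ʳ X)))) (sym ½+½)) (e (inv 2) i T X)))) ⟩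
      (1ℚ +ʳ 1ℚ *ʳ i) *ʳ (T *ʳ (1ℚ +ʳ X))  ≤⟨ mulˡ (1ℚ +ʳ 1ℚ *ʳ i) (0≤+ 0≤1 (0≤* 0≤1 (0≤inv p))) (gain ps) ⟩
      (1ℚ +ʳ 1ℚ *ʳ i) *ʳ W ps ∎
      where
      0≤1-½i : 0ℚ ≤ʳ 1ℚ -ʳ inv 2 *ʳ i
      0≤1-½i = subst (_≤ʳ 1ℚ -ʳ inv 2 *ʳ i) (ℚₚ.+-inverseʳ (inv 2 *ʳ i)) (ℚₚ.+-monoˡ-≤ (-ʳ (inv 2 *ʳ i)) ½i≤1)
      e₀ : ∀ k i T X → (1ℚ +ʳ (k +ʳ k) *ʳ i) *ʳ (T *ʳ (1ℚ +ʳ X)) ≡ T *ʳ (1ℚ +ʳ X +ʳ k *ʳ i *ʳ (1ℚ +ʳ X +ʳ (1ℚ +ʳ X)))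
      e₀ = solve-∀ ring
      e : ∀ k i T X → T *ʳ (1ℚ +ʳ X +ʳ k *ʳ i *ʳ (1ℚ +ʳ X +ʳ (k +ʳ k +ʳ X))) ≡
        (1ℚ +ʳ k *ʳ i) *ʳ T *ʳ (1ℚ +ʳ (k *ʳ k *ʳ i +ʳ X)) +ʳ T *ʳ (k *ʳ i *ʳ X +ʳ k *ʳ (k *ʳ i *ʳ (1ℚ -ʳ k *ʳ i)))
      e = solve-∀ ring

-- Pointwise, `1 - Φ s` is at most the indicator of `Φ s < 1`.
markov : ∀ ps Φ → (∀ s → 0ℚ ≤ʳ Φ s) → W ps -ʳ 𝔼 ps Φ ≤ʳ 𝔼 ps (λ s → 𝟙 (Φ s ℚₚ.<? 1ℚ))
markov ps Φ 0≤Φ = subst (_≤ʳ 𝔼 ps (λ s → 𝟙 (Φ s ℚₚ.<? 1ℚ))) eq (𝔼-mono ps pointwise)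
  where
  eq : 𝔼 ps (λ s → 1ℚ +ʳ (-ʳ 1ℚ) *ʳ Φ s) ≡ W ps -ʳ 𝔼 ps Φ
  eq = trans (𝔼-+ ps (λ _ → 1ℚ) (λ s → (-ʳ 1ℚ) *ʳ Φ s)) (cong₂ _+ʳ_ (𝔼-one ps) (trans (𝔼-*ˡ ps (-ʳ 1ℚ) Φ) (e (𝔼 ps Φ))))
    where
    e : ∀ a → (-ʳ 1ℚ) *ʳ a ≡ -ʳ a
    e = solve-∀ ring
  pointwise : ∀ s → 1ℚ +ʳ (-ʳ 1ℚ) *ʳ Φ s ≤ʳ 𝟙 (Φ s ℚₚ.<? 1ℚ)
  pointwise s = go (Φ s ℚₚ.<? 1ℚ)
    where
    e : ∀ a → 1ℚ +ʳ (-ʳ 1ℚ) *ʳ a ≡ 1ℚ -ʳ a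
    e = solve-∀ ring
    go : (d : Dec (Φ s <ʳ 1ℚ)) → 1ℚ +ʳ (-ʳ 1ℚ) *ʳ Φ s ≤ʳ 𝟙 d
    go (yes _) = subst (_≤ʳ 1ℚ) (sym (e (Φ s))) (≤-byʳ (Φ s) (0≤Φ s) (e′ (Φ s)))
      where
      e′ : ∀ a → 1ℚ ≡ 1ℚ -ʳ a +ʳ a
      e′ = solve-∀ ring
    go (no ¬lt) = subst₂ _≤ʳ_ (sym (e (Φ s))) (ℚₚ.+-inverseʳ (Φ s)) (ℚₚ.+-monoˡ-≤ (-ʳ Φ s) (ℚₚ.≮⇒≥ ¬lt))

-- Levels and blocks of primes.

Jr : ℕ → ℕ → List ℕ
Jr u zero = []
Jr u (suc n) = J (u + n) ++ Jr u n

Jr⁻ : ∀ u n {q} → q ∈ Jr u n → Prime q × bp u ≤ q × q < bp (u + n)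
Jr⁻ u (suc n) {q} q∈ with ∈-++⁻ (J (u + n)) q∈
... | inj₁ h = let (a , b , c) = ∈-J⁻ {u + n} h in a , ≤-trans (bp-mono (m≤m+n u n)) b , subst (λ z → q < bp z) (sym (+-suc u n)) c
... | inj₂ h = let (a , b , c) = Jr⁻ u n h in a , b , ≤-trans c (bp-mono (+-monoʳ-≤ u (n≤1+n n)))

Jr⁺ : ∀ u n {q} → Prime q → bp u ≤ q → q < bp (u + n) → q ∈ Jr u n
Jr⁺ u zero {q} pq lo hi = ⊥-elim (<-irrefl refl (≤-trans (subst (λ z → q < bp z) (+-identityʳ u) hi) lo))
Jr⁺ u (suc n) {q} pq lo hi with bp (u + n) ≤? q
... | yes le = ∈-++⁺ˡ (∈-J⁺ {u + n} pq le (subst (λ z → q < bp z) (+-suc u n) hi))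
... | no gt = ∈-++⁺ʳ (J (u + n)) (Jr⁺ u n pq lo (≰⇒> gt))

downFrom-sorted : ∀ n → AllPairs _>_ (downFrom n)
downFrom-sorted zero = []
downFrom-sorted (suc n) = All.tabulate (λ i∈ → ∈-downFrom⁻ i∈) ∷ downFrom-sorted n

J-sorted : ∀ k → AllPairs _>_ (J k)
J-sorted k = AllPairsₚ.filter⁺ (bp k ≤?_) (AllPairsₚ.filter⁺ prime? (downFrom-sorted (bp (suc k))))

++-sorted : ∀ {xs ys} B → AllPairs _>_ xs → AllPairs _>_ ys → All (B ≤_) xs → All (_< B) ys → AllPairs _>_ (xs ++ ys)
++-sorted {xs} {ys} B sx sy hx hy = AllPairsₚ.++⁺ sx sy (All.map (λ B≤x → All.map (λ y<B → ≤-trans y<B B≤x) hy) hx)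

Jr-sorted : ∀ u n → AllPairs _>_ (Jr u n)
Jr-sorted u zero = []
Jr-sorted u (suc n) = ++-sorted (bp (u + n)) (J-sorted (u + n)) (Jr-sorted u n) (All.tabulate (λ h → proj₁ (proj₂ (∈-J⁻ {u + n} h)))) (All.tabulate (λ h → proj₂ (proj₂ (Jr⁻ u n h))))

sorted⇒unique : ∀ {xs} → AllPairs _>_ xs → Unique xs
sorted⇒unique = AllPairs.map (λ gt e → <-irrefl (sym e) gt)

block : ℕ → List ℕ
block i = Jr (2 ^ i) (2 ^ i)

2^suc : ∀ i → 2 ^ suc i ≡ 2 ^ i + 2 ^ i
2^suc i = cong (λ z → 2 ^ i + z) (+-identityʳ (2 ^ i))

block⁻ : ∀ i {q} → q ∈ block i → Prime q × bp (2 ^ i) ≤ q × q < bp (2 ^ suc i)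
block⁻ i {q} q∈ = let (a , b , c) = Jr⁻ (2 ^ i) (2 ^ i) q∈ in a , b , subst (λ z → q < bp z) (sym (2^suc i)) c

-- The primes of `[bp (2 ^ a) , bp (2 ^ (a + m)))` in decreasing order, grouped in the blocks
-- `a, …, a + m - 1`. The order makes every subset the unique sorted list with its product.
PB : ℕ → ℕ → List ℕ
PB a zero = []
PB a (suc m) = block (a + m) ++ PB a m

PB⁻ : ∀ a m {q} → q ∈ PB a m → Prime q × bp (2 ^ a) ≤ q × q < bp (2 ^ (a + m))
PB⁻ a (suc m) {q} q∈ with ∈-++⁻ (block (a + m)) q∈
... | inj₁ h = let (x , y , z) = block⁻ (a + m) h in x , ≤-trans (bp-mono (^-monoʳ-≤ 2 (m≤m+n a m))) y , subst (λ w → q < bp (2 ^ w)) (sym (+-suc a m)) z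
... | inj₂ h = let (x , y , z) = PB⁻ a m h in x , y , ≤-trans z (bp-mono (^-monoʳ-≤ 2 (+-monoʳ-≤ a (n≤1+n m))))

PB⁺ : ∀ a m {q} → Prime q → bp (2 ^ a) ≤ q → q < bp (2 ^ (a + m)) → q ∈ PB a m
PB⁺ a zero {q} pq lo hi = ⊥-elim (<-irrefl refl (≤-trans (subst (λ z → q < bp (2 ^ z)) (+-identityʳ a) hi) lo))
PB⁺ a (suc m) {q} pq lo hi with bp (2 ^ (a + m)) ≤? q
... | yes le = ∈-++⁺ˡ (Jr⁺ (2 ^ (a + m)) (2 ^ (a + m)) pq le (subst (λ z → q < bp z) (trans (cong (2 ^_) (+-suc a m)) (2^suc (a + m))) hi))
... | no gt = ∈-++⁺ʳ (block (a + m)) (PB⁺ a m pq lo (≰⇒> gt))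

PB-sorted : ∀ a m → AllPairs _>_ (PB a m)
PB-sorted a zero = []
PB-sorted a (suc m) = ++-sorted (bp (2 ^ (a + m))) (Jr-sorted (2 ^ (a + m)) (2 ^ (a + m))) (PB-sorted a m) (All.tabulate (λ h → proj₁ (proj₂ (block⁻ (a + m) h)))) (All.tabulate (λ h → proj₂ (proj₂ (PB⁻ a m h))))

∑-lower : ∀ (xs : List ℕ) c → (∀ {x} → x ∈ xs → c ≤ʳ inv x) → ι (length xs) *ʳ c ≤ʳ ∑ inv xs
∑-lower xs c h = subst (_≤ʳ ∑ inv xs) (∑-const c xs) (∑-mono xs h)

∑-upper : ∀ {A : Set} (f : A → ℚ) (xs : List A) c → (∀ {x} → x ∈ xs → f x ≤ʳ c) → ∑ f xs ≤ʳ ι (length xs) *ʳ c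
∑-upper f xs c h = subst (∑ f xs ≤ʳ_) (∑-const c xs) (∑-mono xs h)

inv-transfer : ∀ N M ℓ → 1 ≤ N → 1 ≤ M → N ≤ M * ℓ → inv M ≤ʳ ι ℓ *ʳ inv N
inv-transfer N M ℓ 1≤N 1≤M le = ι-cancelˡ M 1≤M (subst₂ _≤ʳ_ (trans (ι-inv N 1≤N) (sym (ι-inv M 1≤M))) (trans (cong (_*ʳ inv N) (ι-* M ℓ)) (ℚₚ.*-assoc (ι M) (ι ℓ) (inv N))) (mulʳ (inv N) (0≤inv N) (ι-mono le)))

level-sum : ∀ {G : ℕ → Set} (G? : Decidable G) u n B → u + n ≤ B → 1 ≤ B → (∀ k → u ≤ k → k < u + n → bp (suc k) ≤ 64 * (suc k * length (filter G? (J k)))) →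
  ι n *ʳ inv (64 * B) ≤ʳ ∑ inv (filter G? (Jr u n))
level-sum G? u zero B le 1≤B h = ℚₚ.≤-reflexive (trans (cong (_*ʳ inv (64 * B)) ι0) (ℚₚ.*-zeroˡ (inv (64 * B))))
level-sum G? u (suc n) B le 1≤B h = begin
  ι (suc n) *ʳ c                                                    ≡⟨ trans (cong (_*ʳ c) (trans (ι-+ 1 n) (cong (_+ʳ ι n) ι1))) (e c (ι n)) ⟩
  c +ʳ ι n *ʳ c                                                     ≤⟨ add-mono lev (level-sum G? u n B (≤-trans (+-monoʳ-≤ u (n≤1+n n)) le) 1≤B (λ k lo hi → h k lo (≤-trans hi (+-monoʳ-≤ u (n≤1+n n))))) ⟩
  ∑ inv (filter G? (J k)) +ʳ ∑ inv (filter G? (Jr u n))             ≡⟨ sym (trans (cong (∑ inv) (filter-++ G? (J k) (Jr u n))) (∑-++ inv (filter G? (J k)) (filter G? (Jr u n)))) ⟩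
  ∑ inv (filter G? (J k ++ Jr u n)) ∎
  where
  open ℚₚ.≤-Reasoning
  c = inv (64 * B)
  k = u + n
  e : ∀ c n → (1ℚ +ʳ n) *ʳ c ≡ c +ʳ n *ʳ c
  e = solve-∀ ring
  sk≤B : suc k ≤ B
  sk≤B = subst (_≤ B) (+-suc u n) le
  xs = filter G? (J k)
  lev : c ≤ʳ ∑ inv xs
  lev = ≤ʳ-trans (inv-anti (s≤s z≤n) (*-monoʳ-≤ 64 sk≤B))
    (≤ʳ-trans (inv-transfer (bp (suc k)) (64 * suc k) (length xs) (1≤bp (suc k)) (s≤s z≤n) (≤-trans (h k (m≤m+n u n) (≤-reflexive (sym (+-suc u n)))) (≤-reflexive (sym (*-assoc 64 (suc k) (length xs))))))
      (∑-lower xs (inv (bp (suc k))) (λ {q} q∈ → let (pq , _ , hi) = ∈-J⁻ {k} (proj₁ (∈-filter⁻ G? {xs = J k} q∈)) in inv-anti (prime⇒≥1 pq) (<⇒≤ hi))))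

-- The block has `2 ^ i` levels, and each contributes at least `1 / (64 · 2 ^ (i + 1))` by the
-- hypothesis on `J k`.
block-sum : ∀ {G : ℕ → Set} (G? : Decidable G) i → (∀ k → 2 ^ i ≤ k → bp (suc k) ≤ 64 * (suc k * length (filter G? (J k)))) → inv 128 ≤ʳ ∑ inv (filter G? (block i))
block-sum G? i h = subst (_≤ʳ ∑ inv (filter G? (block i))) eq (level-sum G? (2 ^ i) (2 ^ i) (2 ^ suc i) (≤-reflexive (sym (2^suc i))) (1≤2^ (suc i)) (λ k lo _ → h k lo))
  where
  sw : ∀ u → 64 * (2 * u) ≡ u * 128
  sw = ℕSolver.solve-∀
  eq : ι (2 ^ i) *ʳ inv (64 * 2 ^ suc i) ≡ inv 128
  eq = trans (cong (λ z → ι (2 ^ i) *ʳ inv z) (sw (2 ^ i))) (trans (cong (ι (2 ^ i) *ʳ_) (inv-* (2 ^ i) 128)) (trans (sym (ℚₚ.*-assoc (ι (2 ^ i)) (inv (2 ^ i)) (inv 128))) (trans (cong (_*ʳ inv 128) (ι-inv (2 ^ i) (1≤2^ i))) (ℚₚ.*-identityˡ (inv 128)))))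

true? : Decidable {A = ℕ} (λ _ → ⊤)
true? _ = yes tt

filter-true : ∀ xs → filter true? xs ≡ xs
filter-true [] = refl
filter-true (x ∷ xs) = cong (x ∷_) (filter-true xs)

PB-sum : ∀ a t → ι t *ʳ inv 128 ≤ʳ ∑ inv (PB a t)
PB-sum a zero = ℚₚ.≤-reflexive (trans (cong (_*ʳ inv 128) ι0) (ℚₚ.*-zeroˡ (inv 128)))
PB-sum a (suc t) = begin
  ι (suc t) *ʳ inv 128                 ≡⟨ trans (cong (_*ʳ inv 128) (trans (ι-+ 1 t) (cong (_+ʳ ι t) ι1))) (e (inv 128) (ι t)) ⟩
  inv 128 +ʳ ι t *ʳ inv 128            ≤⟨ add-mono (subst (inv 128 ≤ʳ_) (cong (∑ inv) (filter-true (block (a + t)))) (block-sum true? (a + t) (λ k lo → subst (λ z → bp (suc k) ≤ 64 * (suc k * length z)) (sym (filter-true (J k))) (J-count k (≤-trans (1≤2^ (a + t)) lo))))) (PB-sum a t) ⟩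
  ∑ inv (block (a + t)) +ʳ ∑ inv (PB a t) ≡⟨ sym (∑-++ inv (block (a + t)) (PB a t)) ⟩
  ∑ inv (PB a (suc t)) ∎
  where
  open ℚₚ.≤-Reasoning
  e : ∀ c n → (1ℚ +ʳ n) *ʳ c ≡ c +ʳ n *ʳ c
  e = solve-∀ ring

-- The `4` comes from the `16` in `bp`: `bp (2 ^ (a + t)) = 2 ^ (2 ^ (a + t + 4))`, so these `r` fit
-- the level of the sieve once `k ≥ 2 ^ (a + t + 4)`.
PB-bounds : ∀ a t k → 2 ^ (a + t + 4) ≤ k → All (λ r → Prime r × 4 ≤ r × r ≤ 2 ^ suc k) (PB a t)
PB-bounds a t k le = All.tabulate λ {r} r∈ → let (x , y , z) = PB⁻ a t r∈ in x ,
  ≤-trans (≤-trans (toWitness {a? = 4 ≤? 65536} tt) (≤-reflexive (sym (bp-def 1)))) (≤-trans (bp-mono (1≤2^ a)) y) ,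
  ≤-trans (<⇒≤ z) (≤-trans (≤-reflexive (bp-def (2 ^ (a + t)))) (^-monoʳ-≤ 2 (≤-trans (≤-reflexive (trans (*-comm 16 (2 ^ (a + t))) (sym (^-distribˡ-+-* 2 (a + t) 4)))) (≤-trans le (n≤1+n k)))))

hits-block : ∀ a t i → a + t + 4 ≤ i → ∀ {R} → Unique R → (∀ {r} → r ∈ R → r ∈ PB a t) → ι 128 ≤ʳ ∑ inv R → inv 128 ≤ʳ ∑ inv (filter (hits? R) (block i))
hits-block a t i le {R} uR sub big = block-sum (hits? R) i (λ k lo → hit-count k (≤-trans (1≤2^ i) lo) R uR (All.tabulate (λ r∈ → All.lookup (PB-bounds a t k (≤-trans (^-monoʳ-≤ 2 le) lo)) (sub r∈))) big)

-- Logarithms to base β and upper bounds for weighted sums.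

level : ℕ → ℕ → ℕ → ℕ
level q zero k = k
level q (suc f) k = ite (q <? bp k) k (level q f (suc k))

level-spec : ∀ q f k → q < bp (k + f) → q < bp (level q f k)
level-spec q zero k h = subst (λ z → q < bp z) (+-identityʳ k) h
level-spec q (suc f) k h = go (q <? bp k)
  where
  go : (d : Dec (q < bp k)) → q < bp (ite d k (level q f (suc k)))
  go (yes p) = p
  go (no _) = level-spec q f (suc k) (subst (λ z → q < bp z) (+-suc k f) h)

level-min : ∀ q f k k′ → k ≤ k′ → q < bp k′ → level q f k ≤ k′
level-min q zero k k′ le h = le
level-min q (suc f) k k′ le h = go (q <? bp k)
  where
  go : (d : Dec (q < bp k)) → ite d k (level q f (suc k)) ≤ k′
  go (yes _) = le
  go (no ¬p) = level-min q f (suc k) k′ (≤∧≢⇒< le (λ { refl → ¬p h })) h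

lg : ℕ → ℕ
lg q = level q q 0

lg-spec : ∀ q → q < bp (lg q)
lg-spec q = level-spec q q 0 (≤-trans (n<2^n q) (≤-trans (^-monoʳ-≤ 2 (m≤n*m q 16)) (≤-reflexive (sym (bp-def q)))))

lg-min : ∀ q k → q < bp k → lg q ≤ k
lg-min q k = level-min q q 0 k z≤n

-- The constant in `∑ log q / q ≪ log`: the `3` is that of `π-upper`, and `bp 1` is the ratio of the
-- end points of a level.
c₃ : ℕ
c₃ = 3 * bp 1

lgw : ℕ → ℚ
lgw q = ι (lg q) *ʳ inv q

J-lg : ∀ k → ∑ lgw (J k) ≤ʳ ι c₃
J-lg k = ≤ʳ-trans (∑-upper lgw (J k) (ι (suc k) *ʳ inv (bp k)) (λ {q} q∈ → let (pq , lo , hi) = ∈-J⁻ {k} q∈ in mul-mono (0≤ι _) (0≤inv q) (ι-mono (lg-min q (suc k) hi)) (inv-anti (1≤bp k) lo)))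
  (subst (_≤ʳ ι c₃) (trans (cong (inv (bp k) *ʳ_) (ι-* (suc k) (length (J k)))) (e (inv (bp k)) (ι (suc k)) (ι (length (J k))))) (≤ι*⇒inv*≤ (bp k) (1≤bp k) (subst (ι (suc k * length (J k)) ≤ʳ_) (ι-* (bp k) c₃) (ι-mono bound))))
  where
  e : ∀ b k l → b *ʳ (k *ʳ l) ≡ l *ʳ (k *ʳ b)
  e = solve-∀ ring
  bound : suc k * length (J k) ≤ bp k * c₃
  bound = ≤-trans (*-monoʳ-≤ (suc k) (length-filter (bp k ≤?_) (primesBelow (bp (suc k))))) (≤-trans (π-upper (suc k) (s≤s z≤n)) (≤-reflexive (trans (cong (3 *_) (bp-+ 1 k)) (sw (bp 1) (bp k)))))
    where
    sw : ∀ a b → 3 * (a * b) ≡ b * (3 * a)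
    sw = ℕSolver.solve-∀

Jr-lg : ∀ u n → ∑ lgw (Jr u n) ≤ʳ ι (n * c₃)
Jr-lg u zero = ℚₚ.≤-reflexive (sym ι0)
Jr-lg u (suc n) = subst₂ _≤ʳ_ (sym (∑-++ lgw (J (u + n)) (Jr u n))) (sym (ι-+ c₃ (n * c₃))) (add-mono (J-lg (u + n)) (Jr-lg u n))

PB-lg : ∀ a m → ∑ lgw (PB a m) ≤ʳ ι (2 ^ (a + m) * c₃)
PB-lg a zero = 0≤ι (2 ^ (a + 0) * c₃)
PB-lg a (suc m) = subst₂ _≤ʳ_ (sym (∑-++ lgw (block (a + m)) (PB a m))) (trans (sym (ι-+ (u * c₃) (u * c₃))) (cong ι (trans (sym (*-distribʳ-+ c₃ u u)) (cong (_* c₃) (sym (trans (cong (2 ^_) (+-suc a m)) (2^suc (a + m)))))))) (add-mono (Jr-lg u u) (PB-lg a m))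
  where
  u = 2 ^ (a + m)

product-lg : ∀ s → product s ≤ bp (sum (map lg s))
product-lg [] = ≤-reflexive (sym bp0)
product-lg (q ∷ s) = ≤-trans (*-mono-≤ (<⇒≤ (lg-spec q)) (product-lg s)) (≤-reflexive (sym (bp-+ (lg q) (sum (map lg s)))))

ι-sum-lg : ∀ s → ∑ (λ q → ι (lg q)) s ≡ ι (sum (map lg s))
ι-sum-lg [] = sym ι0
ι-sum-lg (q ∷ s) = trans (cong (ι (lg q) +ʳ_) (ι-sum-lg s)) (sym (ι-+ (lg q) (sum (map lg s))))

harmonic-upper : ∀ l → ∑< (2 ^ l) (λ m → inv (suc m)) ≤ʳ ι (suc l)
harmonic-upper zero = ℚₚ.≤-reflexive (trans (ℚₚ.+-identityˡ (inv 1)) (trans inv1 (sym ι1)))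
harmonic-upper (suc l) = subst₂ _≤ʳ_ (sym (trans (cong (λ z → ∑< z (λ m → inv (suc m))) (2^suc l)) (∑<-split u u (λ m → inv (suc m))))) (trans (cong (ι (suc l) +ʳ_) (sym ι1)) (trans (sym (ι-+ (suc l) 1)) (cong ι (+-comm (suc l) 1)))) (add-mono (harmonic-upper l) half)
  where
  u = 2 ^ l
  half : ∑< u (λ i → inv (suc (u + i))) ≤ʳ 1ℚ
  half = subst (∑< u (λ i → inv (suc (u + i))) ≤ʳ_) (trans (∑<-const u (inv u)) (ι-inv u (1≤2^ l))) (∑<-mono u (λ i _ → inv-anti (1≤2^ l) (≤-trans (m≤m+n u i) (n≤1+n (u + i)))))

harmonic-list : ∀ l xs → Unique xs → All (λ x → 1 ≤ x × x ≤ 2 ^ l) xs → ∑ inv xs ≤ʳ ι (suc l)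
harmonic-list l xs u h = ≤ʳ-trans (∑-⊆ inv xs (map suc (downFrom (2 ^ l))) 0≤inv u (λ {x} x∈ → mem x (All.lookup h x∈)))
  (subst (_≤ʳ ι (suc l)) (sym (trans (∑-map inv suc (downFrom (2 ^ l))) (sym (∑<-downFrom (2 ^ l) (λ m → inv (suc m)))))) (harmonic-upper l))
  where
  mem : ∀ x → 1 ≤ x × x ≤ 2 ^ l → x ∈ map suc (downFrom (2 ^ l))
  mem (suc x) (_ , le) = ∈-map⁺ suc (∈-downFrom⁺ le)

-- Write `q - 1 = r k`. The `k` are distinct, positive and at most `2 ^ l`, so a harmonic sum bounds
-- the sum of the `1 / k`.
progression-sum : ∀ l r qs → 1 ≤ r → Unique qs → All (λ q → 2 ≤ q × q ≤ 2 ^ l × r ∣ pred q) qs → ∑ inv qs ≤ʳ inv r *ʳ ι (suc l)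
progression-sum l r@(suc _) qs 1≤r u h = begin
  ∑ inv qs                                   ≤⟨ ∑-mono qs (λ {q} q∈ → bound q (All.lookup h q∈)) ⟩
  ∑ (λ q → inv r *ʳ inv (k q)) qs            ≡⟨ ∑-*ˡ (inv r) (inv ∘ k) qs ⟩
  inv r *ʳ ∑ (inv ∘ k) qs                    ≡⟨ cong (inv r *ʳ_) (sym (∑-map inv k qs)) ⟩
  inv r *ʳ ∑ inv (map k qs)                  ≤⟨ mulˡ (inv r) (0≤inv r) (harmonic-list l (map k qs) (unique-map-on qs u inj) (Allₚ.map⁺ (All.map kb h))) ⟩
  inv r *ʳ ι (suc l) ∎
  where
  open ℚₚ.≤-Reasoning
  k : ℕ → ℕ
  k q = pred q div r
  Ok : ℕ → Set
  Ok q = 2 ≤ q × q ≤ 2 ^ l × r ∣ pred q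
  back : ∀ q → Ok q → pred q ≡ k q * r
  back q (_ , _ , d) = sym (m/n*n≡m d)
  bound : ∀ q → Ok q → inv q ≤ʳ inv r *ʳ inv (k q)
  bound q ok@(2≤q , _ , _) = subst (inv q ≤ʳ_) (trans (cong inv (trans (back q ok) (*-comm (k q) r))) (inv-* r (k q))) (inv-anti (pred-mono-≤ 2≤q) pred[n]≤n)
  inj : ∀ {x y} → x ∈ qs → y ∈ qs → k x ≡ k y → x ≡ y
  inj {x} {y} x∈ y∈ e = pred-inj x y (All.lookup h x∈) (All.lookup h y∈) (trans (back x (All.lookup h x∈)) (trans (cong (_* r) e) (sym (back y (All.lookup h y∈)))))
    where
    pred-inj : ∀ x y → Ok x → Ok y → pred x ≡ pred y → x ≡ y
    pred-inj (suc x) (suc y) _ _ refl = refl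
    pred-inj zero _ (() , _)
    pred-inj (suc x) zero _ (() , _)
  kb : ∀ {q} → Ok q → 1 ≤ k q × k q ≤ 2 ^ l
  kb {q} ok@(2≤q , q≤ , _) = pos (k q) (subst (1 ≤_) (back q ok) (pred-mono-≤ 2≤q)) , ≤-trans (m/n≤m (pred q) r) (≤-trans pred[n]≤n q≤)
    where
    pos : ∀ x → 1 ≤ x * r → 1 ≤ x
    pos (suc x) _ = s≤s z≤n

∑-< : ∀ {A : Set} (f : A → ℚ) xs {x c} → (∀ y → 0ℚ ≤ʳ f y) → x ∈ xs → ∑ f xs <ʳ c → f x <ʳ c
∑-< f (y ∷ ys) 0≤f (here refl) lt = ℚₚ.≤-<-trans (≤+ʳ (∑ f ys) (∑-nonneg ys (λ {z} _ → 0≤f z))) lt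
∑-< f (y ∷ ys) 0≤f (there x∈) lt = ∑-< f ys 0≤f x∈ (ℚₚ.≤-<-trans (≤+ˡ (f y) (0≤f y)) lt)

<-+ˡ : ∀ {a b c} → 0ℚ ≤ʳ b → a +ʳ b <ʳ c → a <ʳ c
<-+ˡ {a} {b} 0≤b lt = ℚₚ.≤-<-trans (≤+ʳ b 0≤b) lt

<-+ʳ : ∀ {a b c} → 0ℚ ≤ʳ a → a +ʳ b <ʳ c → b <ʳ c
<-+ʳ {a} {b} 0≤a lt = ℚₚ.≤-<-trans (≤+ˡ a 0≤a) lt

∑-member : ∀ {A : Set} (f : A → ℚ) xs {x} → (∀ y → 0ℚ ≤ʳ f y) → x ∈ xs → f x ≤ʳ ∑ f xs
∑-member f (y ∷ ys) 0≤f (here refl) = ≤+ʳ (∑ f ys) (∑-nonneg ys (λ {z} _ → 0≤f z))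
∑-member f (y ∷ ys) 0≤f (there x∈) = ≤ʳ-trans (∑-member f ys 0≤f x∈) (≤+ˡ (f y) (0≤f y))

PB-split : ∀ a x y → PB a (x + y) ≡ PB (a + x) y ++ PB a x
PB-split a x zero = cong (PB a) (+-identityʳ x)
PB-split a x (suc y) = trans (cong (PB a) (+-suc x y)) (trans (cong₂ _++_ (cong block (sym (+-assoc a x y))) (PB-split a x y)) (sym (++-assoc (block (a + x + y)) (PB (a + x) y) (PB a x))))

_^ʳ_ : ℚ → ℕ → ℚ
x ^ʳ zero = 1ℚ
x ^ʳ suc n = x *ʳ x ^ʳ n

0≤^ʳ : ∀ {x} n → 0ℚ ≤ʳ x → 0ℚ ≤ʳ x ^ʳ n
0≤^ʳ zero h = 0≤1
0≤^ʳ (suc n) h = 0≤* h (0≤^ʳ n h)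

^ʳ-+ : ∀ x m n → x ^ʳ (m + n) ≡ x ^ʳ m *ʳ x ^ʳ n
^ʳ-+ x zero n = sym (ℚₚ.*-identityˡ (x ^ʳ n))
^ʳ-+ x (suc m) n = trans (cong (x *ʳ_) (^ʳ-+ x m n)) (sym (ℚₚ.*-assoc x (x ^ʳ m) (x ^ʳ n)))

-- κ = 1 + ¼ · 1/128 is the gain per block, υ = 512/513 its inverse.
κ υ : ℚ
κ = 1ℚ +ʳ inv 4 *ʳ inv 128
υ = ι 512 *ʳ inv 513

κ≡ : κ ≡ ι 513 *ʳ inv 512
κ≡ = trans (cong₂ _+ʳ_ (sym (ι-inv 512 (s≤s z≤n))) (sym (inv-* 4 128))) (trans (e (ι 512) (inv 512)) (cong (_*ʳ inv 512) (trans (cong (ι 512 +ʳ_) (sym ι1)) (sym (ι-+ 512 1)))))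
  where
  e : ∀ a i → a *ʳ i +ʳ i ≡ (a +ʳ 1ℚ) *ʳ i
  e = solve-∀ ring

υκ : υ *ʳ κ ≡ 1ℚ
υκ = trans (cong (υ *ʳ_) κ≡) (trans (e (ι 512) (inv 513) (ι 513) (inv 512)) (trans (cong₂ _*ʳ_ (ι-inv 512 (s≤s z≤n)) (ι-inv 513 (s≤s z≤n))) (ℚₚ.*-identityˡ 1ℚ)))
  where
  e : ∀ a b c d → a *ʳ b *ʳ (c *ʳ d) ≡ a *ʳ d *ʳ (c *ʳ b)
  e = solve-∀ ring

0≤υ : 0ℚ ≤ʳ υ
0≤υ = 0≤* (0≤ι 512) (0≤inv 513)

0≤κ : 0ℚ ≤ʳ κ
0≤κ = 0≤+ 0≤1 (0≤* (0≤inv 4) (0≤inv 128))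

υ≤1 : υ ≤ʳ 1ℚ
υ≤1 = subst (υ ≤ʳ_) (ι-inv 513 (s≤s z≤n)) (mulʳ (inv 513) (0≤inv 513) (ι-mono (n≤1+n 512)))

513υ : ι 513 *ʳ υ +ʳ 1ℚ ≡ ι 513
513υ = trans (cong (_+ʳ 1ℚ) (trans (e (ι 513) (ι 512) (inv 513)) (trans (cong (ι 512 *ʳ_) (ι-inv 513 (s≤s z≤n))) (ℚₚ.*-identityʳ (ι 512))))) (trans (cong (ι 512 +ʳ_) (sym ι1)) (sym (ι-+ 512 1)))
  where
  e : ∀ a b c → a *ʳ (b *ʳ c) ≡ b *ʳ (a *ʳ c)
  e = solve-∀ ring

υκ^ : ∀ n → υ ^ʳ n *ʳ κ ^ʳ n ≡ 1ℚ
υκ^ zero = ℚₚ.*-identityˡ 1ℚ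
υκ^ (suc n) = trans (e υ (υ ^ʳ n) κ (κ ^ʳ n)) (trans (cong₂ _*ʳ_ υκ (υκ^ n)) (ℚₚ.*-identityˡ 1ℚ))
  where
  e : ∀ a b c d → a *ʳ b *ʳ (c *ʳ d) ≡ a *ʳ c *ʳ (b *ʳ d)
  e = solve-∀ ring

υ^-anti : ∀ {m n} → m ≤ n → υ ^ʳ n ≤ʳ υ ^ʳ m
υ^-anti {m} {n} le = subst₂ _≤ʳ_ (trans (sym (^ʳ-+ υ m (n ∸ m))) (cong (υ ^ʳ_) (m+[n∸m]≡n le))) (ℚₚ.*-identityʳ (υ ^ʳ m)) (mulˡ (υ ^ʳ m) (0≤^ʳ m 0≤υ) (≤1 (n ∸ m)))
  where
  ≤1 : ∀ n → υ ^ʳ n ≤ʳ 1ℚ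
  ≤1 zero = ℚₚ.≤-refl
  ≤1 (suc n) = subst (υ ^ʳ suc n ≤ʳ_) (ℚₚ.*-identityˡ 1ℚ) (mul-mono 0≤υ (0≤^ʳ n 0≤υ) υ≤1 (≤1 n))

bernoulli : ∀ n → 1ℚ +ʳ ι n *ʳ (inv 4 *ʳ inv 128) ≤ʳ κ ^ʳ n
bernoulli zero = ℚₚ.≤-reflexive (trans (cong (λ z → 1ℚ +ʳ z *ʳ (inv 4 *ʳ inv 128)) ι0) (trans (cong (1ℚ +ʳ_) (ℚₚ.*-zeroˡ (inv 4 *ʳ inv 128))) (ℚₚ.+-identityʳ 1ℚ)))
bernoulli (suc n) = ≤ʳ-trans (≤-byʳ (x *ʳ (ι n *ʳ x)) (0≤* 0≤x (0≤* (0≤ι n) 0≤x)) (trans (e x (ι n)) (cong (λ z → 1ℚ +ʳ z *ʳ x +ʳ x *ʳ (ι n *ʳ x)) (trans (cong (_+ʳ ι n) (sym ι1)) (sym (ι-+ 1 n)))))) (mulˡ κ 0≤κ (bernoulli n))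
  where
  x = inv 4 *ʳ inv 128
  0≤x = 0≤* (0≤inv 4) (0≤inv 128)
  e : ∀ x n → (1ℚ +ʳ x) *ʳ (1ℚ +ʳ n *ʳ x) ≡ 1ℚ +ʳ (1ℚ +ʳ n) *ʳ x +ʳ x *ʳ (n *ʳ x)
  e = solve-∀ ring

-- Bernoulli gives `κ ^ 512 ≥ 1 + 512/512 = 2`, so `512` factors `υ` halve.
υ^-half : ∀ y → υ ^ʳ (y * 512) ≤ʳ inv (2 ^ y)
υ^-half zero = ℚₚ.≤-reflexive (sym inv1)
υ^-half (suc y) = subst₂ _≤ʳ_ (sym (^ʳ-+ υ 512 (y * 512))) (sym (inv-* 2 (2 ^ y))) (mul-mono (0≤^ʳ 512 0≤υ) (0≤^ʳ (y * 512) 0≤υ) half (υ^-half y))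
  where
  two : ι 2 ≤ʳ κ ^ʳ 512
  two = subst (_≤ʳ κ ^ʳ 512) (trans (cong (1ℚ +ʳ_) (trans (cong (ι 512 *ʳ_) (sym (inv-* 4 128))) (ι-inv 512 (s≤s z≤n)))) (sym ι2)) (bernoulli 512)
  half : υ ^ʳ 512 ≤ʳ inv 2
  half = ι-cancelˡ 2 (s≤s z≤n) (subst₂ _≤ʳ_ (ℚₚ.*-comm (υ ^ʳ 512) (ι 2)) (trans (υκ^ 512) (sym (ι-inv 2 (s≤s z≤n)))) (mulˡ (υ ^ʳ 512) (0≤^ʳ 512 0≤υ) two))

2^2^inv : ∀ a b → ι (2 ^ a) *ʳ inv (2 ^ (a + b)) ≡ inv (2 ^ b)
2^2^inv a b = trans (cong (ι (2 ^ a) *ʳ_) (trans (cong inv (^-distribˡ-+-* 2 a b)) (inv-* (2 ^ a) (2 ^ b)))) (trans (sym (ℚₚ.*-assoc (ι (2 ^ a)) (inv (2 ^ a)) (inv (2 ^ b)))) (trans (cong (_*ʳ inv (2 ^ b)) (ι-inv (2 ^ a) (1≤2^ a))) (ℚₚ.*-identityˡ (inv (2 ^ b)))))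

-- The `13` is `10 + 3`: `513 ≤ 2 ^ 10`, and `2 ^ 3` gives the target `1/8`.
υ-tail : ∀ K x → (K + 13) * 512 ≤ x → ι (2 ^ K) *ʳ (ι 513 *ʳ υ ^ʳ x) ≤ʳ inv 8
υ-tail K x le = begin
  ι (2 ^ K) *ʳ (ι 513 *ʳ υ ^ʳ x)                      ≤⟨ mulˡ (ι (2 ^ K)) (0≤ι (2 ^ K)) (mul-mono (0≤ι 513) (0≤^ʳ x 0≤υ) (ι-mono (toWitness {a? = 513 ≤? 1024} tt)) (≤ʳ-trans (υ^-anti le) (υ^-half (K + 13)))) ⟩
  ι (2 ^ K) *ʳ (ι (2 ^ 10) *ʳ inv (2 ^ (K + 13)))      ≡⟨ e (ι (2 ^ K)) (ι (2 ^ 10)) (inv (2 ^ (K + 13))) ⟩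
  ι (2 ^ 10) *ʳ (ι (2 ^ K) *ʳ inv (2 ^ (K + 13)))      ≡⟨ cong (ι (2 ^ 10) *ʳ_) (2^2^inv K 13) ⟩
  ι (2 ^ 10) *ʳ inv (2 ^ (10 + 3))                     ≡⟨ 2^2^inv 10 3 ⟩
  inv 8 ∎
  where
  open ℚₚ.≤-Reasoning
  e : ∀ a b c → a *ʳ (b *ʳ c) ≡ b *ʳ (a *ʳ c)
  e = solve-∀ ring

-- `513` is the value of `1 / (1 - υ)`, and the proof telescopes with `513 υ + 1 = 513`.
geometric-up : ∀ j n → ∑ (λ i → υ ^ʳ (j + i)) (downFrom n) ≤ʳ ι 513 *ʳ υ ^ʳ j
geometric-up j n = ≤-byʳ (ι 513 *ʳ υ ^ʳ (j + n)) (0≤* (0≤ι 513) (0≤^ʳ (j + n) 0≤υ)) (sym (exact n))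
  where
  exact : ∀ n → ∑ (λ i → υ ^ʳ (j + i)) (downFrom n) +ʳ ι 513 *ʳ υ ^ʳ (j + n) ≡ ι 513 *ʳ υ ^ʳ j
  exact zero = trans (ℚₚ.+-identityˡ (ι 513 *ʳ υ ^ʳ (j + 0))) (cong (λ z → ι 513 *ʳ υ ^ʳ z) (+-identityʳ j))
  exact (suc n) = trans (trans (cong (λ z → υ ^ʳ (j + n) +ʳ S +ʳ ι 513 *ʳ υ ^ʳ z) (+-suc j n)) (e (υ ^ʳ (j + n)) S (ι 513) υ)) (trans (cong (λ z → S +ʳ z *ʳ υ ^ʳ (j + n)) 513υ) (exact n))
    where
    S = ∑ (λ i → υ ^ʳ (j + i)) (downFrom n)
    e : ∀ p S c u → p +ʳ S +ʳ c *ʳ (u *ʳ p) ≡ S +ʳ (c *ʳ u +ʳ 1ℚ) *ʳ p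
    e = solve-∀ ring

geometric-down : ∀ T n n′ → n′ ≤ n → ∑ (λ i → υ ^ʳ (n + T ∸ i)) (downFrom n′) ≤ʳ ι 513 *ʳ υ ^ʳ (n + T ∸ n′)
geometric-down T n zero le = 0≤* (0≤ι 513) (0≤^ʳ (n + T) 0≤υ)
geometric-down T n (suc n′) le = begin
  υ ^ʳ (n + T ∸ n′) +ʳ ∑ (λ i → υ ^ʳ (n + T ∸ i)) (downFrom n′)   ≤⟨ ℚₚ.+-monoʳ-≤ (υ ^ʳ (n + T ∸ n′)) (geometric-down T n n′ (<⇒≤ le)) ⟩
  υ ^ʳ (n + T ∸ n′) +ʳ ι 513 *ʳ υ ^ʳ (n + T ∸ n′)                  ≡⟨ cong (λ z → υ ^ʳ z +ʳ ι 513 *ʳ υ ^ʳ z) eq ⟩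
  υ ^ʳ suc x +ʳ ι 513 *ʳ υ ^ʳ suc x                                ≤⟨ ℚₚ.+-monoˡ-≤ (ι 513 *ʳ υ ^ʳ suc x) (υ^-anti (n≤1+n x)) ⟩
  υ ^ʳ x +ʳ ι 513 *ʳ (υ *ʳ υ ^ʳ x)                                 ≡⟨ e (υ ^ʳ x) (ι 513) υ ⟩
  (ι 513 *ʳ υ +ʳ 1ℚ) *ʳ υ ^ʳ x                                     ≡⟨ cong (_*ʳ υ ^ʳ x) 513υ ⟩
  ι 513 *ʳ υ ^ʳ x ∎
  where
  open ℚₚ.≤-Reasoning
  x = n + T ∸ suc n′
  eq : n + T ∸ n′ ≡ suc x
  eq = sym (suc[m]-∸ (≤-trans le (m≤m+n n T)))
    where
    suc[m]-∸ : ∀ {m k} → suc k ≤ m → suc (m ∸ suc k) ≡ m ∸ k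
    suc[m]-∸ {suc m} {zero} _ = refl
    suc[m]-∸ {suc m} {suc k} (s≤s h) = suc[m]-∸ h
  e : ∀ p c u → p +ʳ c *ʳ (u *ʳ p) ≡ (c *ʳ u +ʳ 1ℚ) *ʳ p
  e = solve-∀ ring

halves : ∀ n → ∑ (λ i → inv (2 ^ (i + 4))) (downFrom n) ≤ʳ inv 8
halves n = ≤ʳ-trans (≤+ʳ (inv (2 ^ (n + 3))) (0≤inv (2 ^ (n + 3)))) (ℚₚ.≤-reflexive (exact n))
  where
  exact : ∀ n → ∑ (λ i → inv (2 ^ (i + 4))) (downFrom n) +ʳ inv (2 ^ (n + 3)) ≡ inv 8
  exact zero = ℚₚ.+-identityˡ (inv 8)
  exact (suc n) = trans (trans (cong (λ z → inv z +ʳ S +ʳ inv (2 ^ (suc n + 3))) (cong (2 ^_) (+-suc n 3))) (trans (cong (λ z → z +ʳ S +ʳ z) (inv-* 2 (2 ^ (n + 3)))) (e (inv 2) (inv (2 ^ (n + 3))) S))) (trans (cong (λ z → S +ʳ z *ʳ inv (2 ^ (n + 3))) ½+½) (trans (cong (S +ʳ_) (ℚₚ.*-identityˡ (inv (2 ^ (n + 3))))) (exact n)))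
    where
    S = ∑ (λ i → inv (2 ^ (i + 4))) (downFrom n)
    e : ∀ h p S → h *ʳ p +ʳ S +ʳ h *ʳ p ≡ S +ʳ (h +ʳ h) *ʳ p
    e = solve-∀ ring

-- The window of blocks b, …, b + w - 1, in which prime factors q with some r ∈ R dividing q - 1 are sought.
module Scale (b w : ℕ) (R : List ℕ) where

  InW : ℕ → Set
  InW q = bp (2 ^ b) ≤ q × q < bp (2 ^ (b + w))

  inW? : Decidable InW
  inW? q = (bp (2 ^ b) ≤? q) ×-dec (q <? bp (2 ^ (b + w)))

  Good : ℕ → Set
  Good q = InW q × hits R q

  good? : Decidable Good
  good? q = inW? q ×-dec hits? R q

  open Half good? public

  class? : ∀ r → Decidable (λ q → InW q × r ∣ pred q)
  class? r q = inW? q ×-dec (r ∣? pred q)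

  x : ℕ → ℕ → ℚ
  x r q = 𝟙 (class? r q)

  0≤x : ∀ r q → 0ℚ ≤ʳ x r q
  0≤x r q = 0≤𝟙 (class? r q)

  clashes : List ℕ → ℚ
  clashes s = ∑ (λ r → pairs (x r) s) R

  0≤pairs : ∀ r s → 0ℚ ≤ʳ pairs (x r) s
  0≤pairs r [] = ℚₚ.≤-refl
  0≤pairs r (q ∷ s) = 0≤+ (0≤* (0≤x r q) (∑-nonneg s (λ {y} _ → 0≤x r y))) (0≤pairs r s)

  0≤clashes : ∀ s → 0ℚ ≤ʳ clashes s
  0≤clashes s = ∑-nonneg R (λ {r} _ → 0≤pairs r s)

  0≤mulθ : ∀ s → 0ℚ ≤ʳ mul θ s
  0≤mulθ [] = 0≤1
  0≤mulθ (q ∷ s) = 0≤* (0≤θ q) (0≤mulθ s)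

  mulθ : ∀ s → mul θ s ≡ inv (2 ^ length (filter good? s))
  mulθ [] = sym inv1
  mulθ (q ∷ s) = go (good? q)
    where
    go : Dec (Good q) → θ q *ʳ mul θ s ≡ inv (2 ^ length (filter good? (q ∷ s)))
    go (yes g) = trans (cong₂ _*ʳ_ (θ-yes g) (mulθ s)) (trans (sym (inv-* 2 (2 ^ length (filter good? s)))) (cong (λ z → inv (2 ^ length z)) (sym (filter-accept good? g))))
    go (no ¬g) = trans (cong (_*ʳ mul θ s) (θ-no ¬g)) (trans (ℚₚ.*-identityˡ (mul θ s)) (trans (mulθ s) (cong (λ z → inv (2 ^ length z)) (sym (filter-reject good? ¬g)))))

  many-good : ∀ K s → ι (2 ^ K) *ʳ mul θ s <ʳ 1ℚ → K ≤ length (filter good? s)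
  many-good K s lt with K ≤? length (filter good? s)
  ... | yes h = h
  ... | no ¬h = ⊥-elim (ℚₚ.<-irrefl refl (ℚₚ.<-≤-trans lt (subst₂ _≤ʳ_ (ι-inv (2 ^ N) (1≤2^ N)) (cong (ι (2 ^ K) *ʳ_) (sym (mulθ s))) (mulʳ (inv (2 ^ N)) (0≤inv (2 ^ N)) (ι-mono (^-monoʳ-≤ 2 (<⇒≤ (≰⇒> ¬h))))))))
    where
    N = length (filter good? s)

  -- Every good `q` in `s` takes some `r ∈ R` dividing `q - 1`. Two of them taking the same `r`
  -- would contribute `1` to `pairs (x r) s`, so the chosen `r` are distinct.
  select : ∀ s → (∀ {r} → r ∈ R → pairs (x r) s <ʳ 1ℚ) →
    ∃[ rs ] (Unique rs × All (λ r → r ∈ R × (∃[ q ] (q ∈ s × InW q × r ∣ pred q))) rs × length rs ≡ length (filter good? s))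
  select [] h = [] , [] , [] , refl
  select (q ∷ s) h with select s (λ {r} r∈ → <-+ʳ (0≤* (0≤x r q) (∑-nonneg s (λ {y} _ → 0≤x r y))) (h r∈)) | good? q
  ... | rs , u , al , len | no ¬g = rs , u , All.map (λ (r∈ , q′ , q′∈ , rest) → r∈ , q′ , there q′∈ , rest) al , trans len (cong length (sym (filter-reject good? ¬g)))
  ... | rs , u , al , len | yes g@(inw , hit) = let (r , r∈ , r∣) = find hit in
      r ∷ rs , All.tabulate (λ {r′} r′∈ e → fresh r r∈ r∣ (subst (_∈ rs) (sym e) r′∈)) ∷ u ,
      (r∈ , q , here refl , inw , r∣) ∷ All.map (λ (r∈ , q′ , q′∈ , rest) → r∈ , q′ , there q′∈ , rest) al ,
      trans (cong suc len) (cong length (sym (filter-accept good? g)))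
    where
    fresh : ∀ r → r ∈ R → r ∣ pred q → r ∉ rs
    fresh r r∈ r∣ r∈rs = let (_ , q′ , q′∈ , inw′ , r∣′) = All.lookup al r∈rs in
      ℚₚ.<-irrefl refl (ℚₚ.<-≤-trans (<-+ˡ (0≤pairs r s) (h r∈)) (subst (_≤ʳ x r q *ʳ ∑ (x r) s) (ℚₚ.*-identityˡ 1ℚ)
        (mul-mono 0≤1 0≤1 (ℚₚ.≤-reflexive (sym (𝟙-yes (class? r q) (inw , r∣)))) (subst (_≤ʳ ∑ (x r) s) (𝟙-yes (class? r q′) (inw′ , r∣′)) (∑-member (x r) s (0≤x r) q′∈)))))

  -- The Euler products factor over the parts above, inside and below the window. Each block inside
  -- gains a factor `κ`; outside only `θ ≤ 1` is used.
  window-gain : ∀ j₀ i e → b ≡ j₀ + i → (∀ y → y < w → inv 128 ≤ʳ ∑ inv (filter (hits? R) (block (b + y)))) →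
    PP θ (PB j₀ (i + w + e)) *ʳ κ ^ʳ w ≤ʳ W (PB j₀ (i + w + e))
  window-gain j₀ i e b≡ h = subst₂ (λ u v → u *ʳ κ ^ʳ w ≤ʳ v) (sym (split θ)) (sym (split one)) (begin
    PP θ X *ʳ (PP θ Y *ʳ PP θ Z) *ʳ κ ^ʳ w       ≡⟨ v (PP θ X) (PP θ Y) (PP θ Z) (κ ^ʳ w) ⟩
    PP θ X *ʳ ((PP θ Y *ʳ κ ^ʳ w) *ʳ PP θ Z)     ≤⟨ mul-mono (0≤PP θ X 0≤θ) (0≤* (0≤* (0≤PP θ Y 0≤θ) (0≤^ʳ w 0≤κ)) (0≤PP θ Z 0≤θ)) (PP-mono X 0≤θ θ≤1)
                                                    (mul-mono (0≤* (0≤PP θ Y 0≤θ) (0≤^ʳ w 0≤κ)) (0≤PP θ Z 0≤θ) (middle w ≤-refl) (PP-mono Z 0≤θ θ≤1)) ⟩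
    W X *ʳ (W Y *ʳ W Z) ∎)
    where
    open ℚₚ.≤-Reasoning
    X = PB (j₀ + (i + w)) e
    Y = PB b w
    Z = PB j₀ i
    v : ∀ x y z k → x *ʳ (y *ʳ z) *ʳ k ≡ x *ʳ ((y *ʳ k) *ʳ z)
    v = solve-∀ ring
    split : ∀ η → PP η (PB j₀ (i + w + e)) ≡ PP η X *ʳ (PP η Y *ʳ PP η Z)
    split η = trans (cong (PP η) (trans (PB-split j₀ (i + w) e) (cong (X ++_) (trans (PB-split j₀ i w) (cong (λ z → PB z w ++ Z) (sym b≡)))))) (trans (PP-++ η X (Y ++ Z)) (cong (PP η X *ʳ_) (PP-++ η Y Z)))
    middle : ∀ n → n ≤ w → PP θ (PB b n) *ʳ κ ^ʳ n ≤ʳ W (PB b n)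
    middle zero _ = ℚₚ.≤-reflexive (ℚₚ.*-identityˡ 1ℚ)
    middle (suc n) n<w = subst₂ _≤ʳ_ (trans (v′ (PP θ (block (b + n))) κ (PP θ (PB b n)) (κ ^ʳ n)) (cong (_*ʳ κ ^ʳ suc n) (sym (PP-++ θ (block (b + n)) (PB b n))))) (sym (PP-++ one (block (b + n)) (PB b n)))
      (mul-mono (0≤* (0≤PP θ (block (b + n)) 0≤θ) 0≤κ) (0≤* (0≤PP θ (PB b n) 0≤θ) (0≤^ʳ n 0≤κ)) (≤ʳ-trans (mulˡ (PP θ (block (b + n))) (0≤PP θ (block (b + n)) 0≤θ) (ℚₚ.+-monoʳ-≤ 1ℚ (mulˡ (inv 4) (0≤inv 4) enough))) (gain (block (b + n)))) (middle n (<⇒≤ n<w)))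
      where
      v′ : ∀ a k p q → a *ʳ k *ʳ (p *ʳ q) ≡ a *ʳ p *ʳ (k *ʳ q)
      v′ = solve-∀ ring
      enough : inv 128 ≤ʳ ∑ inv (filter good? (block (b + n)))
      enough = ≤ʳ-trans (h n n<w) (∑-⊆ inv (filter (hits? R) (block (b + n))) (filter good? (block (b + n))) 0≤inv
        (Uniqueₚ.filter⁺ (hits? R) (sorted⇒unique (Jr-sorted (2 ^ (b + n)) (2 ^ (b + n)))))
        (λ {q} q∈ → let (q∈b , hit) = ∈-filter⁻ (hits? R) {xs = block (b + n)} q∈ ; (_ , lo , hi) = block⁻ (b + n) q∈b in
          ∈-filter⁺ good? q∈b ((≤-trans (bp-mono (^-monoʳ-≤ 2 (m≤m+n b n))) lo , ≤-trans hi (bp-mono (^-monoʳ-≤ 2 (≤-trans (≤-reflexive (sym (+-suc b n))) (+-monoʳ-≤ b n<w))))) , hit)))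

  σ-bound : ∀ ps l r → AllPairs _>_ ps → All Prime ps → 1 ≤ r → bp (2 ^ (b + w)) ≤ 2 ^ l → ∑ (λ p → x r p *ʳ inv p) ps ≤ʳ inv r *ʳ ι (suc l)
  σ-bound ps l r srt pps 1≤r le = subst (_≤ʳ inv r *ʳ ι (suc l)) (∑-filter (class? r) inv ps)
    (progression-sum l r (filter (class? r) ps) 1≤r (Uniqueₚ.filter⁺ (class? r) (sorted⇒unique srt))
      (All.tabulate (λ {q} q∈ → let (q∈ps , (_ , hi) , d) = ∈-filter⁻ (class? r) {xs = ps} q∈ in prime⇒≥2 (All.lookup pps q∈ps) , ≤-trans (<⇒≤ hi) le , d)))

  -- For one `r` the mean number of clashing pairs is at most `W (l / r)²` up to shifting `l` by
  -- one. Summing over `r ≥ B` leaves `l² / B` times a harmonic sum, hence `l³ / B`.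
  clashes-bound : ∀ ps l B → AllPairs _>_ ps → All Prime ps → bp (2 ^ (b + w)) ≤ 2 ^ l → 1 ≤ B → Unique R → All (λ r → B ≤ r × r ≤ 2 ^ l) R →
    𝔼 ps clashes ≤ʳ W ps *ʳ (inv B *ʳ ι (suc l * suc l * suc l))
  clashes-bound ps l B srt pps le 1≤B uR hR = begin
    𝔼 ps clashes                                              ≡⟨ 𝔼-∑ ps (λ r → pairs (x r)) R ⟩
    ∑ (λ r → 𝔼 ps (pairs (x r))) R                            ≤⟨ ∑-mono R (λ {r} r∈ → each r (All.lookup hR r∈)) ⟩
    ∑ (λ r → (W ps *ʳ (inv B *ʳ (M *ʳ M))) *ʳ inv r) R        ≡⟨ ∑-*ˡ (W ps *ʳ (inv B *ʳ (M *ʳ M))) inv R ⟩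
    (W ps *ʳ (inv B *ʳ (M *ʳ M))) *ʳ ∑ inv R                  ≤⟨ mulˡ (W ps *ʳ (inv B *ʳ (M *ʳ M))) (0≤* (0≤W ps) (0≤* (0≤inv B) (0≤* (0≤ι (suc l)) (0≤ι (suc l))))) (harmonic-list l R uR (All.map (λ (lo , hi) → ≤-trans 1≤B lo , hi) hR)) ⟩
    (W ps *ʳ (inv B *ʳ (M *ʳ M))) *ʳ M                        ≡⟨ e (W ps) (inv B) M ⟩
    W ps *ʳ (inv B *ʳ (M *ʳ M *ʳ M))                          ≡⟨ cong (λ z → W ps *ʳ (inv B *ʳ z)) (sym (trans (ι-* (suc l * suc l) (suc l)) (cong (_*ʳ M) (ι-* (suc l) (suc l))))) ⟩
    W ps *ʳ (inv B *ʳ ι (suc l * suc l * suc l)) ∎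
    where
    open ℚₚ.≤-Reasoning
    M = ι (suc l)
    e : ∀ w b m → (w *ʳ (b *ʳ (m *ʳ m))) *ʳ m ≡ w *ʳ (b *ʳ (m *ʳ m *ʳ m))
    e = solve-∀ ring
    each : ∀ r → B ≤ r × r ≤ 2 ^ l → 𝔼 ps (pairs (x r)) ≤ʳ (W ps *ʳ (inv B *ʳ (M *ʳ M))) *ʳ inv r
    each r (lo , hi) = begin
      𝔼 ps (pairs (x r))                                       ≤⟨ 𝔼-pairs (x r) (0≤x r) ps ⟩
      W ps *ʳ (σ *ʳ σ)                                         ≤⟨ mulˡ (W ps) (0≤W ps) (mul-mono 0≤σ 0≤σ σ≤ σ≤) ⟩
      W ps *ʳ (inv r *ʳ M *ʳ (inv r *ʳ M))                     ≡⟨ e₁ (W ps) (inv r) M ⟩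
      W ps *ʳ (M *ʳ M) *ʳ inv r *ʳ inv r                       ≤⟨ mulʳ (inv r) (0≤inv r) (mulˡ (W ps *ʳ (M *ʳ M)) (0≤* (0≤W ps) (0≤* (0≤ι (suc l)) (0≤ι (suc l)))) (inv-anti 1≤B lo)) ⟩
      W ps *ʳ (M *ʳ M) *ʳ inv B *ʳ inv r                       ≡⟨ e₂ (W ps) (inv B) M (inv r) ⟩
      (W ps *ʳ (inv B *ʳ (M *ʳ M))) *ʳ inv r ∎
      where
      σ = ∑ (λ p → x r p *ʳ inv p) ps
      0≤σ : 0ℚ ≤ʳ σ
      0≤σ = ∑-nonneg ps (λ {q} _ → 0≤* (0≤x r q) (0≤inv q))
      σ≤ : σ ≤ʳ inv r *ʳ M
      σ≤ = σ-bound ps l r srt pps (≤-trans 1≤B lo) le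
      e₁ : ∀ w i m → w *ʳ (i *ʳ m *ʳ (i *ʳ m)) ≡ w *ʳ (m *ʳ m) *ʳ i *ʳ i
      e₁ = solve-∀ ring
      e₂ : ∀ w b m i → w *ʳ (m *ʳ m) *ʳ b *ʳ i ≡ (w *ʳ (b *ʳ (m *ʳ m))) *ʳ i
      e₂ = solve-∀ ring

-- At least half of the mass serves all scales below the top.

module GoodPart (t K a₀ T n : ℕ) (rich : ∀ a → ι 128 ≤ʳ ∑ inv (PB a t)) (a₀≥ : t + 10 ≤ a₀)
  (j₀≥ : (K + 13) * 512 ≤ a₀ + t + 4) (T≥ : (K + 13) * 512 ≤ T) where

  j₀ m Λ : ℕ
  j₀ = a₀ + t + 4
  m = n + T
  Λ = 2 ^ (j₀ + m) * c₃

  𝒫 : List ℕ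
  𝒫 = PB j₀ m

  -- The window of scale `i` starts as soon as the sieve by `Rᵢ i` works. The cap `bᵢ i` keeps the
  -- logarithm of its upper end quadratic in that of the least `r`, so clashes stay rare; the cap
  -- `m ∸ i` keeps it inside `𝒫`.
  bᵢ wᵢ : ℕ → ℕ
  bᵢ i = j₀ + i
  wᵢ i = bᵢ i ⊓ (m ∸ i)

  Rᵢ : ℕ → List ℕ
  Rᵢ i = PB (a₀ + i) t

  module S (i : ℕ) = Scale (bᵢ i) (wᵢ i) (Rᵢ i)

  1≤Λ : 1 ≤ 8 * Λ
  1≤Λ = *-mono-≤ {1} {8} (s≤s z≤n) (*-mono-≤ (1≤2^ (j₀ + m)) (*-mono-≤ {1} {3} (s≤s z≤n) (1≤bp 1)))

  term : ℕ → List ℕ → ℚ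
  term i s = ι (2 ^ K) *ʳ mul (S.θ i) s +ʳ S.clashes i s

  size : List ℕ → ℚ
  size s = inv (8 * Λ) *ʳ ∑ (λ q → ι (lg q)) s

  -- Φ s < 1 forces every scale to have K good primes without clashes, and s to be small.
  Φ : List ℕ → ℚ
  Φ s = ∑ (λ i → term i s) (downFrom n) +ʳ size s

  0≤term : ∀ i s → 0ℚ ≤ʳ term i s
  0≤term i s = 0≤+ (0≤* (0≤ι (2 ^ K)) (S.0≤mulθ i s)) (S.0≤clashes i s)

  0≤size : ∀ s → 0ℚ ≤ʳ size s
  0≤size s = 0≤* (0≤inv (8 * Λ)) (∑-nonneg s (λ {q} _ → 0≤ι (lg q)))

  0≤Φ : ∀ s → 0ℚ ≤ʳ Φ s
  0≤Φ s = 0≤+ (∑-nonneg (downFrom n) (λ {i} _ → 0≤term i s)) (0≤size s)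

  pp : All Prime 𝒫
  pp = All.tabulate (λ q∈ → proj₁ (PB⁻ j₀ m q∈))

  b≡ : ∀ i → bᵢ i ≡ a₀ + i + t + 4
  b≡ i = e a₀ t i
    where
    e : ∀ a t i → a + t + 4 + i ≡ a + i + t + 4
    e = ℕSolver.solve-∀

  -- A window of `w` blocks gains `κ ^ w`, so the exponential moment is at most `W υ ^ w`. Replacing
  -- the minimum in `wᵢ` by a sum of two terms makes the total over `i` two geometric series.
  rare-few : ∀ i → i < n → ι (2 ^ K) *ʳ 𝔼 𝒫 (mul (S.θ i)) ≤ʳ W 𝒫 *ʳ (ι (2 ^ K) *ʳ (υ ^ʳ (j₀ + i) +ʳ υ ^ʳ (m ∸ i)))
  rare-few i i<n = begin
    ι (2 ^ K) *ʳ 𝔼 𝒫 (mul (S.θ i))                    ≡⟨ cong (ι (2 ^ K) *ʳ_) (𝔼-mul (S.θ i) 𝒫) ⟩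
    ι (2 ^ K) *ʳ PP (S.θ i) 𝒫                          ≤⟨ mulˡ (ι (2 ^ K)) (0≤ι (2 ^ K)) (≤ʳ-trans step (mulˡ (W 𝒫) (0≤W 𝒫) (min-sum (⊓-sel (bᵢ i) (m ∸ i))))) ⟩
    ι (2 ^ K) *ʳ (W 𝒫 *ʳ (υ ^ʳ (j₀ + i) +ʳ υ ^ʳ (m ∸ i)))  ≡⟨ e (ι (2 ^ K)) (W 𝒫) _ ⟩
    W 𝒫 *ʳ (ι (2 ^ K) *ʳ (υ ^ʳ (j₀ + i) +ʳ υ ^ʳ (m ∸ i))) ∎
    where
    open ℚₚ.≤-Reasoning
    w = wᵢ i
    e : ∀ a b c → a *ʳ (b *ʳ c) ≡ b *ʳ (a *ʳ c)
    e = solve-∀ ring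
    i≤m : i ≤ m
    i≤m = ≤-trans (<⇒≤ i<n) (m≤m+n n T)
    fits : i + w + (m ∸ (i + w)) ≡ m
    fits = m+[n∸m]≡n (≤-trans (+-monoʳ-≤ i (m⊓n≤n (bᵢ i) (m ∸ i))) (≤-reflexive (m+[n∸m]≡n i≤m)))
    gained : PP (S.θ i) 𝒫 *ʳ κ ^ʳ w ≤ʳ W 𝒫
    gained = subst (λ z → PP (S.θ i) (PB j₀ z) *ʳ κ ^ʳ w ≤ʳ W (PB j₀ z)) fits (S.window-gain i j₀ i (m ∸ (i + w)) refl
      (λ y _ → hits-block (a₀ + i) t (bᵢ i + y) (≤-trans (≤-reflexive (sym (b≡ i))) (m≤m+n (bᵢ i) y)) (sorted⇒unique (PB-sorted (a₀ + i) t)) (λ r∈ → r∈) (rich (a₀ + i))))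
    step : PP (S.θ i) 𝒫 ≤ʳ W 𝒫 *ʳ υ ^ʳ w
    step = subst (_≤ʳ W 𝒫 *ʳ υ ^ʳ w) (trans (ℚₚ.*-assoc (PP (S.θ i) 𝒫) (κ ^ʳ w) (υ ^ʳ w)) (trans (cong (PP (S.θ i) 𝒫 *ʳ_) (trans (ℚₚ.*-comm (κ ^ʳ w) (υ ^ʳ w)) (υκ^ w))) (ℚₚ.*-identityʳ (PP (S.θ i) 𝒫)))) (mulʳ (υ ^ʳ w) (0≤^ʳ w 0≤υ) gained)
    min-sum : w ≡ bᵢ i ⊎ w ≡ m ∸ i → υ ^ʳ w ≤ʳ υ ^ʳ (j₀ + i) +ʳ υ ^ʳ (m ∸ i)
    min-sum (inj₁ eq) = subst (λ z → υ ^ʳ z ≤ʳ υ ^ʳ (j₀ + i) +ʳ υ ^ʳ (m ∸ i)) (sym eq) (≤+ʳ (υ ^ʳ (m ∸ i)) (0≤^ʳ (m ∸ i) 0≤υ))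
    min-sum (inj₂ eq) = subst (λ z → υ ^ʳ z ≤ʳ υ ^ʳ (j₀ + i) +ʳ υ ^ʳ (m ∸ i)) (sym eq) (≤+ˡ (υ ^ʳ (j₀ + i)) (0≤^ʳ (j₀ + i) 0≤υ))

  -- The `r` exceed `B = bp (2 ^ a)`, whose exponent is exponential in `a`, while `l` is only `2` to
  -- a linear function of `a`; thus `l³ / B` is summable. The inequality of exponents is where
  -- `a₀ ≥ t + 10` enters.
  rare-clash : ∀ i → 𝔼 𝒫 (S.clashes i) ≤ʳ W 𝒫 *ʳ inv (2 ^ (i + 4))
  rare-clash i = ≤ʳ-trans (S.clashes-bound i 𝒫 l B (PB-sorted j₀ m) pp bp≤ (1≤bp (2 ^ a)) (sorted⇒unique (PB-sorted a t)) hR)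
      (mulˡ (W 𝒫) (0≤W 𝒫) (subst (_≤ʳ inv (2 ^ (i + 4))) (ℚₚ.*-comm (ι X) (inv B)) (ι-cancelˡ (2 ^ (i + 4)) (1≤2^ (i + 4))
        (subst₂ _≤ʳ_ (trans (cong (_*ʳ inv B) (ι-* (2 ^ (i + 4)) X)) (ℚₚ.*-assoc (ι (2 ^ (i + 4))) (ι X) (inv B))) (trans (ι-inv B (1≤bp (2 ^ a))) (sym (ι-inv (2 ^ (i + 4)) (1≤2^ (i + 4))))) (mulʳ (inv B) (0≤inv B) (ι-mono small))))))
    where
    a = a₀ + i
    b = bᵢ i
    l = 16 * 2 ^ (b + b)
    B = bp (2 ^ a)
    X = suc l * suc l * suc l
    bp≤ : bp (2 ^ (b + wᵢ i)) ≤ 2 ^ l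
    bp≤ = ≤-trans (bp-mono (^-monoʳ-≤ 2 (+-monoʳ-≤ b (m⊓n≤m b (m ∸ i))))) (≤-reflexive (bp-def (2 ^ (b + b))))
    a+t≤b : a + t ≤ b
    a+t≤b = ≤-trans (m≤m+n (a + t) 4) (≤-reflexive (sym (b≡ i)))
    hR : All (λ r → B ≤ r × r ≤ 2 ^ l) (Rᵢ i)
    hR = All.tabulate (λ r∈ → let (_ , lo , hi) = PB⁻ a t r∈ in lo , ≤-trans (<⇒≤ hi) (≤-trans (bp-mono (^-monoʳ-≤ 2 (≤-trans a+t≤b (m≤m+n b b)))) (≤-reflexive (bp-def (2 ^ (b + b))))))
    sl≤ : suc l ≤ 2 ^ (5 + (b + b))
    sl≤ = ≤-trans (+-mono-≤ {1} {l} (≤-trans (1≤2^ (4 + (b + b))) (≤-reflexive (^-distribˡ-+-* 2 4 (b + b)))) (≤-refl {l})) (≤-reflexive (trans (cong (λ z → z + z) (sym (^-distribˡ-+-* 2 4 (b + b)))) (sym (2^suc (4 + (b + b))))))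
    expo : (i + 4) + (5 + (b + b) + (5 + (b + b)) + (5 + (b + b))) ≤ 16 * 2 ^ a
    expo = ≤-trans (≤-trans (+-monoˡ-≤ _ (+-monoˡ-≤ 4 (m≤n+m i a₀))) (≤-trans (≤-reflexive (cong (λ z → (a + 4) + (5 + (z + z) + (5 + (z + z)) + (5 + (z + z)))) (b≡ i)))
        (lin a t (≤-trans a₀≥ (m≤m+n a₀ i))))) (*-monoʳ-≤ 16 (n<2^n a))
      where
      lin : ∀ a t → t + 10 ≤ a → (a + 4) + (5 + (a + t + 4 + (a + t + 4)) + (5 + (a + t + 4 + (a + t + 4))) + (5 + (a + t + 4 + (a + t + 4)))) ≤ 16 * suc a
      lin a t le = ≤-trans (≤-reflexive (cong f (sym eq))) (≤-trans (m≤m+n _ (3 * t + 9 * d + 63)) (≤-reflexive (trans (e t d) (cong (λ z → 16 * suc z) eq))))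
        where
        d = a ∸ (t + 10)
        eq : t + 10 + d ≡ a
        eq = m+[n∸m]≡n le
        f : ℕ → ℕ
        f a = (a + 4) + (5 + (a + t + 4 + (a + t + 4)) + (5 + (a + t + 4 + (a + t + 4))) + (5 + (a + t + 4 + (a + t + 4))))
        e : ∀ t d → (t + 10 + d + 4) + (5 + (t + 10 + d + t + 4 + (t + 10 + d + t + 4)) + (5 + (t + 10 + d + t + 4 + (t + 10 + d + t + 4))) + (5 + (t + 10 + d + t + 4 + (t + 10 + d + t + 4)))) + (3 * t + 9 * d + 63) ≡ 16 * suc (t + 10 + d)
        e = ℕSolver.solve-∀
    small : 2 ^ (i + 4) * X ≤ B
    small = ≤-trans (*-monoʳ-≤ (2 ^ (i + 4)) (*-mono-≤ (*-mono-≤ sl≤ sl≤) sl≤))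
      (≤-trans (≤-reflexive (sym (trans (^-distribˡ-+-* 2 (i + 4) (c + c + c)) (cong (2 ^ (i + 4) *_) (trans (^-distribˡ-+-* 2 (c + c) c) (cong (_* 2 ^ c) (^-distribˡ-+-* 2 c c)))))))
        (≤-trans (^-monoʳ-≤ 2 expo) (≤-reflexive (sym (bp-def (2 ^ a))))))
      where
      c = 5 + (b + b)

  -- Four contributions of `1/8` each: windows of length `bᵢ i ≥ j₀`, windows cut by the top of `𝒫`
  -- but still longer than `T`, clashes, and the size of `s`.
  mean-Φ : 𝔼 𝒫 Φ ≤ʳ W 𝒫 *ʳ inv 2
  mean-Φ = begin
    𝔼 𝒫 Φ                                                        ≡⟨ 𝔼-+ 𝒫 (λ s → ∑ (λ i → term i s) (downFrom n)) size ⟩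
    𝔼 𝒫 (λ s → ∑ (λ i → term i s) (downFrom n)) +ʳ 𝔼 𝒫 size      ≡⟨ cong (_+ʳ 𝔼 𝒫 size) (𝔼-∑ 𝒫 term (downFrom n)) ⟩
    ∑ (λ i → 𝔼 𝒫 (term i)) (downFrom n) +ʳ 𝔼 𝒫 size             ≤⟨ add-mono (∑-mono (downFrom n) (λ {i} i∈ → each i (∈-downFrom⁻ i∈))) small-size ⟩
    ∑ (λ i → w *ʳ (c *ʳ (u i +ʳ v i) +ʳ h i)) (downFrom n) +ʳ w *ʳ inv 8   ≡⟨ cong (_+ʳ w *ʳ inv 8) (trans (∑-*ˡ w (λ i → c *ʳ (u i +ʳ v i) +ʳ h i) (downFrom n)) (cong (w *ʳ_) (trans (∑-+ (λ i → c *ʳ (u i +ʳ v i)) h (downFrom n)) (cong (_+ʳ ∑ h (downFrom n)) (trans (∑-*ˡ c (λ i → u i +ʳ v i) (downFrom n)) (cong (c *ʳ_) (∑-+ u v (downFrom n)))))))) ⟩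
    w *ʳ (c *ʳ (∑ u (downFrom n) +ʳ ∑ v (downFrom n)) +ʳ ∑ h (downFrom n)) +ʳ w *ʳ inv 8
      ≤⟨ ℚₚ.+-monoˡ-≤ (w *ʳ inv 8) (mulˡ w (0≤W 𝒫) (add-mono (subst (_≤ʳ inv 8 +ʳ inv 8) (sym (ℚₚ.*-distribˡ-+ c (∑ u (downFrom n)) (∑ v (downFrom n)))) (add-mono (≤ʳ-trans (mulˡ c (0≤ι (2 ^ K)) (geometric-up j₀ n)) (υ-tail K j₀ j₀≥)) (≤ʳ-trans (mulˡ c (0≤ι (2 ^ K)) (geometric-down T n n ≤-refl)) (υ-tail K (n + T ∸ n) (≤-trans T≥ (≤-reflexive (sym (m+n∸m≡n n T)))))))) (halves n))) ⟩
    w *ʳ (inv 8 +ʳ inv 8 +ʳ inv 8) +ʳ w *ʳ inv 8                 ≡⟨ e w (inv 8) ⟩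
    w *ʳ ((inv 8 +ʳ inv 8) +ʳ (inv 8 +ʳ inv 8))                  ≡⟨ cong (w *ʳ_) (trans (cong (λ z → z +ʳ z) dbl₈) dbl₄) ⟩
    w *ʳ inv 2 ∎
    where
    open ℚₚ.≤-Reasoning
    w = W 𝒫
    c = ι (2 ^ K)
    u v h : ℕ → ℚ
    u i = υ ^ʳ (j₀ + i)
    v i = υ ^ʳ (m ∸ i)
    h i = inv (2 ^ (i + 4))
    e : ∀ w x → w *ʳ (x +ʳ x +ʳ x) +ʳ w *ʳ x ≡ w *ʳ ((x +ʳ x) +ʳ (x +ʳ x))
    e = solve-∀ ring
    dbl : ∀ n → inv (2 * n) +ʳ inv (2 * n) ≡ inv n
    dbl n = trans (cong (λ z → z +ʳ z) (inv-* 2 n)) (trans (sym (ℚₚ.*-distribʳ-+ (inv n) (inv 2) (inv 2))) (trans (cong (_*ʳ inv n) ½+½) (ℚₚ.*-identityˡ (inv n))))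
    dbl₈ : inv 8 +ʳ inv 8 ≡ inv 4
    dbl₈ = dbl 4
    dbl₄ : inv 4 +ʳ inv 4 ≡ inv 2
    dbl₄ = dbl 2
    each : ∀ i → i < n → 𝔼 𝒫 (term i) ≤ʳ w *ʳ (c *ʳ (u i +ʳ v i) +ʳ h i)
    each i i<n = subst₂ _≤ʳ_ (sym (trans (𝔼-+ 𝒫 (λ s → c *ʳ mul (S.θ i) s) (S.clashes i)) (cong (_+ʳ 𝔼 𝒫 (S.clashes i)) (𝔼-*ˡ 𝒫 c (mul (S.θ i)))))) (sym (ℚₚ.*-distribˡ-+ w (c *ʳ (u i +ʳ v i)) (h i))) (add-mono (rare-few i i<n) (rare-clash i))
    small-size : 𝔼 𝒫 size ≤ʳ w *ʳ inv 8
    small-size = begin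
      𝔼 𝒫 size                                     ≡⟨ 𝔼-*ˡ 𝒫 (inv (8 * Λ)) (∑ (λ q → ι (lg q))) ⟩
      inv (8 * Λ) *ʳ 𝔼 𝒫 (∑ (λ q → ι (lg q)))      ≤⟨ mulˡ (inv (8 * Λ)) (0≤inv (8 * Λ)) (≤ʳ-trans (𝔼-count (λ q → ι (lg q)) (λ q → 0≤ι (lg q)) 𝒫) (mulˡ w (0≤W 𝒫) (PB-lg j₀ m))) ⟩
      inv (8 * Λ) *ʳ (w *ʳ ι Λ)                    ≡⟨ trans (cong (_*ʳ (w *ʳ ι Λ)) (inv-* 8 Λ)) (e′ (inv 8) (inv Λ) w (ι Λ)) ⟩
      w *ʳ inv 8 *ʳ (ι Λ *ʳ inv Λ)                 ≡⟨ trans (cong (w *ʳ inv 8 *ʳ_) (ι-inv Λ (*-mono-≤ (1≤2^ (j₀ + m)) (*-mono-≤ {1} {3} (s≤s z≤n) (1≤bp 1))))) (ℚₚ.*-identityʳ (w *ʳ inv 8)) ⟩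
      w *ʳ inv 8 ∎
      where
      e′ : ∀ a l w L → a *ʳ l *ʳ (w *ʳ L) ≡ w *ʳ a *ʳ (L *ʳ l)
      e′ = solve-∀ ring

  good-weight : W 𝒫 *ʳ inv 2 ≤ʳ 𝔼 𝒫 (λ s → 𝟙 (Φ s ℚₚ.<? 1ℚ))
  good-weight = ≤ʳ-trans (sub-mono (subst (W 𝒫 *ʳ inv 2 +ʳ 𝔼 𝒫 Φ ≤ʳ_) eq (ℚₚ.+-monoʳ-≤ (W 𝒫 *ʳ inv 2) mean-Φ))) (markov 𝒫 Φ 0≤Φ)
    where
    eq : W 𝒫 *ʳ inv 2 +ʳ W 𝒫 *ʳ inv 2 ≡ W 𝒫
    eq = trans (sym (ℚₚ.*-distribˡ-+ (W 𝒫) (inv 2) (inv 2))) (trans (cong (W 𝒫 *ʳ_) ½+½) (ℚₚ.*-identityʳ (W 𝒫)))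

  good-size : ∀ s → Φ s <ʳ 1ℚ → product s ≤ bp (8 * Λ)
  good-size s lt = ≤-trans (product-lg s) (bp-mono (ι-cancel (subst₂ _≤ʳ_ (ι-sum-lg s) (ℚₚ.*-identityʳ (ι (8 * Λ))) (inv*≤⇒≤ι* (8 * Λ) 1≤Λ (ℚₚ.<⇒≤ (<-+ʳ (∑-nonneg (downFrom n) (λ {i} _ → 0≤term i s)) lt))))))

  good-scale : ∀ s → Φ s <ʳ 1ℚ → ∀ i → i < n → ∃[ rs ] (Unique rs × K ≤ length rs × All (λ r → r ∈ PB (a₀ + i) t × (∃[ q ] (q ∈ s × r ∣ pred q))) rs)
  good-scale s lt i i<n = let (rs , u , al , len) = S.select i s (λ r∈ → ∑-< (λ r → pairs (S.x i r) s) (Rᵢ i) (λ r → S.0≤pairs i r s) r∈ (<-+ʳ (0≤* (0≤ι (2 ^ K)) (S.0≤mulθ i s)) term<)) in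
    rs , u , ≤-trans (S.many-good i K s (<-+ˡ (S.0≤clashes i s) term<)) (≤-reflexive (sym len)) , All.map (λ (r∈ , q , q∈ , _ , d) → r∈ , q , q∈ , d) al
    where
    term< : term i s <ʳ 1ℚ
    term< = ∑-< (λ i → term i s) (downFrom n) (λ j → 0≤term j s) (∈-downFrom⁺ i<n) (<-+ˡ (0≤size s) lt)

-- The mass of the weights: a lower bound of Mertens type.

gsum≤product : ∀ ps D → gsum sub-inv ps D ≤ʳ foldr (λ p z → (1ℚ +ʳ sub-inv p) *ʳ z) 1ℚ ps
gsum≤product [] zero = 0≤1
gsum≤product [] (suc D) = ℚₚ.≤-refl
gsum≤product (p ∷ ps) D = subst (gsum sub-inv (p ∷ ps) D ≤ʳ_) (e _ (sub-inv p)) (add-mono (gsum≤product ps D) (mulˡ (sub-inv p) (0≤sub-inv p) (gsum≤product ps (quot D p))))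
  where
  e : ∀ y s → y +ʳ s *ʳ y ≡ (1ℚ +ʳ s) *ʳ y
  e = solve-∀ ring

W₋ : List ℕ → ℚ
W₋ = foldr (λ p z → (1ℚ +ʳ sub-inv p) *ʳ z) 1ℚ

1+inv : ∀ n → 1 ≤ n → 1ℚ +ʳ inv n ≡ ι (suc n) *ʳ inv n
1+inv n 1≤n = trans (cong (_+ʳ inv n) (sym (ι-inv n 1≤n))) (trans (e (ι n) (inv n)) (cong (_*ʳ inv n) (trans (cong (_+ʳ ι n) (sym ι1)) (sym (ι-+ 1 n)))))
  where
  e : ∀ a i → a *ʳ i +ʳ i ≡ (1ℚ +ʳ a) *ʳ i
  e = solve-∀ ring

-- ∏ (1 - 1/p²) ≥ ∏_{k ≤ n} (1 - 1/k²) = (n + 1)/2n.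
W₋-vs-W : ∀ n → W₋ (primesBelow (suc (suc n))) *ʳ ι (suc (suc n)) ≤ʳ W (primesBelow (suc (suc n))) *ʳ ι (2 * suc n)
W₋-vs-W zero = ℚₚ.≤-refl
W₋-vs-W (suc n) = go (prime? p)
  where
  open ℚₚ.≤-Reasoning
  k = suc n
  p = suc k
  B = W₋ (primesBelow p)
  A = W (primesBelow p)
  ih : B *ʳ ι p ≤ʳ A *ʳ ι (2 * k)
  ih = W₋-vs-W n
  go : Dec (Prime p) → W₋ (primesBelow (suc p)) *ʳ ι (suc p) ≤ʳ W (primesBelow (suc p)) *ʳ ι (2 * p)
  go (yes pp) = begin
    W₋ (primesBelow (suc p)) *ʳ ι (suc p)               ≡⟨ cong (λ z → W₋ z *ʳ ι (suc p)) (filter-accept prime? pp) ⟩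
    (1ℚ +ʳ inv k) *ʳ B *ʳ ι (suc p)                     ≡⟨ trans (cong (λ z → z *ʳ B *ʳ ι (suc p)) (1+inv k (s≤s z≤n))) (e₁ (ι p) (inv k) B (ι (suc p))) ⟩
    (inv k *ʳ ι (suc p)) *ʳ (B *ʳ ι p)                  ≤⟨ mulˡ (inv k *ʳ ι (suc p)) (0≤* (0≤inv k) (0≤ι (suc p))) ih ⟩
    (inv k *ʳ ι (suc p)) *ʳ (A *ʳ ι (2 * k))            ≡⟨ trans (cong (λ z → (inv k *ʳ ι (suc p)) *ʳ (A *ʳ z)) (ι-* 2 k)) (trans (e₂ (inv k) (ι (suc p)) A (ι 2) (ι k)) (cong (ι (suc p) *ʳ A *ʳ ι 2 *ʳ_) (trans (ι-inv k (s≤s z≤n)) (sym (ι-inv p (s≤s z≤n)))))) ⟩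
    ι (suc p) *ʳ A *ʳ ι 2 *ʳ (ι p *ʳ inv p)             ≡⟨ trans (e₃ (ι (suc p)) A (ι 2) (ι p) (inv p)) (cong₂ (λ y z → y *ʳ A *ʳ z) (trans (sym (1+inv p (s≤s z≤n))) (cong (1ℚ +ʳ_) (sym (ℚₚ.*-identityˡ (inv p))))) (sym (ι-* 2 p))) ⟩
    (1ℚ +ʳ 1ℚ *ʳ inv p) *ʳ A *ʳ ι (2 * p)               ≡⟨ cong (λ z → W z *ʳ ι (2 * p)) (sym (filter-accept prime? pp)) ⟩
    W (primesBelow (suc p)) *ʳ ι (2 * p) ∎
    where
    e₁ : ∀ p i B q → p *ʳ i *ʳ B *ʳ q ≡ (i *ʳ q) *ʳ (B *ʳ p)
    e₁ = solve-∀ ring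
    e₂ : ∀ i q A t k → (i *ʳ q) *ʳ (A *ʳ (t *ʳ k)) ≡ q *ʳ A *ʳ t *ʳ (k *ʳ i)
    e₂ = solve-∀ ring
    e₃ : ∀ q A t p i → q *ʳ A *ʳ t *ʳ (p *ʳ i) ≡ q *ʳ i *ʳ A *ʳ (t *ʳ p)
    e₃ = solve-∀ ring
  go (no np) = subst (λ z → W₋ z *ʳ ι (suc p) ≤ʳ W z *ʳ ι (2 * p)) (sym (filter-reject prime? np)) (ι-cancelˡ p (s≤s z≤n) (begin
    ι p *ʳ (B *ʳ ι (suc p))            ≡⟨ e₁ (ι p) B (ι (suc p)) ⟩
    ι (suc p) *ʳ (B *ʳ ι p)            ≤⟨ mulˡ (ι (suc p)) (0≤ι (suc p)) ih ⟩
    ι (suc p) *ʳ (A *ʳ ι (2 * k))      ≡⟨ trans (e₂ (ι (suc p)) A (ι (2 * k))) (cong (A *ʳ_) (sym (ι-* (suc p) (2 * k)))) ⟩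
    A *ʳ ι (suc p * (2 * k))           ≤⟨ mulˡ A (0≤W (primesBelow p)) (ι-mono (≤-trans (m≤m+n _ 2) (≤-reflexive (sq k)))) ⟩
    A *ʳ ι (p * (2 * p))               ≡⟨ trans (cong (A *ʳ_) (ι-* p (2 * p))) (e₂ A (ι p) (ι (2 * p))) ⟩
    ι p *ʳ (A *ʳ ι (2 * p)) ∎))
    where
    e₁ : ∀ p B q → p *ʳ (B *ʳ q) ≡ q *ʳ (B *ʳ p)
    e₁ = solve-∀ ring
    e₂ : ∀ q A k → q *ʳ (A *ʳ k) ≡ A *ʳ (q *ʳ k)
    e₂ = solve-∀ ring
    sq : ∀ k → suc (suc k) * (2 * k) + 2 ≡ suc k * (2 * suc k)
    sq = ℕSolver.solve-∀

-- The product of the `1 + 1/(p - 1)` dominates the harmonic sum up to `2 ^ k`, which is at least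
-- `k/2`; passing to the `1 + 1/p` costs a factor of at most `2`.
W-lower : ∀ k → ι k ≤ʳ ι 4 *ʳ W (primesBelow (suc (2 ^ k)))
W-lower k = go (2 ^ k) (1≤2^ k) refl
  where
  open ℚₚ.≤-Reasoning
  go : ∀ N → 1 ≤ N → N ≡ 2 ^ k → ι k ≤ʳ ι 4 *ʳ W (primesBelow (suc N))
  go (suc n) _ eq = begin
    ι k                                   ≡⟨ trans (sym (ℚₚ.*-identityʳ (ι k))) (trans (cong (ι k *ʳ_) (sym (ι-inv 2 (s≤s z≤n)))) (e (ι k) (ι 2) (inv 2))) ⟩
    ι 2 *ʳ (ι k *ʳ inv 2)                 ≤⟨ mulˡ (ι 2) (0≤ι 2) (≤ʳ-trans harm (≤ʳ-trans (gsum≤product ps (2 ^ k)) B≤2A)) ⟩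
    ι 2 *ʳ (ι 2 *ʳ W ps)                  ≡⟨ trans (sym (ℚₚ.*-assoc (ι 2) (ι 2) (W ps))) (cong (_*ʳ W ps) (sym (ι-* 2 2))) ⟩
    ι 4 *ʳ W ps ∎
    where
    ps = primesBelow (suc (suc n))
    e : ∀ a b c → a *ʳ (b *ʳ c) ≡ b *ʳ (a *ʳ c)
    e = solve-∀ ring
    harm : ι k *ʳ inv 2 ≤ʳ gsum sub-inv ps (2 ^ k)
    harm = ≤ʳ-trans (harmonic k) (subst (_≤ʳ gsum sub-inv ps (2 ^ k)) (trans (∑-map inv suc (downFrom (2 ^ k))) (sym (∑<-downFrom (2 ^ k) (λ m → inv (suc m)))))
      (smooth-harmonic ps (primesBelow-prime (suc (suc n))) (2 ^ k) (2 ^ k) ≤-refl (map suc (downFrom (2 ^ k))) (Uniqueₚ.map⁺ suc-injective (Uniqueₚ.downFrom⁺ (2 ^ k)))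
        (Allₚ.map⁺ (All.tabulate (λ {i} i∈ → let i< = ∈-downFrom⁻ i∈ in s≤s z≤n , i< , λ {q} pq q∣ → ∈-primesBelow⁺ pq (s≤s (≤-trans (∣⇒≤ q∣) (≤-trans i< (≤-reflexive (sym eq))))))))))
    B≤2A : W₋ ps ≤ʳ ι 2 *ʳ W ps
    B≤2A = ι-cancelˡ (suc (suc n)) (s≤s z≤n) (begin
      ι (suc (suc n)) *ʳ W₋ ps                ≡⟨ ℚₚ.*-comm (ι (suc (suc n))) (W₋ ps) ⟩
      W₋ ps *ʳ ι (suc (suc n))                ≤⟨ W₋-vs-W n ⟩
      W ps *ʳ ι (2 * suc n)                   ≤⟨ mulˡ (W ps) (0≤W ps) (ι-mono (*-monoʳ-≤ 2 (n≤1+n (suc n)))) ⟩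
      W ps *ʳ ι (2 * suc (suc n))             ≡⟨ trans (cong (W ps *ʳ_) (ι-* 2 (suc (suc n)))) (e′ (W ps) (ι 2) (ι (suc (suc n)))) ⟩
      ι (suc (suc n)) *ʳ (ι 2 *ʳ W ps) ∎)
      where
      e′ : ∀ w t n → w *ʳ (t *ʳ n) ≡ n *ʳ (t *ʳ w)
      e′ = solve-∀ ring

W≤2^ : ∀ ps → W ps ≤ʳ ι (2 ^ length ps)
W≤2^ [] = ℚₚ.≤-reflexive (sym ι1)
W≤2^ (p ∷ ps) = subst (W (p ∷ ps) ≤ʳ_) (sym (ι-* 2 (2 ^ length ps))) (mul-mono (0≤+ 0≤1 (0≤* 0≤1 (0≤inv p))) (0≤W ps)
  (subst (1ℚ +ʳ 1ℚ *ʳ inv p ≤ʳ_) (sym ι2) (ℚₚ.+-monoʳ-≤ 1ℚ (subst (_≤ʳ 1ℚ) (sym (ℚₚ.*-identityˡ (inv p))) (inv≤1 p)))) (W≤2^ ps))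

lowW : ℕ → ℕ
lowW j = 4 * 2 ^ length (primesBelow (bp (2 ^ j)))

-- The primes below `bp (2 ^ j)` account for a bounded factor, so the mass of `PB j m` still grows
-- like the logarithm `2 ^ (j + m)` of its range. This growth pays for the density of the last prime
-- in `count`.
PB-weight : ∀ j m → ι (2 ^ (j + m)) ≤ʳ ι (lowW j) *ʳ W (PB j m)
PB-weight j m = begin
  ι k                                                      ≤⟨ W-lower k ⟩
  ι 4 *ʳ W (primesBelow (suc (2 ^ k)))                     ≤⟨ mulˡ (ι 4) (0≤ι 4) (W-⊆ _ (low ++ PB j m) (primesBelow-unique (suc (2 ^ k))) (λ q∈ → cover (∈-primesBelow⁻ {n = suc (2 ^ k)} q∈))) ⟩
  ι 4 *ʳ W (low ++ PB j m)                                 ≡⟨ cong (ι 4 *ʳ_) (PP-++ one low (PB j m)) ⟩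
  ι 4 *ʳ (W low *ʳ W (PB j m))                             ≤⟨ mulˡ (ι 4) (0≤ι 4) (mulʳ (W (PB j m)) (0≤W (PB j m)) (W≤2^ low)) ⟩
  ι 4 *ʳ (ι (2 ^ length low) *ʳ W (PB j m))                ≡⟨ trans (sym (ℚₚ.*-assoc (ι 4) (ι (2 ^ length low)) (W (PB j m)))) (cong (_*ʳ W (PB j m)) (sym (ι-* 4 (2 ^ length low)))) ⟩
  ι (lowW j) *ʳ W (PB j m) ∎
  where
  open ℚₚ.≤-Reasoning
  k = 2 ^ (j + m)
  low = primesBelow (bp (2 ^ j))
  cover : ∀ {q} → Prime q × q < suc (2 ^ k) → q ∈ low ++ PB j m
  cover {q} (pq , q≤) with q <? bp (2 ^ j)
  ... | yes lt = ∈-++⁺ˡ (∈-primesBelow⁺ pq lt)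
  ... | no ge = ∈-++⁺ʳ low (PB⁺ j m pq (≮⇒≥ ge) (≤-trans q≤ (≤-trans (^-monoʳ-< 2 (s≤s (s≤s z≤n)) (m<m*n k 16 {{>-nonZero (1≤2^ (j + m))}} (s≤s (s≤s z≤n)))) (≤-reflexive (trans (cong (2 ^_) (*-comm k 16)) (sym (bp-def k)))))))

-- Lists of primes determined by their products.

product-∈ : ∀ {p} xs → All Prime xs → Prime p → p ∣ product xs → p ∈ xs
product-∈ xs pxs pp d = factorisationHasAllPrimeFactors pp d pxs

sorted-product-injective : ∀ xs ys → All Prime xs → All Prime ys → AllPairs _>_ xs → AllPairs _>_ ys → product xs ≡ product ys → xs ≡ ys
sorted-product-injective [] [] _ _ _ _ _ = refl
sorted-product-injective [] (y ∷ ys) _ (py ∷ _) _ _ e = ⊥-elim (<-irrefl (sym (∣1⇒≡1 (subst (y ∣_) (sym e) (m∣m*n (product ys))))) (prime⇒≥2 py))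
sorted-product-injective (x ∷ xs) [] (px ∷ _) _ _ _ e = ⊥-elim (<-irrefl (sym (∣1⇒≡1 (subst (x ∣_) e (m∣m*n (product xs))))) (prime⇒≥2 px))
sorted-product-injective (x ∷ xs) (y ∷ ys) pxs@(px ∷ pxs′) pys@(py ∷ pys′) (sx ∷ sxs) (sy ∷ sys) e with ≤-antisym (top (product-∈ (y ∷ ys) pys px (subst (x ∣_) e (m∣m*n (product xs)))) sy) (top (product-∈ (x ∷ xs) pxs py (subst (y ∣_) (sym e) (m∣m*n (product ys)))) sx)
  where
  top : ∀ {z w ws} → z ∈ w ∷ ws → All (w >_) ws → z ≤ w
  top (here refl) _ = ≤-refl
  top (there z∈) h = <⇒≤ (All.lookup h z∈)
... | refl = cong (x ∷_) (sorted-product-injective xs ys pxs′ pys′ sxs sys (*-cancelˡ-≡ _ _ x {{prime⇒nonZero px}} e))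

distinct-primes-∣ : ∀ rs m → Unique rs → All (λ r → Prime r × r ∣ m) rs → product rs ∣ m
distinct-primes-∣ [] m _ _ = 1∣ m
distinct-primes-∣ (r ∷ rs) m (r∉ ∷ u) ((pr , r∣m) ∷ h) with distinct-primes-∣ rs m u h
... | divides c m≡ = subst (r * product rs ∣_) (sym m≡) (*-monoˡ-∣ (product rs) (divides-c (euclidsLemma c (product rs) pr (subst (r ∣_) m≡ r∣m))))
  where
  divides-c : r ∣ c ⊎ r ∣ product rs → r ∣ c
  divides-c (inj₁ d) = d
  divides-c (inj₂ d) = ⊥-elim (All.lookup r∉ (product-∈ rs (All.map proj₁ h) pr d) refl)

product-≥ : ∀ {B} rs → All (B ≤_) rs → B ^ length rs ≤ product rs
product-≥ [] _ = ≤-refl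
product-≥ (r ∷ rs) (h ∷ hs) = *-mono-≤ h (product-≥ rs hs)

subs-⊆ : ∀ ps {s} → s ∈ subs ps → ∀ {q} → q ∈ s → q ∈ ps
subs-⊆ [] (here refl) ()
subs-⊆ (p ∷ ps) {s} s∈ q∈ with ∈-++⁻ (subs ps) s∈
... | inj₁ h = there (subs-⊆ ps h q∈)
... | inj₂ h with ∈-map⁻ (p ∷_) h
... | s′ , s′∈ , refl with q∈
... | here e = here e
... | there q∈′ = there (subs-⊆ ps s′∈ q∈′)

subs-sorted : ∀ ps → AllPairs _>_ ps → ∀ {s} → s ∈ subs ps → AllPairs _>_ s
subs-sorted [] _ (here refl) = []
subs-sorted (p ∷ ps) (h ∷ srt) {s} s∈ with ∈-++⁻ (subs ps) s∈
... | inj₁ m = subs-sorted ps srt m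
... | inj₂ m with ∈-map⁻ (p ∷_) m
... | s′ , s′∈ , refl = All.tabulate (λ q∈ → All.lookup h (subs-⊆ ps s′∈ q∈)) ∷ subs-sorted ps srt s′∈

subs-unique : ∀ ps → Unique ps → Unique (subs ps)
subs-unique [] _ = [] ∷ []
subs-unique (p ∷ ps) (p∉ ∷ u) = Uniqueₚ.++⁺ (subs-unique ps u) (Uniqueₚ.map⁺ (λ { refl → refl }) (subs-unique ps u)) disj
  where
  disj : ∀ {s} → ¬ (s ∈ subs ps × s ∈ map (p ∷_) (subs ps))
  disj (a , b) with ∈-map⁻ (p ∷_) b
  ... | s′ , _ , refl = All.lookup p∉ (subs-⊆ ps a (here refl)) refl

State : Set
State = List ℕ × List ℕ

-- Extensions of different states differ in their tails, extensions of the same state in their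
-- heads.
unique-extend : ∀ (Q : State → List ℕ) (next : State → ℕ → List ℕ) ss → (∀ z → Unique (Q z)) → Unique (map proj₁ ss) →
  Unique (map proj₁ (concatMap (λ z → map (λ q → (q ∷ proj₁ z , next z q)) (Q z)) ss))
unique-extend Q next [] uQ u = []
unique-extend Q next (z ∷ ss) uQ (z∉ ∷ u) = subst Unique (sym (map-++ proj₁ (map f (Q z)) rest)) (Uniqueₚ.++⁺ head (unique-extend Q next ss uQ u) disj)
  where
  f : ℕ → State
  f q = (q ∷ proj₁ z , next z q)
  ext : State → List State
  ext z = map (λ q → (q ∷ proj₁ z , next z q)) (Q z)
  rest = concatMap ext ss
  head : Unique (map proj₁ (map f (Q z)))
  head = subst Unique (map-∘ {g = proj₁} {f = f} (Q z)) (Uniqueₚ.map⁺ (λ { refl → refl }) (uQ z))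
  tails : ∀ ss {q l} → (q ∷ l) ∈ map proj₁ (concatMap ext ss) → l ∈ map proj₁ ss
  tails (y ∷ ys) {q} {l} m with ∈-++⁻ (map proj₁ (ext y)) (subst ((q ∷ l) ∈_) (map-++ proj₁ (ext y) (concatMap ext ys)) m)
  ... | inj₂ h = there (tails ys h)
  ... | inj₁ h with ∈-map⁻ proj₁ h
  ... | w , w∈ , e with ∈-map⁻ (λ q → (q ∷ proj₁ y , next y q)) w∈
  ... | q′ , _ , refl = here (cong (λ { [] → l ; (_ ∷ t) → t }) e)
  disj : ∀ {l} → ¬ (l ∈ map proj₁ (map f (Q z)) × l ∈ map proj₁ rest)
  disj (a , b) with ∈-map⁻ proj₁ a
  ... | w , w∈ , refl with ∈-map⁻ f w∈
  ... | q , _ , refl = All.lookup z∉ (tails ss b) refl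

-- From primes r dividing λ(n) to the density of φ(n) and λ(n).

module DenseTotient (h M : ℕ) (1≤M : 1 ≤ M) (dM : Density.Dense h M) (ls : List ℕ) (pls : All Prime ls) (uls : Unique ls)
  (avoid : ∀ {q} → q ∈ ls → ¬ q ∣ M) (B : ℕ) (ls≤B : All (_≤ B) ls) (M≤B : ∀ {q} → Prime q → q ∣ M → q ≤ B)
  (reach : ∀ {P} → Prime P → P ≤ B → P * (h * suc h) ≤ M ⊎
    (∃[ rs ] (Unique rs × All (λ r → Prime r × r < P × (∃[ q ] (q ∈ ls × r ∣ pred q))) rs × P * (h * suc h) ≤ product rs))) where

  n : ℕ
  n = M * M * product ls

  1≤n : 1 ≤ n
  1≤n = *-mono-≤ (*-mono-≤ 1≤M 1≤M) (productOfPrimes≥1 pls)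

  instance
    nzn : NonZero n
    nzn = >-nonZero 1≤n
    nzM : NonZero (M * M)
    nzM = >-nonZero (*-mono-≤ 1≤M 1≤M)

  ∤M² : ∀ {q} → q ∈ ls → ¬ q ∣ M * M
  ∤M² q∈ d = case euclidsLemma M M (All.lookup pls q∈) d of λ { (inj₁ x) → avoid q∈ x ; (inj₂ x) → avoid q∈ x }

  M∣λ : M ∣ carmichael n
  M∣λ = square-∣λ M (product ls) cop
    where
    cop : Coprime (M * M) (product ls)
    cop {zero} (z∣ , _) = ⊥-elim (<-irrefl (sym (0∣⇒≡0 z∣)) (*-mono-≤ 1≤M 1≤M))
    cop {suc zero} _ = refl
    cop {d@(suc (suc _))} (d∣M² , d∣ls) = let (q , pq , q∣d) = prime-divisor d (s≤s (s≤s z≤n)) in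
      ⊥-elim (∤M² (product-∈ ls pls pq (∣-trans q∣d d∣ls)) (∣-trans q∣d d∣M²))

  r∣λ : ∀ {r q} → Prime r → q ∈ ls → r ∣ pred q → r ∣ carmichael n
  r∣λ {r} {q} pr q∈ r∣ = subst (λ z → r ∣ carmichael z) (sym n≡) (prime-∣λ q v {{subst NonZero n≡ nzn}} pq (coprime-sym (prime∤⇒coprime pq q∤v)) pr r∣)
    where
    pq = All.lookup pls q∈
    rest = ∈-remove ls q∈
    v = M * M * product rest
    ∈-rest : ∀ xs {x} (m : x ∈ xs) {y} → y ∈ ∈-remove xs m → y ∈ xs
    ∈-rest (_ ∷ xs) (here _) y∈ = there y∈
    ∈-rest (_ ∷ xs) (there m) (here e) = here e
    ∈-rest (_ ∷ xs) (there m) (there y∈) = there (∈-rest xs m y∈)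
    ∉-rest : ∀ xs {x} (m : x ∈ xs) → Unique xs → x ∉ ∈-remove xs m
    ∉-rest (_ ∷ xs) (here refl) (x∉ ∷ _) x∈ = All.lookup x∉ x∈ refl
    ∉-rest (_ ∷ xs) (there m) (y∉ ∷ u) (here refl) = All.lookup y∉ m refl
    ∉-rest (_ ∷ xs) (there m) (y∉ ∷ u) (there x∈) = ∉-rest xs m u x∈
    prod : ∀ xs {x} (m : x ∈ xs) → product xs ≡ x * product (∈-remove xs m)
    prod (_ ∷ xs) (here refl) = refl
    prod (y ∷ xs) {x} (there m) = trans (cong (y *_) (prod xs m)) (sw y x (product (∈-remove xs m)))
      where
      sw : ∀ a b c → a * (b * c) ≡ b * (a * c)
      sw = ℕSolver.solve-∀
    n≡ : n ≡ q * v
    n≡ = trans (cong (M * M *_) (prod ls q∈)) (sw (M * M) q (product rest))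
      where
      sw : ∀ a b c → a * (b * c) ≡ b * (a * c)
      sw = ℕSolver.solve-∀
    q∤v : ¬ q ∣ v
    q∤v d with euclidsLemma (M * M) (product rest) pq d
    ... | inj₁ x = ∤M² q∈ x
    ... | inj₂ x = ∉-rest ls q∈ uls (product-∈ rest (All.tabulate (λ y∈ → All.lookup pls (∈-rest ls q∈ y∈))) pq x)

  φ-bound : ∀ {P} → Prime P → P ∣ φ n → P ≤ B
  φ-bound {P} pP d with factorise (M * M)
  ... | record { factors = fs ; isFactorisation = e ; factorsPrime = pfs } =
    φ-prime-bound (fs ++ ls) (Allₚ.++⁺ pfs pls) B (Allₚ.++⁺ fs≤B ls≤B) pP (subst (λ z → P ∣ φ z) (trans (cong (_* product ls) e) (sym (product-++′ fs ls))) d)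
    where
    product-++′ : ∀ xs ys → product (xs ++ ys) ≡ product xs * product ys
    product-++′ [] ys = sym (+-identityʳ (product ys))
    product-++′ (x ∷ xs) ys = trans (cong (x *_) (product-++′ xs ys)) (sym (*-assoc x (product xs) (product ys)))
    fs≤B : All (_≤ B) fs
    fs≤B = All.tabulate (λ {q} q∈ → let pq = All.lookup pfs q∈ in case euclidsLemma M M pq (subst (q ∣_) (sym e) (∈⇒∣product fs q∈)) of λ { (inj₁ x) → M≤B pq x ; (inj₂ x) → M≤B pq x })

  -- One argument for every `m` between `λ(n)` and `φ(n)` in divisibility: the divisors are
  -- inherited from `λ(n)`, while the bound on the primes of `m` comes from `φ(n)`.
  dense : ∀ m → 1 ≤ m → carmichael n ∣ m → m ∣ φ n → Density.Dense h m
  dense m 1≤m λ∣m m∣φ = dense-from-base M m 1≤m 1≤M dM (∣-trans M∣λ λ∣m) go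
    where
    open Density h
    go : ∀ {P} → Prime P → P ∣ m → Reachable M m P
    go {P} pP P∣m with reach pP (φ-bound pP (∣-trans P∣m m∣φ))
    ... | inj₁ le = inj₁ le
    ... | inj₂ (rs , u , al , le) = inj₂ (product rs , distinct-primes-∣ rs m u (All.map (λ (pr , _ , q , q∈ , d) → pr , ∣-trans (r∣λ pr q∈ d) λ∣m) al) ,
      (λ pq d → proj₁ (proj₂ (All.lookup al (product-∈ rs (All.map proj₁ al) pq d)))) , le)

  dense-φ : Density.Dense h (φ n)
  dense-φ = dense (φ n) (φ-pos n 1≤n) (Carmichael.λ∣φ n) ∣-refl

  dense-λ : Density.Dense h (carmichael n)
  dense-λ = dense (carmichael n) (Carmichael.λ-pos n) ∣-refl (Carmichael.λ∣φ n)

-- Construction and count of the integers n.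

bp-cancel-< : ∀ {a b} → bp a < bp b → a < b
bp-cancel-< {a} {b} lt = ≰⇒> (λ le → <-irrefl refl (≤-trans lt (bp-mono le)))

n<bp : ∀ n → n < bp n
n<bp n = ≤-trans (n<2^n n) (≤-trans (^-monoʳ-≤ 2 (m≤n*m n 16)) (≤-reflexive (sym (bp-def n))))

log-bracket : ∀ y v₀ → bp v₀ ≤ y → v₀ ≤ pred (lg y) × bp (pred (lg y)) ≤ y × y < bp (suc (pred (lg y)))
log-bracket y v₀ le = go (lg y) refl
  where
  go : ∀ z → z ≡ lg y → v₀ ≤ pred z × bp (pred z) ≤ y × y < bp (suc (pred z))
  go zero e = ⊥-elim (<-irrefl refl (≤-trans (lg-spec y) (≤-trans (bp-mono (≤-trans (≤-reflexive (sym e)) z≤n)) le)))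
  go (suc v) e = s≤s⁻¹ (bp-cancel-< (≤-trans (s≤s le) (subst (λ z → y < bp z) (sym e) (lg-spec y)))) ,
    ≮⇒≥ (λ lt → <-irrefl refl (≤-trans (≤-reflexive e) (lg-min y v lt))) , subst (λ z → y < bp z) (sym e) (lg-spec y)

log₂-bracket : ∀ g → 1 ≤ g → ∃[ l ] (2 ^ l ≤ g × g < 2 ^ suc l)
log₂-bracket g 1≤g = go g (n<2^n g)
  where
  go : ∀ e → g < 2 ^ e → ∃[ l ] (2 ^ l ≤ g × g < 2 ^ suc l)
  go zero lt = ⊥-elim (<-irrefl refl (≤-trans lt 1≤g))
  go (suc e) lt with 2 ^ e ≤? g
  ... | yes le = e , le , lt
  ... | no gt = go e (≰⇒> gt)

-- Total in `q`, so that the next state is a plain function of state and prime; for a prime that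
-- hits `R` the second clause does not arise.
pickD : ∀ R q → Dec (hits R q) → List ℕ → List ℕ
pickD R q (yes h) X = proj₁ (find h) ∷ X
pickD R q (no _) X = X

pickD-spec : ∀ R q (d : Dec (hits R q)) X → hits R q → ∃[ r ] (r ∈ R × r ∣ pred q × pickD R q d X ≡ r ∷ X)
pickD-spec R q (yes h) X _ = let (r , r∈ , r∣) = find h in r , r∈ , r∣ , refl
pickD-spec R q (no ¬h) X h = ⊥-elim (¬h h)

inv^ : ∀ c → 1 ≤ c → ∀ s → ι (c ^ s) *ʳ inv c ^ʳ s ≡ 1ℚ
inv^ c 1≤c zero = trans (ℚₚ.*-identityʳ (ι 1)) ι1
inv^ c 1≤c (suc s) = trans (cong (_*ʳ (inv c *ʳ inv c ^ʳ s)) (ι-* c (c ^ s))) (trans (e (ι c) (ι (c ^ s)) (inv c) (inv c ^ʳ s)) (trans (cong₂ _*ʳ_ (ι-inv c 1≤c) (inv^ c 1≤c s)) (ℚₚ.*-identityˡ 1ℚ)))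
  where
  e : ∀ a b c d → a *ʳ b *ʳ (c *ʳ d) ≡ a *ʳ c *ʳ (b *ʳ d)
  e = solve-∀ ring

module Final (H t γ K T a₀ M : ℕ) (rich256 : ∀ a → ι 256 ≤ʳ ∑ inv (PB a t)) (γ≥ : 2 * (8 * c₃ + 6) ≤ 2 ^ γ)
  (K≡ : K ≡ 2 ^ (t + 2)) (a₀≥ : t + 10 ≤ a₀) (j₀≥ : (K + 13) * 512 ≤ a₀ + t + 4) (T≥ : (K + 13) * 512 ≤ T)
  (HH≤ : H * suc H ≤ bp (2 ^ a₀)) (1≤M : 1 ≤ M) (dM : Density.Dense H M)
  (M≥ : bp (2 ^ (a₀ + t)) * (H * suc H) ≤ M) (Mp : ∀ {q} → Prime q → q ∣ M → q < bp (2 ^ a₀)) where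

  -- `S` is chosen so that `S` primes `r` of the top scale, each at least `bp (2 ^ a∗)`, multiply to
  -- the square of the bound `bp (2 ^ (L + γ))` for all prime factors of `n`. It depends on `γ`,
  -- which therefore must not depend on `S`.
  σ S C₁ N₀ : ℕ
  σ = T + t + γ + 5
  S = 2 ^ σ
  C₁ = 8 * c₃
  N₀ = M * M

  1≤S : 1 ≤ S
  1≤S = 1≤2^ σ

  1≤N₀ : 1 ≤ N₀
  1≤N₀ = *-mono-≤ 1≤M 1≤M

  -- In units of `g`, the sum of the logarithms of the lower ends of the ranges of the first `s`
  -- forced primes.
  e₀ : ℕ → ℕ
  e₀ zero = 0
  e₀ (suc s) = e₀ s + (S + s)

  -- The budget for `log x` in units of `g`: `C₁ S` for the random part, `e₀ S + S` for the forced
  -- primes, `2 S` so that the last prime exceeds all others, and `2` for `N₀ ≤ bp g` and for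
  -- rounding.
  E : ℕ
  E = C₁ * S + e₀ S + (S + (2 * S + 2))

  -- `D₁` collects the losses at the last prime, `(128 * S) ^ S` those of the `S` forced stages, and
  -- `2 * lowW` those of `good-weight` and `PB-weight`. Nothing depends on `x`.
  D₁ D : ℕ
  D₁ = 64 * 2 ^ γ * bp 1
  D = D₁ * N₀ * (128 * S) ^ S * (2 * lowW (a₀ + t + 4))

  1≤D : 1 ≤ D
  1≤D = *-mono-≤ (*-mono-≤ (*-mono-≤ (*-mono-≤ {1} {64 * 2 ^ γ} (*-mono-≤ {1} {64} (s≤s z≤n) (1≤2^ γ)) (1≤bp 1)) 1≤N₀) (m^n>0 (128 * S) {{>-nonZero (*-mono-≤ {1} {128} (s≤s z≤n) 1≤S)}} S)) (*-mono-≤ {1} {2} (s≤s z≤n) (*-mono-≤ {1} {4} (s≤s z≤n) (1≤2^ (length (primesBelow (bp (2 ^ (a₀ + t + 4))))))))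

  rich128 : ∀ a → ι 128 ≤ʳ ∑ inv (PB a t)
  rich128 a = ≤ʳ-trans (ι-mono (toWitness {a? = 128 ≤? 256} tt)) (rich256 a)

  module Run (g l x : ℕ) (g≥E : E ≤ g) (g≥N : N₀ ≤ bp g) (g-lo : 2 ^ (a₀ + t + 4 + σ + l) ≤ g) (g-hi : g < 2 ^ suc (a₀ + t + 4 + σ + l))
    (x-lo : bp (E * g) ≤ x) (x-hi : x < bp (E * suc g)) where

    n : ℕ
    n = σ + l + t + γ + 5

    open GoodPart t K a₀ T n rich128 a₀≥ j₀≥ T≥ using (j₀; m; Λ; 𝒫; Φ; good-weight; good-size; good-scale)

    L : ℕ
    L = j₀ + m

    -- The number `n` of scales is chosen for this identity, which places `2 ^ L` between `S g / 2`
    -- and `S g`; the end of the random part then lies below the range of the first forced prime.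
    L≡ : L ≡ σ + (a₀ + t + 4 + σ + l)
    L≡ = e a₀ t γ T σ l
      where
      e : ∀ a t γ T σ l → (a + t + 4) + (σ + l + t + γ + 5 + T) ≡ (T + t + γ + 5) + (a + t + 4 + σ + l)
      e = ℕSolver.solve-∀

    1≤g : 1 ≤ g
    1≤g = ≤-trans (1≤2^ (a₀ + t + 4 + σ + l)) g-lo

    2^L≤Sg : 2 ^ L ≤ S * g
    2^L≤Sg = ≤-trans (≤-reflexive (trans (cong (2 ^_) L≡) (^-distribˡ-+-* 2 σ (a₀ + t + 4 + σ + l)))) (*-monoʳ-≤ S g-lo)

    Sg≤ : S * g ≤ 2 * 2 ^ L
    Sg≤ = ≤-trans (*-monoʳ-≤ S (<⇒≤ g-hi)) (≤-reflexive (trans (sw S 2 (2 ^ (a₀ + t + 4 + σ + l))) (cong (2 *_) (trans (sym (^-distribˡ-+-* 2 σ (a₀ + t + 4 + σ + l))) (cong (2 ^_) (sym L≡))))))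
      where
      sw : ∀ a b c → a * (b * c) ≡ b * (a * c)
      sw = ℕSolver.solve-∀

    a∗ : ℕ
    a∗ = a₀ + n

    R∗ : List ℕ
    R∗ = PB a∗ t

    R∖ : List ℕ → List ℕ
    R∖ X = filter (λ r → ¬? (r ∈? X)) R∗

    uR∗ : Unique R∗
    uR∗ = sorted⇒unique (PB-sorted a∗ t)

    S≤bp : S ≤ bp (2 ^ a∗)
    S≤bp = ≤-trans (^-monoʳ-≤ 2 (≤-trans σ≤a∗ (≤-trans (<⇒≤ (n<2^n a∗)) (m≤n*m (2 ^ a∗) 16)))) (≤-reflexive (sym (bp-def (2 ^ a∗))))
      where
      σ≤a∗ : σ ≤ a∗
      σ≤a∗ = ≤-trans (≤-trans (m≤m+n σ (l + t + γ + 5)) (≤-reflexive (e σ l t γ))) (m≤n+m n a₀)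
        where
        e : ∀ σ l t γ → σ + (l + t + γ + 5) ≡ σ + l + t + γ + 5
        e = ℕSolver.solve-∀

    -- At most `S` primes are removed, each contributing at most `1 / bp (2 ^ a∗) ≤ 1 / S`. The
    -- reserve of `128` in `rich256` covers this loss.
    rich∖ : ∀ X → length X ≤ S → ι 128 ≤ʳ ∑ inv (R∖ X)
    rich∖ X lX = add-cancelʳ (ι 128) (begin
      ι 128 +ʳ ι 128                                            ≡⟨ sym (ι-+ 128 128) ⟩
      ι 256                                                     ≤⟨ rich256 a∗ ⟩
      ∑ inv R∗                                                  ≡⟨ trans (∑-filter-split (_∈? X) inv R∗) (ℚₚ.+-comm (∑ inv used) (∑ inv (R∖ X))) ⟩
      ∑ inv (R∖ X) +ʳ ∑ inv used                                ≤⟨ ℚₚ.+-monoʳ-≤ (∑ inv (R∖ X)) (≤ʳ-trans (∑-upper inv used (inv (bp (2 ^ a∗))) (λ r∈ → inv-anti (1≤bp (2 ^ a∗)) (proj₁ (proj₂ (PB⁻ a∗ t (proj₁ (∈-filter⁻ (_∈? X) {xs = R∗} r∈))))))) few) ⟩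
      ∑ inv (R∖ X) +ʳ ι 128 ∎)
      where
      open ℚₚ.≤-Reasoning
      used = filter (_∈? X) R∗
      few : ι (length used) *ʳ inv (bp (2 ^ a∗)) ≤ʳ ι 128
      few = ≤ʳ-trans (mulʳ (inv (bp (2 ^ a∗))) (0≤inv (bp (2 ^ a∗))) (ι-mono (≤-trans (length-⊆ used X (Uniqueₚ.filter⁺ (_∈? X) uR∗) (λ r∈ → proj₂ (∈-filter⁻ (_∈? X) {xs = R∗} r∈))) (≤-trans lX S≤bp))))
        (subst (_≤ʳ ι 128) (sym (trans (ι-inv (bp (2 ^ a∗)) (1≤bp (2 ^ a∗))) (sym ι1))) (ι-mono (s≤s z≤n)))

    lev : ℕ → ℕ
    lev s = (S + s) * g

    lev-suc : ∀ s → lev s + g ≡ lev (suc s)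
    lev-suc s = e S s g
      where
      e : ∀ S s g → (S + s) * g + g ≡ (S + suc s) * g
      e = ℕSolver.solve-∀

    -- A state is a list of primes of n together with the r already collected for the top scale;
    -- each stage adds a prime q supplying a new r, from its own range so that n determines the list.
    Q : ℕ → State → List ℕ
    Q s z = filter (hits? (R∖ (proj₂ z))) (Jr (lev s) g)

    next : State → ℕ → List ℕ
    next z q = pickD (R∖ (proj₂ z)) q (hits? (R∖ (proj₂ z)) q) (proj₂ z)

    good? : Decidable (λ s → Φ s <ʳ 1ℚ)
    good? s = Φ s ℚₚ.<? 1ℚ

    states : ℕ → List State
    states zero = map (λ s → (s , [])) (filter good? (subs 𝒫))
    states (suc s) = concatMap (λ z → map (λ q → (q ∷ proj₁ z , next z q)) (Q s z)) (states s)

    up : ℕ → ℕ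
    up s = C₁ * 2 ^ L + (e₀ s + s) * g

    record Inv (s : ℕ) (z : State) : Set where
      field
        srt : AllPairs _>_ (proj₁ z)
        prm : All Prime (proj₁ z)
        rng : All (λ q → bp (2 ^ j₀) ≤ q × q < bp (lev s)) (proj₁ z)
        plo : bp (e₀ s * g) ≤ product (proj₁ z)
        phi : product (proj₁ z) ≤ bp (up s)
        scl : ∀ i → i < n → ∃[ rs ] (Unique rs × K ≤ length rs × All (λ r → r ∈ PB (a₀ + i) t × (∃[ q ] (q ∈ proj₁ z × r ∣ pred q))) rs)
        uX  : Unique (proj₂ z)
        lX  : length (proj₂ z) ≡ s
        aX  : All (λ r → r ∈ R∗ × (∃[ q ] (q ∈ proj₁ z × r ∣ pred q))) (proj₂ z)

    inv-start : ∀ {z} → z ∈ states 0 → Inv 0 z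
    inv-start z∈ with ∈-map⁻ (λ s → (s , [])) z∈
    ... | s , s∈ , refl = record
      { srt = subs-sorted 𝒫 (PB-sorted j₀ m) s∈subs ; prm = All.tabulate (λ q∈ → proj₁ (mem q∈))
      ; rng = All.tabulate (λ q∈ → let (_ , lo , hi) = mem q∈ in lo , ≤-trans hi (bp-mono (≤-trans 2^L≤Sg (*-monoˡ-≤ g (m≤m+n S 0)))))
      ; plo = ≤-trans (≤-reflexive bp0) (productOfPrimes≥1 (All.tabulate (λ q∈ → proj₁ (mem q∈))))
      ; phi = ≤-trans (good-size s good) (bp-mono (≤-reflexive (e c₃ (2 ^ L))))
      ; scl = good-scale s good ; uX = [] ; lX = refl ; aX = [] }
      where
      s∈subs = proj₁ (∈-filter⁻ good? {xs = subs 𝒫} s∈)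
      good = proj₂ (∈-filter⁻ good? {xs = subs 𝒫} s∈)
      mem : ∀ {q} → q ∈ s → Prime q × bp (2 ^ j₀) ≤ q × q < bp (2 ^ L)
      mem q∈ = PB⁻ j₀ m (subs-⊆ 𝒫 s∈subs q∈)
      e : ∀ c u → 8 * (u * c) ≡ 8 * c * u + 0
      e = ℕSolver.solve-∀

    Q⁻ : ∀ s z {q} → q ∈ Q s z → (Prime q × bp (lev s) ≤ q × q < bp (lev (suc s))) × hits (R∖ (proj₂ z)) q
    Q⁻ s z {q} q∈ = let (a , b) = ∈-filter⁻ (hits? (R∖ (proj₂ z))) {xs = Jr (lev s) g} q∈ ; (c , d , e) = Jr⁻ (lev s) g a in (c , d , subst (λ y → q < bp y) (lev-suc s) e) , b

    inv-step : ∀ s {z q} → Inv s z → q ∈ Q s z → Inv (suc s) (q ∷ proj₁ z , next z q)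
    inv-step s {z} {q} I q∈ = record
      { srt = All.map (λ (_ , hi) → ≤-trans hi q-lo) rng ∷ srt ; prm = pq ∷ prm
      ; rng = (≤-trans (bp-mono (≤-trans (^-monoʳ-≤ 2 (m≤m+n j₀ m)) (≤-trans 2^L≤Sg (*-monoˡ-≤ g (m≤m+n S s))))) q-lo , q-hi) ∷ All.map (λ (lo , hi) → lo , ≤-trans hi (bp-mono (≤-trans (m≤m+n (lev s) g) (≤-reflexive (lev-suc s))))) rng
      ; plo = ≤-trans (≤-reflexive (trans (cong bp (e₁ (e₀ s) (S + s) g)) (bp-+ (lev s) (e₀ s * g)))) (*-mono-≤ q-lo plo)
      ; phi = ≤-trans (*-mono-≤ (<⇒≤ q-hi) phi) (≤-reflexive (trans (sym (bp-+ (lev (suc s)) (up s))) (cong bp (e₂ S s g (C₁ * 2 ^ L) (e₀ s)))))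
      ; scl = λ i i<n → let (rs , u , k , al) = scl i i<n in rs , u , k , All.map (λ (r∈ , q′ , q′∈ , d) → r∈ , q′ , there q′∈ , d) al
      ; uX = subst Unique (sym X≡) (All.tabulate (λ {r′} r′∈ e → r∉X (subst (_∈ X) (sym e) r′∈)) ∷ uX)
      ; lX = trans (cong length X≡) (cong suc lX)
      ; aX = subst (All _) (sym X≡) ((r∈R , q , here refl , r∣) ∷ All.map (λ (r∈ , q′ , q′∈ , d) → r∈ , q′ , there q′∈ , d) aX) }
      where
      open Inv I
      X = proj₂ z
      pq = proj₁ (proj₁ (Q⁻ s z q∈))
      q-lo = proj₁ (proj₂ (proj₁ (Q⁻ s z q∈)))
      q-hi = proj₂ (proj₂ (proj₁ (Q⁻ s z q∈)))
      pick = pickD-spec (R∖ X) q (hits? (R∖ X) q) X (proj₂ (Q⁻ s z q∈))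
      r = proj₁ pick
      r∣ = proj₁ (proj₂ (proj₂ pick))
      X≡ = proj₂ (proj₂ (proj₂ pick))
      r∈R = proj₁ (∈-filter⁻ (λ r → ¬? (r ∈? X)) {xs = R∗} (proj₁ (proj₂ pick)))
      r∉X = proj₂ (∈-filter⁻ (λ r → ¬? (r ∈? X)) {xs = R∗} (proj₁ (proj₂ pick)))
      e₁ : ∀ a b g → (a + b) * g ≡ b * g + a * g
      e₁ = ℕSolver.solve-∀
      e₂ : ∀ S s g c e → (S + suc s) * g + (c + (e + s) * g) ≡ c + (e + (S + s) + suc s) * g
      e₂ = ℕSolver.solve-∀

    ∈-extend⁻ : ∀ (Q : State → List ℕ) (next : State → ℕ → List ℕ) (ss : List State) {w : State} → w ∈ concatMap (λ z → map (λ q → (q ∷ proj₁ z , next z q)) (Q z)) ss →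
      Σ State (λ z → Σ ℕ (λ q → z ∈ ss × q ∈ Q z × w ≡ (q ∷ proj₁ z , next z q)))
    ∈-extend⁻ Q next (z ∷ ss) w∈ with ∈-++⁻ (map (λ q → (q ∷ proj₁ z , next z q)) (Q z)) w∈
    ... | inj₁ h = let (q , q∈ , e) = ∈-map⁻ (λ q → (q ∷ proj₁ z , next z q)) h in z , q , here refl , q∈ , e
    ... | inj₂ h = let (z′ , q , z∈ , q∈ , e) = ∈-extend⁻ Q next ss h in z′ , q , there z∈ , q∈ , e

    invariant : ∀ s {z} → z ∈ states s → Inv s z
    invariant zero z∈ = inv-start z∈
    invariant (suc s) w∈ = let (z , q , z∈ , q∈ , e) = ∈-extend⁻ (Q s) next (states s) w∈ in subst (Inv (suc s)) (sym e) (inv-step s (invariant s z∈) q∈)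

    Q-unique : ∀ s z → Unique (Q s z)
    Q-unique s z = Uniqueₚ.filter⁺ (hits? (R∖ (proj₂ z))) (sorted⇒unique (Jr-sorted (lev s) g))

    states-unique : ∀ s → Unique (map proj₁ (states s))
    states-unique zero = subst Unique (trans (sym (map-id′ ss)) (map-∘ {g = proj₁} {f = λ s → (s , [])} ss)) (Uniqueₚ.filter⁺ good? (subs-unique 𝒫 (sorted⇒unique (PB-sorted j₀ m))))
      where
      ss = filter good? (subs 𝒫)
      map-id′ : ∀ (xs : List (List ℕ)) → map (λ s → s) xs ≡ xs
      map-id′ [] = refl
      map-id′ (x ∷ xs) = cong (x ∷_) (map-id′ xs)
    states-unique (suc s) = unique-extend (Q s) next (states s) (Q-unique s) (states-unique s)

    c : ℕ
    c = 128 * S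

    1≤c : 1 ≤ c
    1≤c = *-mono-≤ {1} {128} (s≤s z≤n) 1≤S

    -- The range has `g` levels below `2 S g`, each contributing at least `1 / (64 · 2 S g)`. The
    -- result does not depend on `g`, so forcing a prime costs only the constant factor `c`.
    Q-sum : ∀ s z → s < S → Inv s z → inv c ≤ʳ ∑ inv (Q s z)
    Q-sum s z s<S I = subst (_≤ʳ ∑ inv (Q s z)) eq (level-sum (hits? (R∖ X)) (lev s) g (2 * S * g) bound (*-mono-≤ (*-mono-≤ {1} {2} (s≤s z≤n) 1≤S) 1≤g)
        (λ k lo _ → hit-count k (≤-trans (≤-trans 1≤g (≤-trans (m≤n*m g S {{>-nonZero 1≤S}}) (*-monoˡ-≤ g (m≤m+n S s)))) lo) (R∖ X) (Uniqueₚ.filter⁺ (λ r → ¬? (r ∈? X)) uR∗)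
          (All.tabulate (λ r∈ → All.lookup (PB-bounds a∗ t k (≤-trans far lo)) (proj₁ (∈-filter⁻ (λ r → ¬? (r ∈? X)) {xs = R∗} r∈)))) (rich∖ X (≤-trans (≤-reflexive (Inv.lX I)) (<⇒≤ s<S)))))
      where
      X = proj₂ z
      bound : lev s + g ≤ 2 * S * g
      bound = ≤-trans (≤-reflexive (lev-suc s)) (*-monoˡ-≤ g (≤-trans (+-monoʳ-≤ S s<S) (≤-reflexive (cong (λ z → S + z) (sym (+-identityʳ S))))))
      far : 2 ^ (a∗ + t + 4) ≤ lev s
      far = ≤-trans (^-monoʳ-≤ 2 (≤-trans (≤-reflexive (e a₀ n t)) (+-monoʳ-≤ j₀ (m≤m+n n T)))) (≤-trans 2^L≤Sg (*-monoˡ-≤ g (m≤m+n S s)))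
        where
        e : ∀ a n t → a + n + t + 4 ≡ a + t + 4 + n
        e = ℕSolver.solve-∀
      eq : ι g *ʳ inv (64 * (2 * S * g)) ≡ inv c
      eq = trans (cong (λ z → ι g *ʳ inv z) (sw S g)) (trans (cong (ι g *ʳ_) (inv-* g c)) (trans (sym (ℚₚ.*-assoc (ι g) (inv g) (inv c))) (trans (cong (_*ʳ inv c) (ι-inv g 1≤g)) (ℚₚ.*-identityˡ (inv c)))))
        where
        sw : ∀ S g → 64 * (2 * S * g) ≡ g * (128 * S)
        sw = ℕSolver.solve-∀

    weight : List State → ℚ
    weight = ∑ (λ z → wt (proj₁ z))

    states-weight : ∀ s → s ≤ S → inv c ^ʳ s *ʳ (W 𝒫 *ʳ inv 2) ≤ʳ weight (states s)
    states-weight zero _ = subst₂ _≤ʳ_ (sym (ℚₚ.*-identityˡ (W 𝒫 *ʳ inv 2))) (trans (𝔼-subs 𝒫 (λ s → 𝟙 (good? s))) (trans (∑-cong (subs 𝒫) (λ {s} _ → ℚₚ.*-comm (wt s) (𝟙 (good? s)))) (trans (sym (∑-filter good? wt (subs 𝒫))) (sym (∑-map (λ z → wt (proj₁ z)) (λ s → (s , [])) (filter good? (subs 𝒫))))))) good-weight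
    states-weight (suc s) s<S = begin
      inv c *ʳ inv c ^ʳ s *ʳ (W 𝒫 *ʳ inv 2)        ≡⟨ ℚₚ.*-assoc (inv c) (inv c ^ʳ s) (W 𝒫 *ʳ inv 2) ⟩
      inv c *ʳ (inv c ^ʳ s *ʳ (W 𝒫 *ʳ inv 2))      ≤⟨ mulˡ (inv c) (0≤inv c) (states-weight s (<⇒≤ s<S)) ⟩
      inv c *ʳ weight (states s)                   ≡⟨ sym (∑-*ˡ (inv c) (λ z → wt (proj₁ z)) (states s)) ⟩
      ∑ (λ z → inv c *ʳ wt (proj₁ z)) (states s)   ≤⟨ ∑-mono (states s) (λ {z} z∈ → each z (invariant s z∈)) ⟩
      ∑ (λ z → ∑ (λ z → wt (proj₁ z)) (map (λ q → (q ∷ proj₁ z , next z q)) (Q s z))) (states s) ≡⟨ sym (∑-concatMap (λ z → wt (proj₁ z)) (λ z → map (λ q → (q ∷ proj₁ z , next z q)) (Q s z)) (states s)) ⟩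
      weight (states (suc s)) ∎
      where
      open ℚₚ.≤-Reasoning
      each : ∀ z → Inv s z → inv c *ʳ wt (proj₁ z) ≤ʳ ∑ (λ z → wt (proj₁ z)) (map (λ q → (q ∷ proj₁ z , next z q)) (Q s z))
      each z I = subst (inv c *ʳ wt (proj₁ z) ≤ʳ_) (sym (trans (∑-map (λ z → wt (proj₁ z)) (λ q → (q ∷ proj₁ z , next z q)) (Q s z)) (trans (∑-cong (Q s z) (λ {q} _ → trans (inv-* q (product (proj₁ z))) (ℚₚ.*-comm (inv q) (wt (proj₁ z))))) (trans (∑-*ˡ (wt (proj₁ z)) inv (Q s z)) (ℚₚ.*-comm (wt (proj₁ z)) (∑ inv (Q s z))))))) (mulʳ (wt (proj₁ z)) (0≤wt (proj₁ z)) (Q-sum s z s<S I))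

    den : State → ℕ
    den z = N₀ * product (proj₁ z)

    -- The first `pred` gives the largest `v` with `bp v` at most the quotient; the second leaves
    -- room for the whole interval up to `bp (suc k)`, so that every `q ∈ J k` keeps `n ≤ x`.
    level-of : State → ℕ
    level-of z = pred (pred (lg (quot x (den z))))

    record Last (z : State) (k : ℕ) : Set where
      field
        k-lo : 2 * S * g ≤ k
        k-hi : suc k ≤ 2 ^ (L + γ)
        fits : bp (suc k) * den z ≤ x
        full : x < bp (suc (suc k)) * den z

    last : ∀ z → Inv S z → Last z (level-of z)
    last z I = go (pred (lg y)) (log-bracket y (suc (2 * S * g)) (≤quot b 1≤b room))
      where
      open Inv I
      b = den z
      1≤b : 1 ≤ b
      1≤b = *-mono-≤ 1≤N₀ (productOfPrimes≥1 prm)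
      y = quot x b
      -- The upper bound on `N₀ * product` together with the budget `E` leaves a quotient above
      -- `bp (2 S g)`, the end of the range of the last forced prime.
      room : bp (suc (2 * S * g)) * b ≤ x
      room = ≤-trans (*-monoʳ-≤ (bp (suc (2 * S * g))) (*-mono-≤ g≥N phi)) (≤-trans (≤-reflexive (sym (trans (bp-+ (suc (2 * S * g)) (g + up S)) (cong (bp (suc (2 * S * g)) *_) (bp-+ g (up S))))))
        (≤-trans (bp-mono (≤-trans (+-mono-≤ (s≤s (≤-refl {2 * S * g})) (+-monoʳ-≤ g (+-monoˡ-≤ ((e₀ S + S) * g) (*-monoʳ-≤ C₁ 2^L≤Sg)))) (≤-trans (+-monoˡ-≤ (g + (C₁ * (S * g) + (e₀ S + S) * g)) (+-monoˡ-≤ (2 * S * g) 1≤g)) (≤-reflexive (e S g C₁ (e₀ S)))))) x-lo))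
        where
        e : ∀ S g C e → g + 2 * S * g + (g + (C * (S * g) + (e + S) * g)) ≡ (C * S + e + (S + (2 * S + 2))) * g
        e = ℕSolver.solve-∀
      below : x < suc y * b
      below = quot-< x b 1≤b
      go : ∀ v → suc (2 * S * g) ≤ v × bp v ≤ y × y < bp (suc v) → Last z (pred v)
      go (suc k) (lo , bp≤ , bp>) = record { k-lo = s≤s⁻¹ lo ; k-hi = top ; fits = fit ; full = ≤-trans below (*-monoˡ-≤ b bp>) }
        where
        fit : bp (suc k) * b ≤ x
        fit = ≤-trans (*-monoˡ-≤ b bp≤) (quot-*≤ x b)
        sum< : suc k + e₀ S * g < E * suc g
        sum< = bp-cancel-< (≤-trans (s≤s (≤-trans (≤-reflexive (bp-+ (suc k) (e₀ S * g))) (≤-trans (*-monoʳ-≤ (bp (suc k)) (≤-trans plo (m≤n*m (product (proj₁ z)) N₀ {{>-nonZero 1≤N₀}}))) fit))) x-hi)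
        -- The lower bound `plo` cancels the term `e₀ S`, which is quadratic in `S`. What remains is
        -- `(C₁ + 6) S g`, at most `2 (C₁ + 6) 2 ^ L`, with a factor free of `S` that `2 ^ γ`
        -- dominates.
        top : suc k ≤ 2 ^ (L + γ)
        top = ≤-trans (+-cancelʳ-≤ (e₀ S * g) (suc k) ((C₁ + 6) * (S * g)) (≤-trans (<⇒≤ sum<) (≤-trans (≤-reflexive (*-suc E g)) (≤-trans (+-monoˡ-≤ (E * g) g≥E) (≤-trans (≤-reflexive (e S g C₁ (e₀ S))) (≤-trans (+-monoʳ-≤ (C₁ * (S * g) + e₀ S * g + 3 * (S * g)) (*-monoʳ-≤ 3 (m≤n*m g S {{>-nonZero 1≤S}}))) (≤-reflexive (e′ S g C₁ (e₀ S)))))))))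
          (≤-trans (*-monoʳ-≤ (C₁ + 6) Sg≤) (≤-trans (≤-reflexive (e″ (C₁ + 6) (2 ^ L))) (≤-trans (*-monoˡ-≤ (2 ^ L) γ≥) (≤-reflexive (trans (*-comm (2 ^ γ) (2 ^ L)) (sym (^-distribˡ-+-* 2 L γ)))))))
          where
          e : ∀ S g C e → g + (C * S + e + (S + (2 * S + 2))) * g ≡ C * (S * g) + e * g + 3 * (S * g) + 3 * g
          e = ℕSolver.solve-∀
          e′ : ∀ S g C e → C * (S * g) + e * g + 3 * (S * g) + 3 * (S * g) ≡ (C + 6) * (S * g) + e * g
          e′ = ℕSolver.solve-∀
          e″ : ∀ c u → c * (2 * u) ≡ 2 * c * u
          e″ = ℕSolver.solve-∀

    fstates : List State
    fstates = concatMap (λ z → map (λ q → (q ∷ proj₁ z , proj₂ z)) (J (level-of z))) (states S)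

    value : State → ℕ
    value z = N₀ * product (proj₁ z)

    ns : List ℕ
    ns = map value fstates

    record Full (w : State) : Set where
      field
        srt : AllPairs _>_ (proj₁ w)
        prm : All Prime (proj₁ w)
        rng : All (λ q → bp (2 ^ j₀) ≤ q × q < bp (2 ^ (L + γ))) (proj₁ w)
        scl : ∀ i → i < n → ∃[ rs ] (Unique rs × K ≤ length rs × All (λ r → r ∈ PB (a₀ + i) t × (∃[ q ] (q ∈ proj₁ w × r ∣ pred q))) rs)
        uX  : Unique (proj₂ w)
        lX  : length (proj₂ w) ≡ S
        aX  : All (λ r → r ∈ R∗ × (∃[ q ] (q ∈ proj₁ w × r ∣ pred q))) (proj₂ w)
        val : value w ≤ x

    full-inv : ∀ {w} → w ∈ fstates → Full w
    full-inv w∈ with ∈-extend⁻ (λ z → J (level-of z)) (λ z _ → proj₂ z) (states S) w∈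
    ... | z , q , z∈ , q∈ , refl = record
      { srt = All.map (λ (_ , hi) → ≤-trans hi (≤-trans (bp-mono (≤-trans (≤-reflexive lev-S) k-lo)) q-lo)) (Inv.rng I) ∷ Inv.srt I ; prm = pq ∷ Inv.prm I
      ; rng = (≤-trans (bp-mono (≤-trans (^-monoʳ-≤ 2 (m≤m+n j₀ m)) (≤-trans 2^L≤Sg (≤-trans (*-monoˡ-≤ g (m≤n*m S 2)) k-lo)))) q-lo , ≤-trans q-hi (bp-mono k-hi)) ∷ All.map (λ (lo , hi) → lo , ≤-trans hi (bp-mono (≤-trans (≤-reflexive lev-S) (≤-trans k-lo (≤-trans (n≤1+n k) k-hi))))) (Inv.rng I)
      ; scl = λ i i<n → let (rs , u , k , al) = Inv.scl I i i<n in rs , u , k , All.map (λ (r∈ , q′ , q′∈ , d) → r∈ , q′ , there q′∈ , d) al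
      ; uX = Inv.uX I ; lX = Inv.lX I ; aX = All.map (λ (r∈ , q′ , q′∈ , d) → r∈ , q′ , there q′∈ , d) (Inv.aX I)
      ; val = ≤-trans (≤-reflexive (sw N₀ q (product (proj₁ z)))) (≤-trans (*-monoˡ-≤ (den z) (<⇒≤ q-hi)) fits) }
      where
      I = invariant S z∈
      open Last (last z I)
      k = level-of z
      pq = proj₁ (∈-J⁻ {k} q∈)
      q-lo = proj₁ (proj₂ (∈-J⁻ {k} q∈))
      q-hi = proj₂ (proj₂ (∈-J⁻ {k} q∈))
      lev-S : lev S ≡ 2 * S * g
      lev-S = cong (_* g) (cong (λ z → S + z) (sym (+-identityʳ S)))
      sw : ∀ a b c → a * (b * c) ≡ b * (a * c)
      sw = ℕSolver.solve-∀

    ns-unique : Unique ns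
    ns-unique = subst Unique (sym (map-∘ {g = λ l → N₀ * product l} {f = proj₁} fstates))
      (unique-map-on (map proj₁ fstates) (unique-extend (λ z → J (level-of z)) (λ z _ → proj₂ z) (states S) (λ z → J-unique (level-of z)) (states-unique S)) inj)
      where
      of : ∀ {l} → l ∈ map proj₁ fstates → AllPairs _>_ l × All Prime l
      of l∈ = let (w , w∈ , e) = ∈-map⁻ proj₁ l∈ in subst (λ l → AllPairs _>_ l × All Prime l) (sym e) (Full.srt (full-inv w∈) , Full.prm (full-inv w∈))
      inj : ∀ {l l′} → l ∈ map proj₁ fstates → l′ ∈ map proj₁ fstates → N₀ * product l ≡ N₀ * product l′ → l ≡ l′
      inj {l} {l′} a b e = sorted-product-injective l l′ (proj₂ (of a)) (proj₂ (of b)) (proj₁ (of a)) (proj₁ (of b)) (*-cancelˡ-≡ _ _ N₀ {{>-nonZero 1≤N₀}} e)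

    -- Consecutive powers of `β` differ by the factor `bp 1`, so the interval for `q` has length
    -- comparable to `x / den z`; the primes in it lose a factor `k + 1 ≤ 2 ^ (L + γ)`.
    last-count : ∀ z → Inv S z → x ≤ (2 ^ L * D₁ * N₀) * product (proj₁ z) * length (J (level-of z))
    last-count z I = begin
      x                                                ≤⟨ <⇒≤ full ⟩
      bp (suc (suc k)) * den z                         ≡⟨ cong (_* den z) (bp-+ 1 (suc k)) ⟩
      bp 1 * bp (suc k) * den z                        ≤⟨ *-monoˡ-≤ (den z) (*-monoʳ-≤ (bp 1) (≤-trans (J-count k 1≤k) (*-monoʳ-≤ 64 (*-monoˡ-≤ (length (J k)) k-hi)))) ⟩
      bp 1 * (64 * (2 ^ (L + γ) * length (J k))) * den z ≡⟨ cong (λ u → bp 1 * (64 * (u * length (J k))) * den z) (^-distribˡ-+-* 2 L γ) ⟩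
      bp 1 * (64 * (2 ^ L * 2 ^ γ * length (J k))) * den z ≡⟨ e (bp 1) (2 ^ L) (2 ^ γ) (length (J k)) N₀ (product (proj₁ z)) ⟩
      (2 ^ L * D₁ * N₀) * product (proj₁ z) * length (J k) ∎
      where
      open ≤-Reasoning
      open Last (last z I)
      k = level-of z
      1≤k : 1 ≤ k
      1≤k = ≤-trans (*-mono-≤ (*-mono-≤ {1} {2} (s≤s z≤n) 1≤S) 1≤g) k-lo
      e : ∀ b u v j N p → b * (64 * (u * v * j)) * (N * p) ≡ (u * (64 * v * b) * N) * p * j
      e = ℕSolver.solve-∀

    -- The factor `2 ^ L` on the left is the mass of the random part, the one on the right the
    -- density of the last prime; `proportion` cancels them.
    count : x * 2 ^ L ≤ 2 ^ L * D * length ns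
    count = ι-cancel (begin
      ι (x * 2 ^ L)                                              ≡⟨ ι-* x (2 ^ L) ⟩
      ι x *ʳ ι (2 ^ L)                                           ≤⟨ mulˡ (ι x) (0≤ι x) (PB-weight j₀ m) ⟩
      ι x *ʳ (ι Z *ʳ W 𝒫)                                        ≡⟨ cong (λ w → ι x *ʳ (ι Z *ʳ w)) (trans (sym (ℚₚ.*-identityʳ (W 𝒫))) (trans (cong (W 𝒫 *ʳ_) (sym (ι-inv 2 (s≤s z≤n)))) (r₁ (W 𝒫) (ι 2) (inv 2)))) ⟩
      ι x *ʳ (ι Z *ʳ (ι 2 *ʳ (W 𝒫 *ʳ inv 2)))                    ≡⟨ cong (λ w → ι x *ʳ (ι Z *ʳ (ι 2 *ʳ w))) (trans (sym (ℚₚ.*-identityˡ (W 𝒫 *ʳ inv 2))) (trans (cong (_*ʳ (W 𝒫 *ʳ inv 2)) (sym (inv^ c 1≤c S))) (ℚₚ.*-assoc (ι (c ^ S)) (inv c ^ʳ S) (W 𝒫 *ʳ inv 2)))) ⟩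
      ι x *ʳ (ι Z *ʳ (ι 2 *ʳ (ι (c ^ S) *ʳ (inv c ^ʳ S *ʳ (W 𝒫 *ʳ inv 2))))) ≤⟨ mulˡ (ι x) (0≤ι x) (mulˡ (ι Z) (0≤ι Z) (mulˡ (ι 2) (0≤ι 2) (mulˡ (ι (c ^ S)) (0≤ι (c ^ S)) (states-weight S ≤-refl)))) ⟩
      ι x *ʳ (ι Z *ʳ (ι 2 *ʳ (ι (c ^ S) *ʳ weight (states S))))  ≡⟨ r₂ (ι x) (ι Z) (ι 2) (ι (c ^ S)) (weight (states S)) ⟩
      (ι Z *ʳ (ι 2 *ʳ ι (c ^ S))) *ʳ (ι x *ʳ weight (states S))  ≤⟨ mulˡ (ι Z *ʳ (ι 2 *ʳ ι (c ^ S))) (0≤* (0≤ι Z) (0≤* (0≤ι 2) (0≤ι (c ^ S)))) total ⟩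
      (ι Z *ʳ (ι 2 *ʳ ι (c ^ S))) *ʳ (ι Y *ʳ ι (length ns))      ≡⟨ cong₂ (λ a b → ι Z *ʳ a *ʳ b) (sym (ι-* 2 (c ^ S))) (sym (ι-* Y (length ns))) ⟩
      (ι Z *ʳ ι (2 * c ^ S)) *ʳ ι (Y * length ns)                ≡⟨ trans (cong (_*ʳ ι (Y * length ns)) (sym (ι-* Z (2 * c ^ S)))) (sym (ι-* (Z * (2 * c ^ S)) (Y * length ns))) ⟩
      ι (Z * (2 * c ^ S) * (Y * length ns))                      ≡⟨ cong ι (r₃ Z (c ^ S) (2 ^ L) D₁ N₀ (length ns)) ⟩
      ι (2 ^ L * D * length ns) ∎)
      where
      open ℚₚ.≤-Reasoning
      Z = lowW j₀
      Y = 2 ^ L * D₁ * N₀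
      r₁ : ∀ w a b → w *ʳ (a *ʳ b) ≡ a *ʳ (w *ʳ b)
      r₁ = solve-∀ ring
      r₂ : ∀ x z t c w → x *ʳ (z *ʳ (t *ʳ (c *ʳ w))) ≡ (z *ʳ (t *ʳ c)) *ʳ (x *ʳ w)
      r₂ = solve-∀ ring
      r₃ : ∀ Z C u d N k → Z * (2 * C) * (u * d * N * k) ≡ u * (d * N * C * (2 * Z)) * k
      r₃ = ℕSolver.solve-∀
      per : ∀ z → Inv S z → ι x *ʳ wt (proj₁ z) ≤ʳ ι Y *ʳ ι (length (J (level-of z)))
      per z I = subst (_≤ʳ ι Y *ʳ ι j) (ℚₚ.*-comm (wt (proj₁ z)) (ι x)) (≤ι*⇒inv*≤ p 1≤p (subst (ι x ≤ʳ_) (trans (cong ι (sw Y p j)) (trans (ι-* p (Y * j)) (cong (ι p *ʳ_) (ι-* Y j)))) (ι-mono (last-count z I))))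
        where
        p = product (proj₁ z)
        j = length (J (level-of z))
        1≤p : 1 ≤ p
        1≤p = productOfPrimes≥1 (Inv.prm I)
        sw : ∀ Y p j → Y * p * j ≡ p * (Y * j)
        sw = ℕSolver.solve-∀
      lengths : ∀ ss → ι (length (concatMap (λ z → map (λ q → (q ∷ proj₁ z , proj₂ z)) (J (level-of z))) ss)) ≡ ∑ (λ z → ι (length (J (level-of z)))) ss
      lengths [] = ι0
      lengths (z ∷ ss) = trans (cong ι (length-++ (map f (J (level-of z))))) (trans (ι-+ (length (map f (J (level-of z)))) _) (cong₂ _+ʳ_ (cong ι (length-map f (J (level-of z)))) (lengths ss)))
        where
        f : ℕ → State
        f q = (q ∷ proj₁ z , proj₂ z)
      total : ι x *ʳ weight (states S) ≤ʳ ι Y *ʳ ι (length ns)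
      total = subst₂ _≤ʳ_ (∑-*ˡ (ι x) (λ z → wt (proj₁ z)) (states S))
        (trans (∑-*ˡ (ι Y) (λ z → ι (length (J (level-of z)))) (states S)) (cong (ι Y *ʳ_) (trans (sym (lengths (states S))) (cong ι (sym (length-map value fstates))))))
        (∑-mono (states S) (λ {z} z∈ → per z (invariant S z∈)))

    proportion : x ≤ D * length ns
    proportion = *-cancelˡ-≤ (2 ^ L) {{>-nonZero (1≤2^ L)}} (subst₂ _≤_ (*-comm x (2 ^ L)) (*-assoc (2 ^ L) D (length ns)) count)

    scale-of : ∀ {P} k → bp (2 ^ (a₀ + t)) ≤ P → P < bp (2 ^ (a₀ + t + k)) → ∃[ i ] (i < k × bp (2 ^ (a₀ + t + i)) ≤ P × P < bp (2 ^ (a₀ + t + suc i)))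
    scale-of {P} zero lo hi = ⊥-elim (<-irrefl refl (≤-trans (subst (λ z → P < bp (2 ^ z)) (+-identityʳ (a₀ + t)) hi) lo))
    scale-of {P} (suc k) lo hi with bp (2 ^ (a₀ + t + k)) ≤? P
    ... | yes le = k , ≤-refl , le , hi
    ... | no gt = let (i , i<k , rest) = scale-of k lo (≰⇒> gt) in i , m≤n⇒m≤1+n i<k , rest

    -- Three ranges of `P`: below `bp (2 ^ (a₀ + t))` the base suffices, on the `n` scales the
    -- random part gives `K` primes `r`, and above them the `S` primes collected in the second
    -- component of the state are used.
    dense-value : ∀ w → Full w → Density.Dense H (φ (value w)) × Density.Dense H (carmichael (value w))
    dense-value w F = dense-φ , dense-λ
      where
      open Full F
      B = bp (2 ^ (L + γ))
      HH = H * suc H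
      j₀≤ : 2 ^ a₀ ≤ 2 ^ (L + γ)
      j₀≤ = ^-monoʳ-≤ 2 (≤-trans (m≤m+n a₀ (t + 4)) (≤-trans (≤-reflexive (sym (+-assoc a₀ t 4))) (≤-trans (m≤m+n j₀ m) (m≤m+n L γ))))
      power : ∀ a rs → All (λ r → r ∈ PB a t × (∃[ q ] (q ∈ proj₁ w × r ∣ pred q))) rs → bp (2 ^ a * length rs) ≤ product rs
      power a rs al = ≤-trans (≤-reflexive (sym (bp-^ (2 ^ a) (length rs)))) (product-≥ rs (All.map (λ (r∈ , _) → proj₁ (proj₂ (PB⁻ a t r∈))) al))
      reach : ∀ {P} → Prime P → P ≤ B → P * HH ≤ M ⊎ (∃[ rs ] (Unique rs × All (λ r → Prime r × r < P × (∃[ q ] (q ∈ proj₁ w × r ∣ pred q))) rs × P * HH ≤ product rs))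
      reach {P} pP P≤B with bp (2 ^ (a₀ + t)) ≤? P | bp (2 ^ (a₀ + t + n)) ≤? P
      ... | no lt | _ = inj₁ (≤-trans (*-monoˡ-≤ HH (<⇒≤ (≰⇒> lt))) M≥)
      ... | yes _ | yes ge = inj₂ (proj₂ w , uX , All.map (λ (r∈ , ex) → let (pr , _ , hi) = PB⁻ a∗ t r∈ in pr , ≤-trans hi (≤-trans (bp-mono (≤-reflexive (cong (2 ^_) (sw a₀ n t)))) ge) , ex) aX ,
          ≤-trans (*-mono-≤ P≤B (≤-trans HH≤ (bp-mono j₀≤))) (≤-trans (≤-reflexive (trans (sym (bp-+ (2 ^ (L + γ)) (2 ^ (L + γ)))) (cong bp (sym (2^suc (L + γ)))))) (≤-trans (bp-mono (≤-reflexive expo)) (power a∗ (proj₂ w) aX))))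
        where
        sw : ∀ a n t → a + n + t ≡ a + t + n
        sw = ℕSolver.solve-∀
        -- The exponent of `B²` equals `S` times that of the lower end of the top scale. One factor
        -- `B` bounds `P`, the other absorbs `H (H + 1)`.
        expo : 2 ^ suc (L + γ) ≡ 2 ^ a∗ * length (proj₂ w)
        expo = trans (cong (2 ^_) (e a₀ n t T γ)) (trans (^-distribˡ-+-* 2 a∗ σ) (cong (2 ^ a∗ *_) (sym lX)))
          where
          e : ∀ a n t T γ → suc (a + t + 4 + (n + T) + γ) ≡ a + n + (T + t + γ + 5)
          e = ℕSolver.solve-∀
      ... | yes ge | no lt = let (i , i<n , lo , hi) = scale-of n ge (≰⇒> lt) ; (rs , u , K≤ , al) = scl i i<n in
          inj₂ (rs , u , All.map (λ (r∈ , ex) → let (pr , _ , r<) = PB⁻ (a₀ + i) t r∈ in pr , ≤-trans r< (≤-trans (bp-mono (≤-reflexive (cong (2 ^_) (sw a₀ i t)))) lo) , ex) al ,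
            ≤-trans (*-mono-≤ (<⇒≤ hi) (≤-trans HH≤ (bp-mono (^-monoʳ-≤ 2 (≤-trans (m≤m+n a₀ t) (m≤m+n (a₀ + t) (suc i)))))))
              (≤-trans (≤-reflexive (trans (sym (bp-+ (2 ^ (a₀ + t + suc i)) (2 ^ (a₀ + t + suc i)))) (cong bp (sym (2^suc (a₀ + t + suc i))))))
                (≤-trans (bp-mono (≤-trans (≤-reflexive (trans (cong (2 ^_) (e a₀ t i)) (trans (^-distribˡ-+-* 2 (a₀ + i) (t + 2)) (cong (2 ^ (a₀ + i) *_) (sym K≡))))) (*-monoʳ-≤ (2 ^ (a₀ + i)) K≤))) (power (a₀ + i) rs al))))
        where
        sw : ∀ a n t → a + n + t ≡ a + t + n
        sw = ℕSolver.solve-∀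
        -- Since `K = 2 ^ (t + 2)`, the `K` primes `r ≥ bp (2 ^ (a₀ + i))` multiply to at least the
        -- square of the upper end `bp (2 ^ (a₀ + t + i + 1))` of the scale.
        e : ∀ a t i → suc (a + t + suc i) ≡ a + i + (t + 2)
        e = ℕSolver.solve-∀
      open DenseTotient H M 1≤M dM (proj₁ w) prm (sorted⇒unique srt)
        (λ q∈ d → <-irrefl refl (≤-trans (Mp (All.lookup prm q∈) d) (≤-trans (bp-mono (^-monoʳ-≤ 2 (≤-trans (m≤m+n a₀ (t + 4)) (≤-reflexive (sym (+-assoc a₀ t 4)))))) (proj₁ (All.lookup rng q∈)))))
        B (All.map (λ (_ , hi) → <⇒≤ hi) rng) (λ pq d → ≤-trans (<⇒≤ (Mp pq d)) (bp-mono j₀≤)) reach using (dense-φ; dense-λ)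

    ns-good : All (λ k → 1 ≤ k × k ≤ x × Density.Dense H (φ k) × Density.Dense H (carmichael k)) ns
    ns-good = Allₚ.map⁺ (All.tabulate (λ {w} w∈ → let F = full-inv w∈ in *-mono-≤ 1≤N₀ (productOfPrimes≥1 (Full.prm F)) , Full.val F , dense-value w F))

-- Choice of the parameters.

prime∣^ : ∀ {q} b A → Prime q → q ∣ b ^ A → q ∣ b
prime∣^ b zero pq d = ⊥-elim (<-irrefl (sym (∣1⇒≡1 d)) (prime⇒≥2 pq))
prime∣^ b (suc A) pq d = case euclidsLemma b (b ^ A) pq d of λ { (inj₁ x) → x ; (inj₂ x) → prime∣^ b A pq x }

prime∣fac : ∀ {q} n → Prime q → q ∣ fac n → q ≤ n
prime∣fac zero pq d = ⊥-elim (<-irrefl (sym (∣1⇒≡1 d)) (prime⇒≥2 pq))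
prime∣fac (suc n) pq d = case euclidsLemma (suc n) (fac n) pq d of λ { (inj₁ x) → ∣⇒≤ x ; (inj₂ x) → m≤n⇒m≤1+n (prime∣fac n pq x) }

positive-proportion : ∀ h t γ → (∀ a → ι 256 ≤ʳ ∑ inv (PB a t)) → 2 * (8 * c₃ + 6) ≤ 2 ^ γ →
  ∃[ b ] (1 ≤ b × ∃[ x₀ ] (∀ x → x₀ ≤ x → ∃[ ns ] (Unique ns × All (λ n → 1 ≤ n × n ≤ x × Density.Dense h (φ n) × Density.Dense h (carmichael n)) ns × x ≤ b * length ns)))
positive-proportion h t γ rich γ≥ = D , 1≤D , bp (E * g₀) , run
  where
  K T HH V a₀ A M : ℕ
  K = 2 ^ (t + 2)
  T = (K + 13) * 512
  HH = h * suc h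
  V = 2 * suc h
  -- The summand `T` makes the lowest windows long enough, `HH` makes `h (h + 1)` negligible at
  -- every scale, and `V` puts the prime factors of `M` below those of the random part.
  a₀ = t + 10 + (T + (HH + V))
  -- The first summand provides `fac V ≤ 2 ^ A` for `base-dense`, the second makes `M` dominate
  -- every `P` below the first scale.
  A = fac V + bp (2 ^ (a₀ + t)) * HH
  M = 2 ^ A * fac V
  below : ∀ {k} → k ≤ a₀ → k < bp (2 ^ a₀)
  below k≤ = ≤-trans (s≤s (≤-trans k≤ (<⇒≤ (n<2^n a₀)))) (n<bp (2 ^ a₀))
  T≤a₀ : T ≤ a₀
  T≤a₀ = ≤-trans (m≤m+n T (HH + V)) (m≤n+m (T + (HH + V)) (t + 10))
  HH≤a₀ : HH ≤ a₀
  HH≤a₀ = ≤-trans (m≤m+n HH V) (≤-trans (m≤n+m (HH + V) T) (m≤n+m (T + (HH + V)) (t + 10)))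
  V≤a₀ : V ≤ a₀
  V≤a₀ = ≤-trans (m≤n+m V HH) (≤-trans (m≤n+m (HH + V) T) (m≤n+m (T + (HH + V)) (t + 10)))
  j₀≥ : T ≤ a₀ + t + 4
  j₀≥ = ≤-trans T≤a₀ (≤-trans (m≤m+n a₀ t) (m≤m+n (a₀ + t) 4))
  1≤M : 1 ≤ M
  1≤M = *-mono-≤ (1≤2^ A) (1≤fac V)
  M≥ : bp (2 ^ (a₀ + t)) * HH ≤ M
  M≥ = ≤-trans (m≤n+m _ (fac V)) (≤-trans (<⇒≤ (n<2^n A)) (m≤m*n (2 ^ A) (fac V) {{>-nonZero (1≤fac V)}}))
  dM : Density.Dense h M
  dM = Density.base-dense h V A ≤-refl (≤-trans (m≤m+n (fac V) (bp (2 ^ (a₀ + t)) * HH)) (<⇒≤ (n<2^n A)))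
  Mp : ∀ {q} → Prime q → q ∣ M → q < bp (2 ^ a₀)
  Mp {q} pq d = below (≤-trans q≤V V≤a₀)
    where
    q≤V : q ≤ V
    q≤V = case euclidsLemma (2 ^ A) (fac V) pq d of λ { (inj₁ x) → ≤-trans (∣⇒≤ (prime∣^ 2 A pq x)) (*-monoʳ-≤ 2 (s≤s (z≤n {h}))) ; (inj₂ x) → prime∣fac V pq x }
  open Final h t γ K T a₀ M rich γ≥ refl (m≤m+n (t + 10) (T + (HH + V))) j₀≥ ≤-refl (<⇒≤ (below HH≤a₀)) 1≤M dM M≥ Mp
  base : ℕ
  base = a₀ + t + 4 + σ
  g₀ : ℕ
  g₀ = E + (N₀ + 2 ^ base)
  1≤E : 1 ≤ E
  1≤E = ≤-trans (≤-trans 1≤S (m≤m+n S (2 * S + 2))) (m≤n+m (S + (2 * S + 2)) (C₁ * S + e₀ S))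
  run : ∀ x → bp (E * g₀) ≤ x → ∃[ ns ] (Unique ns × All (λ n → 1 ≤ n × n ≤ x × Density.Dense h (φ n) × Density.Dense h (carmichael n)) ns × x ≤ D * length ns)
  run x x≥ with log-bracket x (E * g₀) x≥
  ... | v≥ , bp≤ , bp> = go (log₂-bracket g (≤-trans (≤-trans 1≤E (m≤m+n E (N₀ + 2 ^ base))) g₀≤g))
    where
    v = pred (lg x)
    -- The logarithm `v` of `x` is divided by the budget `E`, so `x` lies between `bp (E * g)` and
    -- `bp (E * suc g)`.
    g = quot v E
    g₀≤g : g₀ ≤ g
    g₀≤g = ≤quot E 1≤E (≤-trans (≤-reflexive (*-comm g₀ E)) v≥)
    v< : v < E * suc g
    v< = ≤-trans (quot-< v E 1≤E) (≤-reflexive (*-comm (suc g) E))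
    x-lo : bp (E * g) ≤ x
    x-lo = ≤-trans (bp-mono (≤-trans (≤-reflexive (*-comm E g)) (quot-*≤ v E))) bp≤
    x-hi : x < bp (E * suc g)
    x-hi = ≤-trans bp> (bp-mono v<)
    go : ∃[ l ] (2 ^ l ≤ g × g < 2 ^ suc l) → ∃[ ns ] (Unique ns × All (λ n → 1 ≤ n × n ≤ x × Density.Dense h (φ n) × Density.Dense h (carmichael n)) ns × x ≤ D * length ns)
    go (l , lo , hi) = ns , ns-unique , ns-good , proportion
      where
      base≤l : base ≤ l
      base≤l = s≤s⁻¹ (≰⇒> (λ le → <-irrefl refl (≤-trans hi (≤-trans (^-monoʳ-≤ 2 le) (≤-trans (≤-trans (m≤n+m (2 ^ base) N₀) (m≤n+m (N₀ + 2 ^ base) E)) g₀≤g)))))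
      l≡ : base + (l ∸ base) ≡ l
      l≡ = m+[n∸m]≡n base≤l
      open Run g (l ∸ base) x (≤-trans (m≤m+n E (N₀ + 2 ^ base)) g₀≤g)
        (≤-trans (≤-trans (m≤m+n N₀ (2 ^ base)) (≤-trans (m≤n+m (N₀ + 2 ^ base) E) g₀≤g)) (<⇒≤ (n<bp g)))
        (subst (λ z → 2 ^ z ≤ g) (sym l≡) lo) (subst (λ z → g < 2 ^ suc z) (sym l≡) hi) x-lo x-hi using (ns; ns-unique; ns-good; proportion)

theorem4 : ∀ (h : ℕ) → .{{_ : NonZero h}} →
    ∃[ a ] ∃[ b ] (1 ≤ a × 1 ≤ b × ∃[ x₀ ] (∀ (x : ℕ) → x₀ ≤ x →
    ∃[ ns ] (Unique ns
    × All (λ n → 1 ≤ n × n ≤ x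
    × DenseIn (φ n) ((+ (suc h)) / h) ((+ h) / 1) ((+ φ n) / suc h)
    × DenseIn (carmichael n) ((+ (suc h)) / h) ((+ h) / 1) ((+ carmichael n) / suc h)) ns
    × a * x ≤ b * length ns)))
-- The sum of `1/p` over `256 * 128` blocks is at least `256`, as each contributes `1/128`. For `γ`
-- the number to be dominated by `2 ^ γ` is itself large enough.
theorem4 (suc h) = 1 , finish (positive-proportion (suc h) (256 * 128) (2 * (8 * c₃ + 6)) (λ a → subst (_≤ʳ ∑ inv (PB a (256 * 128))) ι256 (PB-sum a (256 * 128))) (<⇒≤ (n<2^n (2 * (8 * c₃ + 6)))))
  where
  ι256 : ι (256 * 128) *ʳ inv 128 ≡ ι 256
  ι256 = trans (cong (_*ʳ inv 128) (ι-* 256 128)) (trans (ℚₚ.*-assoc (ι 256) (ι 128) (inv 128)) (trans (cong (ι 256 *ʳ_) (ι-inv 128 (s≤s z≤n))) (ℚₚ.*-identityʳ (ι 256))))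
  finish : ∃[ b ] (1 ≤ b × ∃[ x₀ ] (∀ x → x₀ ≤ x → ∃[ ns ] (Unique ns × All (λ n → 1 ≤ n × n ≤ x × Density.Dense (suc h) (φ n) × Density.Dense (suc h) (carmichael n)) ns × x ≤ b * length ns))) →
    ∃[ b ] (1 ≤ 1 × 1 ≤ b × ∃[ x₀ ] (∀ (x : ℕ) → x₀ ≤ x → ∃[ ns ] (Unique ns
      × All (λ n → 1 ≤ n × n ≤ x
      × DenseIn (φ n) ((+ (suc (suc h))) / suc h) ((+ suc h) / 1) ((+ φ n) / suc (suc h))
      × DenseIn (carmichael n) ((+ (suc (suc h))) / suc h) ((+ suc h) / 1) ((+ carmichael n) / suc (suc h))) ns
      × 1 * x ≤ b * length ns)))
  finish (b , 1≤b , x₀ , f) = b , ≤-refl , 1≤b , x₀ , λ x x≥ → let (ns , u , al , le) = f x x≥ in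
    ns , u , All.map (λ {n} (1≤n , n≤x , dφ , dλ) → 1≤n , n≤x , Dense⇒DenseIn h (φ n) dφ , Dense⇒DenseIn h (carmichael n) dλ) al , ≤-trans (≤-reflexive (*-identityˡ x)) le
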